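{- Let $q(n)$ denote the number of partitions of $n$ into distinct parts. Then $q(n)$ is log-concave for $n\geq 33$, that is, $$q(n)^2\geq q(n-1)\,q(n+1)\qquad\text{for all integers } n\geq 33,$$ and $q(n)$ satisfies the higher order Tur\'an inequalities for $n\geq 121$, that is, $$4\left(q(n)^2-q(n-1)q(n+1)\right)\left(q(n+1)^2-q(n)q(n+2)\right)\geq \left(q(n)q(n+1)-q(n-1)q(n+2)\right)^2\qquad\text{for all integers } n\geq 121.$$
   Context: For an integer $n\ge 0$, $q(n)$ is the number of partitions of $n$ into distinct parts, with generating function $\sum_{n\ge 0}q(n)x^n=\prod_{j=1}^{\infty}(1+x^j)$. -}

module Defs where

open import Data.Nat using (ℕ; zero; suc; _+_; _∸_; _≤_; _≥_; _>_; z≤n; s≤s; s≤s⁻¹; _≤?_)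
open import Data.Nat.Properties
open import Data.Nat.ListAction using (sum)
open import Data.Integer as ℤ using (ℤ)
open import Data.Fin using (Fin; zero; suc)
open import Data.List using (List; []; _∷_; _++_; map; length; lookup)
open import Data.List.Properties using (∷-injectiveʳ)
open import Data.List.Membership.Propositional using (_∈_)
open import Data.List.Membership.Propositional.Properties using (∈-++⁺ˡ; ∈-++⁺ʳ; ∈-++⁻; ∈-map⁺; ∈-map⁻; ∈-lookup)
open import Data.List.Relation.Unary.All as All using (All; []; _∷_)
open import Data.List.Relation.Unary.Any using (here; there; index)
open import Data.List.Relation.Unary.Any.Properties using (lookup-index)
open import Data.List.Relation.Unary.AllPairs as AllPairs using (AllPairs; []; _∷_)
open import Data.List.Relation.Unary.Linked as Linked using (Linked)
open import Data.List.Relation.Unary.Linked.Properties using (Linked⇒AllPairs; AllPairs⇒Linked)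
open import Data.List.Relation.Unary.Unique.Propositional using (Unique)
import Data.List.Relation.Unary.Unique.Propositional.Properties as Uniq
open import Data.Product using (Σ; ∃; _×_; _,_; proj₁; proj₂)
open import Data.Sum using (inj₁; inj₂)
open import Function using (_∘_)
open import Function.Bundles using (_↔_; mk↔ₛ′)
open import Relation.Nullary using (yes; no; contradiction)
open import Relation.Binary.PropositionalEquality

record Partition (n : ℕ) : Set where
  constructor mkPartition
  field
    parts    : List ℕ
    positive : All (_> 0) parts
    sorted   : Linked _≥_ parts
    sum≡     : sum parts ≡ n

open Partition public

DistinctPartition : ℕ → Set
DistinctPartition n = Σ (Partition n) λ π → Unique (parts π)

-- All strictly decreasing lists of positive integers ≤ m with sum n.
-- They are listed only to prove that DistinctPartition n is finite.
enumerate : ℕ → ℕ → List (List ℕ)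
enumerate zero    zero    = [] ∷ []
enumerate zero    (suc n) = []
enumerate (suc m) n with suc m ≤? n
... | yes _ = enumerate m n ++ map (suc m ∷_) (enumerate m (n ∸ suc m))
... | no  _ = enumerate m n

private
  Good : ℕ → ℕ → List ℕ → Set
  Good m n xs = All (_> 0) xs × All (_≤ m) xs × AllPairs _>_ xs × sum xs ≡ n

  sound : ∀ m n {xs} → xs ∈ enumerate m n → Good m n xs
  sound zero zero (here refl) = [] , [] , [] , refl
  sound (suc m) n xs∈ with suc m ≤? n
  sound (suc m) n xs∈ | no _ with sound m n xs∈
  ... | p , b , d , s = p , All.map m≤n⇒m≤1+n b , d , s
  sound (suc m) n xs∈ | yes m<n with ∈-++⁻ (enumerate m n) xs∈
  ... | inj₁ xs∈ˡ with sound m n xs∈ˡ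
  ...   | p , b , d , s = p , All.map m≤n⇒m≤1+n b , d , s
  sound (suc m) n xs∈ | yes m<n | inj₂ xs∈ʳ with ∈-map⁻ (suc m ∷_) xs∈ʳ
  ... | ys , ys∈ , refl with sound m (n ∸ suc m) ys∈
  ...   | p , b , d , s =
    s≤s z≤n ∷ p , ≤-refl ∷ All.map m≤n⇒m≤1+n b , All.map s≤s b ∷ d ,
    trans (cong (suc m +_) s) (m+[n∸m]≡n m<n)

  weaken : ∀ m n {xs} → xs ∈ enumerate m n → xs ∈ enumerate (suc m) n
  weaken m n xs∈ with suc m ≤? n
  ... | yes _ = ∈-++⁺ˡ xs∈
  ... | no  _ = xs∈

  complete : ∀ m n xs → Good m n xs → xs ∈ enumerate m n
  complete zero    _ []       (_ , _ , _ , refl) = here refl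
  complete zero    _ (x ∷ xs) (0<x ∷ _ , x≤0 ∷ _ , _) = contradiction (<-≤-trans 0<x x≤0) λ ()
  complete (suc m) n []       (p , _ , d , s) = weaken m n (complete m n [] (p , [] , d , s))
  complete (suc m) n (x ∷ xs) (0<x ∷ p , x≤ ∷ b , x> ∷ d , s) with x ≤? m
  ... | yes x≤m = weaken m n (complete m n (x ∷ xs)
                    (0<x ∷ p , x≤m ∷ All.map (λ x>y → ≤-trans (<⇒≤ x>y) x≤m) x> , x> ∷ d , s))
  ... | no x≰m with ≤-antisym x≤ (≰⇒> x≰m)
  ...   | refl with suc m ≤? n
  ...     | yes _ = ∈-++⁺ʳ (enumerate m n) (∈-map⁺ (suc m ∷_)
                      (complete m (n ∸ suc m) xs (p , All.map s≤s⁻¹ x> , d ,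
                        trans (sym (m+n∸m≡n (suc m) (sum xs))) (cong (_∸ suc m) s))))
  ...     | no m≮n = contradiction (subst (suc m ≤_) s (m≤m+n (suc m) (sum xs))) m≮n

  unique : ∀ m n → Unique (enumerate m n)
  unique zero    zero    = [] ∷ []
  unique zero    (suc n) = []
  unique (suc m) n with suc m ≤? n
  ... | no  _ = unique m n
  ... | yes _ = Uniq.++⁺ (unique m n) (Uniq.map⁺ ∷-injectiveʳ (unique m (n ∸ suc m))) disjoint
    where
    disjoint : ∀ {xs} → xs ∈ enumerate m n × xs ∈ map (suc m ∷_) (enumerate m (n ∸ suc m)) → _
    disjoint (xs∈ˡ , xs∈ʳ) with ∈-map⁻ (suc m ∷_) xs∈ʳ
    ... | ys , _ , refl with sound m n xs∈ˡ
    ...   | _ , m<m ∷ _ , _ = <-irrefl refl m<m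

  lookup-injective : ∀ {A : Set} {xs : List A} → Unique xs → ∀ i j → lookup xs i ≡ lookup xs j → i ≡ j
  lookup-injective (_ ∷ _) zero    zero    _  = refl
  lookup-injective (x ∷ _) zero    (suc j) eq = contradiction eq (All.lookup x (∈-lookup j))
  lookup-injective (x ∷ _) (suc i) zero    eq = contradiction (sym eq) (All.lookup x (∈-lookup i))
  lookup-injective (_ ∷ u) (suc i) (suc j) eq = cong suc (lookup-injective u i j eq)

  bounded : ∀ xs → All (_≤ sum xs) xs
  bounded []       = []
  bounded (x ∷ xs) = m≤m+n x (sum xs) ∷ All.map (λ y≤ → ≤-trans y≤ (m≤n+m (sum xs) x)) (bounded xs)

  good : ∀ {n} (π : DistinctPartition n) → Good n n (parts (proj₁ π))
  good (mkPartition xs p s refl , u) =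
    p , bounded xs ,
    AllPairs.zipWith (λ (x≥y , x≢y) → ≤∧≢⇒< x≥y (x≢y ∘ sym)) (Linked⇒AllPairs (λ x≥y y≥z → ≤-trans y≥z x≥y) s , u) ,
    refl

  member : ∀ {n} (π : DistinctPartition n) → parts (proj₁ π) ∈ enumerate n n
  member {n} π = complete n n (parts (proj₁ π)) (good π)

  build : ∀ {m n xs} → Good m n xs → DistinctPartition n
  build {xs = xs} (p , _ , d , s) =
    mkPartition xs p (AllPairs⇒Linked (AllPairs.map <⇒≤ d)) s , AllPairs.map (λ x>y x≡y → <⇒≢ x>y (sym x≡y)) d

  parts-injective : ∀ {n} (π ρ : DistinctPartition n) → parts (proj₁ π) ≡ parts (proj₁ ρ) → π ≡ ρ
  parts-injective (mkPartition xs p s e , u) (mkPartition .xs p′ s′ e′ , u′) refl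
    with refl ← All.irrelevant ≤-irrelevant p p′
       | refl ← Linked.irrelevant ≤-irrelevant s s′
       | refl ← ≡-irrelevant e e′
       | refl ← AllPairs.irrelevant (λ _ _ → refl) u u′ = refl

finite : ∀ n → ∃ λ k → DistinctPartition n ↔ Fin k
finite n = length (enumerate n n) , mk↔ₛ′ to from to∘from from∘to
  where
  to : DistinctPartition n → Fin (length (enumerate n n))
  to π = index (member π)

  from : Fin (length (enumerate n n)) → DistinctPartition n
  from i = build (sound n n (∈-lookup i))

  to∘from : ∀ i → to (from i) ≡ i
  to∘from i = lookup-injective (unique n n) _ i (sym (lookup-index (member (from i))))

  from∘to : ∀ π → from (to π) ≡ π
  from∘to π = parts-injective _ π (sym (lookup-index (member π)))

q : ℕ → ℕ
q n = proj₁ (finite n)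

-- q as an integer, so that the differences in the Turán inequality are not truncated.
qℤ : ℕ → ℤ
qℤ n = ℤ.+ q n

{-# OPTIONS --safe #-}
module Submission where

-- For 0 < r < 1 the numbers q(m) r^m / ∏ (1 + r^j) are the law P of a sum of independent variables j · Bernoulli, so q(m)
-- may be replaced by P(m): both inequalities are homogeneous and invariant under a geometric factor. With v₀, …, v₃ four
-- consecutive values, the Turán expression is the discriminant of a binary cubic, hence unchanged when the vᵢ are replaced
-- by the backward differences Δ³P, Δ²P, ΔP, P at one point ν; log-concavity likewise becomes (ΔP)² ≥ P · Δ²P. With r chosen
-- so that the mean of P is ν, Stein's identity
--   (m - μ) Δⁱ P(m) + i Δⁱ⁻¹ P(m - 1) = - V Δⁱ⁺¹ P(m) + error
-- determines the differences of P at ν up to errors that Fourier inversion bounds; the main terms are those of a Gaussian,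
-- for which the inequalities are strict. All estimates are made in ℚ: the Fourier integral is a mean over the powers of
-- (3 + 4i)/5, which is not a root of unity. This settles all indices up to n + 2 ≥ 65536. The remaining q(n) are
-- computed, packed into one large number in base X = 2^773: the generating function of partitions into k distinct parts is
-- x^k / (1 - x^k) times that for k - 1, and multiplying by it becomes a division by X^k - 1.

open import Data.Bool as Bool using (Bool; true; false; _∧_)
open import Data.Integer as ℤ using (ℤ; +_; -[1+_])
import Data.Integer.Properties as ℤ
open import Data.List using (List; []; _∷_; length)
open import Data.List.Properties using (length-++; length-map)
open import Data.Nat as ℕ using (ℕ; zero; suc)
open import Data.Nat.Divisibility using (divides-refl)
open import Data.Nat.DivMod using (m≡m%n+[m/n]*n; m%n<n; +-distrib-/-∣ʳ; /-mono-≤; m<n⇒m/n≡0; m*n/n≡m; [m+kn]%n≡m%n; m<n⇒m%n≡m)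
import Data.Nat.Properties as ℕ
open import Data.Nat.Solver using (module +-*-Solver)
open import Data.Product using (∃; Σ; _×_; _,_; proj₁; proj₂)
open import Data.Sum using (_⊎_; inj₁; inj₂; [_,_]′)
open import Relation.Binary.PropositionalEquality hiding ([_])
open import Relation.Nullary using (¬_; Dec; yes; no; contradiction)
open import Defs using (enumerate; q)

-- The errors of Fourier inversion are absolute, so they say something only against a lower bound
-- for P(ν). That bound comes from the second moment, sharpened by a recursion that keeps P below a
-- Gaussian profile. Stein's sum runs over the laws with one part removed. Characteristic functions
-- are therefore bounded for those laws, and the whole law is a mixture of two shifts of one of
-- them. In units of 1/√(3V) the Turán inequality becomes w N² ≤ 4 Q³ with w close to 1/3. A centred
-- Gaussian has N = 0 and Q = 1 to leading order; the estimates give |N| ≤ 1.607 and Q ≥ 0.689. They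
-- assume x = 1 - r ≤ 1/256. Since x² μ ≤ 1, the tilt x = 1/256 has mean at most 256² = 65536, which
-- is the origin of the threshold. Beyond it r is found on a rational grid, with a mean that meets ν
-- up to 1/10000. The base 2^773 exceeds an elementary bound for every q(n) that occurs in the
-- computation.

atMost : ℕ → ℕ → ℕ
atMost M n = length (enumerate M n)

atMost-use : ∀ M n → suc M ℕ.≤ n → atMost (suc M) n ≡ atMost M n ℕ.+ atMost M (n ℕ.∸ suc M)
atMost-use M n p with suc M ℕ.≤? n
... | yes _ = trans (length-++ (enumerate M n)) (cong (λ e → atMost M n ℕ.+ e) (length-map _ (enumerate M (n ℕ.∸ suc M))))
... | no ¬p = contradiction p ¬p

atMost-skip : ∀ M n → n ℕ.< suc M → atMost (suc M) n ≡ atMost M n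
atMost-skip M n p with suc M ℕ.≤? n
... | yes p′ = contradiction p′ (ℕ.<⇒≱ p)
... | no  _  = refl

atMost-stable : ∀ {M n} → n ℕ.≤ M → atMost M n ≡ q n
atMost-stable {M} {n} p = go (ℕ.≤⇒≤′ p)
  where
  go : ∀ {M} → n ℕ.≤′ M → atMost M n ≡ q n
  go ℕ.≤′-refl     = refl
  go {suc M} (ℕ.≤′-step p) = trans (atMost-skip M n (ℕ.s≤s (ℕ.≤′⇒≤ p))) (go p)

-- The index is that of the first of four consecutive values. Log-concavity concerns the last three
-- of them, because the asymptotic part works with backward differences at k + 3; thus n = k + 2
-- there and n = k + 1 in the Turán inequality.
LogConcaveAt TuránAt : ℕ → Set
LogConcaveAt k = + q (1 ℕ.+ k) ℤ.* + q (3 ℕ.+ k) ℤ.≤ + q (2 ℕ.+ k) ℤ.* + q (2 ℕ.+ k)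
TuránAt k = (b ℤ.* c ℤ.- a ℤ.* d) ℤ.* (b ℤ.* c ℤ.- a ℤ.* d) ℤ.≤ + 4 ℤ.* ((b ℤ.* b ℤ.- a ℤ.* c) ℤ.* (c ℤ.* c ℤ.- b ℤ.* d))
  where
  a b c d : ℤ
  a = + q k
  b = + q (1 ℕ.+ k)
  c = + q (2 ℕ.+ k)
  d = + q (3 ℕ.+ k)

-- Exact computation of q(n) for n < 65536

module Computation where

  -- Partitions into distinct parts, counted by the number of parts

  shift : ℕ → (ℕ → ℕ) → ℕ → ℕ
  shift zero    f n       = f n
  shift (suc k) f zero    = 0
  shift (suc k) f (suc n) = shift k f n

  shift-+ : ∀ k f n → shift k f (k ℕ.+ n) ≡ f n
  shift-+ zero    f n = refl
  shift-+ (suc k) f n = shift-+ k f n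

  shift-vanish : ∀ k {f m} i → (∀ j → j ℕ.< i → f j ≡ 0) → m ℕ.< k ℕ.+ i → shift k f m ≡ 0
  shift-vanish zero            i h p          = h _ p
  shift-vanish (suc k) {m = zero}  i h p          = refl
  shift-vanish (suc k) {m = suc m} i h (ℕ.s≤s p) = shift-vanish k i h p

  shift-< : ∀ k {f m} → m ℕ.< k → shift k f m ≡ 0
  shift-< k p = shift-vanish k 0 (λ _ ()) (subst (_ ℕ.<_) (sym (ℕ.+-identityʳ k)) p)

  -- dist M i n counts the partitions of n into i distinct parts ≤ M.
  dist : ℕ → ℕ → ℕ → ℕ
  dist zero    zero    zero    = 1
  dist zero    zero    (suc n) = 0
  dist zero    (suc i) n       = 0
  dist (suc M) zero    n       = dist M zero n
  dist (suc M) (suc i) n       = dist M (suc i) n ℕ.+ shift (suc M) (dist M i) n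

  dist-few : ∀ M i n → n ℕ.< i → dist M i n ≡ 0
  dist-few zero    (suc i) n p         = refl
  dist-few (suc M) (suc i) n (ℕ.s≤s p) = cong₂ ℕ._+_ (dist-few M (suc i) n (ℕ.s≤s p))
    (shift-vanish (suc M) i (dist-few M i) (ℕ.s≤s (ℕ.≤-trans p (ℕ.m≤n+m i M))))

  dist-stable : ∀ {M} i n → n ℕ.≤ M → dist M i n ≡ dist n i n
  dist-stable i n p = go (ℕ.≤⇒≤′ p)
    where
    step : ∀ M i → n ℕ.≤ M → dist (suc M) i n ≡ dist M i n
    step M zero    p = refl
    step M (suc i) p = trans (cong (λ e → dist M (suc i) n ℕ.+ e) (shift-< (suc M) (ℕ.s≤s p))) (ℕ.+-identityʳ _)
    go : ∀ {M} → n ℕ.≤′ M → dist M i n ≡ dist n i n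
    go ℕ.≤′-refl = refl
    go {suc M} (ℕ.≤′-step p) = trans (step M i (ℕ.≤′⇒≤ p)) (go p)

  -- Subtract one from every part.
  dist-dual : ∀ M i n → dist (suc M) (suc i) (suc i ℕ.+ n) ≡ dist M (suc i) n ℕ.+ dist M i n
  dist-dual zero    zero    zero    = refl
  dist-dual zero    zero    (suc n) = refl
  dist-dual zero    (suc i) n       = refl
  dist-dual (suc M) i n = trans (cong (ℕ._+ shift (suc M) (dist (suc M) i) (i ℕ.+ n)) (dist-dual M i n))
      (trans (cong (λ e → dist M (suc i) n ℕ.+ dist M i n ℕ.+ e) (rest i)) (trans (ℕ.+-assoc (dist M (suc i) n) _ _) (trans (cong (λ e → dist M (suc i) n ℕ.+ e) (conclude i)) (sym (ℕ.+-assoc (dist M (suc i) n) _ _)))))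
    where
    -- The share of `dist (suc M) i n` in which the part `suc M` occurs. It is zero for i = 0, which
    -- lets `rest` and `conclude` have one form for both cases of i.
    lower : ℕ → ℕ
    lower zero    = 0
    lower (suc i) = shift (suc M) (dist M i) n
    conclude : ∀ i → dist M i n ℕ.+ (shift (suc M) (dist M i) n ℕ.+ lower i) ≡ shift (suc M) (dist M i) n ℕ.+ dist (suc M) i n
    conclude zero    = trans (cong (λ e → dist M 0 n ℕ.+ e) (ℕ.+-identityʳ _)) (ℕ.+-comm (dist M 0 n) _)
    conclude (suc i) = solve 3 (λ a b c → a :+ (b :+ c) := b :+ (a :+ c)) refl (dist M (suc i) n) (shift (suc M) (dist M (suc i)) n) (shift (suc M) (dist M i) n)
      where open +-*-Solver
    rest : ∀ i → shift (suc M) (dist (suc M) i) (i ℕ.+ n) ≡ shift (suc M) (dist M i) n ℕ.+ lower i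
    rest zero    = sym (ℕ.+-identityʳ _)
    rest (suc i) = [ above , below ]′ (ℕ.≤-<-connex (suc M) n)
      where
      above : suc M ℕ.≤ n → shift (suc M) (dist (suc M) (suc i)) (suc i ℕ.+ n) ≡ shift (suc M) (dist M (suc i)) n ℕ.+ shift (suc M) (dist M i) n
      above p = subst (λ n → shift (suc M) (dist (suc M) (suc i)) (suc i ℕ.+ n) ≡ shift (suc M) (dist M (suc i)) n ℕ.+ shift (suc M) (dist M i) n) (ℕ.m+[n∸m]≡n p) (shifted (n ℕ.∸ suc M))
        where
        shifted : ∀ n → shift (suc M) (dist (suc M) (suc i)) (suc i ℕ.+ (suc M ℕ.+ n)) ≡ shift (suc M) (dist M (suc i)) (suc M ℕ.+ n) ℕ.+ shift (suc M) (dist M i) (suc M ℕ.+ n)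
        shifted n = trans (cong (shift (suc M) (dist (suc M) (suc i))) (solve 3 (λ i M n → i :+ (M :+ n) := M :+ (i :+ n)) refl (suc i) (suc M) n))
          (trans (shift-+ (suc M) _ (suc i ℕ.+ n)) (trans (dist-dual M i n) (sym (cong₂ ℕ._+_ (shift-+ (suc M) (dist M (suc i)) n) (shift-+ (suc M) (dist M i) n)))))
          where open +-*-Solver
      below : n ℕ.< suc M → shift (suc M) (dist (suc M) (suc i)) (suc i ℕ.+ n) ≡ shift (suc M) (dist M (suc i)) n ℕ.+ shift (suc M) (dist M i) n
      below p = trans (shift-vanish (suc M) (suc i) (dist-few (suc M) (suc i)) (subst (suc (suc i ℕ.+ n) ℕ.≤_) (ℕ.+-comm (suc i) (suc M)) (subst (ℕ._≤ suc i ℕ.+ suc M) (ℕ.+-suc (suc i) n) (ℕ.+-monoʳ-≤ (suc i) p))))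
        (sym (cong₂ ℕ._+_ (shift-< (suc M) p) (shift-< (suc M) p)))

  triangle : ℕ → ℕ
  triangle zero    = 0
  triangle (suc i) = suc i ℕ.+ triangle i

  -- The smallest choice of i distinct parts is 1, ..., i. In the induction one is subtracted from
  -- every part, which lowers the threshold from `triangle (suc i)` to `triangle i`.
  dist-triangle : ∀ M i n → n ℕ.< triangle i → dist M i n ≡ 0
  dist-triangle zero    (suc i) n p = refl
  dist-triangle (suc M) (suc i) n p = [ (λ h → trans (cong (dist (suc M) (suc i)) (sym (ℕ.m+[n∸m]≡n h))) (step (n ℕ.∸ suc i) (subst (ℕ._< triangle (suc i)) (sym (ℕ.m+[n∸m]≡n h)) p))) , dist-few (suc M) (suc i) n ]′ (ℕ.≤-<-connex (suc i) n)
    where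
    step : ∀ n → suc i ℕ.+ n ℕ.< triangle (suc i) → dist (suc M) (suc i) (suc i ℕ.+ n) ≡ 0
    step n p = trans (dist-dual M i n) (cong₂ ℕ._+_ (dist-triangle M (suc i) n (ℕ.≤-trans n< (ℕ.m≤n+m (triangle i) (suc i)))) (dist-triangle M i n n<))
      where
      n< : n ℕ.< triangle i
      n< = ℕ.+-cancelˡ-< (suc i) n (triangle i) p

  triangle-mono : ∀ {i j} → i ℕ.≤ j → triangle i ℕ.≤ triangle j
  triangle-mono ℕ.z≤n     = ℕ.z≤n
  triangle-mono (ℕ.s≤s p) = ℕ.+-mono-≤ (ℕ.s≤s p) (triangle-mono p)

  -- total f k = f 0 + … + f k
  total : (ℕ → ℕ) → ℕ → ℕ
  total f zero    = f 0
  total f (suc k) = total f k ℕ.+ f (suc k)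

  total-cut : ∀ {f k} m → (∀ i → k ℕ.< i → f i ≡ 0) → total f (m ℕ.+ k) ≡ total f k
  total-cut zero    h = refl
  total-cut {f} {k} (suc m) h = trans (cong₂ ℕ._+_ (total-cut m h) (h (suc m ℕ.+ k) (ℕ.s≤s (ℕ.m≤n+m k m)))) (ℕ.+-identityʳ _)

  term≤total : ∀ f {i} m → f i ℕ.≤ total f (m ℕ.+ i)
  term≤total f {zero}  zero = ℕ.≤-refl
  term≤total f {suc i} zero = ℕ.m≤n+m _ _
  term≤total f (suc m)      = ℕ.≤-trans (term≤total f m) (ℕ.m≤m+n _ _)

  total-dist : ∀ M n {k} → M ℕ.≤ k → total (λ i → dist M i n) k ≡ atMost M n
  total-dist zero n {k} p = trans (cong (total (λ i → dist 0 i n)) (sym (ℕ.+-identityʳ k))) (trans (total-cut {λ i → dist 0 i n} {0} k λ { (suc i) _ → refl }) (base n))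
    where
    base : ∀ n → dist 0 0 n ≡ atMost 0 n
    base zero    = refl
    base (suc n) = refl
  total-dist (suc M) n {suc k} (ℕ.s≤s p) = trans (split k) (trans (cong₂ ℕ._+_ (total-dist M n (ℕ.m≤n⇒m≤1+n p)) (pull k)) (combine p))
    where
    split : ∀ k → total (λ i → dist (suc M) i n) (suc k) ≡ total (λ i → dist M i n) (suc k) ℕ.+ total (λ i → shift (suc M) (dist M i) n) k
    split zero    = sym (ℕ.+-assoc (dist M 0 n) _ _)
    split (suc k) = trans (cong (ℕ._+ dist (suc M) (suc (suc k)) n) (split k)) (solve 4 (λ a b c d → a :+ b :+ (c :+ d) := a :+ c :+ (b :+ d)) refl (total (λ i → dist M i n) (suc k)) (total (λ i → shift (suc M) (dist M i) n) k) (dist M (suc (suc k)) n) (shift (suc M) (dist M (suc k)) n))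
      where open +-*-Solver
    pull : ∀ k → total (λ i → shift (suc M) (dist M i) n) k ≡ shift (suc M) (λ m → total (λ i → dist M i m) k) n
    pull zero    = refl
    pull (suc k) = trans (cong (ℕ._+ shift (suc M) (dist M (suc k)) n) (pull k)) (shift-additive (suc M) n)
      where
      shift-additive : ∀ {f g} j n → shift j f n ℕ.+ shift j g n ≡ shift j (λ m → f m ℕ.+ g m) n
      shift-additive zero    n       = refl
      shift-additive (suc j) zero    = refl
      shift-additive (suc j) (suc n) = shift-additive j n
    combine : ∀ {k} → M ℕ.≤ k → atMost M n ℕ.+ shift (suc M) (λ m → total (λ i → dist M i m) k) n ≡ atMost (suc M) n
    combine {k} p = [ use , skip ]′ (ℕ.≤-<-connex (suc M) n)
      where
      use : suc M ℕ.≤ n → atMost M n ℕ.+ shift (suc M) (λ m → total (λ i → dist M i m) k) n ≡ atMost (suc M) n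
      use h = trans (cong (λ e → atMost M n ℕ.+ e) (trans (cong (shift (suc M) _) (sym (ℕ.m+[n∸m]≡n h))) (trans (shift-+ (suc M) _ (n ℕ.∸ suc M)) (total-dist M (n ℕ.∸ suc M) p)))) (sym (atMost-use M n h))
      skip : n ℕ.< suc M → atMost M n ℕ.+ shift (suc M) (λ m → total (λ i → dist M i m) k) n ≡ atMost (suc M) n
      skip h = trans (cong (λ e → atMost M n ℕ.+ e) (shift-< (suc M) h)) (trans (ℕ.+-identityʳ _) (sym (atMost-skip M n h)))

  -- count k n is the number of partitions of n into k distinct parts.
  count : ℕ → ℕ → ℕ
  count k n = dist n k n

  count-rec : ∀ k n → count (suc k) (suc k ℕ.+ n) ≡ count (suc k) n ℕ.+ count k n
  count-rec k n = trans (dist-dual (k ℕ.+ n) k n) (cong₂ ℕ._+_ (dist-stable (suc k) n (ℕ.m≤n+m n k)) (dist-stable k n (ℕ.m≤n+m n k)))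

  total-count : ∀ {K n} → n ℕ.< triangle (suc K) → total (λ k → count k n) K ≡ q n
  total-count {K} {n} p = trans (sym (total-cut n λ i h → dist-triangle n i n (ℕ.<-≤-trans p (triangle-mono h)))) (total-dist n n (ℕ.m≤m+n n K))

  count≤q : ∀ k n → count k n ℕ.≤ q n
  count≤q k n = ℕ.≤-trans (term≤total (λ k → count k n) n) (ℕ.≤-reflexive (total-dist n n (ℕ.m≤m+n n k)))

  -- Evaluates its first argument before it is copied into the body.
  force : {A : Set} → ℕ → (ℕ → A) → A
  force zero      f = f zero
  force n@(suc _) f = f n

  force≡ : ∀ {A : Set} n (f : ℕ → A) → force n f ≡ f n
  force≡ zero    f = refl
  force≡ (suc n) f = refl

  -- Division with the junk value 0 for a zero divisor.
  quot rem : ℕ → ℕ → ℕ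
  quot a zero    = 0
  quot a (suc b) = a ℕ./ suc b
  rem a zero    = 0
  rem a (suc b) = a ℕ.% suc b

  quot-unique : ∀ {t m} k → t ℕ.< m → quot (t ℕ.+ k ℕ.* m) m ≡ k
  quot-unique {t} {suc m} k p = trans (+-distrib-/-∣ʳ t (divides-refl k)) (cong₂ ℕ._+_ (m<n⇒m/n≡0 p) (m*n/n≡m k (suc m)))

  rem-unique : ∀ {t m} k → t ℕ.< m → rem (t ℕ.+ k ℕ.* m) m ≡ t
  rem-unique {t} {suc m} k p = trans ([m+kn]%n≡m%n t k (suc m)) (m<n⇒m%n≡m p)

  -- Bounding q

  -- Rankin's bound q(n) ≤ r^(-n) ∏ (1 + r^j) for r = 2^(-1/(ℓ + 1)), with all exponents rounded to
  -- integers; `a` stands for the product over j ≤ M. The ℓ + 1 parts of one block share the same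
  -- power of two.
  Bounded : ℕ → ℕ → ℕ → Set
  Bounded ℓ M a = ∀ n → atMost M n ℕ.≤ a ℕ.* 2 ℕ.^ (n ℕ./ suc ℓ)

  grow : ℕ → ℕ → ℕ → ℕ
  grow p a zero    = a
  grow p a (suc j) = force (a ℕ.+ suc (quot a p)) λ a′ → grow p a′ j

  levels : ℕ → ℕ → ℕ → ℕ → ℕ
  levels ℓ zero    p a = a
  levels ℓ (suc t) p a = force (grow p a (suc ℓ)) λ a′ → levels ℓ t (2 ℕ.* p) a′

  quot-upper : ∀ a p → 0 ℕ.< p → a ℕ.≤ suc (quot a p) ℕ.* p
  quot-upper a (suc p) _ = ℕ.≤-trans (ℕ.≤-reflexive (m≡m%n+[m/n]*n a (suc p))) (ℕ.+-monoˡ-≤ _ (ℕ.<⇒≤ (m%n<n a (suc p))))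

  module _ {ℓ : ℕ} where

    -- Using the part `suc M` lowers n by at least e (ℓ + 1), which saves a factor 2^e. The quotient
    -- a / 2^e is replaced by the next larger integer.
    bounded-suc : ∀ {M a} e → e ℕ.* suc ℓ ℕ.≤ M → Bounded ℓ M a → Bounded ℓ (suc M) (a ℕ.+ suc (quot a (2 ℕ.^ e)))
    bounded-suc {M} {a} e e≤ h n = [ use , skip ]′ (ℕ.≤-<-connex (suc M) n)
      where
      a′ = suc (quot a (2 ℕ.^ e))
      gap : ∀ n → n ℕ./ suc ℓ ℕ.+ e ℕ.≤ (suc M ℕ.+ n) ℕ./ suc ℓ
      gap n = ℕ.≤-trans (ℕ.≤-reflexive (sym (trans (+-distrib-/-∣ʳ n (divides-refl e)) (cong (n ℕ./ suc ℓ ℕ.+_) (m*n/n≡m e (suc ℓ))))))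
        (/-mono-≤ (ℕ.≤-trans (ℕ.≤-reflexive (ℕ.+-comm n (e ℕ.* suc ℓ))) (ℕ.+-monoˡ-≤ n (ℕ.m≤n⇒m≤1+n e≤))) ℕ.≤-refl)
      lower : ∀ n → a ℕ.* 2 ℕ.^ (n ℕ./ suc ℓ) ℕ.≤ a′ ℕ.* 2 ℕ.^ ((suc M ℕ.+ n) ℕ./ suc ℓ)
      lower n = begin
        a ℕ.* 2 ℕ.^ (n ℕ./ suc ℓ)                    ≤⟨ ℕ.*-monoˡ-≤ _ (quot-upper a (2 ℕ.^ e) (ℕ.m^n>0 2 e)) ⟩
        a′ ℕ.* 2 ℕ.^ e ℕ.* 2 ℕ.^ (n ℕ./ suc ℓ)       ≡⟨ ℕ.*-assoc a′ (2 ℕ.^ e) _ ⟩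
        a′ ℕ.* (2 ℕ.^ e ℕ.* 2 ℕ.^ (n ℕ./ suc ℓ))     ≡⟨ cong (a′ ℕ.*_) (trans (ℕ.*-comm (2 ℕ.^ e) _) (sym (ℕ.^-distribˡ-+-* 2 (n ℕ./ suc ℓ) e))) ⟩
        a′ ℕ.* 2 ℕ.^ (n ℕ./ suc ℓ ℕ.+ e)             ≤⟨ ℕ.*-monoʳ-≤ a′ (ℕ.^-monoʳ-≤ 2 (gap n)) ⟩
        a′ ℕ.* 2 ℕ.^ ((suc M ℕ.+ n) ℕ./ suc ℓ)       ∎
        where open ℕ.≤-Reasoning
      both : ∀ n → atMost M (suc M ℕ.+ n) ℕ.+ atMost M n ℕ.≤ (a ℕ.+ a′) ℕ.* 2 ℕ.^ ((suc M ℕ.+ n) ℕ./ suc ℓ)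
      both n = ℕ.≤-trans (ℕ.+-mono-≤ (h (suc M ℕ.+ n)) (ℕ.≤-trans (h n) (lower n))) (ℕ.≤-reflexive (sym (ℕ.*-distribʳ-+ _ a a′)))
      use : suc M ℕ.≤ n → atMost (suc M) n ℕ.≤ (a ℕ.+ a′) ℕ.* 2 ℕ.^ (n ℕ./ suc ℓ)
      use p = ℕ.≤-trans (ℕ.≤-reflexive (atMost-use M n p)) (subst (λ m → atMost M m ℕ.+ atMost M (n ℕ.∸ suc M) ℕ.≤ (a ℕ.+ a′) ℕ.* 2 ℕ.^ (m ℕ./ suc ℓ)) (ℕ.m+[n∸m]≡n p) (both (n ℕ.∸ suc M)))
      skip : n ℕ.< suc M → atMost (suc M) n ℕ.≤ (a ℕ.+ a′) ℕ.* 2 ℕ.^ (n ℕ./ suc ℓ)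
      skip p = ℕ.≤-trans (ℕ.≤-reflexive (atMost-skip M n p)) (ℕ.≤-trans (h n) (ℕ.*-monoˡ-≤ _ (ℕ.m≤m+n a a′)))

    bounded-grow : ∀ {M a} e j → e ℕ.* suc ℓ ℕ.≤ M → Bounded ℓ M a → Bounded ℓ (j ℕ.+ M) (grow (2 ℕ.^ e) a j)
    bounded-grow e zero    e≤ h = h
    bounded-grow {M} {a} e (suc j) e≤ h = subst (Bounded ℓ (suc j ℕ.+ M)) (sym (force≡ a′ (λ a′ → grow (2 ℕ.^ e) a′ j)))
      (subst (λ m → Bounded ℓ m (grow (2 ℕ.^ e) a′ j)) (ℕ.+-suc j M) (bounded-grow {suc M} {a′} e j (ℕ.m≤n⇒m≤1+n e≤) (bounded-suc {M} {a} e e≤ h)))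
      where
      a′ : ℕ
      a′ = a ℕ.+ suc (quot a (2 ℕ.^ e))

    bounded-levels : ∀ {a} e t → Bounded ℓ (e ℕ.* suc ℓ) a → Bounded ℓ ((t ℕ.+ e) ℕ.* suc ℓ) (levels ℓ t (2 ℕ.^ e) a)
    bounded-levels e zero    h = h
    bounded-levels {a} e (suc t) h = subst (Bounded ℓ (suc (t ℕ.+ e) ℕ.* suc ℓ)) (sym (force≡ (grow (2 ℕ.^ e) a (suc ℓ)) (λ a′ → levels ℓ t (2 ℕ.* 2 ℕ.^ e) a′)))
      (subst (λ m → Bounded ℓ (m ℕ.* suc ℓ) (levels ℓ t (2 ℕ.^ suc e) (grow (2 ℕ.^ e) a (suc ℓ)))) (ℕ.+-suc t e) (bounded-levels (suc e) t (bounded-grow {a = a} e (suc ℓ) ℕ.≤-refl h)))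

    bounded-zero : Bounded ℓ 0 1
    bounded-zero zero    = ℕ.≤-refl
    bounded-zero (suc n) = ℕ.z≤n

  q-upper : ∀ ℓ E n → n ℕ.< E ℕ.* suc ℓ → q n ℕ.≤ levels ℓ E 1 1 ℕ.* 2 ℕ.^ E
  q-upper ℓ E n p = ℕ.≤-trans (ℕ.≤-reflexive (sym (atMost-stable (ℕ.<⇒≤ p)))) (ℕ.≤-trans (subst (λ m → Bounded ℓ (m ℕ.* suc ℓ) (levels ℓ E 1 1)) (ℕ.+-identityʳ E) (bounded-levels 0 E bounded-zero) n)
    (ℕ.*-monoʳ-≤ (levels ℓ E 1 1) (ℕ.^-monoʳ-≤ 2 (ℕ.≤-trans (/-mono-≤ (ℕ.<⇒≤ p) ℕ.≤-refl) (ℕ.≤-reflexive (m*n/n≡m E (suc ℓ)))))))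

  -- Sequences packed in base X, most significant entry first

  module Packing (X : ℕ) where

    pack : (ℕ → ℕ) → ℕ → ℕ → ℕ
    pack f s zero    = 0
    pack f s (suc n) = pack f s n ℕ.* X ℕ.+ f (s ℕ.+ n)

    pack-split : ∀ f s m n → pack f s (m ℕ.+ n) ≡ pack f s m ℕ.* X ℕ.^ n ℕ.+ pack f (s ℕ.+ m) n
    pack-split f s m zero    = trans (cong (pack f s) (ℕ.+-identityʳ m)) (sym (trans (ℕ.+-identityʳ _) (ℕ.*-identityʳ _)))
    pack-split f s m (suc n) = trans (cong (pack f s) (ℕ.+-suc m n)) (trans (cong₂ (λ a b → a ℕ.* X ℕ.+ f b) (pack-split f s m n) (sym (ℕ.+-assoc s m n)))
      (solve 5 (λ a y b x c → (a :* y :+ b) :* x :+ c := a :* (x :* y) :+ (b :* x :+ c)) refl (pack f s m) (X ℕ.^ n) (pack f (s ℕ.+ m) n) X (f (s ℕ.+ m ℕ.+ n))))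
      where open +-*-Solver

    pack-+ : ∀ f g s n → pack (λ i → f i ℕ.+ g i) s n ≡ pack f s n ℕ.+ pack g s n
    pack-+ f g s zero    = refl
    pack-+ f g s (suc n) = trans (cong (λ e → e ℕ.* X ℕ.+ (f (s ℕ.+ n) ℕ.+ g (s ℕ.+ n))) (pack-+ f g s n))
      (solve 5 (λ a b x c d → (a :+ b) :* x :+ (c :+ d) := a :* x :+ c :+ (b :* x :+ d)) refl (pack f s n) (pack g s n) X (f (s ℕ.+ n)) (g (s ℕ.+ n)))
      where open +-*-Solver

    pack-cong : ∀ {f g} s s′ n → (∀ i → i ℕ.< n → f (s ℕ.+ i) ≡ g (s′ ℕ.+ i)) → pack f s n ≡ pack g s′ n
    pack-cong s s′ zero    h = refl
    pack-cong s s′ (suc n) h = cong₂ (λ a b → a ℕ.* X ℕ.+ b) (pack-cong s s′ n λ i p → h i (ℕ.m≤n⇒m≤1+n p)) (h n ℕ.≤-refl)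

    pack-zero : ∀ {f} s n → (∀ i → i ℕ.< n → f (s ℕ.+ i) ≡ 0) → pack f s n ≡ 0
    pack-zero s zero    h = refl
    pack-zero s (suc n) h = cong₂ (λ a b → a ℕ.* X ℕ.+ b) (pack-zero s n λ i p → h i (ℕ.m≤n⇒m≤1+n p)) (h n ℕ.≤-refl)

    pack-fits : ∀ {f} s n → (∀ i → i ℕ.< n → 2 ℕ.+ f (s ℕ.+ i) ℕ.≤ X) → suc (pack f s n) ℕ.≤ X ℕ.^ n
    -- Entries of size at most X - 2 keep a nonempty block below X^n - 1 and not merely below X^n,
    -- so that it can be the remainder of a division by X^n - 1.
    pack-fits⁺ : ∀ {f} s n → (∀ i → i ℕ.< suc n → 2 ℕ.+ f (s ℕ.+ i) ℕ.≤ X) → 2 ℕ.+ pack f s (suc n) ℕ.≤ X ℕ.^ suc n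
    pack-fits s zero    h = ℕ.≤-refl
    pack-fits s (suc n) h = ℕ.≤-trans (ℕ.n≤1+n _) (pack-fits⁺ s n h)
    pack-fits⁺ {f} s n h = begin
      2 ℕ.+ (pack f s n ℕ.* X ℕ.+ f (s ℕ.+ n)) ≡⟨ solve 2 (λ a b → con 2 :+ (a :+ b) := con 2 :+ b :+ a) refl (pack f s n ℕ.* X) (f (s ℕ.+ n)) ⟩
      2 ℕ.+ f (s ℕ.+ n) ℕ.+ pack f s n ℕ.* X   ≤⟨ ℕ.+-monoˡ-≤ _ (h n ℕ.≤-refl) ⟩
      suc (pack f s n) ℕ.* X                   ≤⟨ ℕ.*-monoˡ-≤ X (pack-fits s n λ i p → h i (ℕ.m≤n⇒m≤1+n p)) ⟩
      X ℕ.^ n ℕ.* X                            ≡⟨ ℕ.*-comm (X ℕ.^ n) X ⟩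
      X ℕ.* X ℕ.^ n                            ∎
      where
      open ℕ.≤-Reasoning
      open +-*-Solver

    -- `Y` runs through the powers X^k, `d` through the packed sequences `D k`, and `acc` sums them.
    -- Quotient, sum and power are evaluated in three separate functions, since `force` fixes one
    -- number at a time.
    chain chain₂ chain₃ : ℕ → ℕ → ℕ → ℕ → ℕ
    chain zero    Y d acc = acc
    chain (suc j) Y d acc = force (quot d (Y ℕ.∸ 1)) (chain₂ j Y acc)
    chain₂ j Y acc d = force (acc ℕ.+ d) (chain₃ j Y d)
    chain₃ j Y d acc = force (X ℕ.* Y) λ Y → chain j Y d acc

    -- D k packs the numbers of partitions into k distinct parts; clearing the factor 1 - x^k is a division with small remainder.
    module Chain (L Z : ℕ) (fits : ∀ n → n ℕ.< Z → 2 ℕ.+ q n ℕ.≤ X) where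

      D : ℕ → ℕ
      D k = pack (count k) 0 L

      D-suc : ∀ k → L ℕ.+ suc k ℕ.≤ Z → quot (D k) (X ℕ.^ suc k ℕ.∸ 1) ≡ D (suc k)
      D-suc k p = conclude (X ℕ.^ suc k) (pack-fits⁺ L k λ i i< → ℕ.≤-trans (ℕ.s≤s (ℕ.s≤s (count≤q (suc k) (L ℕ.+ i)))) (fits (L ℕ.+ i) (ℕ.≤-trans (ℕ.≤-reflexive (sym (ℕ.+-suc L i))) (ℕ.≤-trans (ℕ.+-monoʳ-≤ L i<) p)))) identity
        where
        t : ℕ
        t = pack (count (suc k)) L (suc k)
        -- Both sides pack `count (suc k)` on L + k + 1 places. The left side cuts after L places;
        -- on the right the first k + 1 entries vanish and the recurrence `count-rec` splits the
        -- others.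
        identity : D (suc k) ℕ.* X ℕ.^ suc k ℕ.+ t ≡ D (suc k) ℕ.+ D k
        identity = trans (sym (pack-split (count (suc k)) 0 L (suc k))) (trans (cong (pack (count (suc k)) 0) (ℕ.+-comm L (suc k)))
          (trans (pack-split (count (suc k)) 0 (suc k) L) (trans (cong (λ e → e ℕ.* X ℕ.^ L ℕ.+ pack (count (suc k)) (suc k) L) (pack-zero 0 (suc k) λ i i< → dist-few i (suc k) i i<))
          (trans (pack-cong (suc k) 0 L (λ i _ → count-rec k i)) (pack-+ (count (suc k)) (count k) 0 L)))))
        conclude : ∀ Y → 2 ℕ.+ t ℕ.≤ Y → D (suc k) ℕ.* Y ℕ.+ t ≡ D (suc k) ℕ.+ D k → quot (D k) (Y ℕ.∸ 1) ≡ D (suc k)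
        conclude (suc Y) (ℕ.s≤s t<) e = trans (cong (λ d → quot d Y) (ℕ.+-cancelˡ-≡ (D (suc k)) (D k) (t ℕ.+ D (suc k) ℕ.* Y)
          (trans (sym e) (solve 3 (λ d y t → d :* (con 1 :+ y) :+ t := d :+ (t :+ d :* y)) refl (D (suc k)) Y t)))) (quot-unique (D (suc k)) t<)
          where open +-*-Solver

      chain-total : ∀ j k → L ℕ.+ (j ℕ.+ k) ℕ.≤ Z → chain j (X ℕ.^ suc k) (D k) (total D k) ≡ total D (j ℕ.+ k)
      chain-total zero    k p = refl
      chain-total (suc j) k p = trans (force≡ d′ (chain₂ j Y (total D k))) (trans (force≡ (total D k ℕ.+ d′) (chain₃ j Y d′)) (trans (force≡ (X ℕ.* Y) (λ Y → chain j Y d′ (total D k ℕ.+ d′)))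
        (trans (cong (λ d → chain j (X ℕ.* Y) d (total D k ℕ.+ d)) (D-suc k (ℕ.≤-trans (ℕ.+-monoʳ-≤ L (ℕ.s≤s (ℕ.m≤n+m k j))) p)))
        (trans (chain-total j (suc k) (subst (λ e → L ℕ.+ e ℕ.≤ Z) (sym (ℕ.+-suc j k)) p)) (cong (total D) (ℕ.+-suc j k))))))
        where
        Y d′ : ℕ
        Y = X ℕ.^ suc k
        d′ = quot (D k) (Y ℕ.∸ 1)

      total-D : ∀ K → L ℕ.≤ triangle (suc K) → total D K ≡ pack q 0 L
      total-D K p = trans (sym (pull K)) (pack-cong 0 0 L λ i i< → total-count {K} (ℕ.<-≤-trans i< p))
        where
        pull : ∀ K → pack (λ n → total (λ k → count k n) K) 0 L ≡ total D K
        pull zero    = refl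
        pull (suc K) = trans (pack-+ (λ n → total (λ k → count k n) K) (count (suc K)) 0 L) (cong (ℕ._+ D (suc K)) (pull K))

    -- Moduli are the list X^(2^(k-1)), …, X², X.
    data Moduli : ℕ → List ℕ → Set where
      []  : Moduli 0 []
      _∷_ : ∀ {k ms} {m} → m ≡ X ℕ.^ (2 ℕ.^ k) → Moduli k ms → Moduli (suc k) (m ∷ ms)

    moduli : ℕ → ℕ → List ℕ → List ℕ
    moduli zero    y ms = ms
    moduli (suc k) y ms = force (y ℕ.* y) λ y′ → moduli k y′ (y ∷ ms)

    ^-2* : ∀ k → X ℕ.^ (2 ℕ.^ k) ℕ.* X ℕ.^ (2 ℕ.^ k) ≡ X ℕ.^ (2 ℕ.^ suc k)
    ^-2* k = trans (sym (ℕ.^-distribˡ-+-* X (2 ℕ.^ k) (2 ℕ.^ k))) (cong (λ e → X ℕ.^ (2 ℕ.^ k ℕ.+ e)) (sym (ℕ.+-identityʳ (2 ℕ.^ k))))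

    moduli-correct : ∀ j {k ms} → Moduli k ms → Moduli (j ℕ.+ k) (moduli j (X ℕ.^ (2 ℕ.^ k)) ms)
    moduli-correct zero    h = h
    moduli-correct (suc j) {k} {ms} h = subst (Moduli (suc j ℕ.+ k)) (sym (force≡ (X ℕ.^ (2 ℕ.^ k) ℕ.* X ℕ.^ (2 ℕ.^ k)) _))
      (subst₂ (λ a b → Moduli a (moduli j b (X ℕ.^ (2 ℕ.^ k) ∷ ms))) (ℕ.+-suc j k) (sym (^-2* k)) (moduli-correct j (refl ∷ h)))

    -- The product of the moduli is X^(2^k - 1), the packed form of the sequence 1, 0, 0, ... with
    -- which the chain starts.
    top : List ℕ → ℕ
    top []       = 1
    top (m ∷ ms) = top ms ℕ.* m

    top-correct : ∀ {k ms} → Moduli k ms → top ms ≡ pack (count 0) 0 (2 ℕ.^ k)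
    top-correct [] = refl
    top-correct {suc k} (refl ∷ h) = trans (cong (ℕ._* X ℕ.^ (2 ℕ.^ k)) (top-correct h)) (sym (trans (cong (λ e → pack (count 0) 0 (2 ℕ.^ k ℕ.+ e)) (ℕ.+-identityʳ (2 ℕ.^ k)))
      (trans (pack-split (count 0) 0 (2 ℕ.^ k) (2 ℕ.^ k)) (trans (cong (λ e → pack (count 0) 0 (2 ℕ.^ k) ℕ.* X ℕ.^ (2 ℕ.^ k) ℕ.+ e) (pack-zero (2 ℕ.^ k) (2 ℕ.^ k) λ i _ → none (2 ℕ.^ k) i (ℕ.m^n>0 2 k))) (ℕ.+-identityʳ _)))))
      where
      nothing : ∀ M n → dist M 0 (suc n) ≡ 0
      nothing zero    n = refl
      nothing (suc M) n = nothing M n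
      none : ∀ m i → 0 ℕ.< m → count 0 (m ℕ.+ i) ≡ 0
      none (suc m) i _ = nothing (suc m ℕ.+ i) (m ℕ.+ i)

    segment : (ℕ → ℕ) → ℕ → ℕ → List ℕ
    segment f s zero    = []
    segment f s (suc n) = f s ∷ segment f (suc s) n

    -- Binary splitting: each division halves the length of the numbers. The list `xs` holds the
    -- entries to the right, which are already unpacked.
    unpack : List ℕ → ℕ → List ℕ → List ℕ
    unpack []       v xs = v ∷ xs
    unpack (m ∷ ms) v xs = unpack ms (quot v m) (unpack ms (rem v m) xs)

    unpack-correct : ∀ {f k ms} s n → Moduli k ms → (∀ i → i ℕ.< 2 ℕ.^ k → 2 ℕ.+ f (s ℕ.+ i) ℕ.≤ X) →
      unpack ms (pack f s (2 ℕ.^ k)) (segment f (s ℕ.+ 2 ℕ.^ k) n) ≡ segment f s (2 ℕ.^ k ℕ.+ n)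
    unpack-correct {f} s n [] h = cong₂ (λ a b → f a ∷ segment f b n) (ℕ.+-identityʳ s) (ℕ.+-comm s 1)
    unpack-correct {f} {suc k} {m ∷ ms} s n (refl ∷ h) fits = trans (cong (λ e → unpack (m ∷ ms) (pack f s (2^k ℕ.+ e)) (segment f (s ℕ.+ (2^k ℕ.+ e)) n)) (ℕ.+-identityʳ 2^k))
        (trans (cong₂ (λ a b → unpack ms a (unpack ms b (segment f (s ℕ.+ (2^k ℕ.+ 2^k)) n))) (trans (cong (λ e → quot e m) split) (quot-unique high low<)) (trans (cong (λ e → rem e m) split) (rem-unique high low<)))
        (trans (cong (unpack ms high) (trans (cong (λ e → unpack ms low (segment f e n)) (sym (ℕ.+-assoc s 2^k 2^k))) (unpack-correct (s ℕ.+ 2^k) n h λ i p → subst (λ e → 2 ℕ.+ f e ℕ.≤ X) (sym (ℕ.+-assoc s 2^k i)) (fits (2^k ℕ.+ i) (ℕ.≤-trans (ℕ.≤-reflexive (sym (ℕ.+-suc 2^k i))) (ℕ.+-monoʳ-≤ 2^k (ℕ.≤-trans p (ℕ.m≤m+n 2^k 0))))))))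
        (trans (unpack-correct s (2^k ℕ.+ n) h λ i p → fits i (ℕ.≤-trans p (ℕ.m≤m+n 2^k _)))
          (cong (segment f s) (trans (sym (ℕ.+-assoc 2^k 2^k n)) (cong (λ e → 2^k ℕ.+ e ℕ.+ n) (sym (ℕ.+-identityʳ 2^k))))))))
      where
      2^k high low : ℕ
      2^k = 2 ℕ.^ k
      high = pack f s 2^k
      low = pack f (s ℕ.+ 2^k) 2^k
      split : pack f s (2^k ℕ.+ 2^k) ≡ low ℕ.+ high ℕ.* m
      split = trans (pack-split f s 2^k 2^k) (ℕ.+-comm (high ℕ.* m) low)
      low< : low ℕ.< m
      low< = pack-fits (s ℕ.+ 2^k) 2^k λ i p → subst (λ e → 2 ℕ.+ f e ℕ.≤ X) (sym (ℕ.+-assoc s 2^k i)) (fits (2^k ℕ.+ i) (ℕ.≤-trans (ℕ.≤-reflexive (sym (ℕ.+-suc 2^k i))) (ℕ.+-monoʳ-≤ 2^k (ℕ.≤-trans p (ℕ.m≤m+n 2^k 0)))))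

  -- Checking a property of four consecutive values

  module Scan (ok : ℕ → ℕ → ℕ → ℕ → Bool) where

    scan : ℕ → List ℕ → Bool
    scan zero    (a ∷ b ∷ c ∷ d ∷ xs) = ok a b c d ∧ scan zero (b ∷ c ∷ d ∷ xs)
    scan zero    xs                   = true
    scan (suc j) []                   = true
    scan (suc j) (a ∷ xs)             = scan j xs

    open Packing using (segment)

    At : (ℕ → ℕ) → ℕ → Set
    At f i = ok (f i) (f (1 ℕ.+ i)) (f (2 ℕ.+ i)) (f (3 ℕ.+ i)) ≡ true

    scan-sound : ∀ {X} f s n j → scan j (segment X f s n) ≡ true → ∀ i → j ℕ.≤ i → 3 ℕ.+ i ℕ.< n → At f (i ℕ.+ s)
    scan-sound {X} f s (suc n) (suc j) h (suc i) (ℕ.s≤s j≤) (ℕ.s≤s p) = subst (At f) (ℕ.+-suc i s) (scan-sound {X} f (suc s) n j h i j≤ p)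
    scan-sound {X} f s (suc (suc (suc (suc n)))) zero h zero _ _ = ∧-left h
      where
      ∧-left : ∀ {a b} → a ∧ b ≡ true → a ≡ true
      ∧-left {true} _ = refl
    scan-sound {X} f s (suc (suc (suc (suc n)))) zero h (suc i) _ (ℕ.s≤s p) = subst (At f) (ℕ.+-suc i s) (scan-sound {X} f (suc s) (suc (suc (suc n))) zero (∧-right (ok (f s) (f (1 ℕ.+ s)) (f (2 ℕ.+ s)) (f (3 ℕ.+ s))) h) i ℕ.z≤n p)
      where
      ∧-right : ∀ a {b} → a ∧ b ≡ true → b ≡ true
      ∧-right true h = h
    scan-sound f s (suc zero)             zero h i _ (ℕ.s≤s ())
    scan-sound f s (suc (suc zero))       zero h i _ (ℕ.s≤s (ℕ.s≤s ()))
    scan-sound f s (suc (suc (suc zero))) zero h i _ (ℕ.s≤s (ℕ.s≤s (ℕ.s≤s ())))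

  module Table (X : ℕ) where
    open Packing X

    table′ : ℕ → List ℕ → List ℕ
    table′ K ms = unpack ms (force (top ms) λ d → chain K X d d) []

    table : ℕ → ℕ → List ℕ
    table K k = table′ K (moduli k X [])

    table-correct : ∀ Z K k → (∀ n → n ℕ.< Z → 2 ℕ.+ q n ℕ.≤ X) → 2 ℕ.^ k ℕ.+ K ℕ.≤ Z → 2 ℕ.^ k ℕ.≤ triangle (suc K) → table K k ≡ segment q 0 (2 ℕ.^ k)
    table-correct Z K k fits p p′ = trans (cong (λ v → unpack ms v []) value) (trans (unpack-correct {q} 0 0 correct λ i i< → fits i (ℕ.≤-trans i< (ℕ.≤-trans (ℕ.m≤m+n _ K) p))) (cong (segment q 0) (ℕ.+-identityʳ _)))
      where
      open Chain (2 ℕ.^ k) Z fits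
      ms : List ℕ
      ms = moduli k X []
      correct : Moduli k ms
      correct = subst₂ (λ a b → Moduli a (moduli k b [])) (ℕ.+-identityʳ k) (ℕ.*-identityʳ X) (moduli-correct k [])
      value : force (top ms) (λ d → chain K X d d) ≡ pack q 0 (2 ℕ.^ k)
      value = trans (force≡ (top ms) (λ d → chain K X d d)) (trans (cong₂ (λ Y d → chain K Y d d) (sym (ℕ.*-identityʳ X)) (top-correct correct))
        (trans (chain-total K 0 (subst (λ e → 2 ℕ.^ k ℕ.+ e ℕ.≤ Z) (sym (ℕ.+-identityʳ K)) p)) (trans (cong (total D) (ℕ.+-identityʳ K)) (total-D K p′))))

  -- The test starts at index j of a table of 2^k values, computed in base 2^B from the partitions
  -- into at most K parts. The numbers ℓ and E belong to the bound on q(n), which is needed for n <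
  -- E (ℓ + 1) because the chain looks K places beyond the table.
  module Verify (ok : ℕ → ℕ → ℕ → ℕ → Bool) (j ℓ E B k K : ℕ) where
    open Scan ok
    open Table

    verify′ : ℕ → Bool
    verify′ X = (2 ℕ.+ levels ℓ E 1 1 ℕ.* 2 ℕ.^ E ℕ.≤ᵇ X) ∧ ((2 ℕ.^ k ℕ.+ K ℕ.≤ᵇ E ℕ.* suc ℓ) ∧ ((2 ℕ.^ k ℕ.≤ᵇ triangle (suc K)) ∧ scan j (table X K k)))

    verify : Bool
    verify = force (2 ℕ.^ B) verify′

    verify-sound : verify ≡ true → ∀ i → j ℕ.≤ i → 3 ℕ.+ i ℕ.< 2 ℕ.^ k → At q i
    verify-sound h = split (2 ℕ.^ B) (trans (sym (force≡ (2 ℕ.^ B) verify′)) h)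
      where
      both : ∀ {a b} → a ∧ b ≡ true → a ≡ true × b ≡ true
      both {true} h = refl , h
      ≤ᵇ-sound : ∀ m {n} → (m ℕ.≤ᵇ n) ≡ true → m ℕ.≤ n
      ≤ᵇ-sound m h = ℕ.≤ᵇ⇒≤ m _ (subst Bool.T (sym h) _)
      conclude : ∀ X → 2 ℕ.+ levels ℓ E 1 1 ℕ.* 2 ℕ.^ E ℕ.≤ X → 2 ℕ.^ k ℕ.+ K ℕ.≤ E ℕ.* suc ℓ → 2 ℕ.^ k ℕ.≤ triangle (suc K) → scan j (table X K k) ≡ true → ∀ i → j ℕ.≤ i → 3 ℕ.+ i ℕ.< 2 ℕ.^ k → At q i
      conclude X h₁ h₂ h₃ h₄ i j≤ i< = subst (At q) (ℕ.+-identityʳ i) (scan-sound {X} q 0 (2 ℕ.^ k) j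
        (trans (cong (scan j) (sym (table-correct X (E ℕ.* suc ℓ) K k (λ n n< → ℕ.≤-trans (ℕ.+-monoʳ-≤ 2 (q-upper ℓ E n n<)) h₁) h₂ h₃))) h₄) i j≤ i<)
      split : ∀ X → verify′ X ≡ true → ∀ i → j ℕ.≤ i → 3 ℕ.+ i ℕ.< 2 ℕ.^ k → At q i
      split X h = conclude X (≤ᵇ-sound (2 ℕ.+ levels ℓ E 1 1 ℕ.* 2 ℕ.^ E) (proj₁ (both h))) (≤ᵇ-sound (2 ℕ.^ k ℕ.+ K) (proj₁ h′)) (≤ᵇ-sound (2 ℕ.^ k) (proj₁ (both {2 ℕ.^ k ℕ.≤ᵇ triangle (suc K)} (proj₂ h′)))) (proj₂ (both {2 ℕ.^ k ℕ.≤ᵇ triangle (suc K)} (proj₂ h′)))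
        where
        h′ = both {2 ℕ.^ k ℕ.+ K ℕ.≤ᵇ E ℕ.* suc ℓ} (proj₂ (both {2 ℕ.+ levels ℓ E 1 1 ℕ.* 2 ℕ.^ E ℕ.≤ᵇ X} h))

  -- The first three tests of `turán` make the truncated subtractions of the fourth exact.
  concave turán : ℕ → ℕ → ℕ → ℕ → Bool
  concave a b c d = b ℕ.* d ℕ.≤ᵇ c ℕ.* c
  turán a b c d = (a ℕ.* c ℕ.≤ᵇ b ℕ.* b) ∧ ((b ℕ.* d ℕ.≤ᵇ c ℕ.* c) ∧ ((a ℕ.* d ℕ.≤ᵇ b ℕ.* c) ∧ ((b ℕ.* c ℕ.∸ a ℕ.* d) ℕ.* (b ℕ.* c ℕ.∸ a ℕ.* d) ℕ.≤ᵇ 4 ℕ.* ((b ℕ.* b ℕ.∸ a ℕ.* c) ℕ.* (c ℕ.* c ℕ.∸ b ℕ.* d)))))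

  opaque
    -- Here 1 + ... + 16 = 136 exceeds 2^7, so fifteen parts suffice, and 2^7 + 15 = 143 is below 18
    -- · 8 = 144.
    small : Verify.verify concave 31 7 18 38 7 15 ≡ true
    small = refl

    -- Here 1 + ... + 362 = 65703 exceeds 2^16, so 361 parts suffice, and 2^16 + 361 = 65897 is
    -- below 379 · 174 = 65946.
    medium : Verify.verify turán 120 173 379 773 16 361 ≡ true
    medium = refl

-- Indices with n + 2 ≥ 65536: local estimates for the tilted law

module Asymptotics where

  open import Data.List.Relation.Unary.All as All using (All; all?)
  open import Data.Maybe using (Maybe; just; nothing)
  import Data.Nat.Coprimality as Coprime
  open import Data.Rational using (ℚ; mkℚ; 0ℚ; 1ℚ; ½; _+_; _*_; _-_; -_; _≤_; _<_; _/_; 1/_; *≤*; toℚᵘ; positive; nonNegative)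
  open import Data.Rational.Properties
  import Data.Rational.Unnormalised as ℚᵘ
  import Data.Rational.Unnormalised.Properties as ℚᵘ
  open import Level using (0ℓ)
  open import Relation.Nullary.Decidable using (True; toWitness)
  open import Tactic.RingSolver using (solve-∀; solve)
  import Tactic.RingSolver.Core.AlmostCommutativeRing as ACR

  ringℚ : ACR.AlmostCommutativeRing 0ℓ 0ℓ
  ringℚ = ACR.fromCommutativeRing +-*-commutativeRing isZero
    where
    isZero : ∀ x → Maybe (0ℚ ≡ x)
    isZero x with 0ℚ ≟ x
    ... | yes p = just p
    ... | no  _ = nothing

  -- Closed rational inequalities, decided by evaluation.
  ≤! : ∀ {p q} {_ : True (p ≤? q)} → p ≤ q
  ≤! {_} {_} {w} = toWitness w

  <! : ∀ {p q} {_ : True (p <? q)} → p < q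
  <! {_} {_} {w} = toWitness w

  0≤+ : ∀ {a b} → 0ℚ ≤ a → 0ℚ ≤ b → 0ℚ ≤ a + b
  0≤+ p q = +-mono-≤ p q

  0≤* : ∀ {a b} → 0ℚ ≤ a → 0ℚ ≤ b → 0ℚ ≤ a * b
  0≤* {a} {b} p q = nonNegative⁻¹ (a * b) {{nonNeg*nonNeg⇒nonNeg a {{nonNegative p}} b {{nonNegative q}}}}

  0<* : ∀ {a b} → 0ℚ < a → 0ℚ < b → 0ℚ < a * b
  0<* {a} {b} p q = positive⁻¹ (a * b) {{pos*pos⇒pos a {{positive p}} b {{positive q}}}}

  0<+ : ∀ {a b} → 0ℚ < a → 0ℚ ≤ b → 0ℚ < a + b
  0<+ p q = +-mono-<-≤ p q

  private
    -a*-a : ∀ a → (- a) * (- a) ≡ a * a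
    -a*-a = solve-∀ ringℚ
    a-a : ∀ a → a - a ≡ 0ℚ
    a-a = solve-∀ ringℚ
    a+0 : ∀ a → a + 0ℚ ≡ a
    a+0 = solve-∀ ringℚ

  0≤sq : ∀ a → 0ℚ ≤ a * a
  0≤sq a with ≤-total 0ℚ a
  ... | inj₁ p = 0≤* p p
  ... | inj₂ p = subst (0ℚ ≤_) (-a*-a a) (0≤* (neg-antimono-≤ p) (neg-antimono-≤ p))

  ≤⇒0≤ : ∀ {a b} → a ≤ b → 0ℚ ≤ b - a
  ≤⇒0≤ {a} {b} p = subst (_≤ b - a) (a-a a) (+-monoˡ-≤ (- a) p)

  le-by : ∀ {a b e} → 0ℚ ≤ e → b ≡ a + e → a ≤ b
  le-by {a} {b} {e} p eq = subst₂ _≤_ (a+0 a) (sym eq) (+-monoʳ-≤ a p)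

  *-monoˡ : ∀ {a b} c → 0ℚ ≤ c → a ≤ b → c * a ≤ c * b
  *-monoˡ c p q = *-monoˡ-≤-nonNeg c {{nonNegative p}} q

  *-monoʳ : ∀ {a b} c → 0ℚ ≤ c → a ≤ b → a * c ≤ b * c
  *-monoʳ c p q = *-monoʳ-≤-nonNeg c {{nonNegative p}} q

  *-mono : ∀ {a b c d} → 0ℚ ≤ a → a ≤ b → 0ℚ ≤ c → c ≤ d → a * c ≤ b * d
  *-mono {a} {b} {c} {d} a≥0 a≤b c≥0 c≤d =
    ≤-trans (*-monoʳ c c≥0 a≤b) (*-monoˡ b (≤-trans a≥0 a≤b) c≤d)

  *-cancelˡ : ∀ {a b} c → 0ℚ < c → c * a ≤ c * b → a ≤ b
  *-cancelˡ c p q = *-cancelˡ-≤-pos c {{positive p}} q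

  sq-cancel : ∀ {a b} → 0ℚ ≤ b → a * a ≤ b * b → a ≤ b
  sq-cancel {a} {b} b≥0 h with ≤-total a b
  ... | inj₁ a≤b = a≤b
  ... | inj₂ b≤a with a ≟ b
  ...   | yes refl = ≤-refl
  ...   | no a≢b = contradiction (<-≤-trans (*-mono-< ) h) (<-irrefl refl)
    where
    b<a : b < a
    b<a = ≰⇒> λ a≤b → a≢b (≤-antisym a≤b b≤a)
    a>0 : 0ℚ < a
    a>0 = ≤-<-trans b≥0 b<a
    *-mono-< : b * b < a * a
    *-mono-< = ≤-<-trans (*-monoˡ b b≥0 b≤a) (*-monoˡ-<-pos a {{positive a>0}} b<a)

  -- The reciprocal, with recip 0 = 0.
  recip : ℚ → ℚ
  recip x with x ≟ 0ℚ
  ... | yes _ = 0ℚ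
  ... | no x≢0 = (1/ x) {{Data.Rational.≢-nonZero x≢0}}

  *-recip : ∀ {x} → 0ℚ < x → x * recip x ≡ 1ℚ
  *-recip {x} x>0 with x ≟ 0ℚ
  ... | yes refl = contradiction x>0 (<-irrefl refl)
  ... | no x≢0 = *-inverseʳ x {{Data.Rational.≢-nonZero x≢0}}

  0≤recip : ∀ {x} → 0ℚ < x → 0ℚ ≤ recip x
  0≤recip {x} x>0 = *-cancelˡ x x>0 (subst₂ _≤_ (sym (*-zeroʳ x)) (sym (*-recip x>0)) ≤!)

  -- y ∈± b says |y| ≤ b.
  infix 4 _∈±_
  _∈±_ : ℚ → ℚ → Set
  y ∈± b = (- b ≤ y) × (y ≤ b)

  ±-+ : ∀ {x y a b} → x ∈± a → y ∈± b → x + y ∈± a + b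
  ±-+ {x} {y} {a} {b} (p , p′) (q , q′) =
    subst (_≤ x + y) (sym (neg-distrib-+ a b)) (+-mono-≤ p q) , +-mono-≤ p′ q′

  ±-neg : ∀ {x a} → x ∈± a → - x ∈± a
  ±-neg {x} {a} (p , p′) = neg-antimono-≤ p′ , subst (- x ≤_) (⁻¹-inv a) (neg-antimono-≤ p)
    where
    ⁻¹-inv : ∀ a → - (- a) ≡ a
    ⁻¹-inv = solve-∀ ringℚ

  ±-- : ∀ {x y a b} → x ∈± a → y ∈± b → x - y ∈± a + b
  ±-- p q = ±-+ p (±-neg q)

  ±-* : ∀ {x a} c → 0ℚ ≤ c → x ∈± a → c * x ∈± c * a
  ±-* {x} {a} c c≥0 (p , p′) =
    subst (_≤ c * x) (sym (neg-distribʳ-* c a)) (*-monoˡ c c≥0 p) , *-monoˡ c c≥0 p′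

  ±-weaken : ∀ {x a b} → x ∈± a → a ≤ b → x ∈± b
  ±-weaken (p , p′) q = ≤-trans (neg-antimono-≤ q) p , ≤-trans p′ q

  ±-0≤ : ∀ {x a} → x ∈± a → 0ℚ ≤ a
  ±-0≤ {x} {a} (p , p′) = *-cancelˡ (+ 2 / 1) <! (le-by (0≤+ (≤⇒0≤ p) (≤⇒0≤ p′)) (lem x a))
    where
    lem : ∀ x a → (+ 2 / 1) * a ≡ (+ 2 / 1) * 0ℚ + ((x - - a) + (a - x))
    lem = solve-∀ ringℚ

  ±-sq : ∀ {x a} → 0ℚ ≤ a → x * x ≤ a * a → x ∈± a
  ±-sq {x} {a} a≥0 h = lower , sq-cancel a≥0 h
    where
    lower : - a ≤ x
    lower = subst (- a ≤_) (n x) (neg-antimono-≤ (sq-cancel a≥0 (subst (_≤ a * a) (sym (-a*-a x)) h)))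
      where
      n : ∀ a → - (- a) ≡ a
      n = solve-∀ ringℚ

  ±-mul : ∀ {x y a b} → x ∈± a → y ∈± b → x * y ∈± a * b
  ±-mul {x} {y} {a} {b} p q = ±-sq (0≤* (±-0≤ p) (±-0≤ q)) (subst₂ _≤_ (m x y) (m a b) (*-mono (0≤sq x) (sq p) (0≤sq y) (sq q)))
    where
    m : ∀ x y → x * x * (y * y) ≡ x * y * (x * y)
    m = solve-∀ ringℚ
    sq : ∀ {x a} → x ∈± a → x * x ≤ a * a
    sq {x} {a} (l , u) = le-by (0≤* (≤⇒0≤ l) (≤⇒0≤ u)) (d x a)
      where
      d : ∀ x a → a * a ≡ x * x + (x - - a) * (a - x)
      d = solve-∀ ringℚ

  -- Integers as rationals

  opaque
    -- The fraction i/1, written down without the gcd computation of `_/_`. It is opaque, so that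
    -- later proofs rely only on the laws of this block.
    ιℤ : ℤ → ℚ
    ιℤ i = mkℚ i 0 (Coprime.sym (Coprime.1-coprimeTo ℤ.∣ i ∣))

    ιℤ-+ : ∀ i j → ιℤ (i ℤ.+ j) ≡ ιℤ i + ιℤ j
    ιℤ-+ i j = toℚᵘ-injective (ℚᵘ.≃-trans (ℚᵘ.*≡* lem) (ℚᵘ.≃-sym (toℚᵘ-homo-+ (ιℤ i) (ιℤ j))))
      where
      lem : (i ℤ.+ j) ℤ.* + 1 ≡ (i ℤ.* + 1 ℤ.+ j ℤ.* + 1) ℤ.* + 1
      lem = cong (ℤ._* + 1) (sym (cong₂ ℤ._+_ (ℤ.*-identityʳ i) (ℤ.*-identityʳ j)))

    ιℤ-* : ∀ i j → ιℤ (i ℤ.* j) ≡ ιℤ i * ιℤ j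
    ιℤ-* i j = toℚᵘ-injective (ℚᵘ.≃-trans (ℚᵘ.*≡* refl) (ℚᵘ.≃-sym (toℚᵘ-homo-* (ιℤ i) (ιℤ j))))

    ιℤ-mono : ∀ {i j} → i ℤ.≤ j → ιℤ i ≤ ιℤ j
    ιℤ-mono {i} {j} p = *≤* (subst₂ ℤ._≤_ (sym (ℤ.*-identityʳ i)) (sym (ℤ.*-identityʳ j)) p)

    ιℤ-cancel : ∀ {i j} → ιℤ i ≤ ιℤ j → i ℤ.≤ j
    ιℤ-cancel {i} {j} (*≤* p) = subst₂ ℤ._≤_ (ℤ.*-identityʳ i) (ℤ.*-identityʳ j) p

    ιℤ-0 : ιℤ (+ 0) ≡ 0ℚ
    ιℤ-0 = refl

    ιℤ-1 : ιℤ (+ 1) ≡ 1ℚ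
    ιℤ-1 = refl

    ιℤ-lit : ∀ n → ιℤ (+ n) ≡ + n / 1
    ιℤ-lit n = sym (↥p/↧p≡p (ιℤ (+ n)))

    archimedean : ∀ x → ∃ λ n → x ≤ ιℤ (+ n)
    archimedean x = ℤ.∣ Data.Rational.↥ x ∣ , *≤* (ℤ.≤-trans (ℤ.≤-reflexive (ℤ.*-identityʳ _)) (bound (Data.Rational.↥ x) (ℚ.denominator-1 x)))
      where
      bound : ∀ i d → i ℤ.≤ + ℤ.∣ i ∣ ℤ.* + suc d
      bound (+ n) d = subst (+ n ℤ.≤_) (ℤ.pos-* n (suc d)) (ℤ.+≤+ (ℕ.m≤m*n n (suc d)))
      bound -[1+ n ] d = ℤ.-≤+

  ιℤ-neg : ∀ i → ιℤ (ℤ.- i) ≡ - ιℤ i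
  ιℤ-neg i = lem (ιℤ i) (ιℤ (ℤ.- i)) (trans (sym (ιℤ-+ i (ℤ.- i))) (trans (cong ιℤ (ℤ.+-inverseʳ i)) ιℤ-0))
    where
    lem : ∀ a b → a + b ≡ 0ℚ → b ≡ - a
    lem a b h = trans (b≡ a b) (trans (cong (λ e → e - a) h) (+-identityˡ (- a)))
      where
      b≡ : ∀ a b → b ≡ a + b - a
      b≡ = solve-∀ ringℚ

  ιℤ-- : ∀ i j → ιℤ (i ℤ.- j) ≡ ιℤ i - ιℤ j
  ιℤ-- i j = trans (ιℤ-+ i (ℤ.- j)) (cong (λ e → ιℤ i + e) (ιℤ-neg j))

  ι : ℕ → ℚ
  ι n = ιℤ (+ n)

  ι-suc : ∀ n → ι (suc n) ≡ 1ℚ + ι n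
  ι-suc n = trans (ιℤ-+ (+ 1) (+ n)) (cong (_+ ι n) ιℤ-1)

  ι-+ : ∀ m n → ι (m ℕ.+ n) ≡ ι m + ι n
  ι-+ m n = ιℤ-+ (+ m) (+ n)

  ι-* : ∀ m n → ι (m ℕ.* n) ≡ ι m * ι n
  ι-* m n = trans (cong ιℤ (ℤ.pos-* m n)) (ιℤ-* (+ m) (+ n))

  ι-mono : ∀ {m n} → m ℕ.≤ n → ι m ≤ ι n
  ι-mono p = ιℤ-mono (ℤ.+≤+ p)

  0≤ι : ∀ n → 0ℚ ≤ ι n
  0≤ι n = subst (_≤ ι n) ιℤ-0 (ι-mono ℕ.z≤n)

  1≤ι : ∀ n → 1ℚ ≤ ι (suc n)
  1≤ι n = subst (_≤ ι (suc n)) ιℤ-1 (ι-mono (ℕ.s≤s ℕ.z≤n))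

  0<ι : ∀ n → 0ℚ < ι (suc n)
  0<ι n = <-≤-trans <! (1≤ι n)

  -- A bounded quantity whose multiples stay bounded above is nonpositive.
  archimedean-≤ : ∀ {a b c} → (∀ n → ι n * a ≤ ι n * b + c) → a ≤ b
  archimedean-≤ {a} {b} {c} h with ≤-total a b
  ... | inj₁ p = p
  ... | inj₂ b≤a with a ≟ b
  ...   | yes refl = ≤-refl
  ...   | no a≢b = contradiction (≤-trans (lem (c + 1ℚ) (a - b) (ι (proj₁ ar)) a-b>0 (proj₂ ar)) (lem′ (ι (proj₁ ar)) (h (proj₁ ar)))) (λ p → <-irrefl refl (<-≤-trans c<c+1 p))
    where
    a-b>0 : 0ℚ < a - b
    a-b>0 = ≰⇒> λ p → a≢b (≤-antisym (nonpos p) b≤a)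
      where
      nonpos : a - b ≤ 0ℚ → a ≤ b
      nonpos p = le-by (≤⇒0≤ p) (solve (a ∷ b ∷ []) ringℚ)
    ar = archimedean ((c + 1ℚ) * recip (a - b))
    c<c+1 : c < c + 1ℚ
    c<c+1 = subst (_< c + 1ℚ) (+-identityʳ c) (+-monoʳ-< c {0ℚ} {1ℚ} <!)
    lem′ : ∀ n → n * a ≤ n * b + c → n * (a - b) ≤ c
    lem′ n h = le-by (≤⇒0≤ h) (solve (a ∷ b ∷ c ∷ n ∷ []) ringℚ)
    lem : ∀ e d n → 0ℚ < d → e * recip d ≤ n → e ≤ n * d
    lem e d n d>0 p = ≤-trans (≤-reflexive (trans (sym (*-identityʳ e)) (trans (cong (e *_) (sym (trans (*-comm _ d) (*-recip d>0)))) (sym (*-assoc e (recip d) d))))) (*-monoʳ d (<⇒≤ d>0) p)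

  -- Finite sums over a list, and over the ways of removing one entry of a list

  Σᴸ : (ℕ → ℚ) → List ℕ → ℚ
  Σᴸ f []      = 0ℚ
  Σᴸ f (j ∷ L) = f j + Σᴸ f L

  Σᴸ-cong : ∀ {f g} L → (∀ j → f j ≡ g j) → Σᴸ f L ≡ Σᴸ g L
  Σᴸ-cong []      h = refl
  Σᴸ-cong (j ∷ L) h = cong₂ _+_ (h j) (Σᴸ-cong L h)

  Σᴸ-*ʳ : ∀ f c L → Σᴸ (λ j → f j * c) L ≡ Σᴸ f L * c
  Σᴸ-*ʳ f c []      = sym (*-zeroˡ c)
  Σᴸ-*ʳ f c (j ∷ L) = trans (cong (λ e → f j * c + e) (Σᴸ-*ʳ f c L)) (sym (*-distribʳ-+ c (f j) (Σᴸ f L)))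

  Σᴸ-+ : ∀ f g L → Σᴸ (λ j → f j + g j) L ≡ Σᴸ f L + Σᴸ g L
  Σᴸ-+ f g []      = refl
  Σᴸ-+ f g (j ∷ L) = trans (cong (λ e → f j + g j + e) (Σᴸ-+ f g L)) (lem (f j) (g j) _ _)
    where
    lem : ∀ a b c d → a + b + (c + d) ≡ a + c + (b + d)
    lem = solve-∀ ringℚ

  Σᴸ-mono : ∀ {f g} L → (∀ j → f j ≤ g j) → Σᴸ f L ≤ Σᴸ g L
  Σᴸ-mono []      h = ≤-refl
  Σᴸ-mono (j ∷ L) h = +-mono-≤ (h j) (Σᴸ-mono L h)

  0≤Σᴸ : ∀ {f} L → (∀ j → 0ℚ ≤ f j) → 0ℚ ≤ Σᴸ f L
  0≤Σᴸ []      h = ≤-refl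
  0≤Σᴸ (j ∷ L) h = 0≤+ (h j) (0≤Σᴸ L h)

  data Rem : List ℕ → ℕ → List ℕ → Set where
    here  : ∀ {x L} → Rem (x ∷ L) x L
    there : ∀ {x L y L′} → Rem L y L′ → Rem (x ∷ L) y (x ∷ L′)

  Σᴿ : (ℕ → List ℕ → ℚ) → List ℕ → ℚ
  Σᴿ φ []      = 0ℚ
  Σᴿ φ (x ∷ L) = φ x L + Σᴿ (λ y L′ → φ y (x ∷ L′)) L

  Σᴿ-cong : ∀ {φ ψ} L → (∀ {y L′} → Rem L y L′ → φ y L′ ≡ ψ y L′) → Σᴿ φ L ≡ Σᴿ ψ L
  Σᴿ-cong []      h = refl
  Σᴿ-cong (x ∷ L) h = cong₂ _+_ (h here) (Σᴿ-cong L λ r → h (there r))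

  Σᴿ-linear : ∀ a b φ ψ L → Σᴿ (λ y L′ → a * φ y L′ + b * ψ y L′) L ≡ a * Σᴿ φ L + b * Σᴿ ψ L
  Σᴿ-linear a b φ ψ []      = lem a b
    where
    lem : ∀ a b → 0ℚ ≡ a * 0ℚ + b * 0ℚ
    lem = solve-∀ ringℚ
  Σᴿ-linear a b φ ψ (x ∷ L) =
    trans (cong (λ e → a * φ x L + b * ψ x L + e) (Σᴿ-linear a b _ _ L)) (lem a b (φ x L) (ψ x L) _ _)
    where
    lem : ∀ a b x y z w → a * x + b * y + (a * z + b * w) ≡ a * (x + z) + b * (y + w)
    lem = solve-∀ ringℚ

  Σᴿ-const : ∀ f L → Σᴿ (λ y _ → f y) L ≡ Σᴸ f L
  Σᴿ-const f []      = refl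
  Σᴿ-const f (x ∷ L) = cong (λ e → f x + e) (Σᴿ-const f L)

  Σᴿ-± : ∀ {φ} {b : ℕ → ℚ} L → (∀ {y L′} → Rem L y L′ → φ y L′ ∈± b y) → Σᴿ φ L ∈± Σᴸ b L
  Σᴿ-± []      h = ≤! , ≤!
  Σᴿ-± (x ∷ L) h = ±-+ (h here) (Σᴿ-± L λ r → h (there r))

  -- Backward differences of functions on ℤ

  Δ : (ℤ → ℚ) → ℤ → ℚ
  Δ f m = f m - f (m ℤ.- + 1)

  Δ^ : ℕ → (ℤ → ℚ) → ℤ → ℚ
  Δ^ zero    f = f
  Δ^ (suc i) f = Δ (Δ^ i f)

  Δ^-cong : ∀ i {f g} → (∀ m → f m ≡ g m) → ∀ m → Δ^ i f m ≡ Δ^ i g m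
  Δ^-cong zero    h m = h m
  Δ^-cong (suc i) h m = cong₂ _-_ (Δ^-cong i h m) (Δ^-cong i h _)

  ℤ-swap : ∀ m j k → m ℤ.- j ℤ.- k ≡ m ℤ.- k ℤ.- j
  ℤ-swap m j k = trans (ℤ.+-assoc m (ℤ.- j) (ℤ.- k)) (trans (cong (λ e → m ℤ.+ e) (ℤ.+-comm (ℤ.- j) (ℤ.- k))) (sym (ℤ.+-assoc m (ℤ.- k) (ℤ.- j))))

  Δ^-shift : ∀ i f j m → Δ^ i (λ k → f (k ℤ.- j)) m ≡ Δ^ i f (m ℤ.- j)
  Δ^-shift zero    f j m = refl
  Δ^-shift (suc i) f j m = cong₂ _-_ (Δ^-shift i f j m)
    (trans (Δ^-shift i f j (m ℤ.- + 1)) (cong (Δ^ i f) (ℤ-swap m (+ 1) j)))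

  Δ^-linear : ∀ i a b f g m → Δ^ i (λ k → a * f k + b * g k) m ≡ a * Δ^ i f m + b * Δ^ i g m
  Δ^-linear zero    a b f g m = refl
  Δ^-linear (suc i) a b f g m =
    trans (cong₂ _-_ (Δ^-linear i a b f g m) (Δ^-linear i a b f g _)) (lem a b _ _ _ _)
    where
    lem : ∀ a b x y z w → a * x + b * y - (a * z + b * w) ≡ a * (x - z) + b * (y - w)
    lem = solve-∀ ringℚ

  ℤ-suc : ∀ m j → m ℤ.- + suc j ≡ m ℤ.- + j ℤ.- + 1
  ℤ-suc m j = trans (cong (λ e → m ℤ.- e) (ℤ.+-comm (+ 1) (+ j))) (trans (cong (λ e → m ℤ.+ e) (ℤ.neg-distrib-+ (+ j) (+ 1))) (sym (ℤ.+-assoc m (ℤ.- + j) (ℤ.- + 1))))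

  m-0 : ∀ m → m ℤ.- + 0 ≡ m
  m-0 m = ℤ.+-identityʳ m

  -- Taylor's formula with the midpoint weights 1 - p, p: the first-order terms of g(m - j) - g(m)
  -- are taken partly at m and partly at m - j.
  module Taylor (g : ℤ → ℚ) {B : ℚ} (h : ∀ m → Δ (Δ g) m ∈± B) (m : ℤ) where

    private
      d : ℕ → ℚ
      d j = Δ g m - Δ g (m ℤ.- + j)

    Δ-lipschitz : ∀ j → d j ∈± ι j * B
    Δ-lipschitz zero = subst₂ _∈±_ (sym (trans (cong (λ e → Δ g m - Δ g e) (m-0 m)) (+-inverseʳ (Δ g m))))
      (sym (trans (cong (_* B) ιℤ-0) (*-zeroˡ B))) (≤! , ≤!)
    Δ-lipschitz (suc j) = subst₂ _∈±_
      (trans (lem (Δ g m) (Δ g (m ℤ.- + j)) (Δ g (m ℤ.- + j ℤ.- + 1))) (cong (λ e → Δ g m - Δ g e) (sym (ℤ-suc m j))))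
      (trans (lem′ (ι j) B) (cong (_* B) (sym (ι-suc j)))) (±-+ (Δ-lipschitz j) (h (m ℤ.- + j)))
      where
      lem : ∀ a b c → a - b + (b - c) ≡ a - c
      lem = solve-∀ ringℚ
      lem′ : ∀ a b → a * b + b ≡ (1ℚ + a) * b
      lem′ = solve-∀ ringℚ

    forward : ∀ j → g (m ℤ.- + j) - g m + ι j * Δ g m ∈± ½ * (ι j * (ι j - 1ℚ) * B)
    forward zero = subst₂ _∈±_
      (sym (trans (cong₂ (λ a b → g a - g m + b * Δ g m) (m-0 m) ιℤ-0) (lem (g m) (Δ g m))))
      (sym (trans (cong (λ e → ½ * (e * (e - 1ℚ) * B)) ιℤ-0) (lem′ B))) (≤! , ≤!)
      where
      lem : ∀ a b → a - a + 0ℚ * b ≡ 0ℚ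
      lem = solve-∀ ringℚ
      lem′ : ∀ b → ½ * (0ℚ * (0ℚ - 1ℚ) * b) ≡ 0ℚ
      lem′ = solve-∀ ringℚ
    forward (suc j) = subst₂ _∈±_
      (trans (lem (g (m ℤ.- + j)) (g m) (ι j) (Δ g m) (g (m ℤ.- + j ℤ.- + 1)))
        (cong₂ (λ e i → g e - g m + i * Δ g m) (sym (ℤ-suc m j)) (sym (ι-suc j))))
      (trans (lem′ (ι j) B) (cong (λ i → ½ * (i * (i - 1ℚ) * B)) (sym (ι-suc j))))
      (±-+ (forward j) (Δ-lipschitz j))
      where
      lem : ∀ a b i d c → a - b + i * d + (d - (a - c)) ≡ c - b + (1ℚ + i) * d
      lem = solve-∀ ringℚ
      lem′ : ∀ i b → ½ * (i * (i - 1ℚ) * b) + i * b ≡ ½ * ((1ℚ + i) * (1ℚ + i - 1ℚ) * b)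
      lem′ = solve-∀ ringℚ

    backward : ∀ j → g (m ℤ.- + j) - g m + ι j * Δ g (m ℤ.- + j) ∈± ½ * (ι j * (ι j + 1ℚ) * B)
    backward zero = subst₂ _∈±_
      (sym (trans (cong₂ (λ a b → g a - g m + b * Δ g a) (m-0 m) ιℤ-0) (lem (g m) (Δ g m))))
      (sym (trans (cong (λ e → ½ * (e * (e + 1ℚ) * B)) ιℤ-0) (lem′ B))) (≤! , ≤!)
      where
      lem : ∀ a b → a - a + 0ℚ * b ≡ 0ℚ
      lem = solve-∀ ringℚ
      lem′ : ∀ b → ½ * (0ℚ * (0ℚ + 1ℚ) * b) ≡ 0ℚ
      lem′ = solve-∀ ringℚ
    backward (suc j) = subst₂ _∈±_
      (trans (lem (g (m ℤ.- + j)) (g m) (ι j) (g (m ℤ.- + j ℤ.- + 1)) (Δ g (m ℤ.- + j ℤ.- + 1)))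
        (cong₂ (λ e i → g e - g m + i * Δ g e) (sym (ℤ-suc m j)) (sym (ι-suc j))))
      (trans (lem′ (ι j) B) (cong (λ i → ½ * (i * (i + 1ℚ) * B)) (sym (ι-suc j))))
      (±-- (backward j) (±-* (1ℚ + ι j) (0≤+ {1ℚ} ≤! (0≤ι j)) (h (m ℤ.- + j))))
      where
      lem : ∀ a b i c d → a - b + i * (a - c) - (1ℚ + i) * (a - c - d) ≡ c - b + (1ℚ + i) * d
      lem = solve-∀ ringℚ
      lem′ : ∀ i b → ½ * (i * (i + 1ℚ) * b) + (1ℚ + i) * b ≡ ½ * ((1ℚ + i) * (1ℚ + i + 1ℚ) * b)
      lem′ = solve-∀ ringℚ

    -- The errors of `forward` and `backward` are j (j - 1) B / 2 and j (j + 1) B / 2. Their mixture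
    -- is (j² - (1 - 2p) j) B / 2, which is at most j² B / 2 because p ≤ ½.
    midpoint : ∀ {p} j → 0ℚ ≤ p → p ≤ ½ →
      g (m ℤ.- + j) - g m + ι j * ((1ℚ - p) * Δ g m + p * Δ g (m ℤ.- + j)) ∈± ½ * (ι j * ι j * B)
    midpoint {p} j p≥0 p≤½ = ±-weaken
      (subst (_∈± _) (lem p (g (m ℤ.- + j)) (g m) (ι j) (Δ g m) (Δ g (m ℤ.- + j)))
        (±-+ (±-* (1ℚ - p) (≤⇒0≤ {p} {1ℚ} (≤-trans p≤½ ≤!)) (forward j)) (±-* p p≥0 (backward j))))
      (bound (ι j) (0≤ι j) (≤-trans (±-0≤ (h m)) ≤-refl))
      where
      lem : ∀ p a b i x y → (1ℚ - p) * (a - b + i * x) + p * (a - b + i * y) ≡ a - b + i * ((1ℚ - p) * x + p * y)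
      lem = solve-∀ ringℚ
      bound : ∀ i → 0ℚ ≤ i → 0ℚ ≤ B →
        (1ℚ - p) * (½ * (i * (i - 1ℚ) * B)) + p * (½ * (i * (i + 1ℚ) * B)) ≤ ½ * (i * i * B)
      bound i i≥0 B≥0 = le-by (0≤* (0≤* i≥0 B≥0) (≤⇒0≤ p≤½)) (id i p B)
        where
        id : ∀ i p B → ½ * (i * i * B) ≡
          ((1ℚ - p) * (½ * (i * (i - 1ℚ) * B)) + p * (½ * (i * (i + 1ℚ) * B))) + i * B * (½ - p)
        id = solve-∀ ringℚ

  -- The law of a sum of independent variables, one for each part j in the list L: the variable
  -- equals j with probability p j and 0 otherwise.
  module Law (p : ℕ → ℚ) where

    E : List ℕ → (ℤ → ℚ) → ℚ
    E []      f = f (+ 0)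
    E (j ∷ L) f = (1ℚ - p j) * E L f + p j * E L (λ s → f (s ℤ.+ + j))

    δ : ℤ → ℤ → ℚ
    δ m s with s ℤ.≟ m
    ... | yes _ = 1ℚ
    ... | no  _ = 0ℚ

    P : List ℕ → ℤ → ℚ
    P L m = E L (δ m)

    E-cong : ∀ L {f g} → (∀ s → f s ≡ g s) → E L f ≡ E L g
    E-cong []      h = h (+ 0)
    E-cong (j ∷ L) h = cong₂ (λ a b → (1ℚ - p j) * a + p j * b) (E-cong L h) (E-cong L λ s → h _)

    E-linear : ∀ L a b f g → E L (λ s → a * f s + b * g s) ≡ a * E L f + b * E L g
    E-linear []      a b f g = refl
    E-linear (j ∷ L) a b f g = trans
      (cong₂ (λ x y → (1ℚ - p j) * x + p j * y) (E-linear L a b f g) (E-linear L a b _ _))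
      (lem (p j) a b (E L f) (E L g) _ _)
      where
      lem : ∀ p a b x y z w → (1ℚ - p) * (a * x + b * y) + p * (a * z + b * w)
        ≡ a * ((1ℚ - p) * x + p * z) + b * ((1ℚ - p) * y + p * w)
      lem = solve-∀ ringℚ

    -- Mean and variance of the sum; `K` is the third-order weight that governs the Taylor errors in
    -- `stein-error`.
    μ V K : List ℕ → ℚ
    μ = Σᴸ λ j → ι j * p j
    V = Σᴸ λ j → ι j * (ι j * (p j * (1ℚ - p j)))
    K = Σᴸ λ j → ι j * (ι j * (ι j * (p j * (1ℚ - p j))))

    E-1 : ∀ L → E L (λ _ → 1ℚ) ≡ 1ℚ
    E-1 []      = refl
    E-1 (j ∷ L) = trans (cong (λ e → (1ℚ - p j) * e + p j * e) (E-1 L)) (lem (p j))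
      where
      lem : ∀ p → (1ℚ - p) * 1ℚ + p * 1ℚ ≡ 1ℚ
      lem = solve-∀ ringℚ

    E-variance : ∀ L c → E L (λ s → (ιℤ s - c) * (ιℤ s - c)) ≡ V L + (μ L - c) * (μ L - c)
    E-variance []      c = trans (cong (λ e → (e - c) * (e - c)) ιℤ-0) (lem c)
      where
      lem : ∀ c → (0ℚ - c) * (0ℚ - c) ≡ 0ℚ + (0ℚ - c) * (0ℚ - c)
      lem = solve-∀ ringℚ
    E-variance (j ∷ L) c = trans
      (cong₂ (λ a b → (1ℚ - p j) * a + p j * b) (E-variance L c)
        (trans (E-cong L λ s → trans (cong (λ e → (e - c) * (e - c)) (ιℤ-+ s (+ j))) (sh (ιℤ s) (ι j) c)) (E-variance L (c - ι j))))
      (lem (p j) (V L) (μ L) c (ι j))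
      where
      sh : ∀ s j c → (s + j - c) * (s + j - c) ≡ (s - (c - j)) * (s - (c - j))
      sh = solve-∀ ringℚ
      lem : ∀ p v u c j → (1ℚ - p) * (v + (u - c) * (u - c)) + p * (v + (u - (c - j)) * (u - (c - j)))
        ≡ j * (j * (p * (1ℚ - p))) + v + (j * p + u - c) * (j * p + u - c)
      lem = solve-∀ ringℚ

    δ-shift : ∀ m j s → δ m (s ℤ.+ j) ≡ δ (m ℤ.- j) s
    δ-shift m j s with s ℤ.+ j ℤ.≟ m | s ℤ.≟ m ℤ.- j
    ... | yes _ | yes _ = refl
    ... | no _  | no _  = refl
    ... | yes p | no ¬q = contradiction (trans (sym (trans (ℤ.+-assoc s j (ℤ.- j)) (trans (cong (λ e → s ℤ.+ e) (ℤ.+-inverseʳ j)) (ℤ.+-identityʳ s)))) (cong (ℤ._- j) p)) ¬q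
    ... | no ¬p | yes q = contradiction (trans (cong (ℤ._+ j) q) (trans (ℤ.+-assoc m (ℤ.- j) j) (trans (cong (λ e → m ℤ.+ e) (ℤ.+-inverseˡ j)) (ℤ.+-identityʳ m)))) ¬p

    P-∷ : ∀ j L m → P (j ∷ L) m ≡ (1ℚ - p j) * P L m + p j * P L (m ℤ.- + j)
    P-∷ j L m = cong (λ e → (1ℚ - p j) * P L m + p j * e) (E-cong L λ s → δ-shift m (+ j) s)

    P-Rem : ∀ {L y L′} → Rem L y L′ → ∀ m → P L m ≡ (1ℚ - p y) * P L′ m + p y * P L′ (m ℤ.- + y)
    P-Rem {x ∷ L} here m = P-∷ x L m
    P-Rem {x ∷ L} {y} {.x ∷ L′} (there r) m = trans (P-∷ x L m)
      (trans (cong₂ (λ a b → (1ℚ - p x) * a + p x * b) (P-Rem r m) (trans (P-Rem r _) (cong (λ e → (1ℚ - p y) * P L′ (m ℤ.- + x) + p y * P L′ e) (ℤ-swap m (+ x) (+ y)))))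
      (trans (lem (p x) (p y) (P L′ m) (P L′ (m ℤ.- + y)) (P L′ (m ℤ.- + x)) _)
        (sym (cong₂ (λ a b → (1ℚ - p y) * a + p y * b) (P-∷ x L′ m) (P-∷ x L′ (m ℤ.- + y))))))
      where
      lem : ∀ p q a b c d → (1ℚ - p) * ((1ℚ - q) * a + q * b) + p * ((1ℚ - q) * c + q * d)
        ≡ (1ℚ - q) * ((1ℚ - p) * a + p * c) + q * ((1ℚ - p) * b + p * d)
      lem = solve-∀ ringℚ

    -- On the event that the sum is m, the number m is the total of the parts present. By
    -- independence the part j contributes j times its probability times the chance that the other
    -- parts sum to m - j.
    size-bias : ∀ L m → ιℤ m * P L m ≡ Σᴿ (λ j L′ → ι j * p j * P L′ (m ℤ.- + j)) L
    size-bias [] m with + 0 ℤ.≟ m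
    ... | yes refl = trans (*-identityʳ _) ιℤ-0
    ... | no _     = *-zeroʳ (ιℤ m)
    size-bias (x ∷ L) m = trans (cong (ιℤ m *_) (P-∷ x L m))
      (trans (lem (ιℤ m) (ι x) (p x) (P L m) (P L (m ℤ.- + x)))
      (trans (cong (λ e → ι x * p x * P L (m ℤ.- + x) + e)
        (trans (cong₂ (λ a b → (1ℚ - p x) * a + p x * b) (size-bias L m)
            (trans (cong (_* P L (m ℤ.- + x)) (sym (ιℤ-- m (+ x)))) (size-bias L (m ℤ.- + x))))
          (sym (Σᴿ-linear (1ℚ - p x) (p x) _ _ L))))
      (cong (λ e → ι x * p x * P L (m ℤ.- + x) + e) (Σᴿ-cong L λ {y} {L′} _ →
        trans (lem₂ (p x) (ι y * p y) (P L′ (m ℤ.- + y)) (P L′ (m ℤ.- + x ℤ.- + y)))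
          (cong (ι y * p y *_) (sym (trans (P-∷ x L′ (m ℤ.- + y)) (cong (λ e → (1ℚ - p x) * P L′ (m ℤ.- + y) + p x * P L′ e) (ℤ-swap m (+ y) (+ x))))))))))
      where
      lem : ∀ m x p a b → m * ((1ℚ - p) * a + p * b) ≡ x * p * b + ((1ℚ - p) * (m * a) + p * ((m - x) * b))
      lem = solve-∀ ringℚ
      lem₂ : ∀ p w a b → (1ℚ - p) * (w * a) + p * (w * b) ≡ w * ((1ℚ - p) * a + p * b)
      lem₂ = solve-∀ ringℚ

    weight : ℕ → ℚ
    weight j = ι j * (p j * (1ℚ - p j))

    -- In μ P(m) = Σ j p P(m) the law P is written, for each j, as the mixture of P′ and its shift
    -- by j. Subtracted from the size-biased sum this leaves p (P′(m - j) - (1 - p) P′(m) - p P′(m -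
    -- j)) = p (1 - p) (P′(m - j) - P′(m)) with the factor j.
    stein : ∀ L m → (ιℤ m - μ L) * P L m ≡ Σᴿ (λ j L′ → weight j * (P L′ (m ℤ.- + j) - P L′ m)) L
    stein L m = trans (lem (ιℤ m) (μ L) (P L m)) (trans
      (cong₂ (λ a b → 1ℚ * a + (- 1ℚ) * b) (size-bias L m)
        (trans (sym (Σᴸ-*ʳ _ (P L m) L)) (sym (Σᴿ-const (λ j → ι j * p j * P L m) L))))
      (trans (sym (Σᴿ-linear 1ℚ (- 1ℚ) _ _ L)) (Σᴿ-cong L λ {y} {L′} r →
        trans (cong (λ e → 1ℚ * (ι y * p y * P L′ (m ℤ.- + y)) + (- 1ℚ) * (ι y * p y * e)) (P-Rem r m))
          (lem₂ (ι y) (p y) (P L′ m) (P L′ (m ℤ.- + y))))))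
      where
      lem : ∀ m u a → (m - u) * a ≡ 1ℚ * (m * a) + (- 1ℚ) * (u * a)
      lem = solve-∀ ringℚ
      lem₂ : ∀ j p a b → 1ℚ * (j * p * b) + (- 1ℚ) * (j * p * ((1ℚ - p) * a + p * b)) ≡ j * (p * (1ℚ - p)) * (b - a)
      lem₂ = solve-∀ ringℚ

    steinSum : ℕ → List ℕ → ℤ → ℚ
    steinSum i L m = Σᴿ (λ j L′ → weight j * (Δ^ i (P L′) (m ℤ.- + j) - Δ^ i (P L′) m)) L

    -- The discrete product rule: the difference of (m - μ) G(m) is (m - μ) Δ G(m) + G(m - 1). `C`
    -- collects the lower-order terms of earlier differencings.
    stein-Δ : ∀ i L (G C : ℤ → ℚ) → (∀ m → (ιℤ m - μ L) * G m + C m ≡ steinSum i L m) →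
      ∀ m → (ιℤ m - μ L) * Δ G m + (G (m ℤ.- + 1) + Δ C m) ≡ steinSum (suc i) L m
    stein-Δ i L G C h m = trans (lem (ιℤ m) (ιℤ (m ℤ.- + 1)) (μ L) (G m) (G (m ℤ.- + 1)) (C m) (C (m ℤ.- + 1)) (trans (ιℤ-- m (+ 1)) (cong (λ e → ιℤ m - e) ιℤ-1)))
      (trans (cong₂ (λ a b → 1ℚ * a + (- 1ℚ) * b) (h m) (h (m ℤ.- + 1)))
      (trans (sym (Σᴿ-linear 1ℚ (- 1ℚ) _ _ L)) (Σᴿ-cong L λ {y} {L′} r →
        trans (cong (λ e → 1ℚ * (weight y * (Δ^ i (P L′) (m ℤ.- + y) - Δ^ i (P L′) m)) + (- 1ℚ) * (weight y * (Δ^ i (P L′) e - Δ^ i (P L′) (m ℤ.- + 1)))) (ℤ-swap m (+ 1) (+ y)))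
          (lem₂ (weight y) (Δ^ i (P L′) (m ℤ.- + y)) (Δ^ i (P L′) m) (Δ^ i (P L′) (m ℤ.- + y ℤ.- + 1)) (Δ^ i (P L′) (m ℤ.- + 1))))))
      where
      lem : ∀ m m′ u a b c d → m′ ≡ m - 1ℚ → (m - u) * (a - b) + (b + (c - d)) ≡ 1ℚ * ((m - u) * a + c) + (- 1ℚ) * ((m′ - u) * b + d)
      lem m .(m - 1ℚ) u a b c d refl = solve (m ∷ u ∷ a ∷ b ∷ c ∷ d ∷ []) ringℚ
      lem₂ : ∀ w a b c d → 1ℚ * (w * (a - b)) + (- 1ℚ) * (w * (c - d)) ≡ w * (a - c - (b - d))
      lem₂ = solve-∀ ringℚ

    -- The midpoint weights 1 - p, p are those by which the whole law is a mixture of the reduced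
    -- law and its shift. The first-order term of every summand is therefore a multiple of the same
    -- difference of the whole law, and these multiples add up to V.
    stein-error : (∀ j → 0ℚ ≤ p j) → (∀ j → p j ≤ ½) → ∀ i L {B} →
      (∀ {y L′} → Rem L y L′ → ∀ m → Δ^ (suc (suc i)) (P L′) m ∈± B) →
      ∀ m → steinSum i L m + V L * Δ^ (suc i) (P L) m ∈± ½ * (K L * B)
    stein-error 0≤p p≤½ i L {B} h m = subst₂ _∈±_ eq eqB (Σᴿ-± L term)
      where
      D = Δ^ (suc i) (P L) m
      term : ∀ {y L′} → Rem L y L′ →
        1ℚ * (weight y * (Δ^ i (P L′) (m ℤ.- + y) - Δ^ i (P L′) m)) + 1ℚ * (weight y * ι y * D) ∈± weight y * (½ * (ι y * ι y * B))
      term {y} {L′} r = subst (_∈± _)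
        (trans (lem (weight y) (Δ^ i (P L′) (m ℤ.- + y)) (Δ^ i (P L′) m) (ι y) _)
          (cong (λ e → 1ℚ * (weight y * (Δ^ i (P L′) (m ℤ.- + y) - Δ^ i (P L′) m)) + 1ℚ * (weight y * ι y * e)) (sym mid)))
        (±-* (weight y) (0≤* (0≤ι y) (0≤* (0≤p y) (≤⇒0≤ {p y} {1ℚ} (≤-trans (p≤½ y) ≤!))))
          (Taylor.midpoint (Δ^ i (P L′)) (h r) m y (0≤p y) (p≤½ y)))
        where
        lem : ∀ w a b j d → w * (a - b + j * d) ≡ 1ℚ * (w * (a - b)) + 1ℚ * (w * j * d)
        lem = solve-∀ ringℚ
        mid : D ≡ (1ℚ - p y) * Δ^ (suc i) (P L′) m + p y * Δ^ (suc i) (P L′) (m ℤ.- + y)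
        mid = trans (Δ^-cong (suc i) (P-Rem r) m) (trans (Δ^-linear (suc i) (1ℚ - p y) (p y) (P L′) (λ k → P L′ (k ℤ.- + y)) m)
          (cong (λ e → (1ℚ - p y) * Δ^ (suc i) (P L′) m + p y * e) (Δ^-shift (suc i) (P L′) (+ y) m)))
      eq : Σᴿ (λ y L′ → 1ℚ * (weight y * (Δ^ i (P L′) (m ℤ.- + y) - Δ^ i (P L′) m)) + 1ℚ * (weight y * ι y * D)) L ≡ steinSum i L m + V L * D
      eq = trans (Σᴿ-linear 1ℚ 1ℚ (λ y L′ → weight y * (Δ^ i (P L′) (m ℤ.- + y) - Δ^ i (P L′) m)) (λ y _ → weight y * ι y * D) L) (cong₂ _+_ (*-identityˡ (steinSum i L m))
        (trans (*-identityˡ _) (trans (Σᴿ-const (λ y → weight y * ι y * D) L) (trans (Σᴸ-*ʳ _ D L) (cong (_* D) (Σᴸ-cong L λ j → *-comm (weight j) (ι j)))))))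
      eqB : Σᴸ (λ y → weight y * (½ * (ι y * ι y * B))) L ≡ ½ * (K L * B)
      eqB = trans (Σᴸ-cong L λ j → lem (ι j) (p j) B) (trans (Σᴸ-*ʳ _ (½ * B) L) (lem′ (K L) B))
        where
        lem : ∀ j p B → j * (p * (1ℚ - p)) * (½ * (j * j * B)) ≡ j * (j * (j * (p * (1ℚ - p)))) * (½ * B)
        lem = solve-∀ ringℚ
        lem′ : ∀ k b → k * (½ * b) ≡ ½ * (k * b)
        lem′ = solve-∀ ringℚ

    E-mono : (∀ j → 0ℚ ≤ p j) → (∀ j → p j ≤ 1ℚ) → ∀ L {f g} → (∀ s → f s ≤ g s) → E L f ≤ E L g
    E-mono 0≤p p≤1 []      h = h (+ 0)
    E-mono 0≤p p≤1 (j ∷ L) h = +-mono-≤ (*-monoˡ (1ℚ - p j) (≤⇒0≤ (p≤1 j)) (E-mono 0≤p p≤1 L h))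
      (*-monoˡ (p j) (0≤p j) (E-mono 0≤p p≤1 L λ s → h _))

  eq-by : ∀ {a b e} → e ≡ 0ℚ → a ≡ b + e → a ≡ b
  eq-by {b = b} e≡0 h = trans h (trans (cong (λ x → b + x) e≡0) (+-identityʳ b))

  0*diff : ∀ {u v} c → u ≡ v → c * (u - v) ≡ 0ℚ
  0*diff {u} c refl = trans (cong (c *_) (+-inverseʳ u)) (*-zeroʳ c)

  0+ : ∀ {a b} → a ≡ 0ℚ → b ≡ 0ℚ → a + b ≡ 0ℚ
  0+ refl refl = refl

  infixr 8 _^_
  _^_ : ℚ → ℕ → ℚ
  x ^ zero  = 1ℚ
  x ^ suc n = x * x ^ n

  -- Gaussian rationals

  record ℂ : Set where
    constructor ⟨_,_⟩
    field
      re im : ℚ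
  open ℂ public

  infixl 7 _·_
  _·_ : ℂ → ℂ → ℂ
  ⟨ a , b ⟩ · ⟨ c , d ⟩ = ⟨ a * c - b * d , a * d + b * c ⟩

  1ᶜ : ℂ
  1ᶜ = ⟨ 1ℚ , 0ℚ ⟩

  conj : ℂ → ℂ
  conj ⟨ a , b ⟩ = ⟨ a , - b ⟩

  norm : ℂ → ℚ
  norm ⟨ a , b ⟩ = a * a + b * b

  pow : ℂ → ℕ → ℂ
  pow z zero    = 1ᶜ
  pow z (suc n) = z · pow z n

  norm-· : ∀ z w → norm (z · w) ≡ norm z * norm w
  norm-· ⟨ a , b ⟩ ⟨ c , d ⟩ = lem a b c d
    where
    lem : ∀ a b c d → (a * c - b * d) * (a * c - b * d) + (a * d + b * c) * (a * d + b * c) ≡ (a * a + b * b) * (c * c + d * d)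
    lem = solve-∀ ringℚ

  ·-assoc : ∀ x y z → x · y · z ≡ x · (y · z)
  ·-assoc ⟨ a , b ⟩ ⟨ c , d ⟩ ⟨ e , f ⟩ = cong₂ ⟨_,_⟩ (l₁ a b c d e f) (l₂ a b c d e f)
    where
    l₁ : ∀ a b c d e f → (a * c - b * d) * e - (a * d + b * c) * f ≡ a * (c * e - d * f) - b * (c * f + d * e)
    l₁ = solve-∀ ringℚ
    l₂ : ∀ a b c d e f → (a * c - b * d) * f + (a * d + b * c) * e ≡ a * (c * f + d * e) + b * (c * e - d * f)
    l₂ = solve-∀ ringℚ

  ·-comm : ∀ x y → x · y ≡ y · x
  ·-comm ⟨ a , b ⟩ ⟨ c , d ⟩ = cong₂ ⟨_,_⟩ (l₁ a b c d) (l₂ a b c d)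
    where
    l₁ : ∀ a b c d → a * c - b * d ≡ c * a - d * b
    l₁ = solve-∀ ringℚ
    l₂ : ∀ a b c d → a * d + b * c ≡ c * b + d * a
    l₂ = solve-∀ ringℚ

  ·-identityˡ : ∀ z → 1ᶜ · z ≡ z
  ·-identityˡ ⟨ a , b ⟩ = cong₂ ⟨_,_⟩ (l₁ a b) (l₂ a b)
    where
    l₁ : ∀ a b → 1ℚ * a - 0ℚ * b ≡ a
    l₁ = solve-∀ ringℚ
    l₂ : ∀ a b → 1ℚ * b + 0ℚ * a ≡ b
    l₂ = solve-∀ ringℚ

  conj-· : ∀ z w → conj (z · w) ≡ conj z · conj w
  conj-· ⟨ a , b ⟩ ⟨ c , d ⟩ = cong₂ ⟨_,_⟩ (l₁ a b c d) (l₂ a b c d)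
    where
    l₁ : ∀ a b c d → a * c - b * d ≡ a * c - - b * - d
    l₁ = solve-∀ ringℚ
    l₂ : ∀ a b c d → - (a * d + b * c) ≡ a * - d + - b * c
    l₂ = solve-∀ ringℚ

  pow-conj : ∀ z n → pow (conj z) n ≡ conj (pow z n)
  pow-conj z zero    = refl
  pow-conj z (suc n) = trans (cong (conj z ·_) (pow-conj z n)) (sym (conj-· z (pow z n)))

  pow-norm : ∀ z → norm z ≡ 1ℚ → ∀ n → norm (pow z n) ≡ 1ℚ
  pow-norm z h zero    = refl
  pow-norm z h (suc n) = trans (norm-· z (pow z n)) (cong₂ _*_ h (pow-norm z h n))

  pow-·-distrib : ∀ z w n → pow (z · w) n ≡ pow z n · pow w n
  pow-·-distrib z w zero    = refl
  pow-·-distrib z w (suc n) = trans (cong (z · w ·_) (pow-·-distrib z w n)) (trans (·-assoc z w _)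
    (trans (cong (z ·_) (trans (sym (·-assoc w (pow z n) (pow w n))) (trans (cong (_· pow w n) (·-comm w (pow z n))) (·-assoc (pow z n) w (pow w n)))))
      (sym (·-assoc z (pow z n) (w · pow w n)))))

  pow-1 : ∀ n → pow 1ᶜ n ≡ 1ᶜ
  pow-1 zero    = refl
  pow-1 (suc n) = trans (·-identityˡ _) (pow-1 n)

  pow-pow : ∀ z k n → pow (pow z k) n ≡ pow (pow z n) k
  pow-pow z zero    n = pow-1 n
  pow-pow z (suc k) n = trans (pow-·-distrib z (pow z k) n) (cong (pow z n ·_) (pow-pow z k n))

  -- Integer powers of a number of norm 1
  cis : ℂ → ℤ → ℂ
  cis z (+ n)    = pow z n
  cis z -[1+ n ] = pow (conj z) (suc n)

  conj-inverse : ∀ z → norm z ≡ 1ℚ → z · conj z ≡ 1ᶜ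
  conj-inverse ⟨ a , b ⟩ h = cong₂ ⟨_,_⟩ (trans (l₁ a b) h) (l₂ a b)
    where
    l₁ : ∀ a b → a * a - b * - b ≡ a * a + b * b
    l₁ = solve-∀ ringℚ
    l₂ : ∀ a b → a * - b + b * a ≡ 0ℚ
    l₂ = solve-∀ ringℚ

  cis-suc : ∀ z → norm z ≡ 1ℚ → ∀ m → cis z (m ℤ.+ + 1) ≡ z · cis z m
  cis-suc z h (+ n)        = cong (pow z) (ℕ.+-comm n 1)
  cis-suc z h -[1+ zero ]  = sym (trans (sym (·-assoc z (conj z) 1ᶜ)) (cong (_· 1ᶜ) (conj-inverse z h)))
  cis-suc z h -[1+ suc n ] = sym (trans (sym (·-assoc z (conj z) _)) (trans (cong (_· pow (conj z) (suc n)) (conj-inverse z h)) (·-identityˡ _)))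

  cis-+ : ∀ z → norm z ≡ 1ℚ → ∀ m j → cis z (m ℤ.+ + j) ≡ pow z j · cis z m
  cis-+ z h m zero    = trans (cong (cis z) (ℤ.+-identityʳ m)) (sym (·-identityˡ _))
  cis-+ z h m (suc j) = trans (cong (cis z) (trans (cong (λ e → m ℤ.+ e) (ℤ.+-comm (+ 1) (+ j))) (sym (ℤ.+-assoc m (+ j) (+ 1)))))
    (trans (cis-suc z h (m ℤ.+ + j)) (trans (cong (z ·_) (cis-+ z h m j)) (sym (·-assoc z (pow z j) (cis z m)))))

  cis-norm : ∀ z → norm z ≡ 1ℚ → ∀ m → norm (cis z m) ≡ 1ℚ
  cis-norm z h (+ n)    = pow-norm z h n
  cis-norm z h -[1+ n ] = pow-norm (conj z) (trans (l (re z) (im z)) h) (suc n)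
    where
    l : ∀ a b → a * a + - b * - b ≡ a * a + b * b
    l = solve-∀ ringℚ

  re-cis : ∀ z m → re (cis z m) ≡ re (pow z ℤ.∣ m ∣)
  re-cis z (+ n)    = refl
  re-cis z -[1+ n ] = cong re (pow-conj z (suc n))

  re-unit : ∀ z → norm z ≡ 1ℚ → re z ∈± 1ℚ
  re-unit ⟨ a , b ⟩ h = ±-sq ≤! (le-by (0≤sq b) (sym h))

  im-unit : ∀ z → norm z ≡ 1ℚ → im z ∈± 1ℚ
  im-unit ⟨ a , b ⟩ h = ±-sq ≤! (le-by (0≤sq a) (trans (sym h) (+-comm (a * a) (b * b))))

  -- Means of bounded sequences

  sumTo : (ℕ → ℚ) → ℕ → ℚ
  sumTo g zero    = 0ℚ
  sumTo g (suc n) = sumTo g n + g n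

  -- The partial sums of g stay within a bounded distance of n a.
  Mean : (ℕ → ℚ) → ℚ → Set
  Mean g a = ∃ λ C → ∀ n → sumTo g n - ι n * a ∈± C

  sumTo-cong : ∀ {f g} → (∀ k → f k ≡ g k) → ∀ n → sumTo f n ≡ sumTo g n
  sumTo-cong h zero    = refl
  sumTo-cong h (suc n) = cong₂ _+_ (sumTo-cong h n) (h n)

  sumTo-linear : ∀ a b f g n → sumTo (λ k → a * f k + b * g k) n ≡ a * sumTo f n + b * sumTo g n
  sumTo-linear a b f g zero    = lem a b
    where
    lem : ∀ a b → 0ℚ ≡ a * 0ℚ + b * 0ℚ
    lem = solve-∀ ringℚ
  sumTo-linear a b f g (suc n) = trans (cong (λ e → e + (a * f n + b * g n)) (sumTo-linear a b f g n)) (lem a b (sumTo f n) (sumTo g n) (f n) (g n))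
    where
    lem : ∀ a b x y z w → a * x + b * y + (a * z + b * w) ≡ a * (x + z) + b * (y + w)
    lem = solve-∀ ringℚ

  sumTo-mono : ∀ {f g} → (∀ k → f k ≤ g k) → ∀ n → sumTo f n ≤ sumTo g n
  sumTo-mono h zero    = ≤-refl
  sumTo-mono h (suc n) = +-mono-≤ (sumTo-mono h n) (h n)

  Mean-cong : ∀ {f g a} → (∀ k → f k ≡ g k) → Mean f a → Mean g a
  Mean-cong h (C , m) = C , λ n → subst (λ e → e - _ ∈± C) (sumTo-cong h n) (m n)

  Mean-value : ∀ {f a b} → a ≡ b → Mean f a → Mean f b
  Mean-value refl m = m

  Mean-linear : ∀ {f g x y} a b → Mean f x → Mean g y → Mean (λ k → a * f k + b * g k) (a * x + b * y)
  Mean-linear {f} {g} {x} {y} a b (C , m) (D , m′) = bound a C + bound b D , λ n →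
    subst (_∈± bound a C + bound b D) (trans (lem a b (sumTo f n) (sumTo g n) x y (ι n)) (cong (λ e → e - ι n * (a * x + b * y)) (sym (sumTo-linear a b f g n))))
      (±-+ (bounded a (m n)) (bounded b (m′ n)))
    where
    lem : ∀ a b s t x y n → a * (s - n * x) + b * (t - n * y) ≡ a * s + b * t - n * (a * x + b * y)
    lem = solve-∀ ringℚ
    bound : ℚ → ℚ → ℚ
    bound c C with ≤-total 0ℚ c
    ... | inj₁ _ = c * C
    ... | inj₂ _ = - c * C
    bounded : ∀ c {u C} → u ∈± C → c * u ∈± bound c C
    bounded c {u} {C} h with ≤-total 0ℚ c
    ... | inj₁ p = ±-* c p h
    ... | inj₂ p = subst (_∈± _) (l c u) (±-neg (±-* (- c) (neg-antimono-≤ p) h))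
      where
      l : ∀ c x → - (- c * x) ≡ c * x
      l = solve-∀ ringℚ

  Mean-const : ∀ c → Mean (λ _ → c) c
  Mean-const c = 0ℚ , λ n → subst (_∈± 0ℚ) (sym (trans (cong (λ e → e - ι n * c) (sum n)) (+-inverseʳ (ι n * c)))) (≤! , ≤!)
    where
    sum : ∀ n → sumTo (λ _ → c) n ≡ ι n * c
    sum zero    = sym (trans (cong (_* c) ιℤ-0) (*-zeroˡ c))
    sum (suc n) = trans (cong (λ e → e + c) (sum n)) (trans (lem (ι n) c) (cong (_* c) (sym (ι-suc n))))
      where
      lem : ∀ n c → n * c + c ≡ (1ℚ + n) * c
      lem = solve-∀ ringℚ

  Mean-mono : ∀ {f g a b} → (∀ k → f k ≤ g k) → Mean f a → Mean g b → a ≤ b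
  Mean-mono {f} {g} {a} {b} h (C , m) (D , m′) = archimedean-≤ λ n →
    bound (ι n * a) (ι n * b) (sumTo f n) (sumTo g n) (proj₁ (m n)) (proj₂ (m′ n)) (sumTo-mono h n)
    where
    bound : ∀ x y s t → - C ≤ s - x → t - y ≤ D → s ≤ t → x ≤ y + (C + D)
    bound x y s t p q r = le-by (0≤+ (0≤+ (≤⇒0≤ p) (≤⇒0≤ q)) (≤⇒0≤ r)) (l x y s t C D)
      where
      l : ∀ x y s t C D → y + (C + D) ≡ x + ((s - x - - C) + (D - (t - y)) + (t - s))
      l = solve-∀ ringℚ

  -- A point of the unit circle that is not a root of unity: the numerators of its powers
  -- are congruent to 3 + 4i modulo 5.
  z₀ : ℂ
  z₀ = ⟨ + 3 / 5 , + 4 / 5 ⟩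

  z₀-numerator : ∀ n → ∃ λ a → ∃ λ b → pow z₀ (suc n) ≡
    ⟨ ιℤ (+ 5 ℤ.* a ℤ.+ + 3) * (+ 1 / 5) ^ suc n , ιℤ (+ 5 ℤ.* b ℤ.+ + 4) * (+ 1 / 5) ^ suc n ⟩
  z₀-numerator zero = + 0 , + 0 , cong₂ ⟨_,_⟩ (cong (_* (+ 1 / 5)) (sym (ιℤ-lit 3))) (cong (_* (+ 1 / 5)) (sym (ιℤ-lit 4)))
  z₀-numerator (suc n) with z₀-numerator n
  ... | a , b , h = + 3 ℤ.* a ℤ.- + 4 ℤ.* b ℤ.- + 2 , + 3 ℤ.* b ℤ.+ + 4 ℤ.* a ℤ.+ + 4 ,
    trans (cong (z₀ ·_) h) (cong₂ ⟨_,_⟩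
      (trans (l₁ (ιℤ A) (ιℤ B) t) (cong (_* (+ 1 / 5 * t)) (trans (lin₁ A B) (cong ιℤ (e₁ a b)))))
      (trans (l₂ (ιℤ A) (ιℤ B) t) (cong (_* (+ 1 / 5 * t)) (trans (lin₂ A B) (cong ιℤ (e₂ a b))))))
    where
    import Data.Integer.Tactic.RingSolver as ℤR
    A = + 5 ℤ.* a ℤ.+ + 3
    B = + 5 ℤ.* b ℤ.+ + 4
    t = (+ 1 / 5) ^ suc n
    l₁ : ∀ x y t → + 3 / 5 * (x * t) - + 4 / 5 * (y * t) ≡ (+ 3 / 1 * x - + 4 / 1 * y) * (+ 1 / 5 * t)
    l₁ = solve-∀ ringℚ
    l₂ : ∀ x y t → + 3 / 5 * (y * t) + + 4 / 5 * (x * t) ≡ (+ 3 / 1 * y + + 4 / 1 * x) * (+ 1 / 5 * t)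
    l₂ = solve-∀ ringℚ
    scale : ∀ k i → + k / 1 * ιℤ i ≡ ιℤ (+ k ℤ.* i)
    scale k i = trans (cong (_* ιℤ i) (sym (ιℤ-lit k))) (sym (ιℤ-* (+ k) i))
    lin₁ : ∀ A B → + 3 / 1 * ιℤ A - + 4 / 1 * ιℤ B ≡ ιℤ (+ 3 ℤ.* A ℤ.- + 4 ℤ.* B)
    lin₁ A B = trans (cong₂ _-_ (scale 3 A) (scale 4 B)) (sym (ιℤ-- (+ 3 ℤ.* A) (+ 4 ℤ.* B)))
    lin₂ : ∀ A B → + 3 / 1 * ιℤ B + + 4 / 1 * ιℤ A ≡ ιℤ (+ 3 ℤ.* B ℤ.+ + 4 ℤ.* A)
    lin₂ A B = trans (cong₂ _+_ (scale 3 B) (scale 4 A)) (sym (ιℤ-+ (+ 3 ℤ.* B) (+ 4 ℤ.* A)))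
    e₁ : ∀ a b → + 3 ℤ.* (+ 5 ℤ.* a ℤ.+ + 3) ℤ.- + 4 ℤ.* (+ 5 ℤ.* b ℤ.+ + 4) ≡ + 5 ℤ.* (+ 3 ℤ.* a ℤ.- + 4 ℤ.* b ℤ.- + 2) ℤ.+ + 3
    e₁ = ℤR.solve-∀
    e₂ : ∀ a b → + 3 ℤ.* (+ 5 ℤ.* b ℤ.+ + 4) ℤ.+ + 4 ℤ.* (+ 5 ℤ.* a ℤ.+ + 3) ≡ + 5 ℤ.* (+ 3 ℤ.* b ℤ.+ + 4 ℤ.* a ℤ.+ + 4) ℤ.+ + 4
    e₂ = ℤR.solve-∀

  5b+4≢0 : ∀ b → ¬ + 5 ℤ.* b ℤ.+ + 4 ≡ + 0
  5b+4≢0 (+ n)    h = contradiction (ℕ.m+n≡0⇒n≡0 (5 ℕ.* n) (ℤ.+-injective (trans (cong (ℤ._+ + 4) (ℤ.pos-* 5 n)) h))) λ ()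
  5b+4≢0 -[1+ n ] h = contradiction
    (ℤ.≤-trans (ℤ.≤-reflexive (sym h)) (ℤ.+-monoˡ-≤ (+ 4) (ℤ.*-monoˡ-≤-nonNeg (+ 5) (ℤ.-≤- (ℕ.z≤n {n}))))) λ ()

  0<^ : ∀ {x} → 0ℚ < x → ∀ n → 0ℚ < x ^ n
  0<^ p zero    = <!
  0<^ p (suc n) = 0<* p (0<^ p n)

  im-z₀≢0 : ∀ n → ¬ im (pow z₀ (suc n)) ≡ 0ℚ
  im-z₀≢0 n h with z₀-numerator n
  ... | a , b , e = 5b+4≢0 b (ιℤ-injective (trans (cancel (ιℤ B) t (0<^ {+ 1 / 5} <! (suc n)) (trans (sym (cong im e)) h)) (sym ιℤ-0)))
    where
    B = + 5 ℤ.* b ℤ.+ + 4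
    t = (+ 1 / 5) ^ suc n
    ιℤ-injective : ∀ {i j} → ιℤ i ≡ ιℤ j → i ≡ j
    ιℤ-injective h = ℤ.≤-antisym (ιℤ-cancel (≤-reflexive h)) (ιℤ-cancel (≤-reflexive (sym h)))
    cancel : ∀ x t → 0ℚ < t → x * t ≡ 0ℚ → x ≡ 0ℚ
    cancel x t p h = ≤-antisym
      (*-cancelˡ t p (≤-reflexive (trans (*-comm t x) (trans h (sym (*-zeroʳ t))))))
      (*-cancelˡ t p (≤-reflexive (sym (trans (*-comm t x) (trans h (sym (*-zeroʳ t)))))))

  -- Geometric sums of a unit w ≠ 1 are bounded.
  Mean-pow : ∀ w → norm w ≡ 1ℚ → ¬ im w ≡ 0ℚ → Mean (λ k → re (pow w k)) 0ℚ
  Mean-pow w h im≢0 = recip e * (+ 5 / 1) , λ n → subst (_∈± recip e * (+ 5 / 1))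
    (trans (trans (sym (*-assoc (recip e) e _)) (trans (cong (_* sumTo (λ k → re (pow w k)) n) (trans (*-comm (recip e) e) (*-recip e>0))) (*-identityˡ _)))
      (l₀ (sumTo (λ k → re (pow w k)) n) (ι n)))
    (±-* (recip e) (0≤recip e>0) (subst (_∈± (+ 5 / 1)) (sym (geometric n)) (bound (pow w n) (pow-norm w h n))))
    where
    c = re w
    d = im w
    e = + 2 / 1 * (1ℚ - c)
    l₀ : ∀ s n → s ≡ s - n * 0ℚ
    l₀ = solve-∀ ringℚ
    c≢1 : ¬ c ≡ 1ℚ
    c≢1 c≡1 = im≢0 (zero-sq d (subst (λ c → c * c + d * d ≡ 1ℚ) c≡1 h))
      where
      zero-sq : ∀ d → 1ℚ * 1ℚ + d * d ≡ 1ℚ → d ≡ 0ℚ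
      zero-sq d h = ≤-antisym (proj₂ (±-sq {d} {0ℚ} ≤! sq)) (proj₁ (±-sq {d} {0ℚ} ≤! sq))
        where
        l : ∀ x → x ≡ 1ℚ * 1ℚ + x - 1ℚ
        l = solve-∀ ringℚ
        sq : d * d ≤ 0ℚ * 0ℚ
        sq = ≤-reflexive (trans (l (d * d)) (cong (λ x → x - 1ℚ) h))
    1-c>0 : 0ℚ < 1ℚ - c
    1-c>0 = ≰⇒> λ p → c≢1 (≤-antisym (proj₂ (re-unit w h)) (l p))
      where
      l : 1ℚ - c ≤ 0ℚ → 1ℚ ≤ c
      l p = le-by (≤⇒0≤ p) (l′ c)
        where
        l′ : ∀ c → c ≡ 1ℚ + (0ℚ - (1ℚ - c))
        l′ = solve-∀ ringℚ
    e>0 : 0ℚ < e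
    e>0 = 0<* {+ 2 / 1} <! 1-c>0
    -- The geometric sum of w is multiplied by e = |1 - w|². This is the real part of (v - 1)(w̄ -
    -- 1) for v = w^n, of size at most 2 · 2 + 1.
    target : ℂ → ℚ
    target v = (c - 1ℚ) * (re v - 1ℚ) + d * im v
    geometric : ∀ n → e * sumTo (λ k → re (pow w k)) n ≡ target (pow w n)
    geometric zero    = l c d
      where
      l : ∀ c d → + 2 / 1 * (1ℚ - c) * 0ℚ ≡ (c - 1ℚ) * (1ℚ - 1ℚ) + d * 0ℚ
      l = solve-∀ ringℚ
    geometric (suc n) = eq-by (0+ (0*diff (- 1ℚ) (geometric′)) (0*diff (- (re (pow w n))) h))
      (l c d (re (pow w n)) (im (pow w n)) (sumTo (λ k → re (pow w k)) n))
      where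
      geometric′ : target (pow w n) ≡ e * sumTo (λ k → re (pow w k)) n
      geometric′ = sym (geometric n)
      l : ∀ c d x y s → + 2 / 1 * (1ℚ - c) * (s + x) ≡
        (c - 1ℚ) * (c * x - d * y - 1ℚ) + d * (c * y + d * x) +
        ((- 1ℚ) * ((c - 1ℚ) * (x - 1ℚ) + d * y - + 2 / 1 * (1ℚ - c) * s) + (- x) * (c * c + d * d - 1ℚ))
      l = solve-∀ ringℚ
    bound : ∀ v → norm v ≡ 1ℚ → target v ∈± + 5 / 1
    bound v hv = ±-weaken (±-+ (±-mul (±-- (re-unit w h) one) (±-- (re-unit v hv) one)) (±-mul (im-unit w h) (im-unit v hv))) ≤!
      where
      one : 1ℚ ∈± 1ℚ
      one = ≤! , ≤!

  pt : ℕ → ℂ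
  pt k = pow z₀ k

  pt-norm : ∀ k → norm (pt k) ≡ 1ℚ
  pt-norm = pow-norm z₀ refl

  Mean-pt : ∀ n → Mean (λ k → re (pow (pt k) (suc n))) 0ℚ
  Mean-pt n = Mean-cong (λ k → cong re (sym (pow-pow z₀ k (suc n)))) (Mean-pow (pow z₀ (suc n)) (pow-norm z₀ refl (suc n)) (im-z₀≢0 n))

  -- Fourier inversion for the laws of Law

  module Fourier (p : ℕ → ℚ) where
    open Law p

    φ : ℂ → List ℕ → ℂ
    φ z []      = 1ᶜ
    φ z (j ∷ L) = ⟨ 1ℚ - p j + p j * re (pow z j) , p j * im (pow z j) ⟩ · φ z L

    φ-split : ∀ q p z f c → re (⟨ q + p * re z , p * im z ⟩ · f · c) ≡ q * re (f · c) + p * re (f · (z · c))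
    φ-split q p ⟨ a , b ⟩ ⟨ c , d ⟩ ⟨ e , f ⟩ = l q p a b c d e f
      where
      l : ∀ q p a b c d e f → ((q + p * a) * c - p * b * d) * e - ((q + p * a) * d + p * b * c) * f ≡
        q * (c * e - d * f) + p * (c * (a * e - b * f) - d * (a * f + b * e))
      l = solve-∀ ringℚ

    -- For the empty law this is orthogonality: the mean of the m-th powers is zero unless m = 0. A
    -- further part acts on the characteristic function and on P by the same mixture, and means are
    -- linear.
    inversion : ∀ L m → Mean (λ k → re (φ (pt k) L · cis (pt k) (ℤ.- m))) (P L m)
    inversion [] m = Mean-cong (λ k → sym (trans (cong re (·-identityˡ (cis (pt k) (ℤ.- m)))) (trans (re-cis (pt k) (ℤ.- m)) (cong (λ e → re (pow (pt k) e)) (ℤ.∣-i∣≡∣i∣ m))))) (base m)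
      where
      base : ∀ m → Mean (λ k → re (pow (pt k) ℤ.∣ m ∣)) (P [] m)
      base m with + 0 ℤ.≟ m
      ... | yes refl = Mean-const 1ℚ
      base (+ zero)  | no ¬p = contradiction refl ¬p
      base (+ suc n) | no _ = Mean-pt n
      base -[1+ n ]  | no _ = Mean-pt n
    inversion (j ∷ L) m = Mean-cong
      (λ k → sym (trans (φ-split (1ℚ - p j) (p j) (pow (pt k) j) (φ (pt k) L) (cis (pt k) (ℤ.- m)))
        (cong (λ e → (1ℚ - p j) * re (φ (pt k) L · cis (pt k) (ℤ.- m)) + p j * re (φ (pt k) L · e))
          (trans (sym (cis-+ (pt k) (pt-norm k) (ℤ.- m) j)) (cong (cis (pt k)) (neg m j))))))
      (Mean-value (sym (P-∷ j L m)) (Mean-linear (1ℚ - p j) (p j) (inversion L m) (inversion L (m ℤ.- + j))))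
      where
      neg : ∀ m j → ℤ.- m ℤ.+ + j ≡ ℤ.- (m ℤ.- + j)
      neg m j = sym (trans (ℤ.neg-distrib-+ m (ℤ.- + j)) (cong (λ e → ℤ.- m ℤ.+ e) (ℤ.neg-involutive (+ j))))

    1-ᶜ : ℂ → ℂ
    1-ᶜ z = ⟨ 1ℚ - re z , - im z ⟩

    inversion-Δ : ∀ i L m → Mean (λ k → re (φ (pt k) L · pow (1-ᶜ (pt k)) i · cis (pt k) (ℤ.- m))) (Δ^ i (P L) m)
    inversion-Δ zero L m = Mean-cong (λ k → cong (λ e → re (e · cis (pt k) (ℤ.- m))) (sym (trans (·-comm (φ (pt k) L) 1ᶜ) (·-identityˡ (φ (pt k) L))))) (inversion L m)
    inversion-Δ (suc i) L m = Mean-cong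
      (λ k → trans (cong (λ e → 1ℚ * re (F k · cis (pt k) (ℤ.- m)) + (- 1ℚ) * re (F k · e)) (trans (cong (cis (pt k)) (neg m)) (cis-suc (pt k) (pt-norm k) (ℤ.- m))))
        (trans (l (F k) (pt k) (cis (pt k) (ℤ.- m))) (cong (λ e → re (e · cis (pt k) (ℤ.- m)))
          (trans (·-assoc (φ (pt k) L) (pow (1-ᶜ (pt k)) i) (1-ᶜ (pt k))) (cong (φ (pt k) L ·_) (·-comm (pow (1-ᶜ (pt k)) i) (1-ᶜ (pt k))))))))
      (Mean-value (l₀ (Δ^ i (P L) m) _) (Mean-linear 1ℚ (- 1ℚ) (inversion-Δ i L m) (inversion-Δ i L (m ℤ.- + 1))))
      where
      F : ℕ → ℂ
      F k = φ (pt k) L · pow (1-ᶜ (pt k)) i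
      l₀ : ∀ a b → 1ℚ * a + (- 1ℚ) * b ≡ a - b
      l₀ = solve-∀ ringℚ
      neg : ∀ m → ℤ.- (m ℤ.- + 1) ≡ ℤ.- m ℤ.+ + 1
      neg m = trans (ℤ.neg-distrib-+ m (ℤ.- + 1)) refl
      l : ∀ f z c → 1ℚ * re (f · c) + (- 1ℚ) * re (f · (z · c)) ≡ re (f · 1-ᶜ z · c)
      l ⟨ a , b ⟩ ⟨ c , d ⟩ ⟨ e , f ⟩ = l′ a b c d e f
        where
        l′ : ∀ a b c d e f → 1ℚ * (a * e - b * f) + (- 1ℚ) * (a * (c * e - d * f) - b * (c * f + d * e)) ≡
          (a * (1ℚ - c) - b * - d) * e - (a * - d + b * (1ℚ - c)) * f
        l′ = solve-∀ ringℚ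

    -- s(z) = |1 - z|²/4 and s_j = s(z^j)
    sin² : ℂ → ℚ
    sin² z = ½ * (1ℚ - re z)

    norm-φ-factor : ∀ q z → norm z ≡ 1ℚ → norm ⟨ 1ℚ - q + q * re z , q * im z ⟩ ≡ 1ℚ - + 4 / 1 * (q * (1ℚ - q)) * sin² z
    norm-φ-factor q ⟨ a , b ⟩ h = eq-by (0*diff (q * q) h) (l q a b)
      where
      l : ∀ q a b → (1ℚ - q + q * a) * (1ℚ - q + q * a) + q * b * (q * b) ≡ 1ℚ - + 4 / 1 * (q * (1ℚ - q)) * (½ * (1ℚ - a)) + q * q * (a * a + b * b - 1ℚ)
      l = solve-∀ ringℚ

    norm-pow-1- : ∀ z → norm z ≡ 1ℚ → ∀ i → norm (pow (1-ᶜ z) i) ≡ (+ 4 / 1 * sin² z) ^ i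
    norm-pow-1- z h zero    = refl
    norm-pow-1- z h (suc i) = trans (norm-· (1-ᶜ z) (pow (1-ᶜ z) i)) (cong₂ _*_ (base z h) (norm-pow-1- z h i))
      where
      base : ∀ z → norm z ≡ 1ℚ → norm (1-ᶜ z) ≡ + 4 / 1 * sin² z
      base ⟨ a , b ⟩ h = eq-by (0*diff 1ℚ h) (l a b)
        where
        l : ∀ a b → (1ℚ - a) * (1ℚ - a) + - b * - b ≡ + 4 / 1 * (½ * (1ℚ - a)) + 1ℚ * (a * a + b * b - 1ℚ)
        l = solve-∀ ringℚ

    -- A mean is bounded by the mean of the moduli. As ℚ has no square roots, |φ| and |1 - z|^i
    -- enter through rational majorants g and w of their squares' roots: only |φ|² ≤ g² and |1 -
    -- z|^(2i) ≤ w² are required.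
    difference-bound : ∀ i L (g w : ℚ → ℚ) {c} →
      (∀ k → 0ℚ ≤ g (sin² (pt k))) → (∀ k → norm (φ (pt k) L) ≤ g (sin² (pt k)) * g (sin² (pt k))) →
      (∀ k → 0ℚ ≤ w (sin² (pt k))) → (∀ k → (+ 4 / 1 * sin² (pt k)) ^ i ≤ w (sin² (pt k)) * w (sin² (pt k))) →
      Mean (λ k → g (sin² (pt k)) * w (sin² (pt k))) c → ∀ m → Δ^ i (P L) m ∈± c
    difference-bound i L g w {c} g≥0 φ≤g w≥0 s≤w mean m =
      subst (_≤ Δ^ i (P L) m) (l c) (Mean-mono (λ k → subst (_≤ _) (sym (l (G k))) (proj₁ (pointwise k))) (Mean-linear (- 1ℚ) 0ℚ mean mean) (inversion-Δ i L m)) ,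
      Mean-mono (λ k → proj₂ (pointwise k)) (inversion-Δ i L m) mean
      where
      G : ℕ → ℚ
      G k = g (sin² (pt k)) * w (sin² (pt k))
      l : ∀ c → (- 1ℚ) * c + 0ℚ * c ≡ - c
      l = solve-∀ ringℚ
      pointwise : ∀ k → re (φ (pt k) L · pow (1-ᶜ (pt k)) i · cis (pt k) (ℤ.- m)) ∈± G k
      pointwise k = ±-sq (0≤* (g≥0 k) (w≥0 k)) (≤-trans (re²≤norm W)
        (≤-trans (≤-reflexive (trans (norm-· (φ (pt k) L · pow (1-ᶜ (pt k)) i) (cis (pt k) (ℤ.- m)))
          (trans (cong₂ _*_ (trans (norm-· (φ (pt k) L) _) (cong (norm (φ (pt k) L) *_) (norm-pow-1- (pt k) (pt-norm k) i))) (cis-norm (pt k) (pt-norm k) (ℤ.- m))) (*-identityʳ _))))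
        (≤-trans (*-mono (norm≥0 (φ (pt k) L)) (φ≤g k) (subst (0ℚ ≤_) (norm-pow-1- (pt k) (pt-norm k) i) (norm≥0 (pow (1-ᶜ (pt k)) i))) (s≤w k))
          (≤-reflexive (l₂ (g (sin² (pt k))) (w (sin² (pt k))))))))
        where
        W = φ (pt k) L · pow (1-ᶜ (pt k)) i · cis (pt k) (ℤ.- m)
        norm≥0 : ∀ z → 0ℚ ≤ norm z
        norm≥0 ⟨ a , b ⟩ = 0≤+ (0≤sq a) (0≤sq b)
        re²≤norm : ∀ z → re z * re z ≤ norm z
        re²≤norm ⟨ a , b ⟩ = le-by (0≤sq b) refl
        l₂ : ∀ g w → g * g * (w * w) ≡ g * w * (g * w)
        l₂ = solve-∀ ringℚ

  -- coeff m a is the coefficient of z^a in ((2 + z + 1/z)/4)^m.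
  coeff : ℕ → ℕ → ℚ
  coeff zero    zero    = 1ℚ
  coeff zero    (suc a) = 0ℚ
  coeff (suc m) zero    = ½ * coeff m 0 + ½ * coeff m 1
  coeff (suc m) (suc a) = ½ * coeff m (suc a) + + 1 / 4 * (coeff m a + coeff m (suc (suc a)))

  spt cpt : ℕ → ℚ
  spt k = ½ * (1ℚ - re (pt k))
  cpt k = 1ℚ - spt k

  0≤spt : ∀ k → 0ℚ ≤ spt k
  0≤spt k = 0≤* {½} ≤! (≤⇒0≤ (proj₂ (re-unit (pt k) (pt-norm k))))

  spt≤1 : ∀ k → spt k ≤ 1ℚ
  spt≤1 k = le-by (0≤* {½} ≤! (≤⇒0≤ (proj₁ (re-unit (pt k) (pt-norm k))))) (l (re (pt k)))
    where
    l : ∀ x → 1ℚ ≡ ½ * (1ℚ - x) + ½ * (x - - 1ℚ)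
    l = solve-∀ ringℚ

  0≤cpt : ∀ k → 0ℚ ≤ cpt k
  0≤cpt k = ≤⇒0≤ (spt≤1 k)

  re-product : ∀ z → norm z ≡ 1ℚ → ∀ a →
    (1ℚ - ½ * (1ℚ - re z)) * re (pow z (suc a)) ≡ ½ * re (pow z (suc a)) + + 1 / 4 * (re (pow z a) + re (pow z (suc (suc a))))
  re-product z h a = eq-by (0*diff (+ 1 / 4 * re (pow z a)) h) (l (re z) (im z) (re (pow z a)) (im (pow z a)))
    where
    l : ∀ x y u v → (1ℚ - ½ * (1ℚ - x)) * (x * u - y * v) ≡
      ½ * (x * u - y * v) + + 1 / 4 * (u + (x * (x * u - y * v) - y * (x * v + y * u))) + + 1 / 4 * u * (x * x + y * y - 1ℚ)
    l = solve-∀ ringℚ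

  Mean-coeff : ∀ m a → Mean (λ k → cpt k ^ m * re (pow (pt k) a)) (coeff m a)
  Mean-coeff zero zero    = Mean-const 1ℚ
  Mean-coeff zero (suc a) = Mean-cong (λ k → sym (*-identityˡ _)) (Mean-pt a)
  Mean-coeff (suc m) zero = Mean-cong
    (λ k → l (re (pt k)) (im (pt k)) (cpt k ^ m))
    (Mean-linear ½ ½ (Mean-coeff m 0) (Mean-coeff m 1))
    where
    l : ∀ x y u → ½ * (u * 1ℚ) + ½ * (u * (x * 1ℚ - y * 0ℚ)) ≡ (1ℚ - ½ * (1ℚ - x)) * u * 1ℚ
    l = solve-∀ ringℚ
  Mean-coeff (suc m) (suc a) = Mean-cong
    (λ k → trans (l (cpt k ^ m) (re (pow (pt k) (suc a))) (re (pow (pt k) a)) (re (pow (pt k) (suc (suc a)))))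
      (trans (cong (cpt k ^ m *_) (sym (re-product (pt k) (pt-norm k) a))) (l₂ (cpt k ^ m) (cpt k) (re (pow (pt k) (suc a))))))
    (Mean-value (l₃ (coeff m (suc a)) (coeff m a) (coeff m (suc (suc a))))
      (Mean-linear ½ (+ 1 / 4) (Mean-coeff m (suc a)) (Mean-linear 1ℚ 1ℚ (Mean-coeff m a) (Mean-coeff m (suc (suc a))))))
    where
    l : ∀ u x y z → ½ * (u * x) + + 1 / 4 * (1ℚ * (u * y) + 1ℚ * (u * z)) ≡ u * (½ * x + + 1 / 4 * (y + z))
    l = solve-∀ ringℚ
    l₂ : ∀ u v x → u * (v * x) ≡ v * u * x
    l₂ = solve-∀ ringℚ
    l₃ : ∀ x y z → ½ * x + + 1 / 4 * (1ℚ * y + 1ℚ * z) ≡ ½ * x + + 1 / 4 * (y + z)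
    l₃ = solve-∀ ringℚ

  -- In closed form `coeff m a` is the binomial coefficient of 2m over m + a, divided by 4^m; this
  -- is the quotient of two neighbours.
  coeff-ratio : ∀ m a → (ι m + 1ℚ + ι a) * coeff m (suc a) ≡ (ι m - ι a) * coeff m a
  coeff-ratio zero zero = trans (*-zeroʳ (ι 0 + 1ℚ + ι 0)) (sym (trans (*-identityʳ _) (+-inverseʳ (ι 0))))
  coeff-ratio zero (suc a) = trans (*-zeroʳ (ι 0 + 1ℚ + ι (suc a))) (sym (*-zeroʳ (ι 0 - ι (suc a))))
  coeff-ratio (suc m) zero = trans
    (cong₂ (λ x y → (x + 1ℚ + y) * coeff (suc m) 1) (ι-suc m) ιℤ-0) (trans
    (eq-by (0*diff (+ 1 / 4) (trans (cong (λ e → (ι m + 1ℚ + e) * coeff m 1) (sym ιℤ-0)) (trans (coeff-ratio m 0) (cong (λ e → (ι m - e) * coeff m 0) ιℤ-0)))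
      `0+` 0*diff (+ 1 / 4) (trans (cong (λ e → (ι m + 1ℚ + e) * coeff m 2) (sym (trans (ι-suc 0) (cong (λ e → 1ℚ + e) ιℤ-0)))) (trans (coeff-ratio m 1) (cong (λ e → (ι m - e) * coeff m 1) (trans (ι-suc 0) (cong (λ e → 1ℚ + e) ιℤ-0))))))
      (l (ι m) (coeff m 0) (coeff m 1) (coeff m 2)))
    (cong₂ (λ x y → (x - y) * coeff (suc m) 0) (sym (ι-suc m)) (sym ιℤ-0)))
    where
    _`0+`_ : ∀ {a b} → a ≡ 0ℚ → b ≡ 0ℚ → a + b ≡ 0ℚ
    _`0+`_ = 0+
    l : ∀ m x y w → (1ℚ + m + 1ℚ + 0ℚ) * (½ * y + + 1 / 4 * (x + w)) ≡
      (1ℚ + m - 0ℚ) * (½ * x + ½ * y) + (+ 1 / 4 * ((m + 1ℚ + 0ℚ) * y - (m - 0ℚ) * x) + + 1 / 4 * ((m + 1ℚ + (1ℚ + 0ℚ)) * w - (m - (1ℚ + 0ℚ)) * y))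
    l = solve-∀ ringℚ
  coeff-ratio (suc m) (suc a) = trans
    (cong₂ (λ x y → (x + 1ℚ + y) * coeff (suc m) (suc (suc a))) (ι-suc m) (ι-suc a)) (trans
    (eq-by (0+ (0+ (0*diff (- (+ 1 / 4)) (sym r₀)) (0*diff (+ 1 / 2) r₁)) (0*diff (+ 1 / 4) r₂))
      (l (ι m) (ι a) (coeff m a) (coeff m (suc a)) (coeff m (suc (suc a))) (coeff m (suc (suc (suc a))))))
    (cong₂ (λ x y → (x - y) * coeff (suc m) (suc a)) (sym (ι-suc m)) (sym (ι-suc a))))
    where
    r₀ : (ι m + 1ℚ + ι a) * coeff m (suc a) ≡ (ι m - ι a) * coeff m a
    r₀ = coeff-ratio m a
    r₁ : (ι m + 1ℚ + (1ℚ + ι a)) * coeff m (suc (suc a)) ≡ (ι m - (1ℚ + ι a)) * coeff m (suc a)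
    r₁ = subst (λ e → (ι m + 1ℚ + e) * coeff m (suc (suc a)) ≡ (ι m - e) * coeff m (suc a)) (ι-suc a) (coeff-ratio m (suc a))
    r₂ : (ι m + 1ℚ + (1ℚ + (1ℚ + ι a))) * coeff m (suc (suc (suc a))) ≡ (ι m - (1ℚ + (1ℚ + ι a))) * coeff m (suc (suc a))
    r₂ = subst (λ e → (ι m + 1ℚ + e) * coeff m (suc (suc (suc a))) ≡ (ι m - e) * coeff m (suc (suc a))) (trans (ι-suc (suc a)) (cong (λ e → 1ℚ + e) (ι-suc a))) (coeff-ratio m (suc (suc a)))
    l : ∀ m a x y z w → (1ℚ + m + 1ℚ + (1ℚ + a)) * (½ * z + + 1 / 4 * (y + w)) ≡
      (1ℚ + m - (1ℚ + a)) * (½ * y + + 1 / 4 * (x + z)) +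
      ((- (+ 1 / 4)) * ((m - a) * x - (m + 1ℚ + a) * y) + + 1 / 2 * ((m + 1ℚ + (1ℚ + a)) * z - (m - (1ℚ + a)) * y)
       + + 1 / 4 * ((m + 1ℚ + (1ℚ + (1ℚ + a))) * w - (m - (1ℚ + (1ℚ + a))) * z))
    l = solve-∀ ringℚ

  -- moment a m is the mean value of s^a (1 - s)^m.
  moment : ℕ → ℕ → ℚ
  moment zero    m = coeff m 0
  moment (suc a) m = moment a m - moment a (suc m)

  Mean-moment : ∀ a m → Mean (λ k → spt k ^ a * cpt k ^ m) (moment a m)
  Mean-moment zero m = Mean-cong (λ k → *-comm (cpt k ^ m) 1ℚ) (Mean-coeff m 0)
  Mean-moment (suc a) m = Mean-cong (λ k → l (spt k) (spt k ^ a) (cpt k ^ m))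
    (Mean-value (l₂ (moment a m) (moment a (suc m))) (Mean-linear 1ℚ (- 1ℚ) (Mean-moment a m) (Mean-moment a (suc m))))
    where
    l : ∀ s u v → 1ℚ * (u * v) + (- 1ℚ) * (u * ((1ℚ - s) * v)) ≡ s * u * v
    l = solve-∀ ringℚ
    l₂ : ∀ x y → 1ℚ * x + (- 1ℚ) * y ≡ x - y
    l₂ = solve-∀ ringℚ

  2ℚ : ℚ
  2ℚ = + 2 / 1

  -- The moments are the Beta values B(a + ½, m + ½) / π; this relation and `moment-ratioˢ` are the
  -- functional equations of Beta in its two arguments.
  moment-ratio : ∀ a m → 2ℚ * (ι m + ι a + 1ℚ) * moment a (suc m) ≡ (2ℚ * ι m + 1ℚ) * moment a m
  moment-ratioˢ : ∀ a m → 2ℚ * (ι m + ι a + 1ℚ) * moment (suc a) m ≡ (2ℚ * ι a + 1ℚ) * moment a m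

  moment-ratio zero m = trans (cong (λ e → 2ℚ * (ι m + e + 1ℚ) * (½ * coeff m 0 + ½ * coeff m 1)) ιℤ-0)
    (eq-by (0*diff 1ℚ r) (l (ι m) (coeff m 0) (coeff m 1)))
    where
    r : (ι m + 1ℚ + 0ℚ) * coeff m 1 ≡ (ι m - 0ℚ) * coeff m 0
    r = subst (λ e → (ι m + 1ℚ + e) * coeff m 1 ≡ (ι m - e) * coeff m 0) ιℤ-0 (coeff-ratio m 0)
    l : ∀ m x y → 2ℚ * (m + 0ℚ + 1ℚ) * (½ * x + ½ * y) ≡ (2ℚ * m + 1ℚ) * x + 1ℚ * ((m + 1ℚ + 0ℚ) * y - (m - 0ℚ) * x)
    l = solve-∀ ringℚ
  moment-ratio (suc a) m = trans (cong (λ x → 2ℚ * (ι m + x + 1ℚ) * moment (suc a) (suc m)) (ι-suc a))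
    (eq-by (0+ (0*diff 1ℚ (sym r₂)) (0*diff 1ℚ r₁)) (l (ι m) (ι a) (moment a m) (moment a (suc m)) (moment a (suc (suc m)))))
    where
    r₁ : 2ℚ * (ι m + ι a + 1ℚ) * moment a (suc m) ≡ (2ℚ * ι m + 1ℚ) * moment a m
    r₁ = moment-ratio a m
    r₂ : 2ℚ * (1ℚ + ι m + ι a + 1ℚ) * moment a (suc (suc m)) ≡ (2ℚ * (1ℚ + ι m) + 1ℚ) * moment a (suc m)
    r₂ = subst (λ e → 2ℚ * (e + ι a + 1ℚ) * moment a (suc (suc m)) ≡ (2ℚ * e + 1ℚ) * moment a (suc m)) (ι-suc m) (moment-ratio a (suc m))
    l : ∀ m a x y z → 2ℚ * (m + (1ℚ + a) + 1ℚ) * (y - z) ≡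
      (2ℚ * m + 1ℚ) * (x - y) +
      (1ℚ * ((2ℚ * (1ℚ + m) + 1ℚ) * y - 2ℚ * (1ℚ + m + a + 1ℚ) * z)
      + 1ℚ * (2ℚ * (m + a + 1ℚ) * y - (2ℚ * m + 1ℚ) * x))
    l = solve-∀ ringℚ

  moment-ratioˢ a m = eq-by (0*diff (- 1ℚ) (moment-ratio a m)) (l (ι m) (ι a) (moment a m) (moment a (suc m)))
    where
    l : ∀ m a x y → 2ℚ * (m + a + 1ℚ) * (x - y) ≡ (2ℚ * a + 1ℚ) * x + (- 1ℚ) * (2ℚ * (m + a + 1ℚ) * y - (2ℚ * m + 1ℚ) * x)
    l = solve-∀ ringℚ

  0≤^ : ∀ {x} → 0ℚ ≤ x → ∀ n → 0ℚ ≤ x ^ n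
  0≤^ h zero    = ≤!
  0≤^ h (suc n) = 0≤* h (0≤^ h n)

  ^≤1 : ∀ {x} → 0ℚ ≤ x → x ≤ 1ℚ → ∀ n → x ^ n ≤ 1ℚ
  ^≤1 h h′ zero    = ≤-refl
  ^≤1 h h′ (suc n) = *-mono h h′ (0≤^ h n) (^≤1 h h′ n)

  ^-mono : ∀ {x y} → 0ℚ ≤ x → x ≤ y → ∀ n → x ^ n ≤ y ^ n
  ^-mono h h′ zero    = ≤-refl
  ^-mono h h′ (suc n) = *-mono h h′ (0≤^ h n) (^-mono h h′ n)

  ^-+ : ∀ x m n → x ^ (m ℕ.+ n) ≡ x ^ m * x ^ n
  ^-+ x zero    n = sym (*-identityˡ _)
  ^-+ x (suc m) n = trans (cong (x *_) (^-+ x m n)) (sym (*-assoc x (x ^ m) (x ^ n)))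

  *-^ : ∀ x y n → (x * y) ^ n ≡ x ^ n * y ^ n
  *-^ x y zero    = refl
  *-^ x y (suc n) = trans (cong (x * y *_) (*-^ x y n)) (lem x y (x ^ n) (y ^ n))
    where
    lem : ∀ x y u v → x * y * (u * v) ≡ x * u * (y * v)
    lem = solve-∀ ringℚ

  1^ : ∀ n → 1ℚ ^ n ≡ 1ℚ
  1^ zero    = refl
  1^ (suc n) = trans (*-identityˡ _) (1^ n)

  ^-antimono : ∀ {x m n} → 0ℚ ≤ x → x ≤ 1ℚ → m ℕ.≤ n → x ^ n ≤ x ^ m
  ^-antimono {x} {m} {n} h h′ m≤n = subst (λ e → x ^ e ≤ x ^ m) (ℕ.m+[n∸m]≡n m≤n)
    (≤-trans (≤-reflexive (^-+ x m (n ℕ.∸ m))) (≤-trans (*-monoˡ (x ^ m) (0≤^ h m) (^≤1 h h′ (n ℕ.∸ m))) (≤-reflexive (*-identityʳ _))))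

  -- Bounds for the moments

  0≤coeff : ∀ m a → 0ℚ ≤ coeff m a
  0≤coeff zero    zero    = ≤!
  0≤coeff zero    (suc a) = ≤!
  0≤coeff (suc m) zero    = 0≤+ (0≤* {½} ≤! (0≤coeff m 0)) (0≤* {½} ≤! (0≤coeff m 1))
  0≤coeff (suc m) (suc a) = 0≤+ (0≤* {½} ≤! (0≤coeff m (suc a))) (0≤* {+ 1 / 4} ≤! (0≤+ (0≤coeff m a) (0≤coeff m (suc (suc a)))))

  0≤2ι+1 : ∀ a → 0ℚ ≤ 2ℚ * ι a + 1ℚ
  0≤2ι+1 a = 0≤+ (0≤* {2ℚ} ≤! (0≤ι a)) ≤!

  0≤moment : ∀ a m → 0ℚ ≤ moment a m
  0≤moment zero    m = 0≤coeff m 0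
  0≤moment (suc a) m = *-cancelˡ (2ℚ * (ι m + ι a + 1ℚ)) (0<* {2ℚ} <! pos)
    (≤-trans (≤-reflexive (*-zeroʳ (2ℚ * (ι m + ι a + 1ℚ))))
      (≤-trans (0≤* (0≤2ι+1 a) (0≤moment a m)) (≤-reflexive (sym (moment-ratioˢ a m)))))
    where
    pos : 0ℚ < ι m + ι a + 1ℚ
    pos = subst (0ℚ <_) (+-comm 1ℚ (ι m + ι a)) (0<+ {1ℚ} <! (0≤+ (0≤ι m) (0≤ι a)))

  -- (2a - 1)!!
  oddFactorial : ℕ → ℚ
  oddFactorial zero    = 1ℚ
  oddFactorial (suc a) = + (1 ℕ.+ 2 ℕ.* a) / 1 * oddFactorial a

  0≤oddFactorial : ∀ a → 0ℚ ≤ oddFactorial a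
  2a+1-lit : ∀ a → + (1 ℕ.+ 2 ℕ.* a) / 1 ≡ 2ℚ * ι a + 1ℚ
  2a+1-lit a = trans (sym (ιℤ-lit (1 ℕ.+ 2 ℕ.* a))) (trans (ι-suc (2 ℕ.* a)) (trans (+-comm 1ℚ (ι (2 ℕ.* a))) (cong (_+ 1ℚ) (trans (ι-* 2 a) (cong (_* ι a) (ιℤ-lit 2))))))
  0≤oddFactorial zero    = ≤!
  0≤oddFactorial (suc a) = 0≤* (subst (0ℚ ≤_) (sym (2a+1-lit a)) (0≤2ι+1 a)) (0≤oddFactorial a)

  -- Each step in a multiplies by (2a + 1) / (2 (m + a + 1)), hence by at most (2a + 1) / x. The
  -- result has the form of Gaussian moments.
  moment-upper : ∀ a m {x} → 0ℚ ≤ x → x ≤ 2ℚ * ι m → x ^ a * moment a m ≤ oddFactorial a * moment 0 m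
  moment-upper zero    m x≥0 h = ≤-refl
  moment-upper (suc a) m {x} x≥0 h = ≤-trans (≤-reflexive (l₁ x (x ^ a) (moment (suc a) m)))
    (≤-trans (*-monoˡ (x ^ a) (0≤^ x≥0 a) step)
    (≤-trans (≤-reflexive (l₂ (x ^ a) (2ℚ * ι a + 1ℚ) (moment a m)))
    (≤-trans (*-monoˡ (2ℚ * ι a + 1ℚ) (0≤2ι+1 a) (moment-upper a m x≥0 h))
      (≤-reflexive (trans (sym (*-assoc (2ℚ * ι a + 1ℚ) (oddFactorial a) (moment 0 m))) (cong (λ e → e * oddFactorial a * moment 0 m) (sym (2a+1-lit a))))))))
    where
    l₁ : ∀ x y z → x * y * z ≡ y * (x * z)
    l₁ = solve-∀ ringℚ
    l₂ : ∀ x y z → x * (y * z) ≡ y * (x * z)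
    l₂ = solve-∀ ringℚ
    bound : ∀ n a → 0ℚ ≤ a → 2ℚ * n ≤ 2ℚ * (n + a + 1ℚ)
    bound n a a≥0 = le-by (0≤* {2ℚ} ≤! (0≤+ {b = 1ℚ} a≥0 ≤!)) (l n a)
      where
      l : ∀ n a → 2ℚ * (n + a + 1ℚ) ≡ 2ℚ * n + 2ℚ * (a + 1ℚ)
      l = solve-∀ ringℚ
    step : x * moment (suc a) m ≤ (2ℚ * ι a + 1ℚ) * moment a m
    step = ≤-trans (*-monoʳ (moment (suc a) m) (0≤moment (suc a) m) (≤-trans h (bound (ι m) (ι a) (0≤ι a)))) (≤-reflexive (moment-ratioˢ a m))

  -- (2m + 1) moment 0 m ² decreases (to 2/π).
  wallis : ℕ → ℚ
  wallis m = (2ℚ * ι m + 1ℚ) * (moment 0 m * moment 0 m)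

  wallis-decreasing : ∀ m → wallis (suc m) ≤ wallis m
  wallis-decreasing m = *-cancelˡ (k * k) (0<* k>0 k>0) (≤-trans (≤-reflexive (trans
      (cong (λ e → k * k * ((2ℚ * e + 1ℚ) * (moment 0 (suc m) * moment 0 (suc m)))) (ι-suc m))
      (trans (l₁ (ι m) k (moment 0 (suc m))) (cong (λ e → (2ℚ * (1ℚ + ι m) + 1ℚ) * (e * e)) ratio))))
    (le-by (0≤* (0≤2ι+1 m) (0≤sq (moment 0 m))) (l₂ (ι m) (moment 0 m))))
    where
    k = 2ℚ * (ι m + 1ℚ)
    k>0 : 0ℚ < k
    k>0 = 0<* {2ℚ} <! (subst (0ℚ <_) (+-comm 1ℚ (ι m)) (0<+ {1ℚ} <! (0≤ι m)))
    ratio : k * moment 0 (suc m) ≡ (2ℚ * ι m + 1ℚ) * moment 0 m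
    ratio = trans (cong (λ e → 2ℚ * (e + 1ℚ) * moment 0 (suc m)) (trans (sym (+-identityʳ (ι m))) (cong (λ e → ι m + e) (sym ιℤ-0)))) (moment-ratio 0 m)
    l₁ : ∀ m k x → k * k * ((2ℚ * (1ℚ + m) + 1ℚ) * (x * x)) ≡ (2ℚ * (1ℚ + m) + 1ℚ) * ((k * x) * (k * x))
    l₁ = solve-∀ ringℚ
    l₂ : ∀ m x → 2ℚ * (m + 1ℚ) * (2ℚ * (m + 1ℚ)) * ((2ℚ * m + 1ℚ) * (x * x)) ≡
      (2ℚ * (1ℚ + m) + 1ℚ) * ((2ℚ * m + 1ℚ) * x * ((2ℚ * m + 1ℚ) * x)) + (2ℚ * m + 1ℚ) * (x * x)
    l₂ = solve-∀ ringℚ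

  wallis-8 : ∀ m → 8 ℕ.≤ m → wallis m ≤ + 6557 / 10000
  wallis-8 m h = ≤-trans (decreasing 8 m h) (≤-trans (≤-reflexive (cong (λ e → (2ℚ * e + 1ℚ) * (moment 0 8 * moment 0 8)) (ιℤ-lit 8))) ≤!)
    where
    decreasing : ∀ a m → a ℕ.≤ m → wallis m ≤ wallis a
    decreasing a m h with ℕ.≤⇒≤′ h
    ... | ℕ.≤′-refl   = ≤-refl
    ... | ℕ.≤′-step p = ≤-trans (wallis-decreasing _) (decreasing a _ (ℕ.≤′⇒≤ p))

  moment-0-upper : ∀ m → 8 ℕ.≤ m → ι m * (moment 0 m * moment 0 m) ≤ + 3279 / 10000
  moment-0-upper m h = *-cancelˡ 2ℚ <! (≤-trans (le-by (0≤sq (moment 0 m)) (l (ι m) (moment 0 m))) (≤-trans (wallis-8 m h) ≤!))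
    where
    l : ∀ m x → (2ℚ * m + 1ℚ) * (x * x) ≡ 2ℚ * (m * (x * x)) + x * x
    l = solve-∀ ringℚ

  -- Products of factors 1 - a b, by rounding the a's down

  bernoulli : ∀ {b} → 0ℚ ≤ b → b ≤ 1ℚ → ∀ n → 1ℚ - ι n * b ≤ (1ℚ - b) ^ n
  bernoulli {b} b≥0 b≤1 zero    = ≤-reflexive (trans (cong (λ e → 1ℚ - e * b) ιℤ-0) (l b))
    where
    l : ∀ b → 1ℚ - 0ℚ * b ≡ 1ℚ
    l = solve-∀ ringℚ
  bernoulli {b} b≥0 b≤1 (suc n) = ≤-trans (≤-reflexive (cong (λ e → 1ℚ - e * b) (ι-suc n)))
    (≤-trans (le-by (0≤* (0≤ι n) (0≤sq b)) (l (ι n) b)) (*-monoˡ (1ℚ - b) (≤⇒0≤ b≤1) (bernoulli b≥0 b≤1 n)))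
    where
    l : ∀ n b → (1ℚ - b) * (1ℚ - n * b) ≡ 1ℚ - (1ℚ + n) * b + n * (b * b)
    l = solve-∀ ringℚ

  floor : ∀ x → 0ℚ ≤ x → ∃ λ n → ι n ≤ x × x ≤ ι n + 1ℚ
  floor x x≥0 = search (proj₁ (archimedean x)) (proj₂ (archimedean x))
    where
    search : ∀ n → x ≤ ι n → ∃ λ n → ι n ≤ x × x ≤ ι n + 1ℚ
    search zero    h = 0 , ≤-trans (≤-reflexive ιℤ-0) x≥0 , ≤-trans h (≤-trans (≤-reflexive (sym (+-identityʳ (ι 0)))) (+-monoʳ-≤ (ι 0) ≤!))
    search (suc n) h with ≤-total (ι n) x
    ... | inj₁ p = n , p , ≤-trans h (≤-reflexive (trans (ι-suc n) (+-comm 1ℚ (ι n))))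
    ... | inj₂ p = search n p

  Σᴸ-Rem : ∀ {L y L′} f → Rem L y L′ → Σᴸ f L ≡ f y + Σᴸ f L′
  Σᴸ-Rem f here = refl
  Σᴸ-Rem {x ∷ L} {y} {.x ∷ L′} f (there r) = trans (cong (λ e → f x + e) (Σᴸ-Rem f r)) (l (f x) (f y) (Σᴸ f L′))
    where
    l : ∀ a b c → a + (b + c) ≡ b + (a + c)
    l = solve-∀ ringℚ

  module FactorBound (p : ℕ → ℚ) where
    open Fourier p

    factor : ℂ → ℕ → ℚ
    factor z j = 1ℚ - + 4 / 1 * (p j * (1ℚ - p j)) * sin² (pow z j)

    norm-φ-∷ : ∀ z → norm z ≡ 1ℚ → ∀ j L → norm (φ z (j ∷ L)) ≡ factor z j * norm (φ z L)
    norm-φ-∷ z h j L = trans (norm-· ⟨ 1ℚ - p j + p j * re (pow z j) , p j * im (pow z j) ⟩ (φ z L)) (cong (_* norm (φ z L)) (norm-φ-factor (p j) (pow z j) (pow-norm z h j)))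

    0≤norm : ∀ z → 0ℚ ≤ norm z
    0≤norm ⟨ a , b ⟩ = 0≤+ (0≤sq a) (0≤sq b)

    0≤factor : ∀ z → norm z ≡ 1ℚ → ∀ j → 0ℚ ≤ factor z j
    0≤factor z h j = subst (0ℚ ≤_) (norm-φ-factor (p j) (pow z j) (pow-norm z h j)) (0≤norm ⟨ 1ℚ - p j + p j * re (pow z j) , p j * im (pow z j) ⟩)

    -- Bernoulli's inequality turns a factor 1 - a b into (1 - b)^n for the integer part n of a, at
    -- a loss of at most one per part. The whole product becomes a power of the single number 1 - b.
    φ-bound : ∀ z → norm z ≡ 1ℚ → ∀ {b} → 0ℚ ≤ b → b ≤ 1ℚ → (a : ℕ → ℚ) → (∀ j → 0ℚ ≤ a j) →
      (∀ j → factor z j ≡ 1ℚ - a j * b) → ∀ L → ∃ λ N → norm (φ z L) ≤ (1ℚ - b) ^ N × Σᴸ (λ j → a j - 1ℚ) L ≤ ι N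
    φ-bound z h {b} b≥0 b≤1 a a≥0 eq []      = 0 , ≤! , ≤-reflexive (sym ιℤ-0)
    φ-bound z h {b} b≥0 b≤1 a a≥0 eq (j ∷ L) with φ-bound z h b≥0 b≤1 a a≥0 eq L | floor (a j) (a≥0 j)
    ... | N , le , sum | n , n≤a , a≤n+1 = n ℕ.+ N ,
      ≤-trans (≤-reflexive (norm-φ-∷ z h j L)) (≤-trans (*-mono (0≤factor z h j) (≤-trans (≤-reflexive (eq j)) (≤-trans (step (a j) (ι n) b b≥0 n≤a) (bernoulli b≥0 b≤1 n))) (0≤norm (φ z L)) le) (≤-reflexive (sym (^-+ (1ℚ - b) n N)))) ,
      ≤-trans (+-mono-≤ (step′ (a j) (ι n) a≤n+1) sum) (≤-reflexive (sym (ι-+ n N)))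
      where
      step : ∀ a n b → 0ℚ ≤ b → n ≤ a → 1ℚ - a * b ≤ 1ℚ - n * b
      step a n b b≥0 h = le-by (0≤* (≤⇒0≤ h) b≥0) (l a n b)
        where
        l : ∀ a n b → 1ℚ - n * b ≡ 1ℚ - a * b + (a - n) * b
        l = solve-∀ ringℚ
      step′ : ∀ a n → a ≤ n + 1ℚ → a - 1ℚ ≤ n
      step′ a n h = le-by (≤⇒0≤ h) (l a n)
        where
        l : ∀ a n → n ≡ a - 1ℚ + (n + 1ℚ - a)
        l = solve-∀ ringℚ

  -- sin²(jx)/sin²(x) as a function of s = sin²(x), with the limit j² at s = 0

  cheb : ℚ → ℕ → ℚ
  cheb s zero          = 0ℚ
  cheb s (suc zero)    = 1ℚ
  cheb s (suc (suc j)) = (2ℚ - + 4 / 1 * s) * cheb s (suc j) - cheb s j + 2ℚ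

  cheb-sin² : ∀ z → norm z ≡ 1ℚ → ∀ j → ½ * (1ℚ - re (pow z j)) ≡ ½ * (1ℚ - re z) * cheb (½ * (1ℚ - re z)) j
  cheb-sin² z h zero = l (re z)
    where
    l : ∀ x → ½ * (1ℚ - 1ℚ) ≡ ½ * (1ℚ - x) * 0ℚ
    l = solve-∀ ringℚ
  cheb-sin² z h (suc zero) = l (re z) (im z)
    where
    l : ∀ x y → ½ * (1ℚ - (x * 1ℚ - y * 0ℚ)) ≡ ½ * (1ℚ - x) * 1ℚ
    l = solve-∀ ringℚ
  cheb-sin² z h (suc (suc j)) = eq-by (0+ (0+ (0*diff (½ * re (pow z j)) h) (0*diff (2ℚ - + 4 / 1 * (½ * (1ℚ - re z))) (cheb-sin² z h (suc j)))) (0*diff (- 1ℚ) (cheb-sin² z h j)))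
    (l (re z) (im z) (re (pow z j)) (im (pow z j)) (cheb (½ * (1ℚ - re z)) j) (cheb (½ * (1ℚ - re z)) (suc j)))
    where
    l : ∀ x y u v a b → ½ * (1ℚ - (x * (x * u - y * v) - y * (x * v + y * u))) ≡
      ½ * (1ℚ - x) * ((2ℚ - + 4 / 1 * (½ * (1ℚ - x))) * b - a + 2ℚ) +
      (½ * u * (x * x + y * y - 1ℚ) + (2ℚ - + 4 / 1 * (½ * (1ℚ - x))) * (½ * (1ℚ - (x * u - y * v)) - ½ * (1ℚ - x) * b) + (- 1ℚ) * (½ * (1ℚ - u) - ½ * (1ℚ - x) * a))
    l = solve-∀ ringℚ

  cheb-0 : ∀ j → cheb 0ℚ j ≡ ι j * ι j
  cheb-0 zero = sym (cong₂ _*_ ιℤ-0 ιℤ-0)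
  cheb-0 (suc zero) = sym (cong₂ _*_ ιℤ-1 ιℤ-1)
  cheb-0 (suc (suc j)) = trans (cong₂ (λ x y → (2ℚ - + 4 / 1 * 0ℚ) * x - y + 2ℚ) (trans (cheb-0 (suc j)) (cong₂ _*_ (ι-suc j) (ι-suc j))) (cheb-0 j))
    (trans (l (ι j)) (sym (cong₂ _*_ e e)))
    where
    e : ι (suc (suc j)) ≡ 1ℚ + (1ℚ + ι j)
    e = trans (ι-suc (suc j)) (cong (λ e → 1ℚ + e) (ι-suc j))
    l : ∀ j → (2ℚ - + 4 / 1 * 0ℚ) * ((1ℚ + j) * (1ℚ + j)) - j * j + 2ℚ ≡ (1ℚ + (1ℚ + j)) * (1ℚ + (1ℚ + j))
    l = solve-∀ ringℚ

  0≤cheb : ∀ k j → 0ℚ ≤ cheb (spt k) j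
  0≤cheb k j with spt k ≟ 0ℚ
  ... | yes e  = subst (λ x → 0ℚ ≤ cheb x j) (sym e) (subst (0ℚ ≤_) (sym (cheb-0 j)) (0≤sq (ι j)))
  ... | no s≢0 = *-cancelˡ (spt k) s>0 (≤-trans (≤-reflexive (*-zeroʳ (spt k)))
    (≤-trans (0≤* {½} ≤! (≤⇒0≤ (proj₂ (re-unit (pow (pt k) j) (pow-norm (pt k) (pt-norm k) j))))) (≤-reflexive (cheb-sin² (pt k) (pt-norm k) j))))
    where
    s>0 : 0ℚ < spt k
    s>0 = ≰⇒> λ p → s≢0 (≤-antisym p (0≤spt k))

  -- The second differences of `cheb s` are 2 - 4 s c for a value c ≥ 0, those of j² are equal to 2,
  -- and both sequences start with 0, 1.
  cheb-upper : ∀ {s} → 0ℚ ≤ s → (∀ j → 0ℚ ≤ cheb s j) → ∀ j → cheb s j ≤ ι j * ι j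
  cheb-upper {s} s≥0 c≥0 zero    = 0≤sq (ι 0)
  cheb-upper {s} s≥0 c≥0 (suc j) = ≤-trans (step (cheb s j) (cheb s (suc j)) (ι j) (cheb-upper s≥0 c≥0 j) (diff j)) (≤-reflexive (sym (cong₂ _*_ (ι-suc j) (ι-suc j))))
    where
    diff : ∀ j → cheb s (suc j) - cheb s j ≤ 2ℚ * ι j + 1ℚ
    diff zero    = ≤-trans ≤! (≤-reflexive (sym (cong (λ e → 2ℚ * e + 1ℚ) ιℤ-0)))
    diff (suc j) = ≤-trans (le-by (0≤+ (≤⇒0≤ (diff j)) (0≤* (0≤* {+ 4 / 1} ≤! s≥0) (c≥0 (suc j)))) (l s (cheb s j) (cheb s (suc j)) (ι j)))
        (≤-reflexive (cong (λ e → 2ℚ * e + 1ℚ) (sym (ι-suc j))))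
      where
      l : ∀ s a b j → 2ℚ * (1ℚ + j) + 1ℚ ≡ (2ℚ - + 4 / 1 * s) * b - a + 2ℚ - b + (2ℚ * j + 1ℚ - (b - a) + + 4 / 1 * s * b)
      l = solve-∀ ringℚ
    step : ∀ a b j → a ≤ j * j → b - a ≤ 2ℚ * j + 1ℚ → b ≤ (1ℚ + j) * (1ℚ + j)
    step a b j p q = le-by (0≤+ (≤⇒0≤ p) (≤⇒0≤ q)) (l a b j)
      where
      l : ∀ a b j → (1ℚ + j) * (1ℚ + j) ≡ b + (j * j - a + (2ℚ * j + 1ℚ - (b - a)))
      l = solve-∀ ringℚ

  parts : ℕ → List ℕ
  parts zero    = []
  parts (suc M) = suc M ∷ parts M

  -- By the recurrence, the generating function of `cheb s` is ρ (1 + ρ) divided by the factor on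
  -- the left; the term with ρ^M accounts for the truncation at M.
  chebSum : ∀ ρ s M → (1ℚ - ρ) * ((1ℚ - ρ) * (1ℚ - ρ) + + 4 / 1 * (ρ * s)) * Σᴸ (λ j → ρ ^ j * cheb s j) (parts M) ≡
    ρ * (1ℚ + ρ) - ρ ^ M * ((1ℚ - ρ) * (ρ * cheb s (suc M) - ρ * ρ * cheb s M) + 2ℚ * (ρ * ρ))
  chebSum ρ s zero = l ρ s
    where
    l : ∀ ρ s → (1ℚ - ρ) * ((1ℚ - ρ) * (1ℚ - ρ) + + 4 / 1 * (ρ * s)) * 0ℚ ≡
      ρ * (1ℚ + ρ) - 1ℚ * ((1ℚ - ρ) * (ρ * 1ℚ - ρ * ρ * 0ℚ) + 2ℚ * (ρ * ρ))
    l = solve-∀ ringℚ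
  chebSum ρ s (suc M) = eq-by (0*diff 1ℚ (chebSum ρ s M)) (l ρ s (ρ ^ M) (cheb s M) (cheb s (suc M)) (Σᴸ (λ j → ρ ^ j * cheb s j) (parts M)))
    where
    l : ∀ ρ s u a b g → (1ℚ - ρ) * ((1ℚ - ρ) * (1ℚ - ρ) + + 4 / 1 * (ρ * s)) * (ρ * u * b + g) ≡
      ρ * (1ℚ + ρ) - ρ * u * ((1ℚ - ρ) * (ρ * ((2ℚ - + 4 / 1 * s) * b - a + 2ℚ) - ρ * ρ * b) + 2ℚ * (ρ * ρ)) +
      1ℚ * ((1ℚ - ρ) * ((1ℚ - ρ) * (1ℚ - ρ) + + 4 / 1 * (ρ * s)) * g - (ρ * (1ℚ + ρ) - u * ((1ℚ - ρ) * (ρ * b - ρ * ρ * a) + 2ℚ * (ρ * ρ))))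
    l = solve-∀ ringℚ

  Σᴸ-linear₃ : ∀ f g h a b L → Σᴸ (λ j → f j + a * g j + b * h j) L ≡ Σᴸ f L + a * Σᴸ g L + b * Σᴸ h L
  Σᴸ-linear₃ f g h a b [] = l a b
    where
    l : ∀ a b → 0ℚ ≡ 0ℚ + a * 0ℚ + b * 0ℚ
    l = solve-∀ ringℚ
  Σᴸ-linear₃ f g h a b (j ∷ L) = trans (cong (λ e → f j + a * g j + b * h j + e) (Σᴸ-linear₃ f g h a b L)) (l (f j) (g j) (h j) _ _ _ a b)
    where
    l : ∀ f g h F G H a b → f + a * g + b * h + (F + a * G + b * H) ≡ f + F + a * (g + G) + b * (h + H)
    l = solve-∀ ringℚ

  geometricSum : ℚ → ℚ → ℕ → ℚ
  geometricSum ρ s M = Σᴸ (λ j → ρ ^ j * cheb s j) (parts M)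

  0≤geometricSum : ∀ {ρ s} M → 0ℚ ≤ ρ → (∀ j → 0ℚ ≤ cheb s j) → 0ℚ ≤ geometricSum ρ s M
  0≤geometricSum M ρ≥0 c≥0 = 0≤Σᴸ (parts M) λ j → 0≤* (0≤^ ρ≥0 j) (c≥0 j)

  geometricSum-± : ∀ {ρ s e} M → 0ℚ ≤ ρ → ρ ≤ 1ℚ → 0ℚ ≤ s → (∀ j → 0ℚ ≤ cheb s j) →
    ρ ^ M * ((1ℚ + ι M) * (1ℚ + ι M) + 2ℚ) ≤ e →
    (1ℚ - ρ) * ((1ℚ - ρ) * (1ℚ - ρ) + + 4 / 1 * (ρ * s)) * geometricSum ρ s M - ρ * (1ℚ + ρ) ∈± e
  geometricSum-± {ρ} {s} {e} M ρ≥0 ρ≤1 s≥0 c≥0 h = ±-weaken (subst (_∈± ρ ^ M * bnd) eq (±-neg (±-* (ρ ^ M) (0≤^ ρ≥0 M) (lower , upper)))) h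
    where
    bnd = (1ℚ + ι M) * (1ℚ + ι M) + 2ℚ
    a = cheb s M
    b = cheb s (suc M)
    br = (1ℚ - ρ) * (ρ * b - ρ * ρ * a) + 2ℚ * (ρ * ρ)
    eq : - (ρ ^ M * br) ≡ (1ℚ - ρ) * ((1ℚ - ρ) * (1ℚ - ρ) + + 4 / 1 * (ρ * s)) * geometricSum ρ s M - ρ * (1ℚ + ρ)
    eq = sym (trans (cong (λ e → e - ρ * (1ℚ + ρ)) (chebSum ρ s M)) (l (ρ * (1ℚ + ρ)) (ρ ^ M * br)))
      where
      l : ∀ x y → x - y - x ≡ - y
      l = solve-∀ ringℚ
    b≤ : b ≤ (1ℚ + ι M) * (1ℚ + ι M)
    b≤ = ≤-trans (cheb-upper s≥0 c≥0 (suc M)) (≤-reflexive (cong₂ _*_ (ι-suc M) (ι-suc M)))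
    1-ρ : 0ℚ ≤ 1ℚ - ρ
    1-ρ = ≤⇒0≤ ρ≤1
    upper : br ≤ bnd
    upper = le-by (0≤+ (0≤+ (0≤+ (≤⇒0≤ b≤) (0≤* (c≥0 (suc M)) (0≤+ 1-ρ (0≤sq ρ)))) (0≤* (0≤* 1-ρ (c≥0 M)) (0≤sq ρ)))
        (0≤* {2ℚ} ≤! (0≤* 1-ρ (0≤+ {1ℚ} ≤! ρ≥0)))) (l ρ a b (ι M))
      where
      l : ∀ ρ a b M → (1ℚ + M) * (1ℚ + M) + 2ℚ ≡ (1ℚ - ρ) * (ρ * b - ρ * ρ * a) + 2ℚ * (ρ * ρ) +
        ((1ℚ + M) * (1ℚ + M) - b + b * (1ℚ - ρ + ρ * ρ) + (1ℚ - ρ) * a * (ρ * ρ) + 2ℚ * ((1ℚ - ρ) * (1ℚ + ρ)))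
      l = solve-∀ ringℚ
    lower : - bnd ≤ br
    lower = le-by (0≤+ (0≤+ (0≤+ (0≤* 1-ρ (0≤* ρ≥0 (c≥0 (suc M)))) (0≤+ (0≤* {2ℚ} ≤! (0≤sq ρ)) (≤⇒0≤ (cheb-upper s≥0 c≥0 M))))
        (0≤* (c≥0 M) (0≤+ (0≤* 1-ρ (0≤+ {1ℚ} ≤! ρ≥0)) (0≤* ρ≥0 (0≤sq ρ))))) (0≤+ (0≤* {2ℚ} ≤! (0≤ι M)) (≤! {0ℚ} {+ 3 / 1}))) (l ρ a b (ι M))
      where
      l : ∀ ρ a b M → (1ℚ - ρ) * (ρ * b - ρ * ρ * a) + 2ℚ * (ρ * ρ) ≡ - ((1ℚ + M) * (1ℚ + M) + 2ℚ) +
        ((1ℚ - ρ) * (ρ * b) + (2ℚ * (ρ * ρ) + (M * M - a)) + a * ((1ℚ - ρ) * (1ℚ + ρ) + ρ * (ρ * ρ)) + (2ℚ * M + + 3 / 1))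
      l = solve-∀ ringℚ

  -- Consequences for ρ = r, r², r³ with r = 1 - x, s = y x²/4, in terms of g = x³ (geometric sum)

  scaled : ℚ → ℚ → ℚ
  scaled x G = x * (x * x) * G

  -- For ρ = r^k one has 1 - ρ ≈ k x, so the kernel is about k x³ (k² + y) and the scaled sum about
  -- 2 / (k (k² + y)). The bounds below are these values for k = 1, 2, 3 with errors linear in x.
  kernel : ℚ → ℚ → ℚ → ℚ
  kernel x ρ y = (1ℚ - ρ) * ((1ℚ - ρ) * (1ℚ - ρ) + + 4 / 1 * (ρ * (+ 1 / 4 * (y * (x * x)))))

  sq cube : ℚ → ℚ
  sq r   = r * r
  cube r = r * (r * r)

  module _ {x : ℚ} (x≥0 : 0ℚ ≤ x) (x≤ : x ≤ + 1 / 256) {y : ℚ} (y≥0 : 0ℚ ≤ y) {G : ℚ} (G≥0 : 0ℚ ≤ G) where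

    private
      x≤1 : x ≤ 1ℚ
      x≤1 = ≤-trans x≤ ≤!
      1-x : 0ℚ ≤ 1ℚ - x
      1-x = ≤⇒0≤ x≤1
      g≥0 : 0ℚ ≤ scaled x G
      g≥0 = 0≤* (0≤* x≥0 (0≤sq x)) G≥0
      1-7x : 0ℚ ≤ 1ℚ - + 7 / 1 * x
      1-7x = ≤⇒0≤ {+ 7 / 1 * x} {1ℚ} (≤-trans (*-monoˡ (+ 7 / 1) ≤! x≤) ≤!)
      r³>0 : 0ℚ < cube (1ℚ - x)
      r³>0 = 0<* r>0 (0<* r>0 r>0)
        where
        r>0 : 0ℚ < 1ℚ - x
        r>0 = <-≤-trans {0ℚ} {½} <! (le-by (≤⇒0≤ x≤half) (l x))
          where
          x≤half : x ≤ ½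
          x≤half = ≤-trans x≤ ≤!
          l : ∀ x → 1ℚ - x ≡ ½ + (½ - x)
          l = solve-∀ ringℚ

    g₁-lower : (1ℚ - x) * (1ℚ + (1ℚ - x)) - x ≤ kernel x (1ℚ - x) y * G → 2ℚ - + 4 / 1 * x ≤ (1ℚ + y) * scaled x G
    g₁-lower h = le-by (0≤+ (0≤+ (≤⇒0≤ h) (0≤* (0≤* x≥0 y≥0) g≥0)) (0≤sq x)) (l x y G)
      where
      l : ∀ x y G → (1ℚ + y) * (x * (x * x) * G) ≡ 2ℚ - + 4 / 1 * x +
        ((1ℚ - (1ℚ - x)) * ((1ℚ - (1ℚ - x)) * (1ℚ - (1ℚ - x)) + + 4 / 1 * ((1ℚ - x) * (+ 1 / 4 * (y * (x * x))))) * G - ((1ℚ - x) * (1ℚ + (1ℚ - x)) - x)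
         + x * y * (x * (x * x) * G) + x * x)
      l = solve-∀ ringℚ

    g₁-upper : kernel x (1ℚ - x) y * G ≤ (1ℚ - x) * (1ℚ + (1ℚ - x)) + x → scaled x G ≤ 2ℚ
    g₁-upper h = le-by (0≤+ (0≤+ (≤⇒0≤ h) (0≤* (0≤* 1-x y≥0) g≥0)) (0≤* x≥0 (0≤+ {1ℚ} ≤! 1-x))) (l x y G)
      where
      l : ∀ x y G → 2ℚ ≡ x * (x * x) * G +
        ((1ℚ - x) * (1ℚ + (1ℚ - x)) + x - (1ℚ - (1ℚ - x)) * ((1ℚ - (1ℚ - x)) * (1ℚ - (1ℚ - x)) + + 4 / 1 * ((1ℚ - x) * (+ 1 / 4 * (y * (x * x))))) * G
         + (1ℚ - x) * y * (x * (x * x) * G) + x * (1ℚ + (1ℚ - x)))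
      l = solve-∀ ringℚ

    g₂-upper : kernel x (sq (1ℚ - x)) y * G ≤ sq (1ℚ - x) * (1ℚ + sq (1ℚ - x)) + x → (+ 4 / 1 + y) * scaled x G ≤ 1ℚ + x
    g₂-upper h = *-cancelˡ (cube (1ℚ - x)) r³>0 (*-cancelˡ 2ℚ <! (le-by
      (0≤+ (0≤+ (0≤+ (≤⇒0≤ h) (0≤* (0≤* x≥0 g≥0) (0≤+ (0≤+ (0≤sq (2ℚ - x)) (0≤* 2-x (0≤* {2ℚ} ≤! 1-x))) (0≤+ (0≤sq (2ℚ * (1ℚ - x))) (0≤* (0≤sq (1ℚ - x)) y≥0)))))
        (0≤* x≥0 1-7x)) (0≤* (0≤* x≥0 (0≤sq x)) (0≤+ {+ 5 / 1} ≤! (0≤* {+ 3 / 1} ≤! 1-x))))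
      (l x y G)))
      where
      2-x : 0ℚ ≤ 2ℚ - x
      2-x = ≤⇒0≤ {x} {2ℚ} (≤-trans x≤1 ≤!)
      l : ∀ x y G → 2ℚ * ((1ℚ - x) * ((1ℚ - x) * (1ℚ - x)) * (1ℚ + x)) ≡ 2ℚ * ((1ℚ - x) * ((1ℚ - x) * (1ℚ - x)) * ((+ 4 / 1 + y) * (x * (x * x) * G))) +
        ((1ℚ - x) * (1ℚ - x) * (1ℚ + (1ℚ - x) * (1ℚ - x)) + x - (1ℚ - (1ℚ - x) * (1ℚ - x)) * ((1ℚ - (1ℚ - x) * (1ℚ - x)) * (1ℚ - (1ℚ - x) * (1ℚ - x)) + + 4 / 1 * ((1ℚ - x) * (1ℚ - x) * (+ 1 / 4 * (y * (x * x))))) * G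
         + x * (x * (x * x) * G) * ((2ℚ - x) * (2ℚ - x) + (2ℚ - x) * (2ℚ * (1ℚ - x)) + (2ℚ * (1ℚ - x) * (2ℚ * (1ℚ - x)) + (1ℚ - x) * (1ℚ - x) * y))
         + x * (1ℚ - + 7 / 1 * x) + x * (x * x) * (+ 5 / 1 + + 3 / 1 * (1ℚ - x)))
      l = solve-∀ ringℚ

    g₂-lower : y ≡ 0ℚ → sq (1ℚ - x) * (1ℚ + sq (1ℚ - x)) - x ≤ kernel x (sq (1ℚ - x)) y * G → 2ℚ - + 7 / 1 * x ≤ + 8 / 1 * scaled x G
    g₂-lower refl h = le-by (0≤+ (0≤+ (≤⇒0≤ h) (0≤* (0≤* x≥0 g≥0) (0≤+ (0≤+ {+ 4 / 1} ≤! (0≤* {2ℚ} ≤! 2-x)) (0≤sq (2ℚ - x)))))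
        (0≤* (0≤sq x) (0≤+ {+ 3 / 1} ≤! (0≤sq (2ℚ - x))))) (l x G)
      where
      2-x : 0ℚ ≤ 2ℚ - x
      2-x = ≤⇒0≤ {x} {2ℚ} (≤-trans x≤1 ≤!)
      l : ∀ x G → + 8 / 1 * (x * (x * x) * G) ≡ 2ℚ - + 7 / 1 * x +
        ((1ℚ - (1ℚ - x) * (1ℚ - x)) * ((1ℚ - (1ℚ - x) * (1ℚ - x)) * (1ℚ - (1ℚ - x) * (1ℚ - x)) + + 4 / 1 * ((1ℚ - x) * (1ℚ - x) * (+ 1 / 4 * (0ℚ * (x * x))))) * G - ((1ℚ - x) * (1ℚ - x) * (1ℚ + (1ℚ - x) * (1ℚ - x)) - x)
         + x * (x * (x * x) * G) * (+ 4 / 1 + 2ℚ * (2ℚ - x) + (2ℚ - x) * (2ℚ - x)) + x * x * (+ 3 / 1 + (2ℚ - x) * (2ℚ - x)))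
      l = solve-∀ ringℚ

    private
      c₃ : ℚ
      c₃ = + 3 / 1 * (1ℚ - x) + x * x
      c₃≥0 : 0ℚ ≤ c₃
      c₃≥0 = 0≤+ (0≤* {+ 3 / 1} ≤! 1-x) (0≤sq x)
      3-x : 0ℚ ≤ + 3 / 1 - x
      3-x = ≤⇒0≤ {x} {+ 3 / 1} (≤-trans x≤1 ≤!)

    g₃-lower : cube (1ℚ - x) * (1ℚ + cube (1ℚ - x)) - x ≤ kernel x (cube (1ℚ - x)) y * G → 2ℚ - + 10 / 1 * x ≤ + 3 / 1 * (+ 9 / 1 + y) * scaled x G
    g₃-lower h = ≤-trans step (≤-trans h (le-by (0≤* g≥0 (0≤+
        (0≤* (0≤* x≥0 3-x) (0≤+ (0≤+ {+ 9 / 1} ≤! (0≤* {+ 3 / 1} ≤! c₃≥0)) (0≤sq c₃)))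
        (0≤* y≥0 (0≤+ (0≤* x≥0 3-x) (0≤* x≥0 (0≤sq c₃)))))) (l x y G)))
      where
      step : 2ℚ - + 10 / 1 * x ≤ cube (1ℚ - x) * (1ℚ + cube (1ℚ - x)) - x
      step = le-by (0≤+ (0≤+ (0≤+ (0≤* (0≤sq x) 3-x) (0≤sq (+ 3 / 1 * x))) (0≤* (0≤* (0≤* {2ℚ} ≤! (0≤sq x)) 3-x) 1-3x)) (0≤sq (x * x * (+ 3 / 1 - x)))) (l′ x)
        where
        1-3x : 0ℚ ≤ 1ℚ - + 3 / 1 * x
        1-3x = ≤⇒0≤ {+ 3 / 1 * x} {1ℚ} (≤-trans (*-monoˡ (+ 3 / 1) ≤! x≤) ≤!)
        l′ : ∀ x → (1ℚ - x) * ((1ℚ - x) * (1ℚ - x)) * (1ℚ + (1ℚ - x) * ((1ℚ - x) * (1ℚ - x))) - x ≡ 2ℚ - + 10 / 1 * x +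
          (x * x * (+ 3 / 1 - x) + + 3 / 1 * x * (+ 3 / 1 * x) + 2ℚ * (x * x) * (+ 3 / 1 - x) * (1ℚ - + 3 / 1 * x) + x * x * (+ 3 / 1 - x) * (x * x * (+ 3 / 1 - x)))
        l′ = solve-∀ ringℚ
      l : ∀ x y G → + 3 / 1 * (+ 9 / 1 + y) * (x * (x * x) * G) ≡
        (1ℚ - (1ℚ - x) * ((1ℚ - x) * (1ℚ - x))) * ((1ℚ - (1ℚ - x) * ((1ℚ - x) * (1ℚ - x))) * (1ℚ - (1ℚ - x) * ((1ℚ - x) * (1ℚ - x))) + + 4 / 1 * ((1ℚ - x) * ((1ℚ - x) * (1ℚ - x)) * (+ 1 / 4 * (y * (x * x))))) * G +
        x * (x * x) * G * (x * (+ 3 / 1 - x) * (+ 9 / 1 + + 3 / 1 * (+ 3 / 1 * (1ℚ - x) + x * x) + (+ 3 / 1 * (1ℚ - x) + x * x) * (+ 3 / 1 * (1ℚ - x) + x * x))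
         + y * (x * (+ 3 / 1 - x) + x * ((+ 3 / 1 * (1ℚ - x) + x * x) * (+ 3 / 1 * (1ℚ - x) + x * x))))
      l = solve-∀ ringℚ

    g₃-upper : kernel x (cube (1ℚ - x)) y * G ≤ cube (1ℚ - x) * (1ℚ + cube (1ℚ - x)) + x → + 27 / 1 * scaled x G ≤ 2ℚ
    g₃-upper h = *-cancelˡ (cube (1ℚ - x)) r³>0 (≤-trans (le-by (0≤* g≥0 (0≤+
        (0≤* (0≤sq x) (0≤+ (0≤+ (0≤* {+ 9 / 1} ≤! (0≤sq (1ℚ - x))) (0≤* (0≤* {+ 3 / 1} ≤! 1-x) c₃≥0)) (0≤sq c₃))) (0≤* (0≤* c₃≥0 (0≤* 1-x (0≤sq (1ℚ - x)))) y≥0))) (l x y G)) (≤-trans h step))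
      where
      l : ∀ x y G → (1ℚ - (1ℚ - x) * ((1ℚ - x) * (1ℚ - x))) * ((1ℚ - (1ℚ - x) * ((1ℚ - x) * (1ℚ - x))) * (1ℚ - (1ℚ - x) * ((1ℚ - x) * (1ℚ - x))) + + 4 / 1 * ((1ℚ - x) * ((1ℚ - x) * (1ℚ - x)) * (+ 1 / 4 * (y * (x * x))))) * G ≡
        (1ℚ - x) * ((1ℚ - x) * (1ℚ - x)) * (+ 27 / 1 * (x * (x * x) * G)) +
        x * (x * x) * G * (x * x * (+ 9 / 1 * ((1ℚ - x) * (1ℚ - x)) + + 3 / 1 * (1ℚ - x) * (+ 3 / 1 * (1ℚ - x) + x * x) + (+ 3 / 1 * (1ℚ - x) + x * x) * (+ 3 / 1 * (1ℚ - x) + x * x)) + (+ 3 / 1 * (1ℚ - x) + x * x) * ((1ℚ - x) * ((1ℚ - x) * (1ℚ - x))) * y)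
      l = solve-∀ ringℚ
      step : cube (1ℚ - x) * (1ℚ + cube (1ℚ - x)) + x ≤ cube (1ℚ - x) * 2ℚ
      step = le-by (0≤* x≥0 (0≤+ (0≤+ (0≤+ {1ℚ} ≤! 1-12x) (0≤* {+ 9 / 1} ≤! (0≤sq x))) (0≤+ (0≤* (0≤* (0≤sq x) 3-x) c₃≥0) (0≤* (0≤sq x) 1-3x)))) (l′ x)
        where
        1-3x : 0ℚ ≤ 1ℚ - + 3 / 1 * x
        1-3x = ≤⇒0≤ {+ 3 / 1 * x} {1ℚ} (≤-trans (*-monoˡ (+ 3 / 1) ≤! x≤) ≤!)
        1-12x : 0ℚ ≤ 1ℚ - + 12 / 1 * x
        1-12x = ≤⇒0≤ {+ 12 / 1 * x} {1ℚ} (≤-trans (*-monoˡ (+ 12 / 1) ≤! x≤) ≤!)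
        l′ : ∀ x → (1ℚ - x) * ((1ℚ - x) * (1ℚ - x)) * 2ℚ ≡ (1ℚ - x) * ((1ℚ - x) * (1ℚ - x)) * (1ℚ + (1ℚ - x) * ((1ℚ - x) * (1ℚ - x))) + x +
          x * (1ℚ + (1ℚ - + 12 / 1 * x) + + 9 / 1 * (x * x) + (x * x * (+ 3 / 1 - x) * (+ 3 / 1 * (1ℚ - x) + x * x) + x * x * (1ℚ - + 3 / 1 * x)))
        l′ = solve-∀ ringℚ

  -- Parts j ≤ M, each present with probability r^j / (1 + r^j), where r = 1 - x
  module Tilt (x : ℚ) (x>0 : 0ℚ < x) (x≤ : x ≤ + 1 / 256) where

    r : ℚ
    r = 1ℚ - x

    x≥0 : 0ℚ ≤ x
    x≥0 = <⇒≤ x>0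

    0≤r : 0ℚ ≤ r
    0≤r = ≤⇒0≤ {x} {1ℚ} (≤-trans x≤ ≤!)

    r≤1 : r ≤ 1ℚ
    r≤1 = le-by x≥0 (l x)
      where
      l : ∀ x → 1ℚ ≡ 1ℚ - x + x
      l = solve-∀ ringℚ

    u w p : ℕ → ℚ
    u j = r ^ j
    w j = recip (1ℚ + u j)
    p j = u j * w j

    0≤u : ∀ j → 0ℚ ≤ u j
    0≤u = 0≤^ 0≤r

    u≤1 : ∀ j → u j ≤ 1ℚ
    u≤1 = ^≤1 0≤r r≤1

    0≤w : ∀ j → 0ℚ ≤ w j
    0≤w j = 0≤recip (0<+ {1ℚ} <! (0≤u j))

    w-inverse : ∀ j → (1ℚ + u j) * w j ≡ 1ℚ
    w-inverse j = *-recip (0<+ {1ℚ} <! (0≤u j))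

    0≤p : ∀ j → 0ℚ ≤ p j
    0≤p j = 0≤* (0≤u j) (0≤w j)

    p≤½ : ∀ j → p j ≤ ½
    p≤½ j = le-by (0≤* (0≤* {½} ≤! (0≤w j)) (≤⇒0≤ (u≤1 j))) (eq-by (0*diff ½ (sym (w-inverse j))) (l (u j) (w j)))
      where
      l : ∀ u w → ½ ≡ u * w + ½ * w * (1ℚ - u) + ½ * (1ℚ - (1ℚ + u) * w)
      l = solve-∀ ringℚ

    p≤1 : ∀ j → p j ≤ 1ℚ
    p≤1 j = ≤-trans (p≤½ j) ≤!

    pq : ℕ → ℚ
    pq j = p j * (1ℚ - p j)

    0≤pq : ∀ j → 0ℚ ≤ pq j
    0≤pq j = 0≤* (0≤p j) (≤⇒0≤ (p≤1 j))

    pq≡ : ∀ j → pq j ≡ u j * (w j * w j)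
    pq≡ j = eq-by (0*diff (u j * w j) (sym (w-inverse j))) (l (u j) (w j))
      where
      l : ∀ u w → u * w * (1ℚ - u * w) ≡ u * (w * w) + u * w * (1ℚ - (1ℚ + u) * w)
      l = solve-∀ ringℚ

    w²-inverse : ∀ j → (1ℚ + u j) * (1ℚ + u j) * (w j * w j) ≡ 1ℚ
    w²-inverse j = trans (l (1ℚ + u j) (w j)) (cong₂ _*_ (w-inverse j) (w-inverse j))
      where
      l : ∀ v w → v * v * (w * w) ≡ v * w * (v * w)
      l = solve-∀ ringℚ

    pq≤u : ∀ j → pq j ≤ u j
    pq≤u j = ≤-trans (≤-reflexive (pq≡ j)) (le-by (0≤* (0≤* (0≤u j) (0≤sq (w j))) (0≤* (0≤u j) (0≤+ {2ℚ} ≤! (0≤u j))))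
      (eq-by (0*diff (u j) (sym (w²-inverse j))) (l (u j) (w j))))
      where
      l : ∀ u w → u ≡ u * (w * w) + u * (w * w) * (u * (2ℚ + u)) + u * (1ℚ - (1ℚ + u) * (1ℚ + u) * (w * w))
      l = solve-∀ ringℚ

    -- The function is u / (1 + u)² = u - 2u² + 3u³ - .... The cubic coefficient 5/4 is the largest
    -- possible on [0, 1], with equality at u = 1; the coefficient 3 in `pq-upper` is that of the
    -- series.
    pq-lower : ∀ j → u j + (- 2ℚ) * (u j * u j) + + 5 / 4 * (u j * (u j * u j)) ≤ pq j
    pq-lower j = le-by (0≤* (0≤* (0≤* (0≤u j) (0≤sq (u j))) (0≤sq (w j))) (0≤* (≤⇒0≤ (u≤1 j)) (0≤+ {+ 7 / 4} ≤! (0≤* {+ 5 / 4} ≤! (0≤u j)))))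
      (trans (pq≡ j) (eq-by (0*diff (u j + (- 2ℚ) * (u j * u j) + + 5 / 4 * (u j * (u j * u j))) (w²-inverse j)) (l (u j) (w j))))
      where
      l : ∀ u w → u * (w * w) ≡ u + (- 2ℚ) * (u * u) + + 5 / 4 * (u * (u * u)) +
        u * (u * u) * (w * w) * ((1ℚ - u) * (+ 7 / 4 + + 5 / 4 * u)) +
        (u + (- 2ℚ) * (u * u) + + 5 / 4 * (u * (u * u))) * ((1ℚ + u) * (1ℚ + u) * (w * w) - 1ℚ)
      l = solve-∀ ringℚ

    pq-upper : ∀ j → pq j ≤ u j + (- 2ℚ) * (u j * u j) + + 3 / 1 * (u j * (u j * u j))
    pq-upper j = ≤-trans (≤-reflexive (pq≡ j)) (le-by (0≤* (0≤* (0≤* (0≤u j) (0≤sq (u j))) (0≤sq (w j))) (0≤+ (0≤* {+ 4 / 1} ≤! (0≤u j)) (0≤* {+ 3 / 1} ≤! (0≤sq (u j)))))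
      (eq-by (0*diff (u j + (- 2ℚ) * (u j * u j) + + 3 / 1 * (u j * (u j * u j))) (sym (w²-inverse j))) (l (u j) (w j))))
      where
      l : ∀ u w → u + (- 2ℚ) * (u * u) + + 3 / 1 * (u * (u * u)) ≡ u * (w * w) +
        u * (u * u) * (w * w) * (+ 4 / 1 * u + + 3 / 1 * (u * u)) +
        (u + (- 2ℚ) * (u * u) + + 3 / 1 * (u * (u * u))) * (1ℚ - (1ℚ + u) * (1ℚ + u) * (w * w))
      l = solve-∀ ringℚ

    open Law p public using (μ; V; K)

    weightedSum : ℚ → ℕ → ℚ
    weightedSum s M = Σᴸ (λ j → pq j * cheb s j) (parts M)

    triple : ∀ a b s M → Σᴸ (λ j → (u j + a * (u j * u j) + b * (u j * (u j * u j))) * cheb s j) (parts M) ≡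
      geometricSum r s M + a * geometricSum (sq r) s M + b * geometricSum (cube r) s M
    triple a b s M = trans (Σᴸ-cong (parts M) λ j → trans (l a b (u j) (cheb s j))
        (cong₂ (λ v v′ → u j * cheb s j + a * (v * cheb s j) + b * (v′ * cheb s j)) (sym (*-^ r r j)) (trans (cong (u j *_) (sym (*-^ r r j))) (sym (*-^ r (r * r) j)))))
      (Σᴸ-linear₃ _ _ _ a b (parts M))
      where
      l : ∀ a b u c → (u + a * (u * u) + b * (u * (u * u))) * c ≡ u * c + a * (u * u * c) + b * (u * (u * u) * c)
      l = solve-∀ ringℚ

    module _ {s : ℚ} (c≥0 : ∀ j → 0ℚ ≤ cheb s j) (M : ℕ) where

      weightedSum-lower : geometricSum r s M + (- 2ℚ) * geometricSum (sq r) s M + + 5 / 4 * geometricSum (cube r) s M ≤ weightedSum s M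
      weightedSum-lower = ≤-trans (≤-reflexive (sym (triple (- 2ℚ) (+ 5 / 4) s M))) (Σᴸ-mono (parts M) λ j → *-monoʳ (cheb s j) (c≥0 j) (pq-lower j))

      weightedSum-upper : weightedSum s M ≤ geometricSum r s M + (- 2ℚ) * geometricSum (sq r) s M + + 3 / 1 * geometricSum (cube r) s M
      weightedSum-upper = ≤-trans (Σᴸ-mono (parts M) λ j → *-monoʳ (cheb s j) (c≥0 j) (pq-upper j)) (≤-reflexive (triple (- 2ℚ) (+ 3 / 1) s M))

    0≤sqr : 0ℚ ≤ sq r
    0≤sqr = 0≤sq r

    0≤cuber : 0ℚ ≤ cube r
    0≤cuber = 0≤* 0≤r (0≤sq r)

    sqr≤r : sq r ≤ r
    sqr≤r = ≤-trans (*-monoˡ r 0≤r r≤1) (≤-reflexive (*-identityʳ r))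

    cuber≤r : cube r ≤ r
    cuber≤r = ≤-trans (*-monoˡ r 0≤r (≤-trans sqr≤r r≤1)) (≤-reflexive (*-identityʳ r))

    module Tail (M : ℕ) (tail : r ^ M * ((1ℚ + ι M) * (1ℚ + ι M) + 2ℚ) ≤ x) where

      tail′ : ∀ {ρ} → 0ℚ ≤ ρ → ρ ≤ r → ρ ^ M * ((1ℚ + ι M) * (1ℚ + ι M) + 2ℚ) ≤ x
      tail′ h h′ = ≤-trans (*-monoʳ _ (0≤+ {b = 2ℚ} (0≤sq (1ℚ + ι M)) ≤!) (^-mono h h′ M)) tail

      module _ {y : ℚ} (y≥0 : 0ℚ ≤ y) (c≥0 : ∀ j → 0ℚ ≤ cheb (+ 1 / 4 * (y * (x * x))) j) where

        private
          s = + 1 / 4 * (y * (x * x))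
          s≥0 : 0ℚ ≤ s
          s≥0 = 0≤* {+ 1 / 4} ≤! (0≤* y≥0 (0≤sq x))
          g : ℚ → ℚ
          g ρ = scaled x (geometricSum ρ s M)
          G≥0 : ∀ {ρ} → 0ℚ ≤ ρ → 0ℚ ≤ geometricSum ρ s M
          G≥0 h = 0≤geometricSum M h c≥0
          both : ∀ {ρ} → 0ℚ ≤ ρ → ρ ≤ r → kernel x ρ y * geometricSum ρ s M - ρ * (1ℚ + ρ) ∈± x
          both h h′ = geometricSum-± M h (≤-trans h′ r≤1) s≥0 c≥0 (tail′ h h′)
          low : ∀ {ρ} → 0ℚ ≤ ρ → ρ ≤ r → ρ * (1ℚ + ρ) - x ≤ kernel x ρ y * geometricSum ρ s M
          low {ρ} h h′ = shift (kernel x ρ y * geometricSum ρ s M) (ρ * (1ℚ + ρ)) (proj₁ (both h h′))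
            where
            shift : ∀ a b → - x ≤ a - b → b - x ≤ a
            shift a b h = le-by (≤⇒0≤ h) (l a b x)
              where
              l : ∀ a b x → a ≡ b - x + (a - b - - x)
              l = solve-∀ ringℚ
          high : ∀ {ρ} → 0ℚ ≤ ρ → ρ ≤ r → kernel x ρ y * geometricSum ρ s M ≤ ρ * (1ℚ + ρ) + x
          high {ρ} h h′ = shift (kernel x ρ y * geometricSum ρ s M) (ρ * (1ℚ + ρ)) (proj₂ (both h h′))
            where
            shift : ∀ a b → a - b ≤ x → a ≤ b + x
            shift a b h = le-by (≤⇒0≤ h) (l a b x)
              where
              l : ∀ a b x → b + x ≡ a + (x - (a - b))
              l = solve-∀ ringℚ

        b₁ : 2ℚ - + 4 / 1 * x ≤ (1ℚ + y) * g r
        b₁ = g₁-lower x≥0 x≤ y≥0 (G≥0 0≤r) (low 0≤r ≤-refl)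

        b₂ : (+ 4 / 1 + y) * g (sq r) ≤ 1ℚ + x
        b₂ = g₂-upper x≥0 x≤ y≥0 (G≥0 0≤sqr) (high 0≤sqr sqr≤r)

        b₃ : 2ℚ - + 10 / 1 * x ≤ + 3 / 1 * (+ 9 / 1 + y) * g (cube r)
        b₃ = g₃-lower x≥0 x≤ y≥0 (G≥0 0≤cuber) (low 0≤cuber cuber≤r)

        a₁ : g r ≤ 2ℚ
        a₁ = g₁-upper x≥0 x≤ y≥0 (G≥0 0≤r) (high 0≤r ≤-refl)

        a₂ : y ≡ 0ℚ → 2ℚ - + 7 / 1 * x ≤ + 8 / 1 * g (sq r)
        a₂ e = g₂-lower x≥0 x≤ y≥0 (G≥0 0≤sqr) e (low 0≤sqr sqr≤r)

        a₃ : + 27 / 1 * g (cube r) ≤ 2ℚ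
        a₃ = g₃-upper x≥0 x≤ y≥0 (G≥0 0≤cuber) (high 0≤cuber cuber≤r)

        private
          x³≥0 : 0ℚ ≤ x * (x * x)
          x³≥0 = 0≤* x≥0 (0≤sq x)
          wsum : g r + (- 2ℚ) * g (sq r) + + 5 / 4 * g (cube r) ≤ scaled x (weightedSum s M)
          wsum = ≤-trans (≤-reflexive (l (x * (x * x)) (geometricSum r s M) (geometricSum (sq r) s M) (geometricSum (cube r) s M) (- 2ℚ) (+ 5 / 4)))
            (*-monoˡ (x * (x * x)) x³≥0 (weightedSum-lower c≥0 M))
            where
            l : ∀ t a b c k m → t * a + k * (t * b) + m * (t * c) ≡ t * (a + k * b + m * c)
            l = solve-∀ ringℚ

        -- To leading order g₁ - 2 g₂ is 2/(1 + y) - 2/(4 + y) = 6/((1 + y)(4 + y)), and g₃ is 2/(3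
        -- (9 + y)). Both decrease in y, so they are evaluated at y₁; the fractions over 256 absorb
        -- the errors in x.
        near : ∀ y₁ κ κ′ → y ≤ y₁ → y₁ ≤ 1ℚ → 0ℚ ≤ κ → 0ℚ ≤ κ′ →
          (1ℚ + y₁) * (+ 4 / 1 + y₁) * κ ≤ + 6 / 1 - + 24 / 256 → + 3 / 1 * (+ 9 / 1 + y₁) * κ′ ≤ 2ℚ - + 10 / 256 →
          κ + + 5 / 4 * κ′ ≤ scaled x (weightedSum s M)
        near y₁ κ κ′ y≤y₁ y₁≤1 κ≥0 κ′≥0 hκ hκ′ = ≤-trans (+-mono-≤ first (*-monoˡ (+ 5 / 4) ≤! third)) wsum
          where
          g₁ = g r
          g₂ = g (sq r)
          g₃ = g (cube r)
          pos : ∀ c → 0ℚ < c → 0ℚ < c + y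
          pos c h = 0<+ h y≥0
          first : κ ≤ g₁ + (- 2ℚ) * g₂
          first = *-cancelˡ ((1ℚ + y) * (+ 4 / 1 + y)) (0<* (pos 1ℚ <!) (pos (+ 4 / 1) <!))
            (≤-trans (*-monoʳ κ κ≥0 (*-mono (<⇒≤ (pos 1ℚ <!)) (+-monoʳ-≤ 1ℚ y≤y₁) (<⇒≤ (pos (+ 4 / 1) <!)) (+-monoʳ-≤ (+ 4 / 1) y≤y₁)))
            (≤-trans hκ (le-by (0≤+ (0≤+ (0≤* (<⇒≤ (pos (+ 4 / 1) <!)) (≤⇒0≤ b₁)) (0≤* (0≤* {2ℚ} ≤! (<⇒≤ (pos 1ℚ <!))) (≤⇒0≤ b₂)))
                (0≤+ (0≤* {+ 24 / 1} ≤! (≤⇒0≤ x≤)) (0≤* (0≤* {+ 6 / 1} ≤! x≥0) (≤⇒0≤ (≤-trans y≤y₁ y₁≤1))))) (l x y g₁ g₂))))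
            where
            l : ∀ x y g₁ g₂ → (1ℚ + y) * (+ 4 / 1 + y) * (g₁ + (- 2ℚ) * g₂) ≡ + 6 / 1 - + 24 / 256 +
              ((+ 4 / 1 + y) * ((1ℚ + y) * g₁ - (2ℚ - + 4 / 1 * x)) + 2ℚ * (1ℚ + y) * (1ℚ + x - (+ 4 / 1 + y) * g₂)
              + (+ 24 / 1 * (+ 1 / 256 - x) + + 6 / 1 * x * (1ℚ - y)))
            l = solve-∀ ringℚ
          third : κ′ ≤ g₃
          third = *-cancelˡ (+ 3 / 1 * (+ 9 / 1 + y)) (0<* {+ 3 / 1} <! (pos (+ 9 / 1) <!))
            (≤-trans (*-monoʳ κ′ κ′≥0 (*-monoˡ (+ 3 / 1) ≤! (+-monoʳ-≤ (+ 9 / 1) y≤y₁)))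
            (≤-trans hκ′ (≤-trans (le-by (0≤* {+ 10 / 1} ≤! (≤⇒0≤ x≤)) (l x)) b₃)))
            where
            l : ∀ x → 2ℚ - + 10 / 1 * x ≡ 2ℚ - + 10 / 256 + + 10 / 1 * (+ 1 / 256 - x)
            l = solve-∀ ringℚ

        -- The first two terms together decay like 6/y², but the cubic one only like 5/(6y), so y
        -- times the sum stays away from zero. After the denominators are cleared, the remainder is
        -- a polynomial with positive coefficients in y, y - ½ and the given bounds.
        far : ½ ≤ y → + 46 / 100 ≤ y * scaled x (weightedSum s M)
        far y≥½ = ≤-trans (*-cancelˡ ((1ℚ + y) * ((+ 4 / 1 + y) * (+ 9 / 1 + y))) (0<* (pos 1ℚ <!) (0<* (pos (+ 4 / 1) <!) (pos (+ 9 / 1) <!)))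
            (le-by (0≤+ (0≤+ (0≤+ (0≤* (0≤* y≥0 (0≤* (nn (+ 4 / 1) <!) (nn (+ 9 / 1) <!))) (≤⇒0≤ b₁))
                  (0≤* (0≤* y≥0 (0≤* (0≤* {2ℚ} ≤! (nn 1ℚ <!)) (nn (+ 9 / 1) <!))) (≤⇒0≤ b₂)))
                  (0≤* (0≤* {+ 5 / 12} ≤! (0≤* y≥0 (0≤* (nn 1ℚ <!) (nn (+ 4 / 1) <!)))) (≤⇒0≤ b₃)))
                (0≤+ (0≤* (≤⇒0≤ x≤) (0≤+ (0≤* (0≤* y≥0 (nn (+ 9 / 1) <!)) (0≤+ {+ 18 / 1} ≤! (0≤* {+ 6 / 1} ≤! y≥0))) (0≤* {+ 50 / 12} ≤! (0≤* y≥0 (0≤* (nn 1ℚ <!) (nn (+ 4 / 1) <!))))))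
                  (0≤+ (0≤+ (0≤* {+ 12811 / 38400} ≤! (0≤* y≥0 (0≤sq y))) (0≤* {+ 129179 / 38400} ≤! (0≤sq y))) (0≤+ (0≤* {+ 81829 / 2400} ≤! (≤⇒0≤ y≥½)) (≤! {0ℚ} {+ 2341 / 4800})))))
              (l x y g₁ g₂ g₃)))
            (*-monoˡ y y≥0 wsum)
          where
          g₁ = g r
          g₂ = g (sq r)
          g₃ = g (cube r)
          pos : ∀ c → 0ℚ < c → 0ℚ < c + y
          pos c h = 0<+ h y≥0
          nn : ∀ c → 0ℚ < c → 0ℚ ≤ c + y
          nn c h = <⇒≤ (pos c h)
          l : ∀ x y g₁ g₂ g₃ → (1ℚ + y) * ((+ 4 / 1 + y) * (+ 9 / 1 + y)) * (y * (g₁ + (- 2ℚ) * g₂ + + 5 / 4 * g₃)) ≡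
            (1ℚ + y) * ((+ 4 / 1 + y) * (+ 9 / 1 + y)) * (+ 46 / 100) +
            (y * ((+ 4 / 1 + y) * (+ 9 / 1 + y)) * ((1ℚ + y) * g₁ - (2ℚ - + 4 / 1 * x))
            + y * (2ℚ * (1ℚ + y) * (+ 9 / 1 + y)) * (1ℚ + x - (+ 4 / 1 + y) * g₂)
            + + 5 / 12 * (y * ((1ℚ + y) * (+ 4 / 1 + y))) * (+ 3 / 1 * (+ 9 / 1 + y) * g₃ - (2ℚ - + 10 / 1 * x))
            + ((+ 1 / 256 - x) * (y * (+ 9 / 1 + y) * (+ 18 / 1 + + 6 / 1 * y) + + 50 / 12 * (y * ((1ℚ + y) * (+ 4 / 1 + y))))
            + (+ 12811 / 38400 * (y * (y * y)) + + 129179 / 38400 * (y * y) + (+ 81829 / 2400 * (y - ½) + + 2341 / 4800))))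
          l = solve-∀ ringℚ

      private
        zero-arg : ∀ x → + 1 / 4 * (0ℚ * (x * x)) ≡ 0ℚ
        zero-arg = solve-∀ ringℚ
        c≥0 : ∀ j → 0ℚ ≤ cheb (+ 1 / 4 * (0ℚ * (x * x))) j
        c≥0 j = subst (λ e → 0ℚ ≤ cheb e j) (sym (zero-arg x)) (subst (0ℚ ≤_) (sym (cheb-0 j)) (0≤sq (ι j)))
        V≡ : V (parts M) ≡ weightedSum (+ 1 / 4 * (0ℚ * (x * x))) M
        V≡ = Σᴸ-cong (parts M) λ j → trans (l (ι j) (pq j)) (cong (pq j *_) (sym (trans (cong (λ e → cheb e j) (zero-arg x)) (cheb-0 j))))
          where
          l : ∀ a b → a * (a * b) ≡ b * (a * a)
          l = solve-∀ ringℚ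

      -- The variance is the weighted sum at s = 0, where `cheb` is j². The constants 1.56 and 1.74
      -- enclose the limit π²/6 of x³ V.
      V-lower : + 156 / 100 ≤ scaled x (V (parts M))
      V-lower = ≤-trans (≤-trans ≤! (near ≤-refl c≥0 0ℚ (+ 1476 / 1000) (+ 726 / 10000) ≤-refl ≤! ≤! ≤! ≤! ≤!)) (≤-reflexive (cong (scaled x) (sym V≡)))

      V-upper : scaled x (V (parts M)) ≤ + 174 / 100
      V-upper = ≤-trans (≤-reflexive (cong (scaled x) V≡)) (≤-trans (*-monoˡ (x * (x * x)) (0≤* x≥0 (0≤sq x)) (weightedSum-upper c≥0 M))
        (le-by (0≤+ (0≤+ (0≤+ (≤⇒0≤ (a₁ ≤-refl c≥0)) (0≤* {+ 1 / 4} ≤! (≤⇒0≤ (a₂ ≤-refl c≥0 refl)))) (0≤* {+ 1 / 9} ≤! (≤⇒0≤ (a₃ ≤-refl c≥0)))) (0≤+ (0≤* {+ 7 / 4} ≤! (≤⇒0≤ x≤)) (≤! {0ℚ} {+ 174 / 100 - 2ℚ + ½ - + 2 / 9 - + 7 / 1024})))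
          (l x (geometricSum r s M) (geometricSum (sq r) s M) (geometricSum (cube r) s M))))
        where
        s = + 1 / 4 * (0ℚ * (x * x))
        l : ∀ x a b c → + 174 / 100 ≡ x * (x * x) * (a + (- 2ℚ) * b + + 3 / 1 * c) +
          (2ℚ - x * (x * x) * a + + 1 / 4 * (+ 8 / 1 * (x * (x * x) * b) - (2ℚ - + 7 / 1 * x)) + + 1 / 9 * (2ℚ - + 27 / 1 * (x * (x * x) * c))
          + (+ 7 / 4 * (+ 1 / 256 - x) + (+ 174 / 100 - 2ℚ + ½ - + 2 / 9 - + 7 / 1024)))
        l = solve-∀ ringℚ

  ι-cancel : ∀ {m n} → ι m ≤ ι n → m ℕ.≤ n
  ι-cancel h with ιℤ-cancel h
  ... | ℤ.+≤+ p = p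

  Σᴸ-parts-1 : ∀ M → Σᴸ (λ _ → 1ℚ) (parts M) ≡ ι M
  Σᴸ-parts-1 zero    = sym ιℤ-0
  Σᴸ-parts-1 (suc M) = trans (cong (λ e → 1ℚ + e) (Σᴸ-parts-1 M)) (sym (ι-suc M))

  module Sums (x : ℚ) (x>0 : 0ℚ < x) (x≤ : x ≤ + 1 / 256) where
    open Tilt x x>0 x≤

    -- Σ j³ r^j ≤ 6 T⁴, with the remainder of the infinite series as a potential.
    cubes : ∀ M → x * (x * (x * x)) * Σᴸ (λ j → ι j * (ι j * (ι j * u j))) (parts M) +
      u M * (ι M * x * (ι M * x * (ι M * x)) + + 3 / 1 * (ι M * x * (ι M * x)) + + 6 / 1 * (ι M * x) + + 6 / 1) ≤ + 6 / 1
    cubes zero = ≤-reflexive (trans (cong (λ e → x * (x * (x * x)) * 0ℚ + 1ℚ * (e * x * (e * x * (e * x)) + + 3 / 1 * (e * x * (e * x)) + + 6 / 1 * (e * x) + + 6 / 1)) ιℤ-0) (l x))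
      where
      l : ∀ x → x * (x * (x * x)) * 0ℚ + 1ℚ * (0ℚ * x * (0ℚ * x * (0ℚ * x)) + + 3 / 1 * (0ℚ * x * (0ℚ * x)) + + 6 / 1 * (0ℚ * x) + + 6 / 1) ≡ + 6 / 1
      l = solve-∀ ringℚ
    cubes (suc M) = ≤-trans (≤-reflexive (cong (λ e → x * (x * (x * x)) * (e * (e * (e * (r * u M))) + S) + r * u M * (e * x * (e * x * (e * x)) + + 3 / 1 * (e * x * (e * x)) + + 6 / 1 * (e * x) + + 6 / 1)) (ι-suc M)))
      (≤-trans (le-by (0≤* (0≤u M) (0≤+ (0≤+ (0≤* (0≤* J≥0 (0≤* J≥0 J≥0)) (0≤* (0≤sq x) (0≤* x≥0 (0≤sq x)))) (0≤* {+ 3 / 1} ≤! (0≤* J≥0 (0≤* x≥0 (0≤sq x))))) (0≤* (0≤sq x) (0≤+ {2ℚ} ≤! 0≤r)))) (l x (ι M) (u M) S)) (cubes M))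
      where
      S = Σᴸ (λ j → ι j * (ι j * (ι j * u j))) (parts M)
      J≥0 : 0ℚ ≤ 1ℚ + ι M
      J≥0 = 0≤+ {1ℚ} ≤! (0≤ι M)
      l : ∀ x M u S → x * (x * (x * x)) * S + u * (M * x * (M * x * (M * x)) + + 3 / 1 * (M * x * (M * x)) + + 6 / 1 * (M * x) + + 6 / 1) ≡
        x * (x * (x * x)) * ((1ℚ + M) * ((1ℚ + M) * ((1ℚ + M) * ((1ℚ - x) * u))) + S) + (1ℚ - x) * u * ((1ℚ + M) * x * ((1ℚ + M) * x * ((1ℚ + M) * x)) + + 3 / 1 * ((1ℚ + M) * x * ((1ℚ + M) * x)) + + 6 / 1 * ((1ℚ + M) * x) + + 6 / 1)
        + u * ((1ℚ + M) * ((1ℚ + M) * (1ℚ + M)) * (x * x * (x * (x * x))) + + 3 / 1 * ((1ℚ + M) * (x * (x * x))) + x * x * (2ℚ + (1ℚ - x)))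
      l = solve-∀ ringℚ

    K-upper : ∀ M → x * (x * (x * x)) * K (parts M) ≤ + 6 / 1
    K-upper M = ≤-trans (*-monoˡ (x * (x * (x * x))) (0≤* x≥0 (0≤* x≥0 (0≤sq x))) (Σᴸ-mono (parts M) λ j → *-monoˡ (ι j) (0≤ι j) (*-monoˡ (ι j) (0≤ι j) (*-monoˡ (ι j) (0≤ι j) (pq≤u j)))))
      (≤-trans (le-by (0≤* (0≤u M) (0≤+ {b = + 6 / 1} (0≤+ (0≤+ (0≤* Mx (0≤* Mx Mx)) (0≤* {+ 3 / 1} ≤! (0≤* Mx Mx))) (0≤* {+ 6 / 1} ≤! Mx)) ≤!)) refl) (cubes M))
      where
      Mx : 0ℚ ≤ ι M * x
      Mx = 0≤* (0≤ι M) x≥0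

    mean-sum : ∀ M → x * x * Σᴸ (λ j → ι j * u j) (parts M) + u M * (1ℚ + ι M * x) ≤ 1ℚ
    mean-sum zero = ≤-reflexive (trans (cong (λ e → x * x * 0ℚ + 1ℚ * (1ℚ + e * x)) ιℤ-0) (l x))
      where
      l : ∀ x → x * x * 0ℚ + 1ℚ * (1ℚ + 0ℚ * x) ≡ 1ℚ
      l = solve-∀ ringℚ
    mean-sum (suc M) = ≤-trans (≤-reflexive (cong (λ e → x * x * (e * (r * u M) + S) + r * u M * (1ℚ + e * x)) (ι-suc M)))
      (≤-trans (le-by (0≤* (0≤u M) (0≤* (0≤+ {1ℚ} ≤! (0≤ι M)) (0≤* x≥0 (0≤sq x)))) (l x (ι M) (u M) S)) (mean-sum M))
      where
      S = Σᴸ (λ j → ι j * u j) (parts M)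
      l : ∀ x M u S → x * x * S + u * (1ℚ + M * x) ≡ x * x * ((1ℚ + M) * ((1ℚ - x) * u) + S) + (1ℚ - x) * u * (1ℚ + (1ℚ + M) * x) + u * ((1ℚ + M) * (x * (x * x)))
      l = solve-∀ ringℚ

    p≤u : ∀ j → p j ≤ u j
    p≤u j = le-by (0≤* (0≤* (0≤u j) (0≤u j)) (0≤w j)) (eq-by (0*diff (u j) (sym (w-inverse j))) (l (u j) (w j)))
      where
      l : ∀ u w → u ≡ u * w + u * u * w + u * (1ℚ - (1ℚ + u) * w)
      l = solve-∀ ringℚ

    μ-upper : ∀ M → x * x * μ (parts M) ≤ 1ℚ
    μ-upper M = ≤-trans (*-monoˡ (x * x) (0≤sq x) (Σᴸ-mono (parts M) λ j → *-monoˡ (ι j) (0≤ι j) (p≤u j)))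
      (≤-trans (le-by (0≤* (0≤u M) (0≤+ {1ℚ} ≤! (0≤* (0≤ι M) x≥0))) refl) (mean-sum M))

    private
      -- A truncation of (1 - x)^j (1 + x)^j ≤ 1.
      binomial : ∀ j → u j * (1ℚ + ι j * x + ½ * (ι j * (ι j - 1ℚ)) * (x * x)) ≤ 1ℚ
      binomial zero = ≤-reflexive (trans (cong (λ e → 1ℚ * (1ℚ + e * x + ½ * (e * (e - 1ℚ)) * (x * x))) ιℤ-0) (l x))
        where
        l : ∀ x → 1ℚ * (1ℚ + 0ℚ * x + ½ * (0ℚ * (0ℚ - 1ℚ)) * (x * x)) ≡ 1ℚ
        l = solve-∀ ringℚ
      binomial (suc j) = ≤-trans (≤-reflexive (cong (λ e → r * u j * (1ℚ + e * x + ½ * (e * (e - 1ℚ)) * (x * x))) (ι-suc j)))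
        (≤-trans (le-by (0≤* (0≤u j) (0≤+ (0≤sq x) (0≤* {½} ≤! (0≤* (0≤* (0≤ι j) (0≤+ {1ℚ} ≤! (0≤ι j))) (0≤* x≥0 (0≤sq x)))))) (l x (ι j) (u j))) (binomial j))
        where
        l : ∀ x j u → u * (1ℚ + j * x + ½ * (j * (j - 1ℚ)) * (x * x)) ≡ (1ℚ - x) * u * (1ℚ + (1ℚ + j) * x + ½ * ((1ℚ + j) * (1ℚ + j - 1ℚ)) * (x * x)) +
          u * (x * x + ½ * (j * (1ℚ + j) * (x * (x * x))))
        l = solve-∀ ringℚ

    u-j² : ∀ j → x * x * (u j * (ι j * ι j)) ≤ 2ℚ
    u-j² j = ≤-trans (le-by (0≤* (0≤* {2ℚ} ≤! (0≤u j)) (0≤+ {1ℚ} ≤! (0≤* (0≤* (0≤ι j) x≥0) (0≤+ {½} ≤! (0≤* {½} ≤! 0≤r))))) (l x (ι j) (u j))) (*-monoˡ 2ℚ ≤! (binomial j))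
      where
      l : ∀ x j u → 2ℚ * (u * (1ℚ + j * x + ½ * (j * (j - 1ℚ)) * (x * x))) ≡ x * x * (u * (j * j)) + 2ℚ * u * (1ℚ + j * x * (½ + ½ * (1ℚ - x)))
      l = solve-∀ ringℚ

  -- (1 - b)^n ≤ 1 / (1 + n b)
  inverse-bernoulli : ∀ {b} → 0ℚ ≤ b → b ≤ 1ℚ → ∀ n → (1ℚ - b) ^ n * (1ℚ + ι n * b) ≤ 1ℚ
  inverse-bernoulli {b} b≥0 b≤1 zero = ≤-reflexive (trans (cong (λ e → 1ℚ * (1ℚ + e * b)) ιℤ-0) (l b))
    where
    l : ∀ b → 1ℚ * (1ℚ + 0ℚ * b) ≡ 1ℚ
    l = solve-∀ ringℚ
  inverse-bernoulli {b} b≥0 b≤1 (suc n) = ≤-trans (≤-reflexive (cong (λ e → (1ℚ - b) * (1ℚ - b) ^ n * (1ℚ + e * b)) (ι-suc n)))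
    (≤-trans (le-by (0≤* (0≤^ (≤⇒0≤ b≤1) n) (0≤* (0≤+ {1ℚ} ≤! (0≤ι n)) (0≤sq b))) (l b (ι n) ((1ℚ - b) ^ n))) (inverse-bernoulli b≥0 b≤1 n))
    where
    l : ∀ b n v → v * (1ℚ + n * b) ≡ (1ℚ - b) * v * (1ℚ + (1ℚ + n) * b) + v * ((1ℚ + n) * (b * b))
    l = solve-∀ ringℚ

  ^-*-^ : ∀ x m n → x ^ (n ℕ.* m) ≡ (x ^ m) ^ n
  ^-*-^ x m zero    = refl
  ^-*-^ x m (suc n) = trans (^-+ x m (n ℕ.* m)) (cong (x ^ m *_) (^-*-^ x m n))

  -- The characteristic function of the law with one part removed, on three ranges of y = 4 s T²
  module CharBound (x : ℚ) (x>0 : 0ℚ < x) (x≤ : x ≤ + 1 / 256) (M : ℕ)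
    (tail : (1ℚ - x) ^ M * ((1ℚ + ι M) * (1ℚ + ι M) + 2ℚ) ≤ x)
    (T : ℚ) (xT : x * T ≡ 1ℚ) (size : ι M ≤ + 8 / 1 * (T * T) + + 8 / 1) where
    open Tilt x x>0 x≤
    open Tail M tail
    open Sums x x>0 x≤
    open Fourier p
    open FactorBound p

    T≥256 : + 256 / 1 ≤ T
    T≥256 = *-cancelˡ x x>0 (≤-trans (≤-trans (*-monoʳ (+ 256 / 1) ≤! x≤) ≤!) (≤-reflexive (sym xT)))

    T≥0 : 0ℚ ≤ T
    T≥0 = ≤-trans ≤! T≥256

    Θ : ℚ
    Θ = T * (T * T)

    Θ≥0 : 0ℚ ≤ Θ
    Θ≥0 = 0≤* T≥0 (0≤sq T)

    unscale : ∀ {a b} → a ≤ scaled x b → a * Θ ≤ b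
    unscale {a} {b} h = ≤-trans (*-monoʳ Θ Θ≥0 h) (≤-reflexive (trans (l x T b) (trans (cong (λ e → e * (e * e) * b) xT) (l′ b))))
      where
      l : ∀ x T b → x * (x * x) * b * (T * (T * T)) ≡ x * T * (x * T * (x * T)) * b
      l = solve-∀ ringℚ
      l′ : ∀ b → 1ℚ * (1ℚ * 1ℚ) * b ≡ b
      l′ = solve-∀ ringℚ

    y : ℕ → ℚ
    y k = + 4 / 1 * spt k * (T * T)

    0≤y : ∀ k → 0ℚ ≤ y k
    0≤y k = 0≤* (0≤* {+ 4 / 1} ≤! (0≤spt k)) (0≤sq T)

    spt≡ : ∀ k → spt k ≡ + 1 / 4 * (y k * (x * x))
    spt≡ k = sym (trans (l (spt k) x T) (trans (cong (λ e → spt k * (e * e)) xT) (l′ (spt k))))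
      where
      l : ∀ s x T → + 1 / 4 * (+ 4 / 1 * s * (T * T) * (x * x)) ≡ s * (x * T * (x * T))
      l = solve-∀ ringℚ
      l′ : ∀ s → s * (1ℚ * 1ℚ) ≡ s
      l′ = solve-∀ ringℚ

    cheb≥0 : ∀ k j → 0ℚ ≤ cheb (+ 1 / 4 * (y k * (x * x))) j
    cheb≥0 k j = subst (λ e → 0ℚ ≤ cheb e j) (spt≡ k) (0≤cheb k j)

    wsum : ℕ → ℚ
    wsum k = weightedSum (spt k) M

    near-sum : ∀ y₁ κ κ′ k → y k ≤ y₁ → y₁ ≤ 1ℚ → 0ℚ ≤ κ → 0ℚ ≤ κ′ →
      (1ℚ + y₁) * (+ 4 / 1 + y₁) * κ ≤ + 6 / 1 - + 24 / 256 → + 3 / 1 * (+ 9 / 1 + y₁) * κ′ ≤ 2ℚ - + 10 / 256 →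
      (κ + + 5 / 4 * κ′) * Θ ≤ wsum k
    near-sum y₁ κ κ′ k h₁ h₂ h₃ h₄ h₅ h₆ = unscale {κ + + 5 / 4 * κ′} (subst (λ e → κ + + 5 / 4 * κ′ ≤ scaled x (weightedSum e M)) (sym (spt≡ k))
      (near (0≤y k) (cheb≥0 k) y₁ κ κ′ h₁ h₂ h₃ h₄ h₅ h₆))

    far-sum : ∀ k → ½ ≤ y k → + 46 / 100 * Θ ≤ y k * wsum k
    far-sum k h = ≤-trans (unscale {+ 46 / 100} {y k * wsum k} (subst (+ 46 / 100 ≤_) (l x (y k) (wsum k)) (subst (λ e → + 46 / 100 ≤ y k * scaled x (weightedSum e M)) (sym (spt≡ k)) (far (0≤y k) (cheb≥0 k) h)))) ≤-refl
      where
      l : ∀ x y w → y * (x * (x * x) * w) ≡ x * (x * x) * (y * w)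
      l = solve-∀ ringℚ

    -- Rounding costs one for each part, at most 8T² + 8 in all, and the missing part at most 8T²
    -- less the one it would have cost. The total 16T² + 7 is below 17/256 · T³ since T ≥ 256.
    removed : ∀ {a : ℕ → ℚ} {z L′ c} → Rem (parts M) z L′ → c ≤ Σᴸ a (parts M) → a z ≤ + 8 / 1 * (T * T) →
      c - + 17 / 256 * Θ ≤ Σᴸ (λ j → a j - 1ℚ) L′
    removed {a} {z} {L′} {c} rem hc hz = le-by (0≤+ (0≤+ (≤⇒0≤ hc) (≤⇒0≤ hz)) (0≤+ (≤⇒0≤ size) Θ-bound))
      (eq-by (0*diff (- 1ℚ) whole) (l (Σᴸ a (parts M)) (Σᴸ (λ j → a j - 1ℚ) L′) (a z) (ι M) T c))
      where
      whole : Σᴸ a (parts M) - ι M ≡ a z - 1ℚ + Σᴸ (λ j → a j - 1ℚ) L′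
      whole = trans (sym (trans (Σᴸ-cong (parts M) λ j → l₀ (a j)) (trans (Σᴸ-+ a (λ _ → - 1ℚ) (parts M)) (cong (λ e → Σᴸ a (parts M) + e) minus)))) (Σᴸ-Rem (λ j → a j - 1ℚ) rem)
        where
        l₀ : ∀ a → a - 1ℚ ≡ a + - 1ℚ
        l₀ a = refl
        minus : Σᴸ (λ _ → - 1ℚ) (parts M) ≡ - ι M
        minus = trans (Σᴸ-*ʳ (λ _ → 1ℚ) (- 1ℚ) (parts M)) (trans (cong (λ e → e * (- 1ℚ)) (Σᴸ-parts-1 M)) (l₁ (ι M)))
          where
          l₁ : ∀ a → a * (- 1ℚ) ≡ - a
          l₁ = solve-∀ ringℚ
      T-256 : 0ℚ ≤ T - + 256 / 1
      T-256 = ≤⇒0≤ T≥256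
      Θ-bound : 0ℚ ≤ + 17 / 256 * Θ - (+ 16 / 1 * (T * T) + + 7 / 1)
      Θ-bound = ≤⇒0≤ (le-by (0≤+ (0≤* {+ 17 / 256} ≤! (0≤* T-256 (0≤sq T))) (0≤+ (0≤* T-256 (0≤+ {b = + 256 / 1} T≥0 ≤!)) (≤! {0ℚ} {+ 256 / 1 * (+ 256 / 1) - + 7 / 1}))) (l₂ T))
        where
        l₂ : ∀ T → + 17 / 256 * (T * (T * T)) ≡ + 16 / 1 * (T * T) + + 7 / 1 + (+ 17 / 256 * ((T - + 256 / 1) * (T * T)) + ((T - + 256 / 1) * (T + + 256 / 1) + (+ 256 / 1 * (+ 256 / 1) - + 7 / 1)))
        l₂ = solve-∀ ringℚ
      l : ∀ A B z M T c → B ≡ c - + 17 / 256 * (T * (T * T)) +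
        (A - c + (+ 8 / 1 * (T * T) - z) + (+ 8 / 1 * (T * T) + + 8 / 1 - M + (+ 17 / 256 * (T * (T * T)) - (+ 16 / 1 * (T * T) + + 7 / 1)))) + (- 1ℚ) * (A - M - (z - 1ℚ + B))
      l = solve-∀ ringℚ

    sin²-cheb : ∀ k j → sin² (pow (pt k) j) ≡ spt k * cheb (spt k) j
    sin²-cheb k j = cheb-sin² (pt k) (pt-norm k) j

    -- Rounding at scale b = s
    φ-near : ∀ {z L′ c} k → Rem (parts M) z L′ → c ≤ + 4 / 1 * wsum k →
      ∃ λ N → norm (φ (pt k) L′) ≤ cpt k ^ N × c - + 17 / 256 * Θ ≤ ι N
    φ-near {z} {L′} {c} k rem hc = finish (φ-bound (pt k) (pt-norm k) (0≤spt k) (spt≤1 k) a a≥0 eq L′)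
      where
      a : ℕ → ℚ
      a j = pq j * cheb (spt k) j * (+ 4 / 1)
      a≥0 : ∀ j → 0ℚ ≤ a j
      a≥0 j = 0≤* {b = + 4 / 1} (0≤* (0≤pq j) (0≤cheb k j)) ≤!
      eq : ∀ j → factor (pt k) j ≡ 1ℚ - a j * spt k
      eq j = trans (cong (λ e → 1ℚ - + 4 / 1 * pq j * e) (sin²-cheb k j)) (l (pq j) (spt k) (cheb (spt k) j))
        where
        l : ∀ q s c → 1ℚ - + 4 / 1 * q * (s * c) ≡ 1ℚ - q * c * (+ 4 / 1) * s
        l = solve-∀ ringℚ
      total : + 4 / 1 * wsum k ≡ Σᴸ a (parts M)
      total = trans (*-comm (+ 4 / 1) (wsum k)) (sym (Σᴸ-*ʳ (λ j → pq j * cheb (spt k) j) (+ 4 / 1) (parts M)))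
      single : pq z * cheb (spt k) z * (+ 4 / 1) ≤ + 8 / 1 * (T * T)
      single = ≤-trans (*-monoʳ (+ 4 / 1) ≤! (*-mono (0≤pq z) (pq≤u z) (0≤cheb k z) (cheb-upper (0≤spt k) (0≤cheb k) z)))
        (≤-trans (≤-reflexive (sym (trans (l (u z) (ι z) x T) (trans (cong (λ e → u z * (ι z * ι z) * (+ 4 / 1) * (e * e)) xT) (*-identityʳ _)))))
          (≤-trans (*-monoʳ (+ 4 / 1 * (T * T)) (0≤* {+ 4 / 1} ≤! (0≤sq T)) (u-j² z)) (≤-reflexive (l′ T))))
        where
        l : ∀ u j x T → x * x * (u * (j * j)) * (+ 4 / 1 * (T * T)) ≡ u * (j * j) * (+ 4 / 1) * (x * T * (x * T))
        l = solve-∀ ringℚ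
        l′ : ∀ T → 2ℚ * (+ 4 / 1 * (T * T)) ≡ + 8 / 1 * (T * T)
        l′ = solve-∀ ringℚ
      bound : c - + 17 / 256 * Θ ≤ Σᴸ (λ j → a j - 1ℚ) L′
      bound = removed {a} rem (≤-trans hc (≤-reflexive total)) single
      finish : (∃ λ N → norm (φ (pt k) L′) ≤ (1ℚ - spt k) ^ N × Σᴸ (λ j → a j - 1ℚ) L′ ≤ ι N) →
        ∃ λ N → norm (φ (pt k) L′) ≤ cpt k ^ N × c - + 17 / 256 * Θ ≤ ι N
      finish (N , le , sum) = N , le , ≤-trans bound sum

    -- The value of s at y = ½. For larger s the scale stays fixed: at scale s the weights `a j`
    -- would shrink while rounding still costs one for each part.
    b₀ : ℚ
    b₀ = + 1 / 8 * (x * x)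

    0≤b₀ : 0ℚ ≤ b₀
    0≤b₀ = 0≤* {+ 1 / 8} ≤! (0≤sq x)

    b₀≤1 : b₀ ≤ 1ℚ
    b₀≤1 = ≤-trans (*-monoˡ (+ 1 / 8) ≤! (*-mono x≥0 x≤ x≥0 x≤)) ≤!

    -- Rounding at the fixed scale b₀
    φ-far : ∀ {z L′} k → Rem (parts M) z L′ → ½ ≤ y k →
      ∃ λ N → norm (φ (pt k) L′) ≤ (1ℚ - b₀) ^ N × + 36 / 10 * Θ ≤ ι N
    φ-far {z} {L′} k rem y≥½ = finish (φ-bound (pt k) (pt-norm k) 0≤b₀ b₀≤1 a a≥0 eq L′)
      where
      a : ℕ → ℚ
      a j = pq j * cheb (spt k) j * (+ 8 / 1 * y k)
      a≥0 : ∀ j → 0ℚ ≤ a j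
      a≥0 j = 0≤* (0≤* (0≤pq j) (0≤cheb k j)) (0≤* {+ 8 / 1} ≤! (0≤y k))
      eq : ∀ j → factor (pt k) j ≡ 1ℚ - a j * b₀
      eq j = trans (cong (λ e → 1ℚ - + 4 / 1 * pq j * e) (sin²-cheb k j)) (trans (cong (λ e → 1ℚ - + 4 / 1 * pq j * (e * cheb (spt k) j)) (spt≡ k)) (l (pq j) (y k) x (cheb (spt k) j)))
        where
        l : ∀ q y x c → 1ℚ - + 4 / 1 * q * (+ 1 / 4 * (y * (x * x)) * c) ≡ 1ℚ - q * c * (+ 8 / 1 * y) * (+ 1 / 8 * (x * x))
        l = solve-∀ ringℚ
      l₁ : ∀ t → + 36 / 10 * t ≡ (+ 36 / 10 + + 17 / 256) * t - + 17 / 256 * t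
      l₁ = solve-∀ ringℚ
      l₂ : ∀ t → + 368 / 100 * t ≡ + 8 / 1 * (+ 46 / 100 * t)
      l₂ = solve-∀ ringℚ
      l₃ : ∀ y w → + 8 / 1 * (y * w) ≡ w * (+ 8 / 1 * y)
      l₃ = solve-∀ ringℚ
      total : + 8 / 1 * (y k * wsum k) ≡ Σᴸ a (parts M)
      total = trans (l₃ (y k) (wsum k)) (sym (Σᴸ-*ʳ (λ j → pq j * cheb (spt k) j) (+ 8 / 1 * y k) (parts M)))
      -- The factor 1 - a z · b₀ is a squared modulus, hence nonnegative, and 1 / b₀ = 8T².
      single : pq z * cheb (spt k) z * (+ 8 / 1 * y k) ≤ + 8 / 1 * (T * T)
      single = ≤-trans (≤-reflexive (trans (l (pq z) (cheb (spt k) z) (spt k) (T * T)) (cong (λ e → pq z * e * (+ 32 / 1 * (T * T))) (sym (sin²-cheb k z)))))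
        (le-by (0≤* (0≤* {+ 8 / 1} ≤! (0≤sq T)) (0≤factor (pt k) (pt-norm k) z)) (l′ (pq z) (sin² (pow (pt k) z)) (T * T)))
        where
        l : ∀ q c s t → q * c * (+ 8 / 1 * (+ 4 / 1 * s * t)) ≡ q * (s * c) * (+ 32 / 1 * t)
        l = solve-∀ ringℚ
        l′ : ∀ q s t → + 8 / 1 * t ≡ q * s * (+ 32 / 1 * t) + + 8 / 1 * t * (1ℚ - + 4 / 1 * q * s)
        l′ = solve-∀ ringℚ
      bound : + 368 / 100 * Θ - + 17 / 256 * Θ ≤ Σᴸ (λ j → a j - 1ℚ) L′
      bound = removed {a} rem (≤-trans (≤-reflexive (l₂ Θ)) (≤-trans (*-monoˡ (+ 8 / 1) ≤! (far-sum k y≥½)) (≤-reflexive total))) single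
      finish : (∃ λ N → norm (φ (pt k) L′) ≤ (1ℚ - b₀) ^ N × Σᴸ (λ j → a j - 1ℚ) L′ ≤ ι N) →
        ∃ λ N → norm (φ (pt k) L′) ≤ (1ℚ - b₀) ^ N × + 36 / 10 * Θ ≤ ι N
      finish (N , le , sum) = N , le , ≤-trans (≤-trans (≤-reflexive (l₁ Θ)) (≤-trans (+-monoˡ-≤ (- (+ 17 / 256 * Θ)) (*-monoʳ Θ Θ≥0 (≤! {+ 36 / 10 + + 17 / 256} {+ 368 / 100}))) bound)) sum

  -- A majorant of the characteristic functions with explicit moments

  module Majorant (x : ℚ) (x>0 : 0ℚ < x) (x≤ : x ≤ + 1 / 256) (M : ℕ)
    (tail : (1ℚ - x) ^ M * ((1ℚ + ι M) * (1ℚ + ι M) + 2ℚ) ≤ x)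
    (T : ℚ) (xT : x * T ≡ 1ℚ) (size : ι M ≤ + 8 / 1 * (T * T) + + 8 / 1) where
    open Tilt x x>0 x≤
    open CharBound x x>0 x≤ M tail T xT size
    open Fourier p
    open FactorBound p
    open Law p using (P)

    Θ-large : + 16777216 / 1 ≤ Θ
    Θ-large = ≤-trans ≤! (*-mono {+ 256 / 1} ≤! T≥256 (≤! {0ℚ} {+ 65536 / 1}) (≤-trans ≤! (*-mono {+ 256 / 1} ≤! T≥256 (≤! {0ℚ} {+ 256 / 1}) T≥256)))

    floor-bounds : ∀ c → 0ℚ ≤ c → ∃ λ n → ι n ≤ c * Θ × c * Θ - 1ℚ ≤ ι n
    floor-bounds c c≥0 = rearrange (floor (c * Θ) (0≤* c≥0 Θ≥0))
      where
      rearrange : (∃ λ n → ι n ≤ c * Θ × c * Θ ≤ ι n + 1ℚ) → ∃ λ n → ι n ≤ c * Θ × c * Θ - 1ℚ ≤ ι n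
      rearrange (n , l , h) = n , l , le-by (≤⇒0≤ h) (lem (c * Θ) (ι n))
        where
        lem : ∀ a n → n ≡ a - 1ℚ + (n + 1ℚ - a)
        lem = solve-∀ ringℚ

    opaque
      -- Exponents for the three ranges of y, in units of Θ. As `g` bounds |φ| and not |φ|², the
      -- first two are half of what the ranges allow: 5.64 ≤ 4 · 1.429875 - 17/256 and 3.76 ≤ 4 ·
      -- 0.961 - 17/256. The third is a four-hundredth of 3.6.
      m₁ m₂ n₀ : ℕ
      m₁ = proj₁ (floor-bounds (+ 282 / 100) ≤!)
      m₂ = proj₁ (floor-bounds (+ 188 / 100) ≤!)
      n₀ = proj₁ (floor-bounds (+ 9 / 1000) ≤!)

      m₁≤ : ι m₁ ≤ + 282 / 100 * Θ
      m₁≤ = proj₁ (proj₂ (floor-bounds (+ 282 / 100) ≤!))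
      m₂≤ : ι m₂ ≤ + 188 / 100 * Θ
      m₂≤ = proj₁ (proj₂ (floor-bounds (+ 188 / 100) ≤!))
      n₀≤ : ι n₀ ≤ + 9 / 1000 * Θ
      n₀≤ = proj₁ (proj₂ (floor-bounds (+ 9 / 1000) ≤!))

      m₁≥ : + 28 / 10 * Θ ≤ ι m₁
      m₁≥ = ≤-trans (le-by (0≤+ (0≤* {+ 2 / 100} ≤! (≤⇒0≤ Θ-large)) (≤! {0ℚ} {+ 2 / 100 * (+ 16777216 / 1) - 1ℚ})) (l Θ)) (proj₂ (proj₂ (floor-bounds (+ 282 / 100) ≤!)))
        where
        l : ∀ t → + 282 / 100 * t - 1ℚ ≡ + 28 / 10 * t + (+ 2 / 100 * (t - + 16777216 / 1) + (+ 2 / 100 * (+ 16777216 / 1) - 1ℚ))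
        l = solve-∀ ringℚ
      m₂≥ : + 185 / 100 * Θ ≤ ι m₂
      m₂≥ = ≤-trans (le-by (0≤+ (0≤* {+ 3 / 100} ≤! (≤⇒0≤ Θ-large)) (≤! {0ℚ} {+ 3 / 100 * (+ 16777216 / 1) - 1ℚ})) (l Θ)) (proj₂ (proj₂ (floor-bounds (+ 188 / 100) ≤!)))
        where
        l : ∀ t → + 188 / 100 * t - 1ℚ ≡ + 185 / 100 * t + (+ 3 / 100 * (t - + 16777216 / 1) + (+ 3 / 100 * (+ 16777216 / 1) - 1ℚ))
        l = solve-∀ ringℚ
      n₀≥ : + 9 / 1000 * Θ - 1ℚ ≤ ι n₀
      n₀≥ = proj₂ (proj₂ (floor-bounds (+ 9 / 1000) ≤!))

    -- The product lam · s = 25y/2 reaches one at y = 2/25, where the second range begins; its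
    -- fourth power contributes s⁴, which makes the moments of that term small. `κ` bounds |φ| on
    -- the third range. The number e₀ is slightly larger than 1.28^(-5), and 1.28 is the value of v
    -- at T = 256.
    e₀ z v κ lam : ℚ
    e₀ = + 100 / 343
    z = + 256 / 1 * x
    v = 1ℚ + + 28 / 25600 * T
    κ = e₀ ^ 40 * z ^ 8
    lam = + 50 / 1 * (T * T)

    z≥0 : 0ℚ ≤ z
    z≥0 = 0≤* {+ 256 / 1} ≤! x≥0

    z≤1 : z ≤ 1ℚ
    z≤1 = ≤-trans (*-monoˡ (+ 256 / 1) ≤! x≤) ≤!

    κ≥0 : 0ℚ ≤ κ
    κ≥0 = 0≤* (0≤^ {e₀} ≤! 40) (0≤^ z≥0 8)

    ϑ : ℚ
    ϑ = (1ℚ - b₀) ^ n₀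

    ϑ≥0 : 0ℚ ≤ ϑ
    ϑ≥0 = 0≤^ (≤⇒0≤ b₀≤1) n₀

    v≤ : v ≤ 1ℚ + ι n₀ * b₀
    v≤ = +-monoʳ-≤ 1ℚ {+ 28 / 25600 * T} {ι n₀ * b₀} (≤-trans (le-by (0≤+ (0≤* {+ 8 / 256000} ≤! (≤⇒0≤ T≥256)) (0≤+ (0≤* {+ 1 / 8} ≤! (0≤* (≤⇒0≤ x≤) (0≤+ {b = + 1 / 256} x≥0 ≤!))) (≤! {0ℚ} {+ 8 / 1000 - + 1 / 8 * (+ 1 / 256 * (+ 1 / 256))})))
        (eq-by (0*diff (+ 9 / 8000 * T) (xx)) (l x T))) (*-monoʳ b₀ 0≤b₀ n₀≥))
      where
      xx : x * T * (x * T) ≡ 1ℚ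
      xx = cong₂ _*_ xT xT
      l : ∀ x T → (+ 9 / 1000 * (T * (T * T)) - 1ℚ) * (+ 1 / 8 * (x * x)) ≡ + 28 / 25600 * T +
        (+ 8 / 256000 * (T - + 256 / 1) + (+ 1 / 8 * ((+ 1 / 256 - x) * (x + + 1 / 256)) + (+ 8 / 1000 - + 1 / 8 * (+ 1 / 256 * (+ 1 / 256)))))
        + + 9 / 8000 * T * (x * T * (x * T) - 1ℚ)
      l = solve-∀ ringℚ

    -- At T = 256 this is 3.43 ≤ 1.28⁵ = 3.4359.... Expanded in powers of T - 256, the difference of
    -- both sides has positive coefficients only.
    v⁵ : + 343 / 100 * T ≤ + 256 / 1 * v ^ 5
    v⁵ = le-by (0≤+ {+ 14934592 / 9765625} ≤! (0≤* t (0≤+ {+ 2563253 / 7812500} ≤! (0≤* t (0≤+ {+ 12544 / 1953125} ≤! (0≤* t (0≤+ {+ 343 / 62500000} ≤! (0≤* t (0≤+ {+ 2401 / 1024000000000} ≤! (0≤* {+ 16807 / 41943040000000000} ≤! t))))))))))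
      (l T)
      where
      t : 0ℚ ≤ T - + 256 / 1
      t = ≤⇒0≤ T≥256
      l : ∀ T → + 256 / 1 * ((1ℚ + + 28 / 25600 * T) * ((1ℚ + + 28 / 25600 * T) * ((1ℚ + + 28 / 25600 * T) * ((1ℚ + + 28 / 25600 * T) * ((1ℚ + + 28 / 25600 * T) * 1ℚ))))) ≡
        + 343 / 100 * T + (+ 14934592 / 9765625 + (T - + 256 / 1) * (+ 2563253 / 7812500 + (T - + 256 / 1) * (+ 12544 / 1953125 + (T - + 256 / 1) * (+ 343 / 62500000 + (T - + 256 / 1) * (+ 2401 / 1024000000000 + + 16807 / 41943040000000000 * (T - + 256 / 1))))))
      l = solve-∀ ringℚ

    ϑ⁵ : ϑ ^ 5 ≤ e₀ * z
    ϑ⁵ = ≤-trans (le-by (0≤* (0≤* {+ 100 / 343} ≤! (0≤* (0≤^ ϑ≥0 5) x≥0)) (≤⇒0≤ v⁵)) (eq-by (0*diff (ϑ ^ 5) xT) (l (ϑ ^ 5) x T (v ^ 5))))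
      (≤-trans (*-monoˡ (e₀ * z) (0≤* {e₀} ≤! z≥0) (≤-trans (≤-reflexive (sym (*-^ ϑ v 5))) (^≤1 (0≤* ϑ≥0 v≥0) ϑv≤1 5))) (≤-reflexive (*-identityʳ (e₀ * z))))
      where
      v≥0 : 0ℚ ≤ v
      v≥0 = 0≤+ {1ℚ} ≤! (0≤* {+ 28 / 25600} ≤! T≥0)
      ϑv≤1 : ϑ * v ≤ 1ℚ
      ϑv≤1 = ≤-trans (*-monoˡ ϑ ϑ≥0 v≤) (inverse-bernoulli 0≤b₀ b₀≤1 n₀)
      l : ∀ ϑ x T v → + 100 / 343 * (+ 256 / 1 * x) * (ϑ * v) ≡ ϑ + + 100 / 343 * (ϑ * x) * (+ 256 / 1 * v - + 343 / 100 * T) + ϑ * (x * T - 1ℚ)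
      l = solve-∀ ringℚ

    opaque
      -- Of the eighty factors z ≤ 1 only sixteen are kept: κ is then a multiple of x⁸, which leaves
      -- x⁶ after the multiplication by H ≤ T²/7 in `κH`. The numerical smallness comes from the
      -- eighty factors e₀.
      ϑ⁴⁰⁰ : ϑ ^ 400 ≤ κ * κ
      ϑ⁴⁰⁰ = ≤-trans (≤-reflexive (^-*-^ ϑ 5 80)) (≤-trans (^-mono (0≤^ ϑ≥0 5) ϑ⁵ 80)
        (≤-trans (≤-reflexive (*-^ e₀ z 80)) (≤-trans (*-monoˡ (e₀ ^ 80) (0≤^ {e₀} ≤! 80) (^-antimono z≥0 z≤1 (ℕ.m≤m+n 16 64)))
          (≤-reflexive (trans (cong₂ _*_ (^-+ e₀ 40 40) (^-+ z 8 8)) (l (e₀ ^ 40) (z ^ 8)))))))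
        where
        l : ∀ a b → a * a * (b * b) ≡ a * b * (a * b)
        l = solve-∀ ringℚ

    g : ℚ → ℚ
    g s = (1ℚ - s) ^ m₁ + (lam * s) ^ 4 * (1ℚ - s) ^ m₂ + κ

    module _ (k : ℕ) where
      private
        A B C : ℚ
        A = cpt k ^ m₁
        B = (lam * spt k) ^ 4 * cpt k ^ m₂
        C = κ
        lam≥0 : 0ℚ ≤ lam * spt k
        lam≥0 = 0≤* (0≤* {+ 50 / 1} ≤! (0≤sq T)) (0≤spt k)
        A≥0 : 0ℚ ≤ A
        A≥0 = 0≤^ (0≤cpt k) m₁
        B≥0 : 0ℚ ≤ B
        B≥0 = 0≤* (0≤^ lam≥0 4) (0≤^ (0≤cpt k) m₂)
        square : ∀ {d} → 0ℚ ≤ d → d ≤ g (spt k) → d * d ≤ g (spt k) * g (spt k)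
        square h h′ = *-mono h h′ h h′
        half : ∀ {N m} → ι m + ι m ≤ ι N → cpt k ^ N ≤ cpt k ^ m * cpt k ^ m
        half {N} {m} h = ≤-trans (^-antimono (0≤cpt k) (le-by (0≤spt k) (l (spt k))) (ι-cancel (≤-trans (≤-reflexive (ι-+ m m)) h))) (≤-reflexive (^-+ (cpt k) m m))
          where
          l : ∀ s → 1ℚ ≡ 1ℚ - s + s
          l = solve-∀ ringℚ

      0≤g : 0ℚ ≤ g (spt k)
      0≤g = 0≤+ (0≤+ A≥0 B≥0) κ≥0

      private
        A≤g : A ≤ g (spt k)
        A≤g = le-by (0≤+ B≥0 κ≥0) (+-assoc A B C)
        B≤g : B ≤ g (spt k)
        B≤g = le-by (0≤+ A≥0 κ≥0) (l A B C)
          where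
          l : ∀ a b c → a + b + c ≡ b + (a + c)
          l = solve-∀ ringℚ
        C≤g : C ≤ g (spt k)
        C≤g = le-by (0≤+ A≥0 B≥0) (+-comm (A + B) C)

        range₁ : ∀ {w L′} → Rem (parts M) w L′ → y k ≤ + 2 / 25 → norm (φ (pt k) L′) ≤ g (spt k) * g (spt k)
        range₁ {w} {L′} rem h = finish (φ-near k rem (≤-trans (≤-reflexive (*-assoc (+ 4 / 1) (+ 1429875 / 1000000) Θ)) (*-monoˡ (+ 4 / 1) ≤! (near-sum (+ 2 / 25) (+ 134 / 100) (+ 719 / 10000) k h ≤! ≤! ≤! ≤! ≤!))))
          where
          finish : (∃ λ N → norm (φ (pt k) L′) ≤ cpt k ^ N × + 4 / 1 * (+ 1429875 / 1000000) * Θ - + 17 / 256 * Θ ≤ ι N) → norm (φ (pt k) L′) ≤ g (spt k) * g (spt k)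
          finish (N , le , big) = ≤-trans le (≤-trans (half {N} {m₁} (≤-trans (+-mono-≤ m₁≤ m₁≤) (≤-trans (le-by (0≤* {+ 4 / 1 * (+ 1429875 / 1000000) - + 17 / 256 - + 564 / 100} ≤! Θ≥0) (l Θ)) big))) (square A≥0 A≤g))
            where
            l : ∀ t → + 4 / 1 * (+ 1429875 / 1000000) * t - + 17 / 256 * t ≡ + 282 / 100 * t + + 282 / 100 * t + (+ 4 / 1 * (+ 1429875 / 1000000) - + 17 / 256 - + 564 / 100) * t
            l = solve-∀ ringℚ

        range₂ : ∀ {w L′} → Rem (parts M) w L′ → + 2 / 25 ≤ y k → y k ≤ ½ → norm (φ (pt k) L′) ≤ g (spt k) * g (spt k)
        range₂ {w} {L′} rem h₀ h = finish (φ-near k rem (≤-trans (≤-reflexive (*-assoc (+ 4 / 1) (+ 961 / 1000) Θ)) (*-monoˡ (+ 4 / 1) ≤! (near-sum ½ (+ 875 / 1000) (+ 688 / 10000) k h ≤! ≤! ≤! ≤! ≤!))))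
          where
          1≤lam : 1ℚ ≤ lam * spt k
          1≤lam = ≤-trans (*-monoˡ (+ 25 / 2) ≤! h₀) (≤-reflexive (l (spt k) T))
            where
            l : ∀ s T → + 25 / 2 * (+ 4 / 1 * s * (T * T)) ≡ + 50 / 1 * (T * T) * s
            l = solve-∀ ringℚ
          c≤B : cpt k ^ m₂ ≤ B
          c≤B = ≤-trans (≤-reflexive (sym (*-identityˡ (cpt k ^ m₂)))) (*-monoʳ (cpt k ^ m₂) (0≤^ (0≤cpt k) m₂) (^-mono {1ℚ} ≤! 1≤lam 4))
          finish : (∃ λ N → norm (φ (pt k) L′) ≤ cpt k ^ N × + 4 / 1 * (+ 961 / 1000) * Θ - + 17 / 256 * Θ ≤ ι N) → norm (φ (pt k) L′) ≤ g (spt k) * g (spt k)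
          finish (N , le , big) = ≤-trans le (≤-trans (half {N} {m₂} (≤-trans (+-mono-≤ m₂≤ m₂≤) (≤-trans (le-by (0≤* {+ 4 / 1 * (+ 961 / 1000) - + 17 / 256 - + 376 / 100} ≤! Θ≥0) (l Θ)) big))) (square (0≤^ (0≤cpt k) m₂) (≤-trans c≤B B≤g)))
            where
            l : ∀ t → + 4 / 1 * (+ 961 / 1000) * t - + 17 / 256 * t ≡ + 188 / 100 * t + + 188 / 100 * t + (+ 4 / 1 * (+ 961 / 1000) - + 17 / 256 - + 376 / 100) * t
            l = solve-∀ ringℚ

        range₃ : ∀ {w L′} → Rem (parts M) w L′ → ½ ≤ y k → norm (φ (pt k) L′) ≤ g (spt k) * g (spt k)
        range₃ {w} {L′} rem h = finish (φ-far k rem h)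
          where
          finish : (∃ λ N → norm (φ (pt k) L′) ≤ (1ℚ - b₀) ^ N × + 36 / 10 * Θ ≤ ι N) → norm (φ (pt k) L′) ≤ g (spt k) * g (spt k)
          finish (N , le , big) = ≤-trans le (≤-trans (≤-trans (^-antimono (≤⇒0≤ b₀≤1) (le-by 0≤b₀ (l b₀)) (ι-cancel {400 ℕ.* n₀} {N}
              (≤-trans (≤-trans (≤-reflexive (ι-* 400 n₀)) (≤-trans (*-monoˡ (ι 400) (0≤ι 400) n₀≤) (≤-reflexive (trans (cong (_* (+ 9 / 1000 * Θ)) (ιℤ-lit 400)) (l′ Θ))))) big)))
            (≤-trans (≤-reflexive (^-*-^ (1ℚ - b₀) n₀ 400)) ϑ⁴⁰⁰)) (square κ≥0 C≤g))
            where
            l : ∀ s → 1ℚ ≡ 1ℚ - s + s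
            l = solve-∀ ringℚ
            l′ : ∀ t → + 400 / 1 * (+ 9 / 1000 * t) ≡ + 36 / 10 * t
            l′ = solve-∀ ringℚ

      φ≤g : ∀ {w L′} → Rem (parts M) w L′ → norm (φ (pt k) L′) ≤ g (spt k) * g (spt k)
      φ≤g rem = [ range₁ rem , (λ h → [ range₂ rem h , range₃ rem ]′ (≤-total (y k) ½)) ]′ (≤-total (y k) (+ 2 / 25))

    M₂ M₄ : ℚ
    M₂ = + 4 / 1 * moment 1 m₁ + (+ 4 / 1 * lam ^ 4 * moment 5 m₂ + + 4 / 1 * κ * moment 1 0)
    M₄ = + 16 / 1 * moment 2 m₁ + (+ 16 / 1 * lam ^ 4 * moment 6 m₂ + + 16 / 1 * κ * moment 2 0)

    Mean-M₂ : Mean (λ k → g (spt k) * (+ 4 / 1 * spt k)) M₂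
    Mean-M₂ = Mean-cong (λ k → l (spt k) (cpt k ^ m₁) (cpt k ^ m₂) lam κ)
      (Mean-value (l₂ (moment 1 m₁) (moment 5 m₂) (moment 1 0) lam κ)
        (Mean-linear (+ 4 / 1) 1ℚ (Mean-moment 1 m₁) (Mean-linear (+ 4 / 1 * lam ^ 4) (+ 4 / 1 * κ) (Mean-moment 5 m₂) (Mean-moment 1 0))))
      where
      l : ∀ s A B lam κ → + 4 / 1 * (s * 1ℚ * A) + 1ℚ * (+ 4 / 1 * (lam * (lam * (lam * (lam * 1ℚ)))) * (s * (s * (s * (s * (s * 1ℚ)))) * B) + + 4 / 1 * κ * (s * 1ℚ * 1ℚ)) ≡
        (A + lam * s * (lam * s * (lam * s * (lam * s * 1ℚ))) * B + κ) * (+ 4 / 1 * s)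
      l = solve-∀ ringℚ
      l₂ : ∀ a b c lam κ → + 4 / 1 * a + 1ℚ * (+ 4 / 1 * (lam * (lam * (lam * (lam * 1ℚ)))) * b + + 4 / 1 * κ * c) ≡ + 4 / 1 * a + (+ 4 / 1 * (lam * (lam * (lam * (lam * 1ℚ)))) * b + + 4 / 1 * κ * c)
      l₂ = solve-∀ ringℚ

    Mean-M₄ : Mean (λ k → g (spt k) * (+ 16 / 1 * (spt k * spt k))) M₄
    Mean-M₄ = Mean-cong (λ k → l (spt k) (cpt k ^ m₁) (cpt k ^ m₂) lam κ)
      (Mean-value (l₂ (moment 2 m₁) (moment 6 m₂) (moment 2 0) lam κ)
        (Mean-linear (+ 16 / 1) 1ℚ (Mean-moment 2 m₁) (Mean-linear (+ 16 / 1 * lam ^ 4) (+ 16 / 1 * κ) (Mean-moment 6 m₂) (Mean-moment 2 0))))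
      where
      l : ∀ s A B lam κ → + 16 / 1 * (s * (s * 1ℚ) * A) + 1ℚ * (+ 16 / 1 * (lam * (lam * (lam * (lam * 1ℚ)))) * (s * (s * (s * (s * (s * (s * 1ℚ))))) * B) + + 16 / 1 * κ * (s * (s * 1ℚ) * 1ℚ)) ≡
        (A + lam * s * (lam * s * (lam * s * (lam * s * 1ℚ))) * B + κ) * (+ 16 / 1 * (s * s))
      l = solve-∀ ringℚ
      l₂ : ∀ a b c lam κ → + 16 / 1 * a + 1ℚ * (+ 16 / 1 * (lam * (lam * (lam * (lam * 1ℚ)))) * b + + 16 / 1 * κ * c) ≡ + 16 / 1 * a + (+ 16 / 1 * (lam * (lam * (lam * (lam * 1ℚ)))) * b + + 16 / 1 * κ * c)
      l₂ = solve-∀ ringℚ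

    4s≥0 : ∀ k → 0ℚ ≤ + 4 / 1 * spt k
    4s≥0 k = 0≤* {+ 4 / 1} ≤! (0≤spt k)

    16s²≥0 : ∀ k → 0ℚ ≤ + 16 / 1 * (spt k * spt k)
    16s²≥0 k = 0≤* {+ 16 / 1} ≤! (0≤sq (spt k))

    Δ²-bound : ∀ {w L′} → Rem (parts M) w L′ → ∀ m → Δ^ 2 (P L′) m ∈± M₂
    Δ²-bound {w} {L′} rem = difference-bound 2 L′ g (λ s → + 4 / 1 * s) 0≤g (λ k → φ≤g k rem) 4s≥0 (λ k → ≤-reflexive (l (spt k))) Mean-M₂
      where
      l : ∀ s → + 4 / 1 * s * (+ 4 / 1 * s * 1ℚ) ≡ + 4 / 1 * s * (+ 4 / 1 * s)
      l = solve-∀ ringℚ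

    Δ⁴-bound : ∀ {w L′} → Rem (parts M) w L′ → ∀ m → Δ^ 4 (P L′) m ∈± M₄
    Δ⁴-bound {w} {L′} rem = difference-bound 4 L′ g (λ s → + 16 / 1 * (s * s)) 0≤g (λ k → φ≤g k rem) 16s²≥0 (λ k → ≤-reflexive (l (spt k))) Mean-M₄
      where
      l : ∀ s → + 4 / 1 * s * (+ 4 / 1 * s * (+ 4 / 1 * s * (+ 4 / 1 * s * 1ℚ))) ≡ + 16 / 1 * (s * s) * (+ 16 / 1 * (s * s))
      l = solve-∀ ringℚ

    -- The odd moment is interpolated between the even ones by the inequality of the means.
    Δ³-bound : ∀ {w L′ τ τ′} → 0ℚ ≤ τ → 0ℚ ≤ τ′ → τ * τ′ ≡ 1ℚ → Rem (parts M) w L′ → ∀ m → Δ^ 3 (P L′) m ∈± ½ * τ * M₂ + ½ * τ′ * M₄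
    Δ³-bound {w} {L′} {τ} {τ′} τ≥0 τ′≥0 ττ′ rem = difference-bound 3 L′ g W 0≤g (λ k → φ≤g k rem)
      (λ k → 0≤+ (0≤* (0≤* {½} ≤! τ≥0) (4s≥0 k)) (0≤* (0≤* {½} ≤! τ′≥0) (16s²≥0 k)))
      (λ k → le-by (0≤sq (½ * (τ * (+ 4 / 1 * spt k) - τ′ * (+ 16 / 1 * (spt k * spt k))))) (eq-by (0*diff (+ 64 / 1 * (spt k * (spt k * spt k))) ττ′) (l (spt k) τ τ′)))
      (Mean-cong (λ k → l₂ (g (spt k)) (½ * τ) (½ * τ′) (+ 4 / 1 * spt k) (+ 16 / 1 * (spt k * spt k))) (Mean-linear (½ * τ) (½ * τ′) Mean-M₂ Mean-M₄))
      where
      W : ℚ → ℚ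
      W s = ½ * τ * (+ 4 / 1 * s) + ½ * τ′ * (+ 16 / 1 * (s * s))
      l : ∀ s τ τ′ → (½ * τ * (+ 4 / 1 * s) + ½ * τ′ * (+ 16 / 1 * (s * s))) * (½ * τ * (+ 4 / 1 * s) + ½ * τ′ * (+ 16 / 1 * (s * s))) ≡
        + 4 / 1 * s * (+ 4 / 1 * s * (+ 4 / 1 * s * 1ℚ)) + ½ * (τ * (+ 4 / 1 * s) - τ′ * (+ 16 / 1 * (s * s))) * (½ * (τ * (+ 4 / 1 * s) - τ′ * (+ 16 / 1 * (s * s)))) + + 64 / 1 * (s * (s * s)) * (τ * τ′ - 1ℚ)
      l = solve-∀ ringℚ
      l₂ : ∀ g a b u v → a * (g * u) + b * (g * v) ≡ g * (a * u + b * v)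
      l₂ = solve-∀ ringℚ

  -- Numerical bounds for the means of the majorant

  module MajorantBounds (x : ℚ) (x>0 : 0ℚ < x) (x≤ : x ≤ + 1 / 256) (M : ℕ)
    (tail : (1ℚ - x) ^ M * ((1ℚ + ι M) * (1ℚ + ι M) + 2ℚ) ≤ x)
    (T : ℚ) (xT : x * T ≡ 1ℚ) (size : ι M ≤ + 8 / 1 * (T * T) + + 8 / 1)
    (H : ℚ) (H≥0 : 0ℚ ≤ H) (HH : H * H ≤ + 522 / 100 * (T * (T * T))) where
    open Tilt x x>0 x≤
    open CharBound x x>0 x≤ M tail T xT size
    open Majorant x x>0 x≤ M tail T xT size

    X : ℚ
    X = x * (x * x)

    X≥0 : 0ℚ ≤ X
    X≥0 = 0≤* x≥0 (0≤sq x)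

    XΘ : X * Θ ≡ 1ℚ
    XΘ = trans (l x T) (cong₂ _*_ xT (cong₂ _*_ xT xT))
      where
      l : ∀ x T → x * (x * x) * (T * (T * T)) ≡ x * T * (x * T * (x * T))
      l = solve-∀ ringℚ

    -- By Wallis, the square of `moment 0 m` is at most 0.3279/m, while H² ≤ 5.22 Θ; in the product
    -- Θ cancels against m ≥ c Θ. The comparison is made between squares.
    moment-0-scaled : ∀ m c β → 0ℚ < c → 0ℚ ≤ β → c * Θ ≤ ι m → 8 ℕ.≤ m → + 522 / 100 * (+ 3279 / 10000) ≤ c * (β * β) → moment 0 m * H ≤ β
    moment-0-scaled m c β c>0 β≥0 hm 8≤m hβ = sq-cancel β≥0 (*-cancelˡ c c>0 (≤-trans (≤-reflexive (l₁ c b H))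
      (≤-trans (*-monoˡ (c * (b * b)) (0≤* (<⇒≤ c>0) (0≤sq b)) HH) (≤-trans (≤-reflexive (l₂ c b Θ))
      (≤-trans (*-monoˡ (+ 522 / 100 * (b * b)) (0≤* {+ 522 / 100} ≤! (0≤sq b)) hm) (≤-trans (≤-reflexive (l₃ b (ι m)))
      (≤-trans (*-monoˡ (+ 522 / 100) ≤! (moment-0-upper m 8≤m)) hβ)))))))
      where
      b = moment 0 m
      l₁ : ∀ c b H → c * (b * H * (b * H)) ≡ c * (b * b) * (H * H)
      l₁ = solve-∀ ringℚ
      l₂ : ∀ c b t → c * (b * b) * (+ 522 / 100 * t) ≡ + 522 / 100 * (b * b) * (c * t)
      l₂ = solve-∀ ringℚ
      l₃ : ∀ b m → + 522 / 100 * (b * b) * m ≡ + 522 / 100 * (m * (b * b))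
      l₃ = solve-∀ ringℚ

    moment-scaled : ∀ a m d β C → 0ℚ < d → d * Θ ≤ 2ℚ * ι m → moment 0 m * H ≤ β → oddFactorial a * β ≤ C * d ^ a → moment a m * H ≤ C * X ^ a
    moment-scaled a m d β C d>0 hd hb hC = *-cancelˡ (d ^ a) (0<^ d>0 a) (≤-trans (≤-reflexive step₁)
      (≤-trans (*-monoˡ (X ^ a) (0≤^ X≥0 a) (≤-trans (*-monoʳ H H≥0 (moment-upper a m (0≤* (<⇒≤ d>0) Θ≥0) hd))
        (≤-trans (≤-reflexive (*-assoc (oddFactorial a) (moment 0 m) H)) (≤-trans (*-monoˡ (oddFactorial a) (0≤oddFactorial a) hb) hC))))
      (≤-reflexive (l₂ (X ^ a) C (d ^ a)))))
      where
      l₂ : ∀ X C d → X * (C * d) ≡ d * (C * X)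
      l₂ = solve-∀ ringℚ
      l₁ : ∀ X d t m H → X * (d * t * m * H) ≡ X * t * (d * (m * H))
      l₁ = solve-∀ ringℚ
      step₁ : d ^ a * (moment a m * H) ≡ X ^ a * ((d * Θ) ^ a * moment a m * H)
      step₁ = sym (trans (cong (λ e → X ^ a * (e * moment a m * H)) (*-^ d Θ a)) (trans (l₁ (X ^ a) (d ^ a) (Θ ^ a) (moment a m) H)
        (trans (cong (λ e → e * (d ^ a * (moment a m * H))) (trans (sym (*-^ X Θ a)) (trans (cong (_^ a) XΘ) (1^ a)))) (*-identityˡ _))))

    private
      8≤ : ∀ {c n} → + 8 / 1 ≤ c * (+ 16777216 / 1) → 0ℚ ≤ c → c * Θ ≤ ι n → 8 ℕ.≤ n
      8≤ {c} h c≥0 h′ = ι-cancel (≤-trans (≤-reflexive (ιℤ-lit 8)) (≤-trans h (≤-trans (*-monoˡ c c≥0 Θ-large) h′)))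
      double : ∀ c n → c * Θ ≤ ι n → 2ℚ * c * Θ ≤ 2ℚ * ι n
      double c n h = ≤-trans (≤-reflexive (*-assoc 2ℚ c Θ)) (*-monoˡ 2ℚ ≤! h)

    b₁H : moment 0 m₁ * H ≤ + 79 / 100
    b₁H = moment-0-scaled m₁ (+ 28 / 10) (+ 79 / 100) <! ≤! m₁≥ (8≤ {+ 28 / 10} ≤! ≤! m₁≥) ≤!

    b₂H : moment 0 m₂ * H ≤ + 97 / 100
    b₂H = moment-0-scaled m₂ (+ 185 / 100) (+ 97 / 100) <! ≤! m₂≥ (8≤ {+ 185 / 100} ≤! ≤! m₂≥) ≤!

    -- The factor 7 is possible since 49 · 5.22 = 255.78 and T ≥ 256.
    7H≤T² : + 7 / 1 * H ≤ T * T
    7H≤T² = sq-cancel (0≤sq T) (≤-trans (≤-reflexive (l₁ H)) (≤-trans (*-monoˡ (+ 49 / 1) ≤! HH)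
      (le-by (0≤* Θ≥0 (0≤+ (≤⇒0≤ T≥256) (≤! {0ℚ} {+ 22 / 100}))) (l₂ T))))
      where
      l₁ : ∀ H → + 7 / 1 * H * (+ 7 / 1 * H) ≡ + 49 / 1 * (H * H)
      l₁ = solve-∀ ringℚ
      l₂ : ∀ T → T * T * (T * T) ≡ + 49 / 1 * (+ 522 / 100 * (T * (T * T))) + T * (T * T) * (T - + 256 / 1 + + 22 / 100)
      l₂ = solve-∀ ringℚ

    κH : κ * H ≤ + 11 / 10000 * (X * X)
    κH = *-cancelˡ (+ 7 / 1) <! (≤-trans (≤-reflexive (l₁ κ H)) (≤-trans (*-monoˡ κ κ≥0 7H≤T²)
      (≤-trans (≤-reflexive step) (≤-trans (*-monoʳ (X * X) (0≤* X≥0 X≥0) (≤! {e₀ ^ 40 * (+ 256 / 1) ^ 8} {+ 77 / 10000})) (≤-reflexive (l₃ (X * X)))))))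
      where
      l₁ : ∀ k H → + 7 / 1 * (k * H) ≡ k * (+ 7 / 1 * H)
      l₁ = solve-∀ ringℚ
      l₃ : ∀ X → + 77 / 10000 * X ≡ + 7 / 1 * (+ 11 / 10000 * X)
      l₃ = solve-∀ ringℚ
      l₂ : ∀ e c x T → e * (c * (x * (x * (x * (x * (x * (x * (x * (x * 1ℚ))))))))) * (T * T) ≡ e * c * (x * (x * x) * (x * (x * x))) * (x * T * (x * T))
      l₂ = solve-∀ ringℚ
      step : κ * (T * T) ≡ e₀ ^ 40 * (+ 256 / 1) ^ 8 * (X * X)
      step = trans (cong (λ e → e₀ ^ 40 * e * (T * T)) (*-^ (+ 256 / 1) x 8)) (trans (l₂ (e₀ ^ 40) ((+ 256 / 1) ^ 8) x T)
        (trans (cong (λ e → e₀ ^ 40 * (+ 256 / 1) ^ 8 * (X * X) * (e * e)) xT) (*-identityʳ _)))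

    lamX : (lam * X) ^ 4 ≤ (+ 50 / 256) ^ 4
    lamX = ^-mono (0≤* (0≤* {+ 50 / 1} ≤! (0≤sq T)) X≥0) (≤-trans (≤-reflexive (trans (l x T) (cong (λ e → + 50 / 1 * x * (e * e)) xT))) (≤-trans (≤-reflexive (*-identityʳ _)) (*-monoˡ (+ 50 / 1) ≤! x≤))) 4
      where
      l : ∀ x T → + 50 / 1 * (T * T) * (x * (x * x)) ≡ + 50 / 1 * x * (x * T * (x * T))
      l = solve-∀ ringℚ

    -- Each of the four factors `lam` meets one extra power of X, and lam · X = 50x ≤ 50/256. The
    -- second term of `g` is thus a small correction of the same order in X as the first.
    lam-moment : ∀ a m C → 0ℚ ≤ C → moment (4 ℕ.+ a) m * H ≤ C * X ^ (4 ℕ.+ a) → lam ^ 4 * (moment (4 ℕ.+ a) m * H) ≤ (+ 50 / 256) ^ 4 * C * X ^ a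
    lam-moment a m C C≥0 h = ≤-trans (*-monoˡ (lam ^ 4) (0≤^ (0≤* {+ 50 / 1} ≤! (0≤sq T)) 4) h)
      (≤-trans (≤-reflexive (trans (cong (λ e → lam ^ 4 * (C * e)) (^-+ X 4 a)) (trans (l (lam ^ 4) C (X ^ 4) (X ^ a)) (cong (λ e → e * (C * X ^ a)) (sym (*-^ lam X 4))))))
      (≤-trans (*-monoʳ (C * X ^ a) (0≤* C≥0 (0≤^ X≥0 a)) lamX) (≤-reflexive (sym (*-assoc ((+ 50 / 256) ^ 4) C (X ^ a))))))
      where
      l : ∀ a C b c → a * (C * (b * c)) ≡ a * b * (C * c)
      l = solve-∀ ringℚ

    X≤1 : X ≤ + 1 / 16777216
    X≤1 = ≤-trans (*-mono x≥0 x≤ (0≤sq x) (*-mono x≥0 x≤ x≥0 x≤)) ≤!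

    M₂H : M₂ * H ≤ + 573 / 1000 * X
    M₂H = ≤-trans (≤-reflexive (l (moment 1 m₁) (lam ^ 4) (moment 5 m₂) κ H))
      (≤-trans (+-mono-≤ (*-monoˡ (+ 4 / 1) ≤! (moment-scaled 1 m₁ (+ 56 / 10) (+ 79 / 100) (+ 14108 / 100000) <! (double (+ 28 / 10) m₁ m₁≥) b₁H ≤!))
        (+-mono-≤ (*-monoˡ (+ 4 / 1) ≤! (lam-moment 1 m₂ (+ 1323 / 1000) ≤! (moment-scaled 5 m₂ (+ 37 / 10) (+ 97 / 100) (+ 1323 / 1000) <! (double (+ 185 / 100) m₂ m₂≥) b₂H ≤!)))
          (*-monoˡ 2ℚ ≤! κH)))
        (le-by (0≤+ (0≤* {+ 22 / 10000} ≤! (0≤* X≥0 (≤⇒0≤ X≤1))) (0≤* {k} ≤! X≥0)) (l′ X)))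
      where
      k : ℚ
      k = + 573 / 1000 - + 22 / 10000 * (+ 1 / 16777216) - + 4 / 1 * (+ 14108 / 100000) - + 4 / 1 * ((+ 50 / 256) ^ 4 * (+ 1323 / 1000))
      l : ∀ a L b κ H → (+ 4 / 1 * a + (+ 4 / 1 * L * b + + 4 / 1 * κ * ½)) * H ≡ + 4 / 1 * (a * H) + (+ 4 / 1 * (L * (b * H)) + 2ℚ * (κ * H))
      l = solve-∀ ringℚ
      l′ : ∀ X → + 573 / 1000 * X ≡ + 4 / 1 * (+ 14108 / 100000 * (X * 1ℚ)) + (+ 4 / 1 * ((+ 50 / 256 * (+ 50 / 256 * (+ 50 / 256 * (+ 50 / 256 * 1ℚ)))) * (+ 1323 / 1000) * (X * 1ℚ)) + 2ℚ * (+ 11 / 10000 * (X * X)))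
        + (+ 22 / 10000 * (X * (+ 1 / 16777216 - X)) + (+ 573 / 1000 - + 22 / 10000 * (+ 1 / 16777216) - + 4 / 1 * (+ 14108 / 100000) - + 4 / 1 * ((+ 50 / 256 * (+ 50 / 256 * (+ 50 / 256 * (+ 50 / 256 * 1ℚ)))) * (+ 1323 / 1000))) * X)
      l′ = solve-∀ ringℚ

    M₄H : M₄ * H ≤ + 131 / 100 * (X * X)
    M₄H = ≤-trans (≤-reflexive (l (moment 2 m₁) (lam ^ 4) (moment 6 m₂) κ H))
      (≤-trans (+-mono-≤ (*-monoˡ (+ 16 / 1) ≤! (moment-scaled 2 m₁ (+ 56 / 10) (+ 79 / 100) (+ 7558 / 100000) <! (double (+ 28 / 10) m₁ m₁≥) b₁H ≤!))
        (+-mono-≤ (*-monoˡ (+ 16 / 1) ≤! (lam-moment 2 m₂ (+ 3931 / 1000) ≤! (moment-scaled 6 m₂ (+ 37 / 10) (+ 97 / 100) (+ 3931 / 1000) <! (double (+ 185 / 100) m₂ m₂≥) b₂H ≤!)))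
          (*-monoˡ (+ 6 / 1) ≤! κH)))
        (le-by (0≤* {k} ≤! (0≤* X≥0 X≥0)) (l′ X)))
      where
      k : ℚ
      k = + 131 / 100 - + 66 / 10000 - + 16 / 1 * (+ 7558 / 100000) - + 16 / 1 * ((+ 50 / 256) ^ 4 * (+ 3931 / 1000))
      l : ∀ a L b κ H → (+ 16 / 1 * a + (+ 16 / 1 * L * b + + 16 / 1 * κ * (+ 3 / 8))) * H ≡ + 16 / 1 * (a * H) + (+ 16 / 1 * (L * (b * H)) + + 6 / 1 * (κ * H))
      l = solve-∀ ringℚ
      l′ : ∀ X → + 131 / 100 * (X * X) ≡ + 16 / 1 * (+ 7558 / 100000 * (X * (X * 1ℚ))) + (+ 16 / 1 * ((+ 50 / 256 * (+ 50 / 256 * (+ 50 / 256 * (+ 50 / 256 * 1ℚ)))) * (+ 3931 / 1000) * (X * (X * 1ℚ))) + + 6 / 1 * (+ 11 / 10000 * (X * X)))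
        + (+ 131 / 100 - + 66 / 10000 - + 16 / 1 * (+ 7558 / 100000) - + 16 / 1 * ((+ 50 / 256 * (+ 50 / 256 * (+ 50 / 256 * (+ 50 / 256 * 1ℚ)))) * (+ 3931 / 1000))) * (X * X)
      l′ = solve-∀ ringℚ

  -- A window around the centre: A - (s - ν)² is dominated by Σ_{|i| ≤ N} (A - i²) [s = ν + i].
  module Window (p : ℕ → ℚ) (0≤p : ∀ j → 0ℚ ≤ p j) (p≤1 : ∀ j → p j ≤ 1ℚ) (L : List ℕ) (ν : ℤ) (A : ℚ) where
    open Law p

    0≤δ : ∀ m s → 0ℚ ≤ δ m s
    0≤δ m s with s ℤ.≟ m
    ... | yes _ = ≤!
    ... | no  _ = ≤!

    δ≤1 : ∀ m s → δ m s ≤ 1ℚ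
    δ≤1 m s with s ℤ.≟ m
    ... | yes _ = ≤!
    ... | no  _ = ≤!

    δ-refl : ∀ m → δ m m ≡ 1ℚ
    δ-refl m with m ℤ.≟ m
    ... | yes _ = refl
    ... | no ¬p = contradiction refl ¬p

    E-0 : ∀ L → E L (λ _ → 0ℚ) ≡ 0ℚ
    E-0 []      = refl
    E-0 (j ∷ L) = trans (cong (λ e → (1ℚ - p j) * e + p j * e) (E-0 L)) (l (p j))
      where
      l : ∀ p → (1ℚ - p) * 0ℚ + p * 0ℚ ≡ 0ℚ
      l = solve-∀ ringℚ

    0≤P : ∀ m → 0ℚ ≤ P L m
    0≤P m = subst (_≤ P L m) (E-0 L) (E-mono 0≤p p≤1 L (0≤δ m))

    P≤1 : ∀ m → P L m ≤ 1ℚ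
    P≤1 m = subst (P L m ≤_) (E-1 L) (E-mono 0≤p p≤1 L (δ≤1 m))

    W : ℕ → ℤ → ℚ
    W zero    s = A * δ ν s
    W (suc N) s = 1ℚ * W N s + (A - ι (suc N) * ι (suc N)) * (1ℚ * δ (ν ℤ.+ + suc N) s + 1ℚ * δ (ν ℤ.- + suc N) s)

    U : ℕ → ℚ
    U zero    = A * P L ν
    U (suc N) = U N + (A - ι (suc N) * ι (suc N)) * (P L (ν ℤ.+ + suc N) + P L (ν ℤ.- + suc N))

    E-W : ∀ N → E L (W N) ≡ U N
    E-W zero    = trans (E-cong L λ s → l A (δ ν s)) (trans (E-linear L A 0ℚ (δ ν) (λ _ → 0ℚ)) (l′ A (P L ν) (E L (λ _ → 0ℚ))))
      where
      l : ∀ a b → a * b ≡ a * b + 0ℚ * 0ℚ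
      l = solve-∀ ringℚ
      l′ : ∀ a b c → a * b + 0ℚ * c ≡ a * b
      l′ = solve-∀ ringℚ
    E-W (suc N) = trans (E-linear L 1ℚ (A - ι (suc N) * ι (suc N)) (W N) _)
      (trans (cong₂ (λ a b → 1ℚ * a + (A - ι (suc N) * ι (suc N)) * b) (E-W N) (E-linear L 1ℚ 1ℚ (δ (ν ℤ.+ + suc N)) (δ (ν ℤ.- + suc N))))
        (l (U N) (A - ι (suc N) * ι (suc N)) (P L (ν ℤ.+ + suc N)) (P L (ν ℤ.- + suc N))))
      where
      l : ∀ u a b c → 1ℚ * u + a * (1ℚ * b + 1ℚ * c) ≡ u + a * (b + c)
      l = solve-∀ ringℚ

    module _ (H : ℕ) (AH : A ≡ ι H * ι H) where

      0≤coef : ∀ {N} → N ℕ.≤ H → 0ℚ ≤ A - ι N * ι N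
      0≤coef {N} h = ≤⇒0≤ (≤-trans (*-mono (0≤ι N) (ι-mono h) (0≤ι N) (ι-mono h)) (≤-reflexive (sym AH)))

      0≤A : 0ℚ ≤ A
      0≤A = subst (0ℚ ≤_) (sym AH) (0≤sq (ι H))

      0≤pair : ∀ N s → 0ℚ ≤ 1ℚ * δ (ν ℤ.+ + suc N) s + 1ℚ * δ (ν ℤ.- + suc N) s
      0≤pair N s = 0≤+ (0≤* {1ℚ} ≤! (0≤δ (ν ℤ.+ + suc N) s)) (0≤* {1ℚ} ≤! (0≤δ (ν ℤ.- + suc N) s))

      0≤W : ∀ N s → N ℕ.≤ H → 0ℚ ≤ W N s
      0≤W zero    s h = 0≤* 0≤A (0≤δ ν s)
      0≤W (suc N) s h = 0≤+ (0≤* {1ℚ} ≤! (0≤W N s (ℕ.<⇒≤ h))) (0≤* (0≤coef h) (0≤pair N s))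

      inside : ∀ N s t → s ≡ ν ℤ.+ t → ℤ.∣ t ∣ ℕ.≤ N → N ℕ.≤ H → A - ιℤ t * ιℤ t ≤ W N s
      inside zero s (+ zero) e h h′ = ≤-reflexive (trans (cong (λ i → A - i * i) ιℤ-0) (trans (l A) (cong (A *_) (sym (trans (cong (δ ν) (trans e (ℤ.+-identityʳ ν))) (δ-refl ν))))))
        where
        l : ∀ a → a - 0ℚ * 0ℚ ≡ a * 1ℚ
        l = solve-∀ ringℚ
      inside (suc N) s t e h h′ with ℕ.m≤n⇒m<n∨m≡n h
      ... | inj₁ (ℕ.s≤s h″) = ≤-trans (inside N s t e h″ (ℕ.<⇒≤ h′)) (le-by (0≤* (0≤coef h′) (0≤pair N s)) (cong (_+ (A - ι (suc N) * ι (suc N)) * (1ℚ * δ (ν ℤ.+ + suc N) s + 1ℚ * δ (ν ℤ.- + suc N) s)) (*-identityˡ (W N s))))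
      inside (suc N) s (+ .(suc N)) e h h′ | inj₂ refl = le-by (0≤+ (0≤W N s (ℕ.<⇒≤ h′)) (0≤* (0≤coef h′) (0≤δ (ν ℤ.- + suc N) s)))
        (trans (cong (λ d → 1ℚ * W N s + (A - ι (suc N) * ι (suc N)) * (1ℚ * d + 1ℚ * δ (ν ℤ.- + suc N) s)) (trans (cong (δ (ν ℤ.+ + suc N)) e) (δ-refl (ν ℤ.+ + suc N)))) (l (W N s) (A - ι (suc N) * ι (suc N)) (δ (ν ℤ.- + suc N) s)))
        where
        l : ∀ w a d → 1ℚ * w + a * (1ℚ * 1ℚ + 1ℚ * d) ≡ a + (w + a * d)
        l = solve-∀ ringℚ
      inside (suc N) s -[1+ .N ] e h h′ | inj₂ refl = ≤-trans (≤-reflexive (cong (λ i → A - i) (trans (cong₂ _*_ (ιℤ-neg (+ suc N)) (ιℤ-neg (+ suc N))) (neg² (ι (suc N))))))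
        (le-by (0≤+ (0≤W N s (ℕ.<⇒≤ h′)) (0≤* (0≤coef h′) (0≤δ (ν ℤ.+ + suc N) s)))
        (trans (cong (λ d → 1ℚ * W N s + (A - ι (suc N) * ι (suc N)) * (1ℚ * δ (ν ℤ.+ + suc N) s + 1ℚ * d)) (trans (cong (δ (ν ℤ.- + suc N)) e) (δ-refl (ν ℤ.- + suc N)))) (l (W N s) (A - ι (suc N) * ι (suc N)) (δ (ν ℤ.+ + suc N) s))))
        where
        l : ∀ w a d → 1ℚ * w + a * (1ℚ * d + 1ℚ * 1ℚ) ≡ a + (w + a * d)
        l = solve-∀ ringℚ
        neg² : ∀ a → - a * - a ≡ a * a
        neg² = solve-∀ ringℚ

      outside : ∀ t → H ℕ.≤ ℤ.∣ t ∣ → A - ιℤ t * ιℤ t ≤ 0ℚ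
      outside t h = le-by (≤⇒0≤ (≤-trans (≤-reflexive AH) (≤-trans (*-mono (0≤ι H) (ι-mono h) (0≤ι H) (ι-mono h)) (≤-reflexive (abs t))))) (l A (ιℤ t * ιℤ t))
        where
        l : ∀ a b → 0ℚ ≡ a - b + (b - a)
        l = solve-∀ ringℚ
        neg² : ∀ a → a * a ≡ - a * - a
        neg² = solve-∀ ringℚ
        abs : ∀ t → ι ℤ.∣ t ∣ * ι ℤ.∣ t ∣ ≡ ιℤ t * ιℤ t
        abs (+ n)    = refl
        abs -[1+ n ] = trans (neg² (ι (suc n))) (sym (cong₂ _*_ (ιℤ-neg (+ suc n)) (ιℤ-neg (+ suc n))))

      pointwise : ∀ s → A - (ιℤ s - ιℤ ν) * (ιℤ s - ιℤ ν) ≤ W H s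
      pointwise s = ≤-trans (≤-reflexive (cong (λ e → A - e * e) (sym (ιℤ-- s ν)))) ([ (λ h → inside H s (s ℤ.- ν) eq h ℕ.≤-refl) , (λ h → ≤-trans (outside (s ℤ.- ν) h) (0≤W H s ℕ.≤-refl)) ]′ (ℕ.≤-total ℤ.∣ s ℤ.- ν ∣ H))
        where
        eq : s ≡ ν ℤ.+ (s ℤ.- ν)
        eq = sym (trans (ℤ.+-comm ν (s ℤ.- ν)) (trans (ℤ.+-assoc s (ℤ.- ν) ν) (trans (cong (λ e → s ℤ.+ e) (ℤ.+-inverseˡ ν)) (ℤ.+-identityʳ s))))

      window : A - (V L + (μ L - ιℤ ν) * (μ L - ιℤ ν)) ≤ U H
      window = ≤-trans (≤-reflexive (sym expectation)) (≤-trans (E-mono 0≤p p≤1 L pointwise) (≤-reflexive (E-W H)))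
        where
        expectation : E L (λ s → A - (ιℤ s - ιℤ ν) * (ιℤ s - ιℤ ν)) ≡ A - (V L + (μ L - ιℤ ν) * (μ L - ιℤ ν))
        expectation = trans (E-cong L λ s → l A ((ιℤ s - ιℤ ν) * (ιℤ s - ιℤ ν))) (trans (E-linear L A (- 1ℚ) (λ _ → 1ℚ) _)
          (trans (cong₂ (λ a b → A * a + (- 1ℚ) * b) (E-1 L) (E-variance L (ιℤ ν))) (sym (l A _))))
          where
          l : ∀ a b → a - b ≡ a * 1ℚ + (- 1ℚ) * b
          l = solve-∀ ringℚ

  -- Sequences with (V + i + 1) Q (i + 1) ≤ V Q i + E lie below 8V² Q i ≤ Q 0 (8V² - 4V i² + i⁴) + 8V E i,
  -- a Taylor polynomial of exp (- i²/2V) plus a linear error.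
  profile : ℚ → ℚ → ℚ
  profile V i = (i * i - 2ℚ * V) * (i * i - 2ℚ * V) + + 4 / 1 * (V * V)

  -- Over the positive integers j⁵ - 3j⁴ is negative only for j = 1, 2, and its minimum is -16, at j
  -- = 2.
  quintic : ∀ n → 0ℚ ≤ ι (suc n) * (ι (suc n) * ι (suc n)) * (ι (suc n) * (ι (suc n) - + 3 / 1)) + + 16 / 1
  quintic 0 = subst (λ e → 0ℚ ≤ e * (e * e) * (e * (e - + 3 / 1)) + + 16 / 1) (sym (ιℤ-lit 1)) ≤!
  quintic 1 = subst (λ e → 0ℚ ≤ e * (e * e) * (e * (e - + 3 / 1)) + + 16 / 1) (sym (ιℤ-lit 2)) ≤!
  quintic (suc (suc n)) = 0≤+ {b = + 16 / 1} (0≤* (0≤* j (0≤* j j)) (0≤* j (≤⇒0≤ (≤-trans (≤-reflexive (sym (ιℤ-lit 3))) (ι-mono (ℕ.s≤s (ℕ.s≤s (ℕ.s≤s (ℕ.z≤n {n}))))))))) ≤!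
    where
    j = 0≤ι (suc (suc (suc n)))

  -- The profile falls no faster than a solution of (V + i + 1) Q(i + 1) = V Q(i), so it remains an
  -- upper barrier for such solutions.
  profile-step : ∀ V n → + 4 / 1 ≤ V → V * profile V (ι n) ≤ (V + ι (suc n)) * profile V (ι (suc n))
  profile-step V n V≥4 = ≤-trans (≤-reflexive (cong (λ e → V * profile V e) (l₀ (ι n) (ι (suc n)) (ι-suc n))))
    (le-by (0≤+ (0≤+ (0≤+ (quintic n) (0≤* {+ 3 / 1} ≤! (0≤sq (j * j - V)))) (0≤* V≥0 (0≤+ (0≤+ (≤⇒0≤ V≥4) (0≤* {+ 4 / 1} ≤! (≤⇒0≤ (1≤ι n)))) (≤! {0ℚ} {+ 3 / 1})))) (0≤* {+ 4 / 1} ≤! (≤⇒0≤ V≥4)))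
      (l V j))
    where
    j = ι (suc n)
    V≥0 : 0ℚ ≤ V
    V≥0 = ≤-trans ≤! V≥4
    l₀ : ∀ a b → b ≡ 1ℚ + a → a ≡ b - 1ℚ
    l₀ a .(1ℚ + a) refl = l′ a
      where
      l′ : ∀ a → a ≡ 1ℚ + a - 1ℚ
      l′ = solve-∀ ringℚ
    l : ∀ V j → (V + j) * ((j * j - 2ℚ * V) * (j * j - 2ℚ * V) + + 4 / 1 * (V * V)) ≡
      V * (((j - 1ℚ) * (j - 1ℚ) - 2ℚ * V) * ((j - 1ℚ) * (j - 1ℚ) - 2ℚ * V) + + 4 / 1 * (V * V)) +
      (j * (j * j) * (j * (j - + 3 / 1)) + + 16 / 1 + + 3 / 1 * ((j * j - V) * (j * j - V)) + V * (V - + 4 / 1 + + 4 / 1 * (j - 1ℚ) + + 3 / 1) + + 4 / 1 * (V - + 4 / 1))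
    l = solve-∀ ringℚ

  below-profile : ∀ {V E} (Q : ℕ → ℚ) → + 4 / 1 ≤ V → 0ℚ ≤ E → 0ℚ ≤ Q 0 → (∀ i → (V + ι (suc i)) * Q (suc i) ≤ V * Q i + E) →
    ∀ i → + 8 / 1 * (V * V) * Q i ≤ Q 0 * profile V (ι i) + + 8 / 1 * (V * E) * ι i
  below-profile {V} {E} Q V≥4 E≥0 Q≥0 step zero = ≤-reflexive (trans (l V E (Q 0)) (sym (cong (λ e → Q 0 * profile V e + + 8 / 1 * (V * E) * e) ιℤ-0)))
    where
    l : ∀ V E Q → + 8 / 1 * (V * V) * Q ≡ Q * ((0ℚ * 0ℚ - 2ℚ * V) * (0ℚ * 0ℚ - 2ℚ * V) + + 4 / 1 * (V * V)) + + 8 / 1 * (V * E) * 0ℚ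
    l = solve-∀ ringℚ
  below-profile {V} {E} Q V≥4 E≥0 Q≥0 step (suc i) = *-cancelˡ (V + ι (suc i)) (<-≤-trans {0ℚ} {+ 4 / 1} <! (≤-trans V≥4 (le-by (0≤ι (suc i)) refl)))
    (le-by (0≤+ (0≤+ (0≤* (0≤* {+ 8 / 1} ≤! (0≤sq V)) (≤⇒0≤ (step i))) (0≤* V≥0 (≤⇒0≤ (below-profile Q V≥4 E≥0 Q≥0 step i)))) (0≤+ (0≤* Q≥0 (≤⇒0≤ (profile-step V i V≥4))) (0≤* (0≤* {+ 8 / 1} ≤! (0≤* V≥0 E≥0)) (0≤sq (ι (suc i))))))
      (l V E (Q 0) (Q i) (Q (suc i)) (profile V (ι i)) (profile V (ι (suc i))) (ι i) (ι (suc i)) (ι-suc i)))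
    where
    V≥0 : 0ℚ ≤ V
    V≥0 = ≤-trans ≤! V≥4
    l : ∀ V E q a b F G i j → j ≡ 1ℚ + i → (V + j) * (q * G + + 8 / 1 * (V * E) * j) ≡ (V + j) * (+ 8 / 1 * (V * V) * b) +
      (+ 8 / 1 * (V * V) * (V * a + E - (V + j) * b) + V * (q * F + + 8 / 1 * (V * E) * i - + 8 / 1 * (V * V) * a) + (q * ((V + j) * G - V * F) + + 8 / 1 * (V * E) * (j * j)))
    l V E q a b F G i .(1ℚ + i) refl = l′ V E q a b F G i
      where
      l′ : ∀ V E q a b F G i → (V + (1ℚ + i)) * (q * G + + 8 / 1 * (V * E) * (1ℚ + i)) ≡ (V + (1ℚ + i)) * (+ 8 / 1 * (V * V) * b) +
        (+ 8 / 1 * (V * V) * (V * a + E - (V + (1ℚ + i)) * b) + V * (q * F + + 8 / 1 * (V * E) * i - + 8 / 1 * (V * V) * a) + (q * ((V + (1ℚ + i)) * G - V * F) + + 8 / 1 * (V * E) * ((1ℚ + i) * (1ℚ + i))))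
      l′ = solve-∀ ringℚ

  -- Σ_{|i| ≤ N} (A - i²) (8V² - 4V i² + i⁴) and Σ_{|i| ≤ N} (A - i²) |i|
  profileSum : ℚ → ℚ → ℚ → ℚ
  profileSum A V n = + 8 / 1 * (V * V) * (A * s₀ - s₂) - + 4 / 1 * V * (A * s₂ - s₄) + (A * s₄ - s₆)
    where
    -- Faulhaber's formulas for the sums of i⁰, i², i⁴ and i⁶ over |i| ≤ n.
    s₀ = 2ℚ * n + 1ℚ
    s₂ = + 1 / 3 * (n * (n + 1ℚ) * (2ℚ * n + 1ℚ))
    s₄ = + 1 / 15 * (n * (n + 1ℚ) * (2ℚ * n + 1ℚ) * (+ 3 / 1 * (n * n) + + 3 / 1 * n - 1ℚ))
    s₆ = + 1 / 21 * (n * (n + 1ℚ) * (2ℚ * n + 1ℚ) * (+ 3 / 1 * (n * (n * (n * n))) + + 6 / 1 * (n * (n * n)) - + 3 / 1 * n + 1ℚ))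

  absSum : ℚ → ℚ → ℚ
  absSum A n = A * (n * (n + 1ℚ)) - ½ * (n * (n + 1ℚ) * (n * (n + 1ℚ)))

  profileSum-0 : ∀ A V → profileSum A V 0ℚ ≡ A * profile V 0ℚ
  profileSum-0 A V = l A V
    where
    l : ∀ A V → + 8 / 1 * (V * V) * (A * (2ℚ * 0ℚ + 1ℚ) - + 1 / 3 * (0ℚ * (0ℚ + 1ℚ) * (2ℚ * 0ℚ + 1ℚ))) - + 4 / 1 * V * (A * (+ 1 / 3 * (0ℚ * (0ℚ + 1ℚ) * (2ℚ * 0ℚ + 1ℚ))) - + 1 / 15 * (0ℚ * (0ℚ + 1ℚ) * (2ℚ * 0ℚ + 1ℚ) * (+ 3 / 1 * (0ℚ * 0ℚ) + + 3 / 1 * 0ℚ - 1ℚ))) +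
      (A * (+ 1 / 15 * (0ℚ * (0ℚ + 1ℚ) * (2ℚ * 0ℚ + 1ℚ) * (+ 3 / 1 * (0ℚ * 0ℚ) + + 3 / 1 * 0ℚ - 1ℚ))) - + 1 / 21 * (0ℚ * (0ℚ + 1ℚ) * (2ℚ * 0ℚ + 1ℚ) * (+ 3 / 1 * (0ℚ * (0ℚ * (0ℚ * 0ℚ))) + + 6 / 1 * (0ℚ * (0ℚ * 0ℚ)) - + 3 / 1 * 0ℚ + 1ℚ))) ≡
      A * ((0ℚ * 0ℚ - 2ℚ * V) * (0ℚ * 0ℚ - 2ℚ * V) + + 4 / 1 * (V * V))
    l = solve-∀ ringℚ

  profileSum-suc : ∀ A V n → profileSum A V (1ℚ + n) ≡ profileSum A V n + 2ℚ * ((A - (1ℚ + n) * (1ℚ + n)) * profile V (1ℚ + n))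
  profileSum-suc A V n = l A V n
    where
    l : ∀ A V n → + 8 / 1 * (V * V) * (A * (2ℚ * (1ℚ + n) + 1ℚ) - + 1 / 3 * ((1ℚ + n) * (1ℚ + n + 1ℚ) * (2ℚ * (1ℚ + n) + 1ℚ))) - + 4 / 1 * V * (A * (+ 1 / 3 * ((1ℚ + n) * (1ℚ + n + 1ℚ) * (2ℚ * (1ℚ + n) + 1ℚ))) - + 1 / 15 * ((1ℚ + n) * (1ℚ + n + 1ℚ) * (2ℚ * (1ℚ + n) + 1ℚ) * (+ 3 / 1 * ((1ℚ + n) * (1ℚ + n)) + + 3 / 1 * (1ℚ + n) - 1ℚ))) +
      (A * (+ 1 / 15 * ((1ℚ + n) * (1ℚ + n + 1ℚ) * (2ℚ * (1ℚ + n) + 1ℚ) * (+ 3 / 1 * ((1ℚ + n) * (1ℚ + n)) + + 3 / 1 * (1ℚ + n) - 1ℚ))) - + 1 / 21 * ((1ℚ + n) * (1ℚ + n + 1ℚ) * (2ℚ * (1ℚ + n) + 1ℚ) * (+ 3 / 1 * ((1ℚ + n) * ((1ℚ + n) * ((1ℚ + n) * (1ℚ + n)))) + + 6 / 1 * ((1ℚ + n) * ((1ℚ + n) * (1ℚ + n))) - + 3 / 1 * (1ℚ + n) + 1ℚ))) ≡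
      + 8 / 1 * (V * V) * (A * (2ℚ * n + 1ℚ) - + 1 / 3 * (n * (n + 1ℚ) * (2ℚ * n + 1ℚ))) - + 4 / 1 * V * (A * (+ 1 / 3 * (n * (n + 1ℚ) * (2ℚ * n + 1ℚ))) - + 1 / 15 * (n * (n + 1ℚ) * (2ℚ * n + 1ℚ) * (+ 3 / 1 * (n * n) + + 3 / 1 * n - 1ℚ))) +
      (A * (+ 1 / 15 * (n * (n + 1ℚ) * (2ℚ * n + 1ℚ) * (+ 3 / 1 * (n * n) + + 3 / 1 * n - 1ℚ))) - + 1 / 21 * (n * (n + 1ℚ) * (2ℚ * n + 1ℚ) * (+ 3 / 1 * (n * (n * (n * n))) + + 6 / 1 * (n * (n * n)) - + 3 / 1 * n + 1ℚ))) +
      2ℚ * ((A - (1ℚ + n) * (1ℚ + n)) * (((1ℚ + n) * (1ℚ + n) - 2ℚ * V) * ((1ℚ + n) * (1ℚ + n) - 2ℚ * V) + + 4 / 1 * (V * V)))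
    l = solve-∀ ringℚ

  absSum-suc : ∀ A n → absSum A (1ℚ + n) ≡ absSum A n + 2ℚ * ((A - (1ℚ + n) * (1ℚ + n)) * (1ℚ + n))
  absSum-suc A n = l A n
    where
    l : ∀ A n → A * ((1ℚ + n) * (1ℚ + n + 1ℚ)) - ½ * ((1ℚ + n) * (1ℚ + n + 1ℚ) * ((1ℚ + n) * (1ℚ + n + 1ℚ))) ≡ A * (n * (n + 1ℚ)) - ½ * (n * (n + 1ℚ) * (n * (n + 1ℚ))) + 2ℚ * ((A - (1ℚ + n) * (1ℚ + n)) * (1ℚ + n))
    l = solve-∀ ringℚ

  horner : List ℚ → ℚ → ℚ
  horner []       g = 0ℚ
  horner (c ∷ cs) g = c + g * horner cs g

  0≤horner : ∀ cs {_ : True (all? (0ℚ ≤?_) cs)} {g} → 0ℚ ≤ g → 0ℚ ≤ horner cs g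
  0≤horner cs {t} h = go cs (toWitness t)
    where
    go : ∀ cs → All (0ℚ ≤_) cs → 0ℚ ≤ horner cs _
    go []       _        = ≤!
    go (c ∷ cs) (p All.∷ ps) = 0≤+ p (0≤* h (go cs ps))

  -- The two numerical inequalities behind the lower bound for P ν, with h = 8800 + g and 3V = h² + w.
  profileSum-upper : ∀ {g w} → 0ℚ ≤ g → 0ℚ ≤ w → w ≤ 2ℚ * (+ 8800 / 1 + g) + 1ℚ →
    let h = + 8800 / 1 + g ; V = + 1 / 3 * (h * h + w) in
    profileSum (h * h) V h ≤ + 8 / 1 * (V * V) * (+ 1065 / 1000 * (h * (h * h)))
  -- For 3V = h² the integral of (h² - t²)(1 - t²/2V + t⁴/8V²) over |t| ≤ h is 1.0619... h³, which
  -- explains 1.065. The difference is written with nonnegative coefficients in g, 2h + 1 - w and 2h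
  -- + 1 + w.
  profileSum-upper {g} {w} g≥0 w≥0 w≤ = le-by (0≤+ (0≤+ (0≤horner ((+ 100179942097159222415443040 / 9) ∷ (+ 8379428799732426170381209 / 945) ∷ (+ 408679574762199236504 / 135) ∷ (+ 387566290409971819 / 675) ∷ (+ 14701717051852 / 225) ∷ (+ 3011500199 / 675) ∷ (+ 114236 / 675) ∷ (+ 13 / 4725) ∷ []) g≥0) (0≤* (≤⇒0≤ w≤) (0≤horner ((+ 57698688661503992960 / 9) ∷ (+ 491750190553599988 / 135) ∷ (+ 22352281494400 / 27) ∷ (+ 846677332 / 9) ∷ (+ 144320 / 27) ∷ (+ 82 / 675) ∷ []) g≥0)))
      (0≤* (0≤* (≤⇒0≤ w≤) (0≤+ (0≤+ {b = 1ℚ} (0≤* {2ℚ} ≤! (0≤+ {+ 8800 / 1} ≤! g≥0)) ≤!) w≥0)) (0≤horner ((+ 1462893203200 / 9) ∷ (+ 1496140792 / 27) ∷ (+ 56672 / 9) ∷ (+ 161 / 675) ∷ []) g≥0)))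
    (l g w)
    where
    l : ∀ g w → + 8 / 1 * (+ 1 / 3 * ((+ 8800 / 1 + g) * (+ 8800 / 1 + g) + w) * (+ 1 / 3 * ((+ 8800 / 1 + g) * (+ 8800 / 1 + g) + w))) * (+ 1065 / 1000 * ((+ 8800 / 1 + g) * ((+ 8800 / 1 + g) * (+ 8800 / 1 + g)))) ≡
      (+ 8 / 1 * ((+ 1 / 3 * (((+ 8800 / 1 + g) * (+ 8800 / 1 + g)) + w)) * (+ 1 / 3 * (((+ 8800 / 1 + g) * (+ 8800 / 1 + g)) + w))) * (((+ 8800 / 1 + g) * (+ 8800 / 1 + g)) * (2ℚ * (+ 8800 / 1 + g) + 1ℚ) - (+ 1 / 3 * ((+ 8800 / 1 + g) * ((+ 8800 / 1 + g) + 1ℚ) * (2ℚ * (+ 8800 / 1 + g) + 1ℚ)))) - + 4 / 1 * (+ 1 / 3 * (((+ 8800 / 1 + g) * (+ 8800 / 1 + g)) + w)) * (((+ 8800 / 1 + g) * (+ 8800 / 1 + g)) * (+ 1 / 3 * ((+ 8800 / 1 + g) * ((+ 8800 / 1 + g) + 1ℚ) * (2ℚ * (+ 8800 / 1 + g) + 1ℚ))) - (+ 1 / 15 * ((+ 8800 / 1 + g) * ((+ 8800 / 1 + g) + 1ℚ) * (2ℚ * (+ 8800 / 1 + g) + 1ℚ) * (+ 3 / 1 * ((+ 8800 / 1 + g) * (+ 8800 / 1 + g)) + + 3 / 1 * (+ 8800 / 1 + g) - 1ℚ)))) + (((+ 8800 / 1 + g) * (+ 8800 / 1 + g)) * (+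 1 / 15 * ((+ 8800 / 1 + g) * ((+ 8800 / 1 + g) + 1ℚ) * (2ℚ * (+ 8800 / 1 + g) + 1ℚ) * (+ 3 / 1 * ((+ 8800 / 1 + g) * (+ 8800 / 1 + g)) + + 3 / 1 * (+ 8800 / 1 + g) - 1ℚ))) - (+ 1 / 21 * ((+ 8800 / 1 + g) * ((+ 8800 / 1 + g) + 1ℚ) * (2ℚ * (+ 8800 / 1 + g) + 1ℚ) * (+ 3 / 1 * ((+ 8800 / 1 + g) * ((+ 8800 / 1 + g) * ((+ 8800 / 1 + g) * (+ 8800 / 1 + g)))) + + 6 / 1 * ((+ 8800 / 1 + g) * ((+ 8800 / 1 + g) * (+ 8800 / 1 + g))) - + 3 / 1 * (+ 8800 / 1 + g) + 1ℚ))))) +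
      ((+ 100179942097159222415443040 / 9 + g * (+ 8379428799732426170381209 / 945 + g * (+ 408679574762199236504 / 135 + g * (+ 387566290409971819 / 675 + g * (+ 14701717051852 / 225 + g * (+ 3011500199 / 675 + g * (+ 114236 / 675 + g * (+ 13 / 4725 + g * 0ℚ)))))))) + (2ℚ * (+ 8800 / 1 + g) + 1ℚ - w) * (+ 57698688661503992960 / 9 + g * (+ 491750190553599988 / 135 + g * (+ 22352281494400 / 27 + g * (+ 846677332 / 9 + g * (+ 144320 / 27 + g * (+ 82 / 675 + g * 0ℚ)))))) + (2ℚ * (+ 8800 / 1 + g) + 1ℚ - w) * (2ℚ * (+ 8800 / 1 + g) + 1ℚ + w) * (+ 1462893203200 / 9 + g * (+ 1496140792 / 27 + g * (+ 56672 / 9 + g * (+ 161 / 675 + g * 0ℚ)))))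
    l = solve-∀ ringℚ

  window-lower : ∀ {g w q} → 0ℚ ≤ g → 0ℚ ≤ w → w ≤ 2ℚ * (+ 8800 / 1 + g) + 1ℚ → q ≤ 1ℚ →
    let h = + 8800 / 1 + g ; V = + 1 / 3 * (h * h + w) in
    + 499 / 10000 * absSum (h * h) h + V * (+ 555 / 1000 * (+ 1065 / 1000) * (h * h)) ≤ V * (h * h - (V + q))
  -- For 3V = h² the sum `absSum` is about h⁴/2, and after division by V h² the claim becomes 0.555
  -- · 1.065 = 0.59107... < 2/3 - 0.07485.
  window-lower {g} {w} {q} g≥0 w≥0 w≤ q≤1 = le-by (0≤+ (0≤+ (0≤horner ((+ 12288774728204 / 9) ∷ (+ 142642416733 / 225) ∷ (+ 13239868951 / 120000) ∷ (+ 1535471 / 180000) ∷ (+ 89 / 360000) ∷ []) g≥0) (0≤* (≤⇒0≤ w≤) (0≤+ {b = + 1 / 3} (0≤* {+ 30929 / 360000} ≤! (0≤sq (+ 8800 / 1 + g))) ≤!)))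
      (0≤+ (0≤* {+ 1 / 9} ≤! (0≤* (≤⇒0≤ w≤) (0≤+ (0≤+ {b = 1ℚ} (0≤* {2ℚ} ≤! (0≤+ {+ 8800 / 1} ≤! g≥0)) ≤!) w≥0))) (0≤* (≤⇒0≤ q≤1) (0≤* {+ 1 / 3} ≤! (0≤+ (0≤sq (+ 8800 / 1 + g)) w≥0)))))
    (l g w q)
    where
    l : ∀ g w q → + 1 / 3 * ((+ 8800 / 1 + g) * (+ 8800 / 1 + g) + w) * ((+ 8800 / 1 + g) * (+ 8800 / 1 + g) - (+ 1 / 3 * ((+ 8800 / 1 + g) * (+ 8800 / 1 + g) + w) + q)) ≡
      + 499 / 10000 * (((+ 8800 / 1 + g) * (+ 8800 / 1 + g)) * ((+ 8800 / 1 + g) * ((+ 8800 / 1 + g) + 1ℚ)) - ½ * ((+ 8800 / 1 + g) * ((+ 8800 / 1 + g) + 1ℚ) * ((+ 8800 / 1 + g) * ((+ 8800 / 1 + g) + 1ℚ)))) + + 1 / 3 * ((+ 8800 / 1 + g) * (+ 8800 / 1 + g) + w) * (+ 555 / 1000 * (+ 1065 / 1000) * ((+ 8800 / 1 + g) * (+ 8800 / 1 + g))) +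
      ((+ 12288774728204 / 9 + g * (+ 142642416733 / 225 + g * (+ 13239868951 / 120000 + g * (+ 1535471 / 180000 + g * (+ 89 / 360000 + g * 0ℚ))))) + (2ℚ * (+ 8800 / 1 + g) + 1ℚ - w) * (+ 30929 / 360000 * ((+ 8800 / 1 + g) * (+ 8800 / 1 + g)) + + 1 / 3) + (+ 1 / 9 * ((2ℚ * (+ 8800 / 1 + g) + 1ℚ - w) * (2ℚ * (+ 8800 / 1 + g) + 1ℚ + w)) + (1ℚ - q) * (+ 1 / 3 * ((+ 8800 / 1 + g) * (+ 8800 / 1 + g) + w))))
    l = solve-∀ ringℚ

  *-cancel-≡ : ∀ {a b} c → 0ℚ < c → c * a ≡ c * b → a ≡ b
  *-cancel-≡ c c>0 h = ≤-antisym (*-cancelˡ c c>0 (≤-reflexive h)) (*-cancelˡ c c>0 (≤-reflexive (sym h)))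

  -- d² times the discriminant of the binary cubic (a, b, c, d) is - (A² + 4 B³) for its depressed form.
  depressed-discriminant : ∀ a b c d →
    d * d * (+ 4 / 1 * ((b * b - a * c) * (c * c - b * d)) - (b * c - a * d) * (b * c - a * d)) ≡
    - ((a * (d * d) - + 3 / 1 * (b * c * d) + + 2 / 1 * (c * c * c)) * (a * (d * d) - + 3 / 1 * (b * c * d) + + 2 / 1 * (c * c * c)) + + 4 / 1 * ((b * d - c * c) * (b * d - c * c) * (b * d - c * c)))
  depressed-discriminant = solve-∀ ringℚ

  -- Differences are measured in units of d and θ ≈ 1/√(3V). The two Stein equations then give the
  -- depressed form as A = d³ θ N / v and B = - d² Q / v, so that the discriminant is nonnegative
  -- once w N² ≤ 4 Q³, and log-concavity is Q ≥ 0.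
  module Cubic {a b c d θ v δ c₁ e₁ e₂ b₁ : ℚ} (d>0 : 0ℚ < d) (θ>0 : 0ℚ < θ) (θ≤ : θ ≤ + 1 / 8800) (v>0 : 0ℚ < v)
    (w≥ : + 1 / 3 ≤ v * (θ * θ)) (w≤ : v * (θ * θ) ≤ + 3335 / 10000)
    (δ± : δ ∈± + 1 / 10000) (c₁± : c₁ ∈± + 27 / 100) (e₁± : e₁ ∈± + 31 / 100) (e₂± : e₂ ∈± + 107 / 100)
    (c≡ : c ≡ d * θ * c₁) (b≡ : b ≡ d * (θ * θ) * b₁)
    (eq₁ : v * b + d - (1ℚ - δ) * c ≡ d * e₁) (eq₂ : v * a + δ * b + + 2 / 1 * (c - b) ≡ d * θ * e₂) where

    w N Q : ℚ
    w = v * (θ * θ)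
    N = c₁ + (+ 2 / 1 - δ) * (θ * b₁) + e₂ - + 3 / 1 * ((1ℚ - δ) * (θ * (c₁ * c₁))) - + 3 / 1 * (c₁ * e₁) + + 2 / 1 * (w * (c₁ * (c₁ * c₁)))
    Q = w * (c₁ * c₁) + 1ℚ - (1ℚ - δ) * (θ * c₁) - e₁

    private
      θ± : θ ∈± + 1 / 8800
      θ± = ≤-trans ≤! (<⇒≤ θ>0) , θ≤
      w± : w ∈± + 3335 / 10000
      w± = ≤-trans ≤! w≥ , w≤
      const : ∀ q → 0ℚ ≤ q → q ∈± q
      const q h = ≤-trans (neg-antimono-≤ h) h , ≤-refl
      1-δ : 1ℚ - δ ∈± 1ℚ + + 1 / 10000
      1-δ = ±-- (const 1ℚ ≤!) δ±
      2-δ : + 2 / 1 - δ ∈± + 2 / 1 + + 1 / 10000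
      2-δ = ±-- (const (+ 2 / 1) ≤!) δ±

    wb₁ : w * b₁ ≡ (1ℚ - δ) * (θ * c₁) + e₁ - 1ℚ
    wb₁ = *-cancel-≡ d d>0 (eq-by (0*diff 1ℚ (trans (sym (cong₂ (λ b c → v * b + d - (1ℚ - δ) * c) b≡ c≡)) eq₁)) (l d θ v δ c₁ e₁ b₁))
      where
      l : ∀ d θ v δ c₁ e₁ b₁ → d * (v * (θ * θ) * b₁) ≡ d * ((1ℚ - δ) * (θ * c₁) + e₁ - 1ℚ) + 1ℚ * (v * (d * (θ * θ) * b₁) + d - (1ℚ - δ) * (d * θ * c₁) - d * e₁)
      l = solve-∀ ringℚ

    b₁± : b₁ ∈± + 394 / 100
    b₁± = lower , upper
      where
      w>0 : 0ℚ < w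
      w>0 = <-≤-trans {0ℚ} {+ 1 / 3} <! w≥
      bounded : w * b₁ ∈± + 1311 / 1000
      bounded = ±-weaken (subst (_∈± (1ℚ + + 1 / 10000) * (+ 1 / 8800 * (+ 27 / 100)) + + 31 / 100 + 1ℚ) (sym wb₁) (±-- (±-+ (±-mul 1-δ (±-mul θ± c₁±)) e₁±) (const 1ℚ ≤!))) ≤!
      upper : b₁ ≤ + 394 / 100
      upper = *-cancelˡ w w>0 (≤-trans (proj₂ bounded) (≤-trans ≤! (*-monoʳ (+ 394 / 100) ≤! w≥)))
      lower : - (+ 394 / 100) ≤ b₁
      lower = *-cancelˡ w w>0 (≤-trans (≤-reflexive (sym (neg-distribʳ-* w (+ 394 / 100)))) (≤-trans (neg-antimono-≤ (≤-trans (≤! {+ 1311 / 1000} {+ 1 / 3 * (+ 394 / 100)}) (*-monoʳ (+ 394 / 100) ≤! w≥))) (proj₁ bounded)))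

    N± : N ∈± + 1607 / 1000
    N± = ±-weaken (±-+ (±-- (±-- (±-+ (±-+ c₁± (±-mul 2-δ (±-mul θ± b₁±))) e₂±) (±-* (+ 3 / 1) ≤! (±-mul 1-δ (±-mul θ± (±-mul c₁± c₁±))))) (±-* (+ 3 / 1) ≤! (±-mul c₁± e₁±)))
      (±-* (+ 2 / 1) ≤! (±-mul w± (±-mul c₁± (±-mul c₁± c₁±))))) ≤!

    Q≥ : + 689 / 1000 ≤ Q
    Q≥ = ≤-trans (le-by (0≤+ (0≤+ (0≤* (≤-trans ≤! w≥) (0≤sq c₁)) (≤⇒0≤ (proj₂ (±-mul 1-δ (±-mul θ± c₁±))))) (0≤+ (≤⇒0≤ (proj₂ e₁±)) (≤! {0ℚ} {1ℚ - (1ℚ + + 1 / 10000) * (+ 1 / 8800 * (+ 27 / 100)) - + 31 / 100 - + 689 / 1000})))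
      (l w c₁ ((1ℚ - δ) * (θ * c₁)) e₁)) ≤-refl
      where
      l : ∀ w c t e → w * (c * c) + 1ℚ - t - e ≡ + 689 / 1000 + (w * (c * c) + ((1ℚ + + 1 / 10000) * (+ 1 / 8800 * (+ 27 / 100)) - t) + (+ 31 / 100 - e + (1ℚ - (1ℚ + + 1 / 10000) * (+ 1 / 8800 * (+ 27 / 100)) - + 31 / 100 - + 689 / 1000)))
      l = solve-∀ ringℚ

    Q≥0 : 0ℚ ≤ Q
    Q≥0 = ≤-trans ≤! Q≥

    -- The decisive comparison: the left side is at most 0.3335 · 1.607² < 0.862, the right side at
    -- least 4 · 0.689³ > 1.308.
    wN²≤4Q³ : w * (N * N) ≤ + 4 / 1 * (Q * Q * Q)
    wN²≤4Q³ = ≤-trans (proj₂ (±-mul w± (±-mul N± N±))) (≤-trans ≤! (*-monoˡ (+ 4 / 1) ≤!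
      (*-mono (≤! {0ℚ} {+ 689 / 1000 * (+ 689 / 1000)}) (*-mono (≤! {0ℚ} {+ 689 / 1000}) Q≥ (≤! {0ℚ} {+ 689 / 1000}) Q≥) (≤! {0ℚ} {+ 689 / 1000}) Q≥)))

    A B : ℚ
    A = a * (d * d) - + 3 / 1 * (b * c * d) + + 2 / 1 * (c * c * c)
    B = b * d - c * c

    vB : v * B ≡ - (d * d * Q)
    vB = trans (cong₂ (λ b c → v * (b * d - c * c)) b≡ c≡) (eq-by (0*diff (d * d) wb₁) (l d θ v c₁ b₁ ((1ℚ - δ) * (θ * c₁)) e₁))
      where
      l : ∀ d θ v c₁ b₁ t e → v * (d * (θ * θ) * b₁ * d - d * θ * c₁ * (d * θ * c₁)) ≡ - (d * d * (v * (θ * θ) * (c₁ * c₁) + 1ℚ - t - e)) + d * d * (v * (θ * θ) * b₁ - (t + e - 1ℚ))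
      l = solve-∀ ringℚ

    vA : v * A ≡ d * d * d * θ * N
    vA = trans (cong₂ (λ b c → v * (a * (d * d) - + 3 / 1 * (b * c * d) + + 2 / 1 * (c * c * c))) b≡ c≡)
      (eq-by (0+ (0*diff (d * d) eq₂′) (0*diff (- (+ 3 / 1 * (d * d * d * θ * c₁))) wb₁)) (l a d θ v δ c₁ b₁ e₁ e₂))
      where
      eq₂′ : v * a + δ * (d * (θ * θ) * b₁) + + 2 / 1 * (d * θ * c₁ - d * (θ * θ) * b₁) ≡ d * θ * e₂
      eq₂′ = trans (sym (cong₂ (λ b c → v * a + δ * b + + 2 / 1 * (c - b)) b≡ c≡)) eq₂
      l : ∀ a d θ v δ c₁ b₁ e₁ e₂ → v * (a * (d * d) - + 3 / 1 * (d * (θ * θ) * b₁ * (d * θ * c₁) * d) + + 2 / 1 * (d * θ * c₁ * (d * θ * c₁) * (d * θ * c₁))) ≡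
        d * d * d * θ * (c₁ + (+ 2 / 1 - δ) * (θ * b₁) + e₂ - + 3 / 1 * ((1ℚ - δ) * (θ * (c₁ * c₁))) - + 3 / 1 * (c₁ * e₁) + + 2 / 1 * (v * (θ * θ) * (c₁ * (c₁ * c₁)))) +
        (d * d * (v * a + δ * (d * (θ * θ) * b₁) + + 2 / 1 * (d * θ * c₁ - d * (θ * θ) * b₁) - d * θ * e₂) +
        (- (+ 3 / 1 * (d * d * d * θ * c₁))) * (v * (θ * θ) * b₁ - ((1ℚ - δ) * (θ * c₁) + e₁ - 1ℚ)))
      l = solve-∀ ringℚ

    log-concave : 0ℚ ≤ c * c - b * d
    log-concave = *-cancelˡ v v>0 (≤-trans (≤-reflexive (*-zeroʳ v)) (≤-trans (0≤* (0≤* (<⇒≤ d>0) (<⇒≤ d>0)) Q≥0)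
      (≤-reflexive (trans (l₁ (d * d * Q)) (trans (cong -_ (sym vB)) (l₂ v b c d))))))
      where
      l₁ : ∀ x → x ≡ - (- x)
      l₁ = solve-∀ ringℚ
      l₂ : ∀ v b c d → - (v * (b * d - c * c)) ≡ v * (c * c - b * d)
      l₂ = solve-∀ ringℚ

    turán : 0ℚ ≤ + 4 / 1 * ((b * b - a * c) * (c * c - b * d)) - (b * c - a * d) * (b * c - a * d)
    turán = *-cancelˡ (d * d * (v * (v * v))) (0<* (0<* d>0 d>0) (0<* v>0 (0<* v>0 v>0)))
      (≤-trans (≤-reflexive (*-zeroʳ (d * d * (v * (v * v))))) (≤-trans (0≤* (0≤* (0≤* d² d²) d²) (≤⇒0≤ wN²≤4Q³)) (≤-reflexive (sym identity))))
      where
      d² : 0ℚ ≤ d * d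
      d² = 0≤sq d
      D = + 4 / 1 * ((b * b - a * c) * (c * c - b * d)) - (b * c - a * d) * (b * c - a * d)
      l₁ : ∀ v d D → d * d * (v * (v * v)) * D ≡ v * (v * v) * (d * d * D)
      l₁ = solve-∀ ringℚ
      l₂ : ∀ v A B → v * (v * v) * - (A * A + + 4 / 1 * (B * B * B)) ≡ - (v * (v * A * (v * A)) + + 4 / 1 * (v * B * (v * B) * (v * B)))
      l₂ = solve-∀ ringℚ
      l₃ : ∀ v d θ N Q → - (v * (d * d * d * θ * N * (d * d * d * θ * N)) + + 4 / 1 * (- (d * d * Q) * - (d * d * Q) * - (d * d * Q))) ≡ d * d * (d * d) * (d * d) * (+ 4 / 1 * (Q * Q * Q) - v * (θ * θ) * (N * N))
      l₃ = solve-∀ ringℚ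
      identity : d * d * (v * (v * v)) * D ≡ d * d * (d * d) * (d * d) * (+ 4 / 1 * (Q * Q * Q) - w * (N * N))
      identity = trans (l₁ v d D) (trans (cong (v * (v * v) *_) (depressed-discriminant a b c d)) (trans (l₂ v A B)
        (trans (cong₂ (λ e f → - (v * (e * e) + + 4 / 1 * (f * f * f))) vA vB) (l₃ v d θ N Q))))

  -- The law near its mean

  module Local (x : ℚ) (x>0 : 0ℚ < x) (x≤ : x ≤ + 1 / 256) (M : ℕ)
    (tail : (1ℚ - x) ^ M * ((1ℚ + ι M) * (1ℚ + ι M) + 2ℚ) ≤ x)
    (T : ℚ) (xT : x * T ≡ 1ℚ) (size : ι M ≤ + 8 / 1 * (T * T) + + 8 / 1)
    (ν : ℤ) (centred : ιℤ ν - Tilt.μ x x>0 x≤ (parts M) ∈± + 1 / 10000)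
    (H : ℕ) (H-lower : ι H * ι H ≤ + 3 / 1 * Tilt.V x x>0 x≤ (parts M)) (H-upper : + 3 / 1 * Tilt.V x x>0 x≤ (parts M) ≤ (ι H + 1ℚ) * (ι H + 1ℚ))
    {w₀ : ℕ} {L₀ : List ℕ} (rem : Rem (parts M) w₀ L₀) where
    open Tilt x x>0 x≤ hiding (u; w)
    open Tail M tail
    open Sums x x>0 x≤
    open CharBound x x>0 x≤ M tail T xT size using (T≥256; T≥0; Θ; Θ≥0; unscale)
    open Majorant x x>0 x≤ M tail T xT size using (M₂; M₄; Θ-large; Δ²-bound; Δ³-bound; Δ⁴-bound)
    open Law p hiding (μ; V; K)

    L : List ℕ
    L = parts M

    h v δ₀ : ℚ
    h = ι H
    v = V L
    δ₀ = ιℤ ν - μ L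

    h≥0 : 0ℚ ≤ h
    h≥0 = 0≤ι H

    private
      X≥0 : 0ℚ ≤ x * (x * x)
      X≥0 = 0≤* x≥0 (0≤sq x)
      XΘ : x * (x * x) * Θ ≡ 1ℚ
      XΘ = trans (l x T) (cong₂ _*_ xT (cong₂ _*_ xT xT))
        where
        l : ∀ x T → x * (x * x) * (T * (T * T)) ≡ x * T * (x * T * (x * T))
        l = solve-∀ ringℚ

    v-lower : + 156 / 100 * Θ ≤ v
    v-lower = unscale {+ 156 / 100} {v} V-lower

    v-upper : v ≤ + 174 / 100 * Θ
    v-upper = ≤-trans (≤-reflexive (sym (trans (l (x * (x * x)) v Θ) (trans (cong (_* v) XΘ) (*-identityˡ v))))) (*-monoʳ Θ Θ≥0 V-upper)
      where
      l : ∀ X v t → X * v * t ≡ X * t * v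
      l = solve-∀ ringℚ

    v≥4 : + 4 / 1 ≤ v
    v≥4 = ≤-trans ≤! (≤-trans (*-monoˡ (+ 156 / 100) ≤! Θ-large) v-lower)

    v≥0 : 0ℚ ≤ v
    v≥0 = ≤-trans ≤! v≥4

    v>0 : 0ℚ < v
    v>0 = <-≤-trans {0ℚ} {+ 4 / 1} <! v≥4

    HH : h * h ≤ + 522 / 100 * Θ
    HH = ≤-trans H-lower (≤-trans (*-monoˡ (+ 3 / 1) ≤! v-upper) (≤-reflexive (l Θ)))
      where
      l : ∀ t → + 3 / 1 * (+ 174 / 100 * t) ≡ + 522 / 100 * t
      l = solve-∀ ringℚ

    open MajorantBounds x x>0 x≤ M tail T xT size h h≥0 HH using (M₂H; M₄H)

    -- From (h + 1)² ≥ 3V ≥ 4.68 T³ ≥ 4.68 · 256 T², and √(4.68 · 256) = 34.613.... At T = 256 it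
    -- yields h ≥ 8858, whence the bound 8800.
    34T≤h+1 : + 34606 / 1000 * T ≤ h + 1ℚ
    34T≤h+1 = sq-cancel (0≤+ {b = 1ℚ} h≥0 ≤!) (≤-trans (le-by (0≤+ (0≤* (0≤* {+ 468 / 100} ≤! (0≤sq T)) (≤⇒0≤ T≥256)) (0≤* {+ 468 / 100 * (+ 256 / 1) - + 34606 / 1000 * (+ 34606 / 1000)} ≤! (0≤sq T))) (l T))
      (≤-trans (*-monoˡ (+ 3 / 1) ≤! v-lower) H-upper))
      where
      l : ∀ T → + 3 / 1 * (+ 156 / 100 * (T * (T * T))) ≡ + 34606 / 1000 * T * (+ 34606 / 1000 * T) +
        (+ 468 / 100 * (T * T) * (T - + 256 / 1) + (+ 468 / 100 * (+ 256 / 1) - + 34606 / 1000 * (+ 34606 / 1000)) * (T * T))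
      l = solve-∀ ringℚ

    T≤λh : T ≤ + 289 / 10000 * h
    T≤λh = le-by (0≤+ (0≤* {+ 289 / 10000} ≤! (≤⇒0≤ 34T≤h+1)) (0≤+ (0≤* {+ 289 / 10000 * (+ 34606 / 1000) - 1ℚ} ≤! (≤⇒0≤ T≥256)) (≤! {0ℚ} {(+ 289 / 10000 * (+ 34606 / 1000) - 1ℚ) * (+ 256 / 1) - + 289 / 10000}))) (l T h)
      where
      l : ∀ T h → + 289 / 10000 * h ≡ T + (+ 289 / 10000 * (h + 1ℚ - + 34606 / 1000 * T) + ((+ 289 / 10000 * (+ 34606 / 1000) - 1ℚ) * (T - + 256 / 1) + ((+ 289 / 10000 * (+ 34606 / 1000) - 1ℚ) * (+ 256 / 1) - + 289 / 10000)))
      l = solve-∀ ringℚ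

    h≥8800 : + 8800 / 1 ≤ h
    h≥8800 = le-by (0≤+ (≤⇒0≤ 34T≤h+1) (0≤+ (0≤* {+ 34606 / 1000} ≤! (≤⇒0≤ T≥256)) (≤! {0ℚ} {+ 34606 / 1000 * (+ 256 / 1) - + 8801 / 1}))) (l T h)
      where
      l : ∀ T h → h ≡ + 8800 / 1 + (h + 1ℚ - + 34606 / 1000 * T + (+ 34606 / 1000 * (T - + 256 / 1) + (+ 34606 / 1000 * (+ 256 / 1) - + 8801 / 1)))
      l = solve-∀ ringℚ

    h>0 : 0ℚ < h
    h>0 = <-≤-trans {0ℚ} {+ 8800 / 1} <! h≥8800

    k : ℚ
    k = K L

    k≥0 : 0ℚ ≤ k
    k≥0 = 0≤Σᴸ L λ j → 0≤* (0≤ι j) (0≤* (0≤ι j) (0≤* (0≤ι j) (0≤pq j)))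

    k-upper : k ≤ + 6 / 1 * (T * Θ)
    k-upper = ≤-trans (≤-reflexive (sym (trans (l x T k) (trans (cong (λ e → e * e * (e * e) * k) xT) (l′ k))))) (*-monoʳ (T * Θ) (0≤* T≥0 Θ≥0) (K-upper M))
      where
      l : ∀ x T k → x * (x * (x * x)) * k * (T * (T * (T * T))) ≡ x * T * (x * T) * (x * T * (x * T)) * k
      l = solve-∀ ringℚ
      l′ : ∀ k → 1ℚ * 1ℚ * (1ℚ * 1ℚ) * k ≡ k
      l′ = solve-∀ ringℚ

    M₂≥0 : 0ℚ ≤ M₂
    M₂≥0 = ±-0≤ (Δ²-bound rem ν)

    M₄≥0 : 0ℚ ≤ M₄
    M₄≥0 = ±-0≤ (Δ⁴-bound rem ν)

    private
      XΘ-cancel : ∀ c → T * Θ * (c * (x * (x * x))) ≡ c * T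
      XΘ-cancel c = trans (l T Θ c (x * (x * x))) (trans (cong (c * T *_) XΘ) (*-identityʳ (c * T)))
        where
        l : ∀ T t c X → T * t * (c * X) ≡ c * T * (X * t)
        l = solve-∀ ringℚ

    -- With K ≤ 6T⁴, M₂ h ≤ 0.573 x³ and T ≤ 0.0289 h the powers of T and h cancel, and 3 · 0.573 ·
    -- 0.0289 = 0.049679... remains.
    ε₀ : ½ * (k * M₂) ≤ + 4968 / 100000
    ε₀ = *-cancelˡ h h>0 (≤-trans (≤-reflexive (l₁ h k M₂)) (≤-trans (*-monoˡ ½ ≤! (*-mono k≥0 k-upper (0≤* M₂≥0 h≥0) M₂H))
      (≤-trans (≤-reflexive (trans (l₂ (T * Θ) (+ 573 / 1000 * (x * (x * x)))) (cong (+ 3 / 1 *_) (XΘ-cancel (+ 573 / 1000)))))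
      (≤-trans (*-monoˡ (+ 3 / 1) ≤! (*-monoˡ (+ 573 / 1000) ≤! T≤λh)) (le-by (0≤* {+ 4968 / 100000 - + 3 / 1 * (+ 573 / 1000 * (+ 289 / 10000))} ≤! h≥0) (l₃ h))))))
      where
      l₁ : ∀ h k m → h * (½ * (k * m)) ≡ ½ * (k * (m * h))
      l₁ = solve-∀ ringℚ
      l₂ : ∀ a b → ½ * (+ 6 / 1 * a * b) ≡ + 3 / 1 * (a * b)
      l₂ = solve-∀ ringℚ
      l₃ : ∀ h → h * (+ 4968 / 100000) ≡ + 3 / 1 * (+ 573 / 1000 * (+ 289 / 10000 * h)) + (+ 4968 / 100000 - + 3 / 1 * (+ 573 / 1000 * (+ 289 / 10000))) * h
      l₃ = solve-∀ ringℚ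

    vM₂ : v * M₂ ≤ + 12 / 100000
    vM₂ = *-cancelˡ h h>0 (≤-trans (≤-reflexive (l₁ h v M₂)) (≤-trans (*-mono v≥0 v-upper (0≤* M₂≥0 h≥0) M₂H)
      (≤-trans (≤-reflexive (trans (l₂ Θ (x * (x * x))) (cong (+ 174 / 100 * (+ 573 / 1000) *_) XΘ))) (≤-trans (≤! {_} {+ 8800 / 1 * (+ 12 / 100000)}) (*-monoʳ (+ 12 / 100000) ≤! h≥8800)))))
      where
      l₁ : ∀ h k m → h * (k * m) ≡ k * (m * h)
      l₁ = solve-∀ ringℚ
      l₂ : ∀ t X → + 174 / 100 * t * (+ 573 / 1000 * X) ≡ + 174 / 100 * (+ 573 / 1000) * (X * t)
      l₂ = solve-∀ ringℚ

    Pr : ℤ → ℚ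
    Pr = P L

    open Window p 0≤p p≤1 L ν (h * h) using (0≤P; P≤1; U; window)

    -- The sum 0.04968 + 0.00012 + 0.0001 of the errors that occur in `step⁻`: Stein's error, a
    -- second difference, and the distance of ν from the mean.
    E₀ : ℚ
    E₀ = + 499 / 10000

    d a b c : ℚ
    d = Pr ν
    c = Δ^ 1 Pr ν
    b = Δ^ 2 Pr ν
    a = Δ^ 3 Pr ν

    δP : ∀ m → δ₀ * Pr m ∈± + 1 / 10000
    δP m = ±-weaken (±-mul centred (≤-trans ≤! (0≤P m) , P≤1 m)) ≤!

    Δ²-whole : ∀ m → Δ^ 2 Pr m ∈± M₂
    Δ²-whole m = ±-weaken (subst (_∈± (1ℚ - p w₀) * M₂ + p w₀ * M₂) (sym mixture) (±-+ (±-* (1ℚ - p w₀) (≤⇒0≤ (p≤1 w₀)) (Δ²-bound rem m)) (±-* (p w₀) (0≤p w₀) (Δ²-bound rem (m ℤ.- + w₀)))))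
      (≤-reflexive (l (p w₀) M₂))
      where
      l : ∀ p m → (1ℚ - p) * m + p * m ≡ m
      l = solve-∀ ringℚ
      mixture : Δ^ 2 Pr m ≡ (1ℚ - p w₀) * Δ^ 2 (P L₀) m + p w₀ * Δ^ 2 (P L₀) (m ℤ.- + w₀)
      mixture = trans (Δ^-cong 2 (P-Rem rem) m) (trans (Δ^-linear 2 (1ℚ - p w₀) (p w₀) (P L₀) (λ k → P L₀ (k ℤ.- + w₀)) m)
        (cong (λ e → (1ℚ - p w₀) * Δ^ 2 (P L₀) m + p w₀ * e) (Δ^-shift 2 (P L₀) (+ w₀) m)))

    equation₀ : ∀ m → (ιℤ m - μ L) * Pr m + v * Δ Pr m ∈± ½ * (k * M₂)
    equation₀ m = subst (λ e → e + v * Δ Pr m ∈± ½ * (k * M₂)) (sym (stein L m)) (stein-error 0≤p p≤½ 0 L Δ²-bound m)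

    step⁺ : ∀ i → (v + ι (suc i)) * Pr (ν ℤ.+ + suc i) ≤ v * Pr (ν ℤ.+ + i) + E₀
    step⁺ i = combine (Pr m) (Pr (ν ℤ.+ + i)) (ιℤ ν) (μ L) (½ * (k * M₂)) (ι (suc i)) ε₀ (proj₁ (δP m))
      (subst₂ (λ e f → (e - μ L) * Pr m + v * (Pr m - Pr f) ≤ ½ * (k * M₂)) (ιℤ-+ ν (+ suc i)) prev (proj₂ (equation₀ m)))
      where
      m = ν ℤ.+ + suc i
      prev : m ℤ.- + 1 ≡ ν ℤ.+ + i
      prev = ℤ.+-assoc ν (+ suc i) (ℤ.- + 1)
      combine : ∀ P P′ n u e j → e ≤ + 4968 / 100000 → - (+ 1 / 10000) ≤ (n - u) * P → (n + j - u) * P + v * (P - P′) ≤ e → (v + j) * P ≤ v * P′ + E₀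
      combine P P′ n u e j h₁ h₂ h₃ = le-by (0≤+ (0≤+ (≤⇒0≤ h₁) (≤⇒0≤ h₂)) (0≤+ (≤⇒0≤ h₃) (≤! {0ℚ} {E₀ - + 4968 / 100000 - + 1 / 10000}))) (l v P P′ n u e j)
        where
        l : ∀ v P P′ n u e j → v * P′ + + 499 / 10000 ≡ (v + j) * P + (+ 4968 / 100000 - e + ((n - u) * P - - (+ 1 / 10000)) + (e - ((n + j - u) * P + v * (P - P′)) + (+ 499 / 10000 - + 4968 / 100000 - + 1 / 10000)))
        l = solve-∀ ringℚ

    -- Stein's identity at ν - i - 1 involves the difference that ends there, while the one up to ν
    -- - i is wanted. A second difference, which costs at most v M₂, makes up for it; `step⁺` has no
    -- such term.
    step⁻ : ∀ i → (v + ι (suc i)) * Pr (ν ℤ.- + suc i) ≤ v * Pr (ν ℤ.- + i) + E₀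
    step⁻ i = subst (λ e → (v + ι (suc i)) * Pr e ≤ v * Pr (ν ℤ.- + i) + E₀) (sym (ℤ-suc ν i))
      (combine (Pr m) (Pr (ν ℤ.- + i)) (Pr (m ℤ.- + 1)) (ιℤ ν) (μ L) (½ * (k * M₂)) (ι (suc i)) (v * M₂) ε₀ vM₂ (proj₂ (δP m)) (subst (_≤ v * Δ^ 2 Pr (ν ℤ.- + i)) (sym (neg-distribʳ-* v M₂)) (*-monoˡ v v≥0 (proj₁ (Δ²-whole (ν ℤ.- + i)))))
        (subst (λ e → - (½ * (k * M₂)) ≤ (e - μ L) * Pr m + v * Δ Pr m) position (proj₁ (equation₀ m))))
      where
      m = ν ℤ.- + i ℤ.- + 1
      position : ιℤ m ≡ ιℤ ν - ι (suc i)
      position = trans (cong ιℤ (sym (ℤ-suc ν i))) (ιℤ-- ν (+ suc i))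
      combine : ∀ P P⁺ P⁻ n u e j f → e ≤ + 4968 / 100000 → f ≤ + 12 / 100000 → (n - u) * P ≤ + 1 / 10000 → - f ≤ v * (P⁺ - P - (P - P⁻)) → - e ≤ (n - j - u) * P + v * (P - P⁻) → (v + j) * P ≤ v * P⁺ + E₀
      combine P P⁺ P⁻ n u e j f h₁ h₂ h₃ h₄ h₅ = le-by (0≤+ (0≤+ (0≤+ (≤⇒0≤ h₁) (≤⇒0≤ h₂)) (≤⇒0≤ h₃)) (0≤+ (≤⇒0≤ h₄) (≤⇒0≤ h₅))) (l v P P⁺ P⁻ n u e j f)
        where
        l : ∀ v P P⁺ P⁻ n u e j f → v * P⁺ + + 499 / 10000 ≡ (v + j) * P + (+ 4968 / 100000 - e + (+ 12 / 100000 - f) + (+ 1 / 10000 - (n - u) * P) + (v * (P⁺ - P - (P - P⁻)) - - f + ((n - j - u) * P + v * (P - P⁻) - - e)))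
        l = solve-∀ ringℚ

    U-upper : ∀ N → N ℕ.≤ H → + 8 / 1 * (v * v) * U N ≤ d * profileSum (h * h) v (ι N) + + 8 / 1 * (v * E₀) * absSum (h * h) (ι N)
    U-upper zero _ = ≤-reflexive (trans (l v (h * h) d) (sym (cong₂ (λ e f → d * e + + 8 / 1 * (v * E₀) * f) (trans (cong (profileSum (h * h) v) ιℤ-0) (profileSum-0 (h * h) v)) (cong (absSum (h * h)) ιℤ-0))))
      where
      l : ∀ v A d → + 8 / 1 * (v * v) * (A * d) ≡ d * (A * ((0ℚ * 0ℚ - 2ℚ * v) * (0ℚ * 0ℚ - 2ℚ * v) + + 4 / 1 * (v * v))) + + 8 / 1 * (v * (+ 499 / 10000)) * (A * (0ℚ * (0ℚ + 1ℚ)) - ½ * (0ℚ * (0ℚ + 1ℚ) * (0ℚ * (0ℚ + 1ℚ))))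
      l = solve-∀ ringℚ
    U-upper (suc N) N≤ = ≤-trans
      (le-by (0≤+ (≤⇒0≤ (U-upper N (ℕ.<⇒≤ N≤))) (0≤* coef (0≤+ (≤⇒0≤ (below⁺ (suc N))) (≤⇒0≤ (below⁻ (suc N))))))
        (l (+ 8 / 1 * (v * v)) (U N) (Pr (ν ℤ.+ + suc N)) (Pr (ν ℤ.- + suc N)) (h * h - ι (suc N) * ι (suc N)) d (profileSum (h * h) v (ι N)) (+ 8 / 1 * (v * E₀)) (absSum (h * h) (ι N)) (profile v (ι (suc N))) (ι (suc N))))
      (≤-reflexive (cong₂ (λ e f → d * e + + 8 / 1 * (v * E₀) * f)
        (trans (cong (λ n → profileSum (h * h) v (ι N) + 2ℚ * ((h * h - n * n) * profile v n)) (ι-suc N)) (trans (sym (profileSum-suc (h * h) v (ι N))) (cong (profileSum (h * h) v) (sym (ι-suc N)))))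
        (trans (cong (λ n → absSum (h * h) (ι N) + 2ℚ * ((h * h - n * n) * n)) (ι-suc N)) (trans (sym (absSum-suc (h * h) (ι N))) (cong (absSum (h * h)) (sym (ι-suc N)))))))
      where
      coef : 0ℚ ≤ h * h - ι (suc N) * ι (suc N)
      coef = ≤⇒0≤ (*-mono (0≤ι (suc N)) (ι-mono N≤) (0≤ι (suc N)) (ι-mono N≤))
      below⁺ : ∀ i → + 8 / 1 * (v * v) * Pr (ν ℤ.+ + i) ≤ d * profile v (ι i) + + 8 / 1 * (v * E₀) * ι i
      below⁺ i = subst (λ e → + 8 / 1 * (v * v) * Pr (ν ℤ.+ + i) ≤ Pr e * profile v (ι i) + + 8 / 1 * (v * E₀) * ι i) (ℤ.+-identityʳ ν) (below-profile (λ i → Pr (ν ℤ.+ + i)) v≥4 ≤! (0≤P (ν ℤ.+ + 0)) step⁺ i)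
      below⁻ : ∀ i → + 8 / 1 * (v * v) * Pr (ν ℤ.- + i) ≤ d * profile v (ι i) + + 8 / 1 * (v * E₀) * ι i
      below⁻ i = subst (λ e → + 8 / 1 * (v * v) * Pr (ν ℤ.- + i) ≤ Pr e * profile v (ι i) + + 8 / 1 * (v * E₀) * ι i) (ℤ.+-identityʳ ν) (below-profile (λ i → Pr (ν ℤ.- + i)) v≥4 ≤! (0≤P (ν ℤ.- + 0)) step⁻ i)
      l : ∀ V U p p′ c d S E B G i → d * (S + 2ℚ * (c * G)) + E * (B + 2ℚ * (c * i)) ≡ V * (U + c * (p + p′)) + (d * S + E * B - V * U + c * (d * G + E * i - V * p + (d * G + E * i - V * p′)))
      l = solve-∀ ringℚ

    d≥0 : 0ℚ ≤ d
    d≥0 = 0≤P ν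

    -- The expectation of h² - (S - ν)² is h² - V - (μ - ν)², and only the window |i| ≤ h
    -- contributes positively. If P were merely at most d there, √(3V) would be the best half-width
    -- and d h ≥ ½ the limit of the method; the profile improves this to 0.555. The Gaussian value
    -- is √(3/2π) = 0.690....
    dh-lower : + 555 / 1000 ≤ d * h
    dh-lower = combine (profileSum-upper g≥0 w≥0 w≤) (window-lower g≥0 w≥0 w≤ η≤1)
      where
      g w η : ℚ
      g = h - + 8800 / 1
      w = + 3 / 1 * v - h * h
      η = (μ L - ιℤ ν) * (μ L - ιℤ ν)
      g≥0 : 0ℚ ≤ g
      g≥0 = ≤⇒0≤ h≥8800
      w≥0 : 0ℚ ≤ w
      w≥0 = ≤⇒0≤ H-lower
      w≤ : w ≤ 2ℚ * (+ 8800 / 1 + g) + 1ℚ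
      w≤ = le-by (≤⇒0≤ H-upper) (l v h)
        where
        l : ∀ v h → 2ℚ * (+ 8800 / 1 + (h - + 8800 / 1)) + 1ℚ ≡ + 3 / 1 * v - h * h + ((h + 1ℚ) * (h + 1ℚ) - + 3 / 1 * v)
        l = solve-∀ ringℚ
      η≤1 : η ≤ 1ℚ
      η≤1 = ≤-trans (proj₂ (±-mul flipped flipped)) ≤!
        where
        flipped : μ L - ιℤ ν ∈± + 1 / 10000
        flipped = subst (_∈± + 1 / 10000) (l (ιℤ ν) (μ L)) (±-neg centred)
          where
          l : ∀ a b → - (a - b) ≡ b - a
          l = solve-∀ ringℚ
      h≡ : + 8800 / 1 + g ≡ h
      h≡ = l h
        where
        l : ∀ h → + 8800 / 1 + (h - + 8800 / 1) ≡ h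
        l = solve-∀ ringℚ
      v≡ : + 1 / 3 * (h * h + w) ≡ v
      v≡ = l v h
        where
        l : ∀ v h → + 1 / 3 * (h * h + (+ 3 / 1 * v - h * h)) ≡ v
        l = solve-∀ ringℚ
      combine : (let h′ = + 8800 / 1 + g ; V = + 1 / 3 * (h′ * h′ + w) in profileSum (h′ * h′) V h′ ≤ + 8 / 1 * (V * V) * (+ 1065 / 1000 * (h′ * (h′ * h′)))) →
        (let h′ = + 8800 / 1 + g ; V = + 1 / 3 * (h′ * h′ + w) in + 499 / 10000 * absSum (h′ * h′) h′ + V * (+ 555 / 1000 * (+ 1065 / 1000) * (h′ * h′)) ≤ V * (h′ * h′ - (V + η))) →
        + 555 / 1000 ≤ d * h
      combine p₁ p₂ = *-cancelˡ (+ 8 / 1 * (v * v) * (+ 1065 / 1000 * (h * h))) (0<* (0<* {+ 8 / 1} <! (0<* v>0 v>0)) (0<* {+ 1065 / 1000} <! (0<* h>0 h>0)))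
        (le-by (0≤+ (0≤+ (0≤* d≥0 (≤⇒0≤ p₁′)) (0≤* (0≤* {+ 8 / 1} ≤! v≥0) (≤⇒0≤ p₂′))) (0≤+ (≤⇒0≤ (U-upper H ℕ.≤-refl)) (0≤* (0≤* {+ 8 / 1} ≤! (0≤sq v)) (≤⇒0≤ (window H refl)))))
          (l v h d η (profileSum (h * h) v h) (absSum (h * h) h) (U H)))
        where
        p₁′ : profileSum (h * h) v h ≤ + 8 / 1 * (v * v) * (+ 1065 / 1000 * (h * (h * h)))
        p₁′ = subst (λ V → profileSum (h * h) V h ≤ + 8 / 1 * (V * V) * (+ 1065 / 1000 * (h * (h * h)))) v≡
          (subst (λ h′ → profileSum (h′ * h′) (+ 1 / 3 * (h′ * h′ + w)) h′ ≤ + 8 / 1 * (+ 1 / 3 * (h′ * h′ + w) * (+ 1 / 3 * (h′ * h′ + w))) * (+ 1065 / 1000 * (h′ * (h′ * h′)))) h≡ p₁)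
        p₂′ : + 499 / 10000 * absSum (h * h) h + v * (+ 555 / 1000 * (+ 1065 / 1000) * (h * h)) ≤ v * (h * h - (v + η))
        p₂′ = subst (λ V → + 499 / 10000 * absSum (h * h) h + V * (+ 555 / 1000 * (+ 1065 / 1000) * (h * h)) ≤ V * (h * h - (V + η))) v≡
          (subst (λ h′ → + 499 / 10000 * absSum (h′ * h′) h′ + + 1 / 3 * (h′ * h′ + w) * (+ 555 / 1000 * (+ 1065 / 1000) * (h′ * h′)) ≤ + 1 / 3 * (h′ * h′ + w) * (h′ * h′ - (+ 1 / 3 * (h′ * h′ + w) + η))) h≡ p₂)
        l : ∀ v h d η S B U → + 8 / 1 * (v * v) * (+ 1065 / 1000 * (h * h)) * (d * h) ≡ + 8 / 1 * (v * v) * (+ 1065 / 1000 * (h * h)) * (+ 555 / 1000) +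
          (d * (+ 8 / 1 * (v * v) * (+ 1065 / 1000 * (h * (h * h))) - S) + + 8 / 1 * v * (v * (h * h - (v + η)) - (+ 499 / 10000 * B + v * (+ 555 / 1000 * (+ 1065 / 1000) * (h * h))))
          + (d * S + + 8 / 1 * (v * (+ 499 / 10000)) * B - + 8 / 1 * (v * v) * U + + 8 / 1 * (v * v) * (U - (h * h - (v + η)))))
        l = solve-∀ ringℚ

    θ : ℚ
    θ = recip h

    hθ : h * θ ≡ 1ℚ
    hθ = *-recip h>0

    θ≥0 : 0ℚ ≤ θ
    θ≥0 = 0≤recip h>0

    θ>0 : 0ℚ < θ
    θ>0 = *-cancelˡ-<-nonNeg h {{nonNegative h≥0}} (subst₂ _<_ (sym (*-zeroʳ h)) (sym hθ) <!)

    θ≤ : θ ≤ + 1 / 8800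
    θ≤ = *-cancelˡ h h>0 (≤-trans (≤-reflexive hθ) (≤-trans ≤! (*-monoʳ (+ 1 / 8800) ≤! h≥8800)))

    d>0 : 0ℚ < d
    d>0 = subst (0ℚ <_) (trans (*-assoc d h θ) (trans (cong (d *_) hθ) (*-identityʳ d))) (0<* (<-≤-trans {0ℚ} {+ 555 / 1000} <! dh-lower) θ>0)

    prev : Pr (ν ℤ.- + 1) ≡ d - c
    prev = l d (Pr (ν ℤ.- + 1))
      where
      l : ∀ a b → b ≡ a - (a - b)
      l = solve-∀ ringℚ

    -- The error bounds below are multiplied by powers of h θ = 1 to compare them with d h.
    c-bound : c ∈± d * θ * (+ 27 / 100)
    c-bound = unv (subst (_∈± E₀) (l v c (δ₀ * d)) (±-weaken (±-- (equation₀ ν) (δP ν)) (≤-trans (+-monoˡ-≤ (+ 1 / 10000) ε₀) ≤!)))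
      where
      l : ∀ v c t → t + v * c - t ≡ v * c
      l = solve-∀ ringℚ
      -- As 3V ≥ h², the right side is at least 0.09 d h ≥ 0.09 · 0.555 = 0.04995.
      big : E₀ ≤ v * (d * θ * (+ 27 / 100))
      big = ≤-trans (≤-trans ≤! (*-monoˡ (+ 9 / 100) ≤! dh-lower)) (le-by (0≤* (0≤* {+ 9 / 100} ≤! (0≤* d≥0 θ≥0)) (≤⇒0≤ H-lower)) (eq-by (0*diff (- (+ 9 / 100 * (d * h))) (sym hθ)) (l′ v d h θ)))
        where
        l′ : ∀ v d h θ → v * (d * θ * (+ 27 / 100)) ≡ + 9 / 100 * (d * h) + + 9 / 100 * (d * θ) * (+ 3 / 1 * v - h * h) + (- (+ 9 / 100 * (d * h))) * (1ℚ - h * θ)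
        l′ = solve-∀ ringℚ
      unv : v * c ∈± E₀ → c ∈± d * θ * (+ 27 / 100)
      unv (lo , hi) = *-cancelˡ v v>0 (≤-trans (≤-reflexive (sym (neg-distribʳ-* v (d * θ * (+ 27 / 100))))) (≤-trans (neg-antimono-≤ big) lo)) , *-cancelˡ v v>0 (≤-trans hi big)

    -- The interpolation is best when its two terms are equal, that is for τ h = √(6.8382 / 0.573) =
    -- 3.454...; hence 69/20.
    τ τ′ M₃ : ℚ
    τ = + 69 / 20 * θ
    τ′ = + 20 / 69 * h
    M₃ = ½ * τ * M₂ + ½ * τ′ * M₄

    ττ′ : τ * τ′ ≡ 1ℚ
    ττ′ = trans (l θ h) hθ
      where
      l : ∀ θ h → + 69 / 20 * θ * (+ 20 / 69 * h) ≡ h * θ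
      l = solve-∀ ringℚ

    hhM₄ : h * h * (M₄ * h) ≤ + 68382 / 10000 * (x * (x * x))
    hhM₄ = ≤-trans (*-mono (0≤sq h) HH (0≤* M₄≥0 h≥0) M₄H) (≤-reflexive (trans (l Θ (x * (x * x))) (trans (cong (+ 68382 / 10000 * (x * (x * x)) *_) XΘ) (*-identityʳ _))))
      where
      l : ∀ t X → + 522 / 100 * t * (+ 131 / 100 * (X * X)) ≡ + 68382 / 10000 * X * (X * t)
      l = solve-∀ ringℚ

    hhM₃ : h * h * M₃ ≤ + 19795 / 10000 * (x * (x * x))
    hhM₃ = ≤-trans (≤-reflexive (eq-by (0*diff (+ 69 / 40 * (M₂ * h)) hθ) (l h θ M₂ M₄)))
      (≤-trans (+-mono-≤ (*-monoˡ (+ 69 / 40) ≤! M₂H) (*-monoˡ (+ 10 / 69) ≤! hhM₄)) (le-by (0≤* {+ 19795 / 10000 - + 69 / 40 * (+ 573 / 1000) - + 10 / 69 * (+ 68382 / 10000)} ≤! X≥0) (l′ (x * (x * x)))))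
      where
      l : ∀ h θ m₂ m₄ → h * h * (½ * (+ 69 / 20 * θ) * m₂ + ½ * (+ 20 / 69 * h) * m₄) ≡ + 69 / 40 * (m₂ * h) + + 10 / 69 * (h * h * (m₄ * h)) + + 69 / 40 * (m₂ * h) * (h * θ - 1ℚ)
      l = solve-∀ ringℚ
      l′ : ∀ X → + 19795 / 10000 * X ≡ + 69 / 40 * (+ 573 / 1000 * X) + + 10 / 69 * (+ 68382 / 10000 * X) + (+ 19795 / 10000 - + 69 / 40 * (+ 573 / 1000) - + 10 / 69 * (+ 68382 / 10000)) * X
      l′ = solve-∀ ringℚ

    private
      -- k m ≤ 6 T Θ c X = 6 c T ≤ 6 c λ h
      k-times : ∀ {m κ} → 0ℚ ≤ m → 0ℚ ≤ κ → m ≤ κ * (x * (x * x)) → ½ * (k * m) ≤ + 3 / 1 * (κ * (+ 289 / 10000)) * h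
      k-times {m} {κ} m≥0 κ≥0 hm = ≤-trans (*-monoˡ ½ ≤! (*-mono k≥0 k-upper m≥0 hm)) (≤-trans (≤-reflexive (trans (l (T * Θ) (κ * (x * (x * x)))) (cong (+ 3 / 1 *_) (XΘ-cancel κ))))
        (≤-trans (*-monoˡ (+ 3 / 1) ≤! (*-monoˡ κ κ≥0 T≤λh)) (≤-reflexive (l′ κ h))))
        where
        l : ∀ a b → ½ * (+ 6 / 1 * a * b) ≡ + 3 / 1 * (a * b)
        l = solve-∀ ringℚ
        l′ : ∀ κ h → + 3 / 1 * (κ * (+ 289 / 10000 * h)) ≡ + 3 / 1 * (κ * (+ 289 / 10000)) * h
        l′ = solve-∀ ringℚ

    M₃≥0 : 0ℚ ≤ M₃
    M₃≥0 = 0≤+ (0≤* (0≤* {½} ≤! (0≤* {+ 69 / 20} ≤! θ≥0)) M₂≥0) (0≤* (0≤* {½} ≤! (0≤* {+ 20 / 69} ≤! h≥0)) M₄≥0)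

    -- The absolute error becomes relative to d through d h ≥ 0.555: 3 · 1.9795 · 0.0289 / 0.555 =
    -- 0.309.... In the same way `ε₂` has 3 · 6.8382 · 0.0289 / 0.555 = 1.068....
    ε₁ : ½ * (k * M₃) ≤ d * (+ 31 / 100)
    ε₁ = *-cancelˡ (h * h) (0<* h>0 h>0) (≤-trans (≤-reflexive (l (h * h) k M₃)) (≤-trans (k-times {κ = + 19795 / 10000} (0≤* (0≤sq h) M₃≥0) ≤! hhM₃)
      (≤-trans (*-monoʳ h h≥0 (≤-trans (≤! {+ 3 / 1 * (+ 19795 / 10000 * (+ 289 / 10000))} {+ 31 / 100 * (+ 555 / 1000)}) (*-monoˡ (+ 31 / 100) ≤! dh-lower))) (≤-reflexive (l′ d h)))))
      where
      l : ∀ h k m → h * (½ * (k * m)) ≡ ½ * (k * (h * m))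
      l = solve-∀ ringℚ
      l′ : ∀ d h → + 31 / 100 * (d * h) * h ≡ h * h * (d * (+ 31 / 100))
      l′ = solve-∀ ringℚ

    ε₂ : ½ * (k * M₄) ≤ d * θ * (+ 107 / 100)
    ε₂ = *-cancelˡ (h * h * h) (0<* (0<* h>0 h>0) h>0) (≤-trans (≤-reflexive (l h k M₄)) (≤-trans (k-times {κ = + 68382 / 10000} (0≤* (0≤sq h) (0≤* M₄≥0 h≥0)) ≤! hhM₄)
      (≤-trans (*-monoʳ h h≥0 (≤-trans (≤! {+ 3 / 1 * (+ 68382 / 10000 * (+ 289 / 10000))} {+ 107 / 100 * (+ 555 / 1000)}) (*-monoˡ (+ 107 / 100) ≤! dh-lower))) (≤-reflexive (eq-by (0*diff (+ 107 / 100 * (d * h * h)) (sym hθ)) (l′ d h θ))))))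
      where
      l : ∀ h k m → h * h * h * (½ * (k * m)) ≡ ½ * (k * (h * h * (m * h)))
      l = solve-∀ ringℚ
      l′ : ∀ d h θ → + 107 / 100 * (d * h) * h ≡ h * h * h * (d * θ * (+ 107 / 100)) + + 107 / 100 * (d * h * h) * (1ℚ - h * θ)
      l′ = solve-∀ ringℚ

    Zero First : ℤ → ℚ
    Zero _ = 0ℚ
    First m = Pr (m ℤ.- + 1) + Δ Zero m

    stein₁ : ∀ m → (ιℤ m - μ L) * Δ Pr m + First m ≡ steinSum 1 L m
    stein₁ = stein-Δ 0 L Pr Zero λ m → trans (+-identityʳ _) (stein L m)

    stein₂ : ∀ m → (ιℤ m - μ L) * Δ (Δ Pr) m + (Δ Pr (m ℤ.- + 1) + Δ First m) ≡ steinSum 2 L m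
    stein₂ = stein-Δ 1 L (Δ Pr) First stein₁

    first-order : v * b + d - (1ℚ - δ₀) * c ∈± d * (+ 31 / 100)
    first-order = subst (_∈± d * (+ 31 / 100)) (l (δ₀) d (Pr (ν ℤ.- + 1)) v b)
      (±-weaken (subst (λ e → e + v * b ∈± ½ * (k * M₃)) (sym (stein₁ ν)) (stein-error 0≤p p≤½ 1 L (Δ³-bound {τ = τ} {τ′ = τ′} (0≤* {+ 69 / 20} ≤! θ≥0) (0≤* {+ 20 / 69} ≤! h≥0) ττ′) ν)) ε₁)
      where
      l : ∀ δ d d′ v b → δ * (d - d′) + (d′ + (0ℚ - 0ℚ)) + v * b ≡ v * b + d - (1ℚ - δ) * (d - d′)
      l = solve-∀ ringℚ

    second-order : v * a + δ₀ * b + + 2 / 1 * (c - b) ∈± d * θ * (+ 107 / 100)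
    second-order = subst (_∈± d * θ * (+ 107 / 100)) (l δ₀ d (Pr (ν ℤ.- + 1)) (Pr (ν ℤ.- + 1 ℤ.- + 1)) v a)
      (±-weaken (subst (λ e → e + v * a ∈± ½ * (k * M₄)) (sym (stein₂ ν)) (stein-error 0≤p p≤½ 2 L Δ⁴-bound ν)) ε₂)
      where
      l : ∀ δ d d′ d″ v a → δ * (d - d′ - (d′ - d″)) + (d′ - d″ + (d′ + (0ℚ - 0ℚ) - (d″ + (0ℚ - 0ℚ)))) + v * a ≡ v * a + δ * (d - d′ - (d′ - d″)) + + 2 / 1 * (d - d′ - (d - d′ - (d′ - d″)))
      l = solve-∀ ringℚ

    private
      normalise : ∀ {y s κ} → 0ℚ < s → y ∈± s * κ → y * recip s ∈± κ × y ≡ s * (y * recip s)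
      normalise {y} {s} {κ} s>0 h = subst (y * recip s ∈±_) (trans (l (recip s) s κ) (trans (cong (_* κ) (*-recip s>0)) (*-identityˡ κ))) (subst (_∈± recip s * (s * κ)) (*-comm (recip s) y) (±-* (recip s) (0≤recip s>0) h)) ,
        sym (trans (l′ s y (recip s)) (trans (cong (_* y) (*-recip s>0)) (*-identityˡ y)))
        where
        l : ∀ r s κ → r * (s * κ) ≡ s * r * κ
        l = solve-∀ ringℚ
        l′ : ∀ s y r → s * (y * r) ≡ s * r * y
        l′ = solve-∀ ringℚ
      dθ>0 : 0ℚ < d * θ
      dθ>0 = 0<* d>0 θ>0
      dθθ>0 : 0ℚ < d * (θ * θ)
      dθθ>0 = 0<* d>0 (0<* θ>0 θ>0)
      cn = normalise dθ>0 c-bound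
      e₁n = normalise d>0 first-order
      e₂n = normalise dθ>0 second-order
      w-lower : + 1 / 3 ≤ v * (θ * θ)
      w-lower = *-cancelˡ (+ 3 / 1) <! (≤-trans (≤-reflexive (sym (trans (l h θ) (cong₂ _*_ hθ hθ)))) (≤-trans (*-monoʳ (θ * θ) (0≤sq θ) H-lower) (≤-reflexive (*-assoc (+ 3 / 1) v (θ * θ)))))
        where
        l : ∀ h θ → h * h * (θ * θ) ≡ h * θ * (h * θ)
        l = solve-∀ ringℚ
      w-upper : v * (θ * θ) ≤ + 3335 / 10000
      w-upper = *-cancelˡ (+ 3 / 1) <! (≤-trans (≤-reflexive (sym (*-assoc (+ 3 / 1) v (θ * θ)))) (≤-trans (*-monoʳ (θ * θ) (0≤sq θ) H-upper)
        (≤-trans (≤-reflexive (trans (l h θ) (cong (λ e → (e + θ) * (e + θ)) hθ))) (≤-trans (*-mono (0≤+ {1ℚ} ≤! θ≥0) (+-monoʳ-≤ 1ℚ θ≤) (0≤+ {1ℚ} ≤! θ≥0) (+-monoʳ-≤ 1ℚ θ≤)) ≤!))))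
        where
        l : ∀ h θ → (h + 1ℚ) * (h + 1ℚ) * (θ * θ) ≡ (h * θ + θ) * (h * θ + θ)
        l = solve-∀ ringℚ
      b-eq : b ≡ d * (θ * θ) * (b * recip (d * (θ * θ)))
      b-eq = sym (trans (l (d * (θ * θ)) b (recip (d * (θ * θ)))) (trans (cong (_* b) (*-recip dθθ>0)) (*-identityˡ b)))
        where
        l : ∀ s y r → s * (y * r) ≡ s * r * y
        l = solve-∀ ringℚ
      module C = Cubic {a} {b} {c} {d} {θ} {v} {δ₀} d>0 θ>0 θ≤ v>0 w-lower w-upper centred (proj₁ cn) (proj₁ e₁n) (proj₁ e₂n) (proj₂ cn) b-eq (proj₂ e₁n) (proj₂ e₂n)

    log-concave : 0ℚ ≤ c * c - b * d
    log-concave = C.log-concave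

    turán : 0ℚ ≤ + 4 / 1 * ((b * b - a * c) * (c * c - b * d)) - (b * c - a * d) * (b * c - a * d)
    turán = C.turán

  -- Choice of the tilt

  prob : ℚ → ℕ → ℚ
  prob r j = r ^ j * recip (1ℚ + r ^ j)

  mean : ℚ → ℕ → ℚ
  mean r M = Σᴸ (λ j → ι j * prob r j) (parts M)

  floor-sqrt : ∀ y → 0ℚ ≤ y → ∃ λ n → ι n * ι n ≤ y × y ≤ (ι n + 1ℚ) * (ι n + 1ℚ)
  floor-sqrt y y≥0 = search (proj₁ ar) (≤-trans (proj₂ ar) (le-by (0≤+ (0≤+ (0≤ι (proj₁ ar)) (0≤sq (ι (proj₁ ar)))) (≤! {0ℚ} {1ℚ})) (l (ι (proj₁ ar)))))
    where
    ar = archimedean y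
    l : ∀ n → (n + 1ℚ) * (n + 1ℚ) ≡ n + (n + n * n + 1ℚ)
    l = solve-∀ ringℚ
    search : ∀ n → y ≤ (ι n + 1ℚ) * (ι n + 1ℚ) → ∃ λ n → ι n * ι n ≤ y × y ≤ (ι n + 1ℚ) * (ι n + 1ℚ)
    search zero    h = 0 , ≤-trans (≤-reflexive (cong₂ _*_ ιℤ-0 ιℤ-0)) y≥0 , h
    search (suc n) h = [ (λ p → suc n , p , h) , (λ p → search n (≤-trans p (≤-reflexive (cong₂ _*_ e e)))) ]′ (≤-total (ι (suc n) * ι (suc n)) y)
      where
      e : ι (suc n) ≡ ι n + 1ℚ
      e = trans (ι-suc n) (+-comm 1ℚ (ι n))

  -- The first crossing of a level on a grid
  crossing : ∀ (f : ℕ → ℚ) c D → f 0 ≤ c → c ≤ f D → ∃ λ i → i ℕ.≤ D × f i ≤ c × (i ≡ D ⊎ (suc i ℕ.≤ D × c ≤ f (suc i)))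
  crossing f c zero    h₀ h = 0 , ℕ.z≤n , h₀ , inj₁ refl
  crossing f c (suc D) h₀ h = [ (λ p → suc D , ℕ.≤-refl , p , inj₁ refl) , below ]′ (≤-total (f (suc D)) c)
    where
    extend : (∃ λ i → i ℕ.≤ D × f i ≤ c × (i ≡ D ⊎ (suc i ℕ.≤ D × c ≤ f (suc i)))) → ∃ λ i → i ℕ.≤ suc D × f i ≤ c × (i ≡ suc D ⊎ (suc i ℕ.≤ suc D × c ≤ f (suc i)))
    extend (i , i≤ , p , inj₁ refl) = i , ℕ.m≤n⇒m≤1+n i≤ , p , inj₂ (ℕ.≤-refl , h)
    extend (i , i≤ , p , inj₂ (q , r)) = i , ℕ.m≤n⇒m≤1+n i≤ , p , inj₂ (ℕ.m≤n⇒m≤1+n q , r)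
    below : c ≤ f (suc D) → ∃ λ i → i ℕ.≤ suc D × f i ≤ c × (i ≡ suc D ⊎ (suc i ℕ.≤ suc D × c ≤ f (suc i)))
    below _ = [ (λ p → D , ℕ.n≤1+n D , p , inj₂ (ℕ.≤-refl , h)) , (λ p → extend (crossing f c D h₀ p)) ]′ (≤-total (f D) c)

  ^-lipschitz : ∀ {r r′} → 0ℚ ≤ r → r ≤ r′ → r′ ≤ 1ℚ → ∀ j → r′ ^ j - r ^ j ≤ ι j * (r′ - r)
  ^-lipschitz {r} {r′} r≥0 r≤r′ r′≤1 zero = ≤-trans ≤! (≤-reflexive (sym (trans (cong (_* (r′ - r)) ιℤ-0) (*-zeroˡ (r′ - r)))))
  ^-lipschitz {r} {r′} r≥0 r≤r′ r′≤1 (suc j) = ≤-trans (le-by (0≤+ (0≤* (≤⇒0≤ r′≤1) (0≤* (0≤ι j) (≤⇒0≤ r≤r′))) (0≤+ (0≤* r′≥0 (≤⇒0≤ (^-lipschitz r≥0 r≤r′ r′≤1 j))) (0≤* (≤⇒0≤ r≤r′) (≤⇒0≤ (^≤1 r≥0 (≤-trans r≤r′ r′≤1) j)))))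
      (l r r′ (r ^ j) (r′ ^ j) (ι j))) (≤-reflexive (cong (_* (r′ - r)) (sym (ι-suc j))))
    where
    r′≥0 : 0ℚ ≤ r′
    r′≥0 = ≤-trans r≥0 r≤r′
    l : ∀ r r′ u u′ j → (1ℚ + j) * (r′ - r) ≡ r′ * u′ - r * u + ((1ℚ - r′) * (j * (r′ - r)) + (r′ * (j * (r′ - r) - (u′ - u)) + (r′ - r) * (1ℚ - u)))
    l = solve-∀ ringℚ

  -- On u ≥ 0 the function u / (1 + u) has slope at most one.
  prob-lipschitz : ∀ {r r′} → 0ℚ ≤ r → r ≤ r′ → r′ ≤ 1ℚ → ∀ j → prob r′ j - prob r j ≤ ι j * (r′ - r)
  prob-lipschitz {r} {r′} r≥0 r≤r′ r′≤1 j = ≤-trans (combine (r ^ j) (r′ ^ j) (recip (1ℚ + r ^ j)) (recip (1ℚ + r′ ^ j)) (^-mono r≥0 r≤r′ j) (0≤^ r≥0 j) (0≤^ r′≥0 j)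
      (0≤recip (0<+ {1ℚ} <! (0≤^ r≥0 j))) (0≤recip (0<+ {1ℚ} <! (0≤^ r′≥0 j))) (*-recip (0<+ {1ℚ} <! (0≤^ r≥0 j))) (*-recip (0<+ {1ℚ} <! (0≤^ r′≥0 j)))) (^-lipschitz r≥0 r≤r′ r′≤1 j)
    where
    r′≥0 : 0ℚ ≤ r′
    r′≥0 = ≤-trans r≥0 r≤r′
    combine : ∀ u u′ w w′ → u ≤ u′ → 0ℚ ≤ u → 0ℚ ≤ u′ → 0ℚ ≤ w → 0ℚ ≤ w′ → (1ℚ + u) * w ≡ 1ℚ → (1ℚ + u′) * w′ ≡ 1ℚ → u′ * w′ - u * w ≤ u′ - u
    combine u u′ w w′ u≤u′ u≥0 u′≥0 w≥0 w′≥0 e e′ = le-by (0≤* (≤⇒0≤ u≤u′) (0≤+ (0≤* u≥0 w≥0) (0≤* (0≤* u′≥0 w′≥0) w≥0)))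
      (eq-by (0+ (0*diff (1ℚ - w′ - (u′ - u)) e) (0*diff (w - 1ℚ - (u′ - u) * w) e′)) (l u u′ w w′))
      where
      l : ∀ u u′ w w′ → u′ - u ≡ u′ * w′ - u * w + (u′ - u) * (u * w + u′ * w′ * w) + ((1ℚ - w′ - (u′ - u)) * ((1ℚ + u) * w - 1ℚ) + (w - 1ℚ - (u′ - u) * w) * ((1ℚ + u′) * w′ - 1ℚ))
      l = solve-∀ ringℚ

  squares-upper : ∀ M → Σᴸ (λ j → ι j * ι j) (parts M) ≤ ι M * (ι M * ι M)
  squares-upper zero    = ≤-reflexive (sym (trans (cong (_* (ι 0 * ι 0)) ιℤ-0) (*-zeroˡ (ι 0 * ι 0))))
  squares-upper (suc M) = ≤-trans (+-monoʳ-≤ (ι (suc M) * ι (suc M)) (squares-upper M)) (≤-trans (le-by (0≤+ (0≤* {2ℚ} ≤! (0≤sq (ι M))) (0≤ι M)) (l (ι M)))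
      (≤-reflexive (cong (λ e → e * (e * e)) (sym (ι-suc M)))) ≤∘ cong (λ e → e * e + ι M * (ι M * ι M)) (ι-suc M))
    where
    _≤∘_ : ∀ {a b c} → b ≤ c → a ≡ b → a ≤ c
    p ≤∘ refl = p
    l : ∀ M → (1ℚ + M) * ((1ℚ + M) * (1ℚ + M)) ≡ (1ℚ + M) * (1ℚ + M) + M * (M * M) + (2ℚ * (M * M) + M)
    l = solve-∀ ringℚ

  mean-lipschitz : ∀ {r r′} → 0ℚ ≤ r → r ≤ r′ → r′ ≤ 1ℚ → ∀ M → mean r′ M - mean r M ≤ ι M * (ι M * ι M) * (r′ - r)
  mean-lipschitz {r} {r′} r≥0 r≤r′ r′≤1 M = ≤-trans (sums M) (*-monoʳ (r′ - r) (≤⇒0≤ r≤r′) (squares-upper M))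
    where
    l : ∀ j a b s t → j * b + t - (j * a + s) ≡ j * (b - a) + (t - s)
    l = solve-∀ ringℚ
    l′ : ∀ j d S → j * (j * d) + S * d ≡ (j * j + S) * d
    l′ = solve-∀ ringℚ
    sums : ∀ M → mean r′ M - mean r M ≤ Σᴸ (λ j → ι j * ι j) (parts M) * (r′ - r)
    sums zero    = ≤-reflexive (sym (*-zeroˡ (r′ - r)))
    sums (suc M) = ≤-trans (≤-reflexive (l (ι (suc M)) (prob r (suc M)) (prob r′ (suc M)) (mean r M) (mean r′ M)))
      (≤-trans (+-mono-≤ (*-monoˡ (ι (suc M)) (0≤ι (suc M)) (prob-lipschitz r≥0 r≤r′ r′≤1 (suc M))) (sums M))
        (≤-reflexive (l′ (ι (suc M)) (r′ - r) (Σᴸ (λ j → ι j * ι j) (parts M)))))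

  -- Σ j r^j in closed form
  weighted-geometric : ∀ r M → (1ℚ - r) * (1ℚ - r) * Σᴸ (λ j → ι j * r ^ j) (parts M) + r * (r ^ M * (1ℚ + ι M * (1ℚ - r))) ≡ r
  weighted-geometric r zero = trans (cong (λ e → (1ℚ - r) * (1ℚ - r) * 0ℚ + r * (1ℚ * (1ℚ + e * (1ℚ - r)))) ιℤ-0) (l r)
    where
    l : ∀ r → (1ℚ - r) * (1ℚ - r) * 0ℚ + r * (1ℚ * (1ℚ + 0ℚ * (1ℚ - r))) ≡ r
    l = solve-∀ ringℚ
  weighted-geometric r (suc M) = trans (cong (λ e → (1ℚ - r) * (1ℚ - r) * (e * (r * r ^ M) + S) + r * (r * r ^ M * (1ℚ + e * (1ℚ - r)))) (ι-suc M))
      (trans (l r (ι M) (r ^ M) S) (weighted-geometric r M))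
    where
    S = Σᴸ (λ j → ι j * r ^ j) (parts M)
    l : ∀ r M u S → (1ℚ - r) * (1ℚ - r) * ((1ℚ + M) * (r * u) + S) + r * (r * u * (1ℚ + (1ℚ + M) * (1ℚ - r))) ≡ (1ℚ - r) * (1ℚ - r) * S + r * (u * (1ℚ + M * (1ℚ - r)))
    l = solve-∀ ringℚ

  module Endpoint (ν : ℕ) (ν≥1 : 1ℚ ≤ ι ν) (x : ℚ) (x>0 : 0ℚ < x) (x≤ : x ≤ + 1 / 256)
    (lower : 1ℚ ≤ + 3 / 2 * (ι ν * (x * x))) (upper : ι ν * (x * x) ≤ 2ℚ) where

    M : ℕ
    M = 8 ℕ.* ν

    private
      r n R : ℚ
      r = 1ℚ - x
      n = ι ν
      R = r ^ ν

      x≥0 : 0ℚ ≤ x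
      x≥0 = <⇒≤ x>0

      r≥0 : 0ℚ ≤ r
      r≥0 = ≤⇒0≤ {x} {1ℚ} (≤-trans x≤ ≤!)

      r≤1 : r ≤ 1ℚ
      r≤1 = le-by x≥0 (l x)
        where
        l : ∀ x → 1ℚ ≡ 1ℚ - x + x
        l = solve-∀ ringℚ

      R≤ : R ≤ + 3 / 2 * x
      R≤ = le-by (0≤+ (0≤+ (0≤* (0≤* {+ 3 / 2} ≤! x≥0) (≤⇒0≤ (inverse-bernoulli x≥0 (≤-trans x≤ ≤!) ν))) (0≤* (0≤* {+ 3 / 2} ≤! x≥0) (0≤^ r≥0 ν))) (0≤* (0≤^ r≥0 ν) (≤⇒0≤ lower))) (l x n R)
        where
        l : ∀ x n R → + 3 / 2 * x ≡ R + (+ 3 / 2 * x * (1ℚ - R * (1ℚ + n * x)) + + 3 / 2 * x * R + R * (+ 3 / 2 * (n * (x * x)) - 1ℚ))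
        l = solve-∀ ringℚ

      M≡ : ι M ≡ + 8 / 1 * n
      M≡ = trans (ι-* 8 ν) (cong (_* n) (ιℤ-lit 8))

      quadratic : (1ℚ + ι M) * (1ℚ + ι M) + 2ℚ ≤ + 83 / 1 * (n * n)
      quadratic = ≤-trans (≤-reflexive (cong (λ e → (1ℚ + e) * (1ℚ + e) + 2ℚ) M≡)) (le-by (0≤* (≤⇒0≤ ν≥1) (0≤+ {b = + 3 / 1} (0≤* {+ 19 / 1} ≤! (0≤ι ν)) ≤!)) (l n))
        where
        l : ∀ n → + 83 / 1 * (n * n) ≡ (1ℚ + + 8 / 1 * n) * (1ℚ + + 8 / 1 * n) + 2ℚ + (n - 1ℚ) * (+ 19 / 1 * n + + 3 / 1)
        l = solve-∀ ringℚ

      κ : ℚ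
      κ = + 544563 / 256

    -- Inverse Bernoulli and 3νx²/2 ≥ 1 give r^ν ≤ 3x/2. Eight such factors against 83 ν² ≤ 83 · 4 /
    -- x⁴ leave a multiple of x⁴, with κ = 83 · (3/2)⁸.
    tail : r ^ M * ((1ℚ + ι M) * (1ℚ + ι M) + 2ℚ) ≤ x
    tail = ≤-trans (*-mono (0≤^ r≥0 M) (≤-trans (≤-reflexive (^-*-^ r ν 8)) (^-mono (0≤^ r≥0 ν) R≤ 8)) (0≤+ {b = 2ℚ} (0≤sq (1ℚ + ι M)) ≤!) quadratic)
      (≤-trans (≤-reflexive (l x n)) (≤-trans (*-monoˡ (κ * x * (x * (x * x))) (0≤* (0≤* {κ} ≤! x≥0) (0≤* x≥0 (0≤sq x))) (*-mono (0≤* (0≤ι ν) (0≤sq x)) upper (0≤* (0≤ι ν) (0≤sq x)) upper))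
      (≤-trans (*-monoʳ (2ℚ * 2ℚ) ≤! (*-monoˡ (κ * x) (0≤* {κ} ≤! x≥0) (*-mono x≥0 x≤ (0≤sq x) (*-mono x≥0 x≤ x≥0 x≤))))
        (le-by (0≤* {1ℚ - κ * (+ 1 / 256 * (+ 1 / 256 * (+ 1 / 256))) * (2ℚ * 2ℚ)} ≤! x≥0) (l′ x)))))
      where
      l : ∀ x n → (+ 3 / 2 * x) * ((+ 3 / 2 * x) * ((+ 3 / 2 * x) * ((+ 3 / 2 * x) * ((+ 3 / 2 * x) * ((+ 3 / 2 * x) * ((+ 3 / 2 * x) * ((+ 3 / 2 * x) * 1ℚ))))))) * (+ 83 / 1 * (n * n)) ≡ + 544563 / 256 * x * (x * (x * x)) * (n * (x * x) * (n * (x * x)))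
      l = solve-∀ ringℚ
      l′ : ∀ x → x ≡ + 544563 / 256 * x * (+ 1 / 256 * (+ 1 / 256 * (+ 1 / 256))) * (2ℚ * 2ℚ) + (1ℚ - + 544563 / 256 * (+ 1 / 256 * (+ 1 / 256 * (+ 1 / 256))) * (2ℚ * 2ℚ)) * x
      l′ = solve-∀ ringℚ

    -- By u / (1 + u) ≥ u - u², the mean is at least Σ j r^j - Σ j r^(2j), about (1 - 1/4) / x²; the
    -- rest of 3/4 covers truncation and the errors in x.
    mean-lower : + 7 / 10 ≤ x * x * mean r M
    mean-lower = ≤-trans (≤! {+ 7 / 10} {1ℚ - 2ℚ * (+ 1 / 256) - + 100 / 398}) (combine x (mean r M) G₁ G₂ (r * (r ^ M * (1ℚ + ι M * (1ℚ - r)))) x≤ first second small between)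
      where
      ρ G₁ G₂ : ℚ
      ρ = r * r
      G₁ = Σᴸ (λ j → ι j * r ^ j) (parts M)
      G₂ = Σᴸ (λ j → ι j * ρ ^ j) (parts M)
      first : x * x * G₁ + r * (r ^ M * (1ℚ + ι M * (1ℚ - r))) ≡ 1ℚ - x
      first = trans (cong (λ e → e * e * G₁ + r * (r ^ M * (1ℚ + ι M * (1ℚ - r)))) (l x)) (weighted-geometric r M)
        where
        l : ∀ x → x ≡ 1ℚ - (1ℚ - x)
        l = solve-∀ ringℚ
      small : r * (r ^ M * (1ℚ + ι M * (1ℚ - r))) ≤ x
      small = ≤-trans (le-by (0≤+ (0≤* x≥0 (0≤* (0≤^ r≥0 M) (0≤+ {1ℚ} ≤! (0≤* (0≤ι M) x≥0)))) (0≤* (0≤^ r≥0 M) (0≤+ {2ℚ} ≤! (0≤* (0≤ι M) (0≤+ (0≤ι M) (0≤+ {1ℚ} ≤! r≥0))))))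
        (l x (ι M) (r ^ M))) tail
        where
        l : ∀ x M u → u * ((1ℚ + M) * (1ℚ + M) + 2ℚ) ≡ (1ℚ - x) * (u * (1ℚ + M * (1ℚ - (1ℚ - x)))) + (x * (u * (1ℚ + M * x)) + u * (2ℚ + M * (M + (1ℚ + (1ℚ - x)))))
        l = solve-∀ ringℚ
      ρ≥0 : 0ℚ ≤ ρ
      ρ≥0 = 0≤* r≥0 r≥0
      ρ≤1 : ρ ≤ 1ℚ
      ρ≤1 = *-mono r≥0 r≤1 r≥0 r≤1
      second : + 398 / 100 * (x * x * G₂) ≤ 1ℚ
      second = ≤-trans (*-monoʳ (x * x * G₂) (0≤* (0≤sq x) (0≤Σᴸ (parts M) λ j → 0≤* (0≤ι j) (0≤^ ρ≥0 j)))
        (≤-trans (≤! {+ 398 / 100} {(+ 511 / 256) * (+ 511 / 256)}) (*-mono {+ 511 / 256} ≤! s≤ ≤! s≤)))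
        (≤-trans (≤-reflexive (l x G₂)) (≤-trans (le-by (0≤* ρ≥0 (0≤* (0≤^ ρ≥0 M) (0≤+ {1ℚ} ≤! (0≤* (0≤ι M) (≤⇒0≤ ρ≤1))))) (sym (weighted-geometric ρ M))) ρ≤1))
        where
        s≤ : + 511 / 256 ≤ 2ℚ - x
        s≤ = le-by (≤⇒0≤ x≤) (l′ x)
          where
          l′ : ∀ x → 2ℚ - x ≡ + 511 / 256 + (+ 1 / 256 - x)
          l′ = solve-∀ ringℚ
        l : ∀ x G → (2ℚ - x) * (2ℚ - x) * (x * x * G) ≡ (1ℚ - (1ℚ - x) * (1ℚ - x)) * (1ℚ - (1ℚ - x) * (1ℚ - x)) * G
        l = solve-∀ ringℚ
      between : G₁ ≤ mean r M + G₂
      between = ≤-trans (Σᴸ-mono (parts M) (λ j → ≤-trans (*-monoˡ (ι j) (0≤ι j) (bound j)) (≤-reflexive (*-distribˡ-+ (ι j) (prob r j) (ρ ^ j)))))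
        (≤-reflexive (Σᴸ-+ (λ j → ι j * prob r j) (λ j → ι j * ρ ^ j) (parts M)))
        where
        bound : ∀ j → r ^ j ≤ prob r j + ρ ^ j
        bound j = ≤-trans (core (r ^ j) (recip (1ℚ + r ^ j)) (0≤^ r≥0 j) (0≤recip (0<+ {1ℚ} <! (0≤^ r≥0 j))) (*-recip (0<+ {1ℚ} <! (0≤^ r≥0 j)))) (≤-reflexive (cong (λ e → prob r j + e) (sym (*-^ r r j))))
          where
          core : ∀ u w → 0ℚ ≤ u → 0ℚ ≤ w → (1ℚ + u) * w ≡ 1ℚ → u ≤ u * w + u * u
          core u w u≥0 w≥0 e = le-by (0≤* (0≤* (0≤* u≥0 u≥0) u≥0) w≥0) (eq-by (0*diff (u - u * u) e) (l u w))
            where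
            l : ∀ u w → u * w + u * u ≡ u + u * u * u * w + (u - u * u) * ((1ℚ + u) * w - 1ℚ)
            l = solve-∀ ringℚ
      combine : ∀ x m G₁ G₂ e → x ≤ + 1 / 256 → x * x * G₁ + e ≡ 1ℚ - x → + 398 / 100 * (x * x * G₂) ≤ 1ℚ → e ≤ x → G₁ ≤ m + G₂ → 1ℚ - 2ℚ * (+ 1 / 256) - + 100 / 398 ≤ x * x * m
      combine x m G₁ G₂ e x≤ eq h₂ h₃ h₄ = le-by (0≤+ (0≤+ (0≤* {2ℚ} ≤! (≤⇒0≤ x≤)) (0≤* {+ 100 / 398} ≤! (≤⇒0≤ h₂))) (0≤+ (≤⇒0≤ h₃) (0≤* (0≤sq x) (≤⇒0≤ h₄)))) (eq-by (0*diff 1ℚ eq) (l x m G₁ G₂ e))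
        where
        l : ∀ x m G₁ G₂ e → x * x * m ≡ 1ℚ - 2ℚ * (+ 1 / 256) - + 100 / 398 + (2ℚ * (+ 1 / 256 - x) + + 100 / 398 * (1ℚ - + 398 / 100 * (x * x * G₂)) + (x - e + x * x * (m + G₂ - G₁))) + 1ℚ * (x * x * G₁ + e - (1ℚ - x))
        l = solve-∀ ringℚ

  0<recip : ∀ {x} → 0ℚ < x → 0ℚ < recip x
  0<recip {x} x>0 = ≰⇒> λ p → <-irrefl refl (<-≤-trans (<! {0ℚ} {1ℚ}) (≤-trans (≤-reflexive (sym (*-recip x>0))) (≤-trans (*-monoˡ x (<⇒≤ x>0) p) (≤-reflexive (*-zeroʳ x)))))

  opaque
    -- The mean is Lipschitz in r with constant M³, and the grid is shorter than one; with at least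
    -- 10000 M³ steps, one step moves the mean by at most 1/10000.
    resolution : ℕ → ℕ
    resolution M = suc (proj₁ (archimedean (+ 10000 / 1 * (ι M * (ι M * ι M)))))

    resolution≥ : ∀ M → + 10000 / 1 * (ι M * (ι M * ι M)) ≤ ι (resolution M)
    resolution≥ M = ≤-trans (proj₂ (archimedean (+ 10000 / 1 * (ι M * (ι M * ι M))))) (ι-mono (ℕ.n≤1+n _))

    resolution>0 : ∀ M → 0ℚ < ι (resolution M)
    resolution>0 M = 0<ι (proj₁ (archimedean (+ 10000 / 1 * (ι M * (ι M * ι M)))))

  -- The condition 1 ≤ 3νx²/2 keeps x from being too small for the tail estimate with 8ν parts.
  Centre : ℕ → Set
  Centre ν = ∃ λ x → Σ (0ℚ < x) λ x>0 → Σ (x ≤ + 1 / 256) λ x≤ → (1ℚ ≤ + 3 / 2 * (ι ν * (x * x))) × ι ν - mean (1ℚ - x) (8 ℕ.* ν) ∈± + 1 / 10000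

  -- A discrete intermediate value argument between x = 1/256, where the mean is at most 256² ≤ ν,
  -- and x₁ = 1/t with t = ⌊√(3ν/2)⌋, where ν x₁² ≤ 2/3 · (313/312)² < 0.7 and so the mean is at
  -- least ν.
  module Grid (ν : ℕ) (ν≥ : + 65536 / 1 ≤ ι ν) (t : ℚ) (t≥0 : 0ℚ ≤ t) (t-lower : t * t ≤ + 3 / 2 * ι ν) (t-upper : + 3 / 2 * ι ν ≤ (t + 1ℚ) * (t + 1ℚ))
    (x₁ : ℚ) (x₁>0 : 0ℚ < x₁) (tx₁ : t * x₁ ≡ 1ℚ) where

    M : ℕ
    M = 8 ℕ.* ν

    private
      x₁≥0 : 0ℚ ≤ x₁
      x₁≥0 = <⇒≤ x₁>0

      t≥312 : + 312 / 1 ≤ t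
      t≥312 = le-by (≤⇒0≤ (sq-cancel {+ 313 / 1} {t + 1ℚ} (0≤+ {b = 1ℚ} t≥0 ≤!) (≤-trans (≤-trans ≤! (*-monoˡ (+ 3 / 2) ≤! ν≥)) t-upper))) (l t)
        where
        l : ∀ t → t ≡ + 312 / 1 + (t + 1ℚ - + 313 / 1)
        l = solve-∀ ringℚ

      x₁≤′ : x₁ ≤ + 1 / 312
      x₁≤′ = le-by (0≤* (0≤* {+ 1 / 312} ≤! x₁≥0) (≤⇒0≤ t≥312)) (eq-by (0*diff (+ 1 / 312) (sym tx₁)) (l t x₁))
        where
        l : ∀ t x → + 1 / 312 ≡ x + + 1 / 312 * x * (t - + 312 / 1) + + 1 / 312 * (1ℚ - t * x)
        l = solve-∀ ringℚ

      x₁≤ : x₁ ≤ + 1 / 256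
      x₁≤ = ≤-trans x₁≤′ ≤!

      ν≥1 : 1ℚ ≤ ι ν
      ν≥1 = ≤-trans ≤! ν≥

      lower₁ : 1ℚ ≤ + 3 / 2 * (ι ν * (x₁ * x₁))
      lower₁ = ≤-trans (≤-reflexive (sym tx₁²)) (≤-trans (*-monoʳ {t * t} {+ 3 / 2 * ι ν} (x₁ * x₁) (0≤sq x₁) t-lower) (≤-reflexive (l′ (ι ν) x₁)))
        where
        l : ∀ t x → t * t * (x * x) ≡ t * x * (t * x)
        l = solve-∀ ringℚ
        tx₁² : t * t * (x₁ * x₁) ≡ 1ℚ
        tx₁² = trans (l t x₁) (trans (cong₂ _*_ tx₁ tx₁) refl)
        l′ : ∀ n x → + 3 / 2 * n * (x * x) ≡ + 3 / 2 * (n * (x * x))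
        l′ = solve-∀ ringℚ

      upper₁ : ι ν * (x₁ * x₁) ≤ + 7 / 10
      upper₁ = ≤-trans (*-cancelˡ {ι ν * (x₁ * x₁)} {+ 2 / 3 * ((1ℚ + + 1 / 312) * (1ℚ + + 1 / 312))} (+ 3 / 2) <!
          (≤-trans (≤-reflexive (l′ (ι ν) x₁)) (≤-trans below (≤! {(1ℚ + + 1 / 312) * (1ℚ + + 1 / 312)} {+ 3 / 2 * (+ 2 / 3 * ((1ℚ + + 1 / 312) * (1ℚ + + 1 / 312)))}))))
        (≤! {+ 2 / 3 * ((1ℚ + + 1 / 312) * (1ℚ + + 1 / 312))} {+ 7 / 10})
        where
        s≥0 : 0ℚ ≤ t * x₁ + x₁
        s≥0 = 0≤+ (0≤* t≥0 x₁≥0) x₁≥0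
        s≤ : t * x₁ + x₁ ≤ 1ℚ + + 1 / 312
        s≤ = +-mono-≤ (≤-reflexive tx₁) x₁≤′
        l : ∀ t x → (t + 1ℚ) * (t + 1ℚ) * (x * x) ≡ (t * x + x) * (t * x + x)
        l = solve-∀ ringℚ
        below : + 3 / 2 * ι ν * (x₁ * x₁) ≤ (1ℚ + + 1 / 312) * (1ℚ + + 1 / 312)
        below = ≤-trans (*-monoʳ {+ 3 / 2 * ι ν} {(t + 1ℚ) * (t + 1ℚ)} (x₁ * x₁) (0≤sq x₁) t-upper) (≤-trans (≤-reflexive (l t x₁)) (*-mono s≥0 s≤ s≥0 s≤))
        l′ : ∀ n x → + 3 / 2 * (n * (x * x)) ≡ + 3 / 2 * n * (x * x)
        l′ = solve-∀ ringℚ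

      open Endpoint ν ν≥1 x₁ x₁>0 x₁≤ lower₁ (≤-trans upper₁ (≤! {+ 7 / 10} {2ℚ})) using (mean-lower)

      D : ℕ
      D = resolution M

      σ : ℚ
      σ = (+ 1 / 256 - x₁) * recip (ι D)

      Dσ : ι D * σ ≡ + 1 / 256 - x₁
      Dσ = trans (l (ι D) (+ 1 / 256 - x₁) (recip (ι D))) (trans (cong (_* (+ 1 / 256 - x₁)) (*-recip (resolution>0 M))) (*-identityˡ (+ 1 / 256 - x₁)))
        where
        l : ∀ D e s → D * (e * s) ≡ D * s * e
        l = solve-∀ ringℚ

      σ≥0 : 0ℚ ≤ σ
      σ≥0 = 0≤* (≤⇒0≤ x₁≤) (0≤recip (resolution>0 M))

      step : ι M * (ι M * ι M) * σ ≤ + 1 / 10000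
      step = *-cancelˡ {ι M * (ι M * ι M) * σ} {+ 1 / 10000} (+ 10000 / 1) <! (≤-trans (≤-reflexive (l (ι M) σ)) (≤-trans (*-monoʳ σ σ≥0 (resolution≥ M)) (≤-trans (≤-reflexive Dσ) (le-by (0≤+ {1ℚ - + 1 / 256} ≤! x₁≥0) (l″ x₁)))))
        where
        l : ∀ M σ → + 10000 / 1 * (M * (M * M) * σ) ≡ + 10000 / 1 * (M * (M * M)) * σ
        l = solve-∀ ringℚ
        l″ : ∀ x → + 10000 / 1 * (+ 1 / 10000) ≡ + 1 / 256 - x + (1ℚ - + 1 / 256 + x)
        l″ = solve-∀ ringℚ

      x : ℕ → ℚ
      x i = + 1 / 256 - ι i * σ

      f : ℕ → ℚ
      f i = mean (1ℚ - x i) M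

      x-0 : x 0 ≡ + 1 / 256
      x-0 = trans (cong (λ e → + 1 / 256 - e * σ) ιℤ-0) (l σ)
        where
        l : ∀ σ → + 1 / 256 - 0ℚ * σ ≡ + 1 / 256
        l = solve-∀ ringℚ

      x-D : x D ≡ x₁
      x-D = trans (cong (λ e → + 1 / 256 - e) Dσ) (l x₁)
        where
        l : ∀ x → + 1 / 256 - (+ 1 / 256 - x) ≡ x
        l = solve-∀ ringℚ

      x-upper : ∀ i → x i ≤ + 1 / 256
      x-upper i = le-by (0≤* (0≤ι i) σ≥0) (l (ι i * σ))
        where
        l : ∀ e → + 1 / 256 ≡ + 1 / 256 - e + e
        l = solve-∀ ringℚ

      x-lower : ∀ {i} → i ℕ.≤ D → x₁ ≤ x i
      x-lower {i} p = le-by (0≤* (≤⇒0≤ (ι-mono p)) σ≥0) (eq-by (0*diff 1ℚ (sym Dσ)) (l x₁ (ι D) (ι i) σ))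
        where
        l : ∀ x D i σ → + 1 / 256 - i * σ ≡ x + (D - i) * σ + 1ℚ * ((+ 1 / 256 - x) - D * σ) 
        l = solve-∀ ringℚ

      start : f 0 ≤ ι ν
      start = ≤-trans (*-cancelˡ {f 0} {+ 65536 / 1} (+ 1 / 256 * (+ 1 / 256)) <! (≤-trans (≤-reflexive (cong (λ e → + 1 / 256 * (+ 1 / 256) * mean (1ℚ - e) M) x-0)) (≤-trans (Sums.μ-upper (+ 1 / 256) <! ≤! M) ≤!))) ν≥

      end : ι ν ≤ f D
      end = ≤-trans (*-cancelˡ {ι ν} {mean (1ℚ - x₁) M} (x₁ * x₁) (0<* x₁>0 x₁>0) (≤-trans (≤-reflexive (*-comm (x₁ * x₁) (ι ν))) (≤-trans upper₁ mean-lower))) (≤-reflexive (cong (λ e → mean (1ℚ - e) M) (sym x-D)))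

      close : ∀ i → i ℕ.≤ D → (i ≡ D ⊎ (suc i ℕ.≤ D × ι ν ≤ f (suc i))) → ι ν - f i ≤ + 1 / 10000
      close i i≤ (inj₁ refl) = ≤-trans (le-by (≤⇒0≤ end) (l (ι ν) (f D))) (≤! {0ℚ} {+ 1 / 10000})
        where
        l : ∀ a b → 0ℚ ≡ a - b + (b - a)
        l = solve-∀ ringℚ
      close i i≤ (inj₂ (i< , above)) = ≤-trans (+-monoˡ-≤ (- f i) above) (≤-trans (mean-lipschitz (≤⇒0≤ {x i} {1ℚ} (≤-trans (x-upper i) ≤!)) (le-by σ≥0 grid) (le-by (≤-trans x₁≥0 (x-lower i<)) (l (x (suc i)))) M)
          (≤-trans (≤-reflexive (cong (λ e → ι M * (ι M * ι M) * e) (trans (cong (_- (1ℚ - x i)) grid) (l′ (1ℚ - x i) σ)))) step))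
        where
        l : ∀ x → 1ℚ ≡ 1ℚ - x + x
        l = solve-∀ ringℚ
        l′ : ∀ e σ → e + σ - e ≡ σ
        l′ = solve-∀ ringℚ
        grid : 1ℚ - x (suc i) ≡ 1ℚ - x i + σ
        grid = trans (cong (λ e → 1ℚ - (+ 1 / 256 - e * σ)) (ι-suc i)) (l″ (ι i) σ)
          where
          l″ : ∀ i σ → 1ℚ - (+ 1 / 256 - (1ℚ + i) * σ) ≡ 1ℚ - (+ 1 / 256 - i * σ) + σ
          l″ = solve-∀ ringℚ

      stretch : ∀ {i} → i ℕ.≤ D → 1ℚ ≤ + 3 / 2 * (ι ν * (x i * x i))
      stretch {i} i≤ = ≤-trans lower₁ (*-monoˡ {ι ν * (x₁ * x₁)} {ι ν * (x i * x i)} (+ 3 / 2) ≤! (*-monoˡ {x₁ * x₁} {x i * x i} (ι ν) (0≤ι ν) (*-mono x₁≥0 (x-lower i≤) x₁≥0 (x-lower i≤))))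

      select : (∃ λ i → i ℕ.≤ D × f i ≤ ι ν × (i ≡ D ⊎ (suc i ℕ.≤ D × ι ν ≤ f (suc i)))) → Centre ν
      select (i , i≤ , below , above) = x i , <-≤-trans x₁>0 (x-lower i≤) , x-upper i , stretch i≤ , ≤-trans lo (≤⇒0≤ below) , close i i≤ above
        where
        lo : - (+ 1 / 10000) ≤ 0ℚ
        lo = ≤!

    result : Centre ν
    result = select (crossing f (ι ν) D start end)

  centre : ∀ ν → + 65536 / 1 ≤ ι ν → Centre ν
  centre ν ν≥ = build (floor-sqrt (+ 3 / 2 * ι ν) (0≤* {+ 3 / 2} ≤! (0≤ι ν)))
    where
    build : (∃ λ n → ι n * ι n ≤ + 3 / 2 * ι ν × + 3 / 2 * ι ν ≤ (ι n + 1ℚ) * (ι n + 1ℚ)) → Centre ν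
    build (zero  , _ , p) = contradiction (≤-trans (≤-trans (*-monoˡ (+ 3 / 2) ≤! ν≥) p) (≤-reflexive (cong (λ e → (e + 1ℚ) * (e + 1ℚ)) ιℤ-0))) (λ h → <-irrefl refl (<-≤-trans (<! {(0ℚ + 1ℚ) * (0ℚ + 1ℚ)} {+ 3 / 2 * (+ 65536 / 1)}) h))
    build (suc n , p , q) = Grid.result ν ν≥ (ι (suc n)) (0≤ι (suc n)) p q (recip (ι (suc n))) (0<recip (0<ι n)) (*-recip (0<ι n))

  Inequalities : (ℤ → ℚ) → ℤ → Set
  Inequalities P m = 0ℚ ≤ Δ P m * Δ P m - Δ^ 2 P m * P m ×
    0ℚ ≤ + 4 / 1 * ((Δ^ 2 P m * Δ^ 2 P m - Δ^ 3 P m * Δ P m) * (Δ P m * Δ P m - Δ^ 2 P m * P m)) - (Δ^ 2 P m * Δ P m - Δ^ 3 P m * P m) * (Δ^ 2 P m * Δ P m - Δ^ 3 P m * P m)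

  law-inequalities : ∀ ν → + 65536 / 1 ≤ ι (suc ν) → ∃ λ r → 0ℚ < r × r ≤ 1ℚ × Inequalities (Law.P (prob r) (parts (8 ℕ.* suc ν))) (+ suc ν)
  law-inequalities ν ν≥ = build (centre (suc ν) ν≥)
    where
    M = 8 ℕ.* suc ν
    n = ι (suc ν)
    build : Centre (suc ν) → ∃ λ r → 0ℚ < r × r ≤ 1ℚ × Inequalities (Law.P (prob r) (parts M)) (+ suc ν)
    build (x , x>0 , x≤ , lower , centred) = 1ℚ - x , r>0 , le-by x≥0 (l₁ x) , Loc.log-concave , Loc.turán
      where
      x≥0 : 0ℚ ≤ x
      x≥0 = <⇒≤ x>0
      l₁ : ∀ x → 1ℚ ≡ 1ℚ - x + x
      l₁ = solve-∀ ringℚ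
      r>0 : 0ℚ < 1ℚ - x
      r>0 = <-≤-trans {0ℚ} {+ 255 / 256} <! (le-by (≤⇒0≤ x≤) (l x))
        where
        l : ∀ x → 1ℚ - x ≡ + 255 / 256 + (+ 1 / 256 - x)
        l = solve-∀ ringℚ
      scaled-ν : x * x * n ≤ 1ℚ + + 1 / 10000 * (x * x)
      scaled-ν = le-by (0≤+ (≤⇒0≤ (Sums.μ-upper x x>0 x≤ M)) (0≤* (0≤sq x) (≤⇒0≤ (proj₂ centred)))) (l x n (mean (1ℚ - x) M))
        where
        l : ∀ x n m → 1ℚ + + 1 / 10000 * (x * x) ≡ x * x * n + (1ℚ - x * x * m + x * x * (+ 1 / 10000 - (n - m)))
        l = solve-∀ ringℚ
      upper : n * (x * x) ≤ 2ℚ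
      upper = ≤-trans (≤-reflexive (*-comm n (x * x))) (≤-trans scaled-ν (≤-trans (+-monoʳ-≤ 1ℚ (*-monoˡ (+ 1 / 10000) ≤! (*-mono x≥0 x≤ x≥0 x≤))) ≤!))
      T : ℚ
      T = recip x
      xT : x * T ≡ 1ℚ
      xT = *-recip x>0
      size : ι M ≤ + 8 / 1 * (T * T) + + 8 / 1
      size = ≤-trans (≤-reflexive (trans (ι-* 8 (suc ν)) (cong (_* n) (ιℤ-lit 8)))) (le-by (0≤+ {b = + 8 / 1 * (1ℚ - + 1 / 10000)} (0≤* (0≤* {+ 8 / 1} ≤! (0≤sq T)) (≤⇒0≤ scaled-ν)) ≤!)
        (eq-by (0*diff (+ 8 / 1 * (n - + 1 / 10000)) (cong₂ _*_ xT xT)) (l n x T)))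
        where
        l : ∀ n x T → + 8 / 1 * (T * T) + + 8 / 1 ≡ + 8 / 1 * n + (+ 8 / 1 * (T * T) * (1ℚ + + 1 / 10000 * (x * x) - x * x * n) + + 8 / 1 * (1ℚ - + 1 / 10000)) + + 8 / 1 * (n - + 1 / 10000) * (x * T * (x * T) - 1ℚ * 1ℚ)
        l = solve-∀ ringℚ
      Vx : ℚ
      Vx = Tilt.V x x>0 x≤ (parts M)
      H = floor-sqrt (+ 3 / 1 * Vx) (0≤* {+ 3 / 1} ≤! (0≤Σᴸ (parts M) λ j → 0≤* (0≤ι j) (0≤* (0≤ι j) (Tilt.0≤pq x x>0 x≤ j))))
      -- Differences are bounded only for laws with one part removed; the whole law is mixed from
      -- two shifts of such a law, here the one without its largest part.
      module Loc = Local x x>0 x≤ M (Endpoint.tail (suc ν) (≤-trans ≤! ν≥) x x>0 x≤ lower upper) T xT size (+ suc ν) centred (proj₁ H) (proj₁ (proj₂ H)) (proj₂ (proj₂ H)) {L₀ = parts (ℕ.pred M)} here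

  -- From the law back to q

  module Link (r : ℚ) (r>0 : 0ℚ < r) where
    open Law (prob r)

    private
      r≥0 : 0ℚ ≤ r
      r≥0 = <⇒≤ r>0

      1+u>0 : ∀ j → 0ℚ < 1ℚ + r ^ j
      1+u>0 j = 0<+ {1ℚ} <! (0≤^ r≥0 j)

      clear : ∀ j x y → (1ℚ + r ^ j) * ((1ℚ - prob r j) * x + prob r j * y) ≡ x + r ^ j * y
      clear j x y = eq-by (0*diff (r ^ j * y - r ^ j * x) (*-recip (1+u>0 j))) (l (r ^ j) (recip (1ℚ + r ^ j)) x y)
        where
        l : ∀ u w x y → (1ℚ + u) * ((1ℚ - u * w) * x + u * w * y) ≡ x + u * y + (u * y - u * x) * ((1ℚ + u) * w - 1ℚ)
        l = solve-∀ ringℚ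

    F : ℕ → ℚ
    F zero    = 1ℚ
    F (suc M) = (1ℚ + r ^ suc M) * F M

    F>0 : ∀ M → 0ℚ < F M
    F>0 zero    = <!
    F>0 (suc M) = 0<* (1+u>0 (suc M)) (F>0 M)

    P-suc : ∀ M m → P (parts (suc M)) m * F (suc M) ≡ P (parts M) m * F M + r ^ suc M * (P (parts M) (m ℤ.- + suc M) * F M)
    P-suc M m = trans (cong (_* F (suc M)) (P-∷ (suc M) (parts M) m)) (trans (l (1ℚ + r ^ suc M) _ (F M)) (trans (cong (_* F M) (clear (suc M) (P (parts M) m) (P (parts M) (m ℤ.- + suc M)))) (l′ (P (parts M) m) (r ^ suc M) (P (parts M) (m ℤ.- + suc M)) (F M))))
      where
      l : ∀ u e f → e * (u * f) ≡ u * e * f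
      l = solve-∀ ringℚ
      l′ : ∀ x u y f → (x + u * y) * f ≡ x * f + u * (y * f)
      l′ = solve-∀ ringℚ

    P-negative : ∀ M m → P (parts M) -[1+ m ] * F M ≡ 0ℚ
    P-negative zero    m = refl
    P-negative (suc M) m = trans (P-suc M -[1+ m ]) (trans (cong₂ (λ a b → a + r ^ suc M * b) (P-negative M m) (P-negative M (suc (m ℕ.+ M)))) (l (r ^ suc M)))
      where
      l : ∀ u → 0ℚ + u * 0ℚ ≡ 0ℚ
      l = solve-∀ ringℚ

    -- Multiplied by F = ∏ (1 + r^j), the mixture for the part M + 1 loses its denominator and
    -- becomes the recursion of `atMost` weighted by r^m.
    P-count : ∀ M m → P (parts M) (+ m) * F M ≡ ι (atMost M m) * r ^ m
    P-count zero    zero    = sym (cong (_* 1ℚ) ιℤ-1)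
    P-count zero    (suc m) = trans refl (sym (trans (cong (_* r ^ suc m) ιℤ-0) (*-zeroˡ (r ^ suc m))))
    P-count (suc M) m = [ use , skip ]′ (ℕ.≤-<-connex (suc M) m)
      where
      use : suc M ℕ.≤ m → P (parts (suc M)) (+ m) * F (suc M) ≡ ι (atMost (suc M) m) * r ^ m
      use p = trans (P-suc M (+ m)) (trans (cong₂ (λ a b → a + r ^ suc M * b) (P-count M m) (trans (cong (λ e → P (parts M) e * F M) (trans (ℤ.m-n≡m⊖n m (suc M)) (ℤ.⊖-≥ p))) (P-count M (m ℕ.∸ suc M))))
        (trans (l (ι (atMost M m)) (r ^ m) (r ^ suc M) (ι (atMost M (m ℕ.∸ suc M))) (r ^ (m ℕ.∸ suc M))) (trans (cong (λ e → ι (atMost M m) * r ^ m + ι (atMost M (m ℕ.∸ suc M)) * e) (trans (sym (^-+ r (suc M) (m ℕ.∸ suc M))) (cong (r ^_) (ℕ.m+[n∸m]≡n p))))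
        (trans (sym (*-distribʳ-+ (r ^ m) (ι (atMost M m)) (ι (atMost M (m ℕ.∸ suc M))))) (cong (_* r ^ m) (trans (sym (ι-+ (atMost M m) (atMost M (m ℕ.∸ suc M)))) (cong ι (sym (atMost-use M m p)))))))))
        where
        l : ∀ a v u b w → a * v + u * (b * w) ≡ a * v + b * (u * w)
        l = solve-∀ ringℚ
      skip : m ℕ.< suc M → P (parts (suc M)) (+ m) * F (suc M) ≡ ι (atMost (suc M) m) * r ^ m
      skip p = trans (P-suc M (+ m)) (trans (cong₂ (λ a b → a + r ^ suc M * b) (P-count M m) (trans (cong (λ e → P (parts M) e * F M) (trans (ℤ.m-n≡m⊖n m (suc M)) (trans (ℤ.⊖-< p) (negative (suc M ℕ.∸ m) (ℕ.m<n⇒0<n∸m p))))) (P-negative M (ℕ.pred (suc M ℕ.∸ m)))))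
        (trans (l (ι (atMost M m) * r ^ m) (r ^ suc M)) (cong (λ e → ι e * r ^ m) (sym (atMost-skip M m p)))))
        where
        l : ∀ a u → a + u * 0ℚ ≡ a
        l = solve-∀ ringℚ
        negative : ∀ k → 0 ℕ.< k → ℤ.- (+ k) ≡ -[1+ ℕ.pred k ]
        negative (suc k) _ = refl

  -- One twenty-seventh of the discriminant of a X³ + 3b X²Y + 3c XY² + d Y³.
  discriminant : ℚ → ℚ → ℚ → ℚ → ℚ
  discriminant a b c d = + 4 / 1 * ((b * b - a * c) * (c * c - b * d)) - (b * c - a * d) * (b * c - a * d)

  -- The discriminant is invariant under the unimodular change from values to differences and homogeneous under a geometric rescaling.
  transfer : ∀ {F r R} v₀ v₁ v₂ v₃ a b c d → 0ℚ < F → 0ℚ < r → 0ℚ < R →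
    v₀ * F ≡ a * R → v₁ * F ≡ b * (r * R) → v₂ * F ≡ c * (r * (r * R)) → v₃ * F ≡ d * (r * (r * (r * R))) →
    (0ℚ ≤ (v₃ - v₂) * (v₃ - v₂) - (v₃ - v₂ - (v₂ - v₁)) * v₃ → 0ℚ ≤ c * c - b * d) ×
    (0ℚ ≤ discriminant (v₃ - v₂ - (v₂ - v₁) - (v₂ - v₁ - (v₁ - v₀))) (v₃ - v₂ - (v₂ - v₁)) (v₃ - v₂) v₃ → 0ℚ ≤ discriminant a b c d)
  transfer {F} {r} {R} v₀ v₁ v₂ v₃ a b c d F>0 r>0 R>0 e₀ e₁ e₂ e₃ = concave , turán
    where
    0≤-cancel : ∀ {x} c → 0ℚ < c → 0ℚ ≤ c * x → 0ℚ ≤ x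
    0≤-cancel {x} c c>0 h = *-cancelˡ {0ℚ} {x} c c>0 (≤-trans (≤-reflexive (*-zeroʳ c)) h)
    s² : ℚ
    s² = r * (r * R) * (r * (r * R))
    concave : 0ℚ ≤ (v₃ - v₂) * (v₃ - v₂) - (v₃ - v₂ - (v₂ - v₁)) * v₃ → 0ℚ ≤ c * c - b * d
    concave h = 0≤-cancel {c * c - b * d} s² (0<* (0<* r>0 (0<* r>0 R>0)) (0<* r>0 (0<* r>0 R>0)))
      (≤-trans (0≤* (<⇒≤ (0<* F>0 F>0)) h) (≤-reflexive (trans (l F v₁ v₂ v₃) (trans (cong₂ _-_ (cong₂ _*_ e₂ e₂) (cong₂ _*_ e₁ e₃)) (l′ r R b c d)))))
      where
      l : ∀ F v₁ v₂ v₃ → F * F * ((v₃ - v₂) * (v₃ - v₂) - (v₃ - v₂ - (v₂ - v₁)) * v₃) ≡ v₂ * F * (v₂ * F) - v₁ * F * (v₃ * F)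
      l = solve-∀ ringℚ
      l′ : ∀ r R b c d → c * (r * (r * R)) * (c * (r * (r * R))) - b * (r * R) * (d * (r * (r * (r * R)))) ≡ r * (r * R) * (r * (r * R)) * (c * c - b * d)
      l′ = solve-∀ ringℚ
    turán : 0ℚ ≤ discriminant (v₃ - v₂ - (v₂ - v₁) - (v₂ - v₁ - (v₁ - v₀))) (v₃ - v₂ - (v₂ - v₁)) (v₃ - v₂) v₃ → 0ℚ ≤ discriminant a b c d
    turán h = 0≤-cancel {discriminant a b c d} (r * R * (r * R) * s²) (0<* (0<* (0<* r>0 R>0) (0<* r>0 R>0)) (0<* (0<* r>0 (0<* r>0 R>0)) (0<* r>0 (0<* r>0 R>0))))
      (≤-trans (0≤* (<⇒≤ (0<* (0<* F>0 F>0) (0<* F>0 F>0))) h) (≤-reflexive (trans (l F v₀ v₁ v₂ v₃) (trans (cong₄ e₀ e₁ e₂ e₃) (l′ r R a b c d)))))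
      where
      cong₄ : ∀ {x₀ x₁ x₂ x₃ y₀ y₁ y₂ y₃} → x₀ ≡ y₀ → x₁ ≡ y₁ → x₂ ≡ y₂ → x₃ ≡ y₃ → discriminant x₀ x₁ x₂ x₃ ≡ discriminant y₀ y₁ y₂ y₃
      cong₄ refl refl refl refl = refl
      l : ∀ F v₀ v₁ v₂ v₃ → F * F * (F * F) * (+ 4 / 1 * (((v₃ - v₂ - (v₂ - v₁)) * (v₃ - v₂ - (v₂ - v₁)) - (v₃ - v₂ - (v₂ - v₁) - (v₂ - v₁ - (v₁ - v₀))) * (v₃ - v₂)) * ((v₃ - v₂) * (v₃ - v₂) - (v₃ - v₂ - (v₂ - v₁)) * v₃)) - ((v₃ - v₂ - (v₂ - v₁)) * (v₃ - v₂) - (v₃ - v₂ - (v₂ - v₁) - (v₂ - v₁ - (v₁ - v₀))) * v₃) * ((v₃ - v₂ - (v₂ - v₁)) * (v₃ - v₂) - (v₃ - v₂ - (v₂ - v₁) - (v₂ - v₁ - (v₁ - v₀))) * v₃))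
        ≡ + 4 / 1 * ((v₁ * F * (v₁ * F) - v₀ * F * (v₂ * F)) * (v₂ * F * (v₂ * F) - v₁ * F * (v₃ * F))) - (v₁ * F * (v₂ * F) - v₀ * F * (v₃ * F)) * (v₁ * F * (v₂ * F) - v₀ * F * (v₃ * F))
      l = solve-∀ ringℚ
      l′ : ∀ r R a b c d → + 4 / 1 * ((b * (r * R) * (b * (r * R)) - a * R * (c * (r * (r * R)))) * (c * (r * (r * R)) * (c * (r * (r * R))) - b * (r * R) * (d * (r * (r * (r * R)))))) - (b * (r * R) * (c * (r * (r * R))) - a * R * (d * (r * (r * (r * R))))) * (b * (r * R) * (c * (r * (r * R))) - a * R * (d * (r * (r * (r * R)))))
        ≡ r * R * (r * R) * (r * (r * R) * (r * (r * R))) * (+ 4 / 1 * ((b * b - a * c) * (c * c - b * d)) - (b * c - a * d) * (b * c - a * d))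
      l′ = solve-∀ ringℚ

  ι-discriminant : ∀ a b c d → ιℤ (+ 4 ℤ.* ((b ℤ.* b ℤ.- a ℤ.* c) ℤ.* (c ℤ.* c ℤ.- b ℤ.* d)) ℤ.- (b ℤ.* c ℤ.- a ℤ.* d) ℤ.* (b ℤ.* c ℤ.- a ℤ.* d)) ≡ discriminant (ιℤ a) (ιℤ b) (ιℤ c) (ιℤ d)
  ι-discriminant a b c d = trans (ιℤ-- _ _) (cong₂ _-_ (trans (ιℤ-* (+ 4) _) (cong₂ _*_ (ιℤ-lit 4) (trans (ιℤ-* _ _) (cong₂ _*_ (minor b b a c) (minor c c b d))))) (trans (ιℤ-* _ _) (cong₂ _*_ (minor b c a d) (minor b c a d))))
    where
    minor : ∀ a b c d → ιℤ (a ℤ.* b ℤ.- c ℤ.* d) ≡ ιℤ a * ιℤ b - ιℤ c * ιℤ d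
    minor a b c d = trans (ιℤ-- (a ℤ.* b) (c ℤ.* d)) (cong₂ _-_ (ιℤ-* a b) (ιℤ-* c d))

  0≤ιℤ-cancel : ∀ {i j} → 0ℚ ≤ ιℤ (i ℤ.- j) → j ℤ.≤ i
  0≤ιℤ-cancel h = ℤ.0≤i-j⇒j≤i (ιℤ-cancel (≤-trans (≤-reflexive ιℤ-0) h))

  large : ∀ k → 65536 ℕ.≤ 3 ℕ.+ k → LogConcaveAt k × TuránAt k
  large k k≥ = build (law-inequalities (2 ℕ.+ k) (≤-trans (≤-reflexive (sym (ιℤ-lit 65536))) (ι-mono k≥)))
    where
    ν = 3 ℕ.+ k
    build : (∃ λ r → 0ℚ < r × r ≤ 1ℚ × Inequalities (Law.P (prob r) (parts (8 ℕ.* ν))) (+ ν)) → LogConcaveAt k × TuránAt k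
    build (r , r>0 , _ , concave , turán) =
        0≤ιℤ-cancel (≤-trans (proj₁ tr concave) (≤-reflexive (sym (trans (ιℤ-- (C ℤ.* C) (B ℤ.* D)) (cong₂ _-_ (ιℤ-* C C) (ιℤ-* B D))))))
      , 0≤ιℤ-cancel (≤-trans (proj₂ tr turán) (≤-reflexive (sym (ι-discriminant A B C D))))
      where
      open Link r r>0
      Pr : ℤ → ℚ
      Pr = Law.P (prob r) (parts (8 ℕ.* ν))
      A B C D : ℤ
      A = + q k
      B = + q (1 ℕ.+ k)
      C = + q (2 ℕ.+ k)
      D = + q (3 ℕ.+ k)
      count : ∀ m → m ℕ.≤ ν → Pr (+ m) * F (8 ℕ.* ν) ≡ ι (q m) * r ^ m
      count m m≤ = trans (P-count (8 ℕ.* ν) m) (cong (λ e → ι e * r ^ m) (atMost-stable {8 ℕ.* ν} (ℕ.≤-trans m≤ (ℕ.m≤n*m ν 8))))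
      tr = transfer {F (8 ℕ.* ν)} {r} {r ^ k} (Pr (+ k)) (Pr (+ (1 ℕ.+ k))) (Pr (+ (2 ℕ.+ k))) (Pr (+ (3 ℕ.+ k))) (ιℤ A) (ιℤ B) (ιℤ C) (ιℤ D) (F>0 (8 ℕ.* ν)) r>0 (0<^ r>0 k)
        (count k (ℕ.m≤n+m k 3)) (count (1 ℕ.+ k) (ℕ.m≤n+m (1 ℕ.+ k) 2)) (count (2 ℕ.+ k) (ℕ.m≤n+m (2 ℕ.+ k) 1)) (count (3 ℕ.+ k) ℕ.≤-refl)

-- Union of the computed and the asymptotic range

open Computation using (concave; turán; small; medium; module Verify)
open Asymptotics using (large)

open import Data.Nat using (ℕ; _≥_; _+_; _∸_)
open import Data.Integer using (+_; _-_; _*_; _^_) renaming (_≥_ to _≥ℤ_)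
open import Data.Product using (_×_)
open import Defs

≤ᵇ-sound : ∀ m {n} → (m ℕ.≤ᵇ n) ≡ true → m ℕ.≤ n
≤ᵇ-sound m h = ℕ.≤ᵇ⇒≤ m _ (subst Bool.T (sym h) _)

∧-sound : ∀ {a b} → a ∧ b ≡ true → a ≡ true × b ≡ true
∧-sound {true} h = refl , h

pos-products : ∀ {m n k l} → m ℕ.* n ℕ.≤ k ℕ.* l → + m * + n ℤ.≤ + k * + l
pos-products {m} {n} {k} {l} h = subst₂ ℤ._≤_ (ℤ.pos-* m n) (ℤ.pos-* k l) (ℤ.+≤+ h)

concave-sound : ∀ a b c d → concave a b c d ≡ true → + b * + d ℤ.≤ + c * + c
concave-sound a b c d h = pos-products {b} {d} {c} {c} (≤ᵇ-sound (b ℕ.* d) h)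

turán-sound : ∀ a b c d → turán a b c d ≡ true → (+ b * + d ℤ.≤ + c * + c) ×
  ((+ b * + c - + a * + d) * (+ b * + c - + a * + d) ℤ.≤ + 4 * ((+ b * + b - + a * + c) * (+ c * + c - + b * + d)))
turán-sound a b c d h = pos-products {b} {d} {c} {c} h₂ , subst₂ ℤ._≤_ left right (ℤ.+≤+ h₄)
  where
  t₁ = ∧-sound {a ℕ.* c ℕ.≤ᵇ b ℕ.* b} h
  t₂ = ∧-sound {b ℕ.* d ℕ.≤ᵇ c ℕ.* c} (proj₂ t₁)
  t₃ = ∧-sound {a ℕ.* d ℕ.≤ᵇ b ℕ.* c} (proj₂ t₂)
  h₁ : a ℕ.* c ℕ.≤ b ℕ.* b
  h₁ = ≤ᵇ-sound (a ℕ.* c) (proj₁ t₁)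
  h₂ : b ℕ.* d ℕ.≤ c ℕ.* c
  h₂ = ≤ᵇ-sound (b ℕ.* d) (proj₁ t₂)
  h₃ : a ℕ.* d ℕ.≤ b ℕ.* c
  h₃ = ≤ᵇ-sound (a ℕ.* d) (proj₁ t₃)
  h₄ = ≤ᵇ-sound ((b ℕ.* c ∸ a ℕ.* d) ℕ.* (b ℕ.* c ∸ a ℕ.* d)) {4 ℕ.* ((b ℕ.* b ∸ a ℕ.* c) ℕ.* (c ℕ.* c ∸ b ℕ.* d))} (proj₂ t₃)
  minor : ∀ {a b c d} → a ℕ.* d ℕ.≤ b ℕ.* c → + (b ℕ.* c ∸ a ℕ.* d) ≡ + b * + c - + a * + d
  minor {a} {b} {c} {d} p = trans (sym (ℤ.⊖-≥ p)) (trans (sym (ℤ.m-n≡m⊖n (b ℕ.* c) (a ℕ.* d))) (cong₂ _-_ (ℤ.pos-* b c) (ℤ.pos-* a d)))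
  left : + ((b ℕ.* c ∸ a ℕ.* d) ℕ.* (b ℕ.* c ∸ a ℕ.* d)) ≡ (+ b * + c - + a * + d) * (+ b * + c - + a * + d)
  left = trans (ℤ.pos-* (b ℕ.* c ∸ a ℕ.* d) (b ℕ.* c ∸ a ℕ.* d)) (cong₂ _*_ (minor {a} {b} {c} {d} h₃) (minor {a} {b} {c} {d} h₃))
  right : + (4 ℕ.* ((b ℕ.* b ∸ a ℕ.* c) ℕ.* (c ℕ.* c ∸ b ℕ.* d))) ≡ + 4 * ((+ b * + b - + a * + c) * (+ c * + c - + b * + d))
  right = trans (ℤ.pos-* 4 ((b ℕ.* b ∸ a ℕ.* c) ℕ.* (c ℕ.* c ∸ b ℕ.* d))) (cong (λ e → + 4 * e) (trans (ℤ.pos-* (b ℕ.* b ∸ a ℕ.* c) (c ℕ.* c ∸ b ℕ.* d))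
    (cong₂ _*_ (minor {a} {b} {b} {c} h₁) (minor {b} {c} {c} {d} h₂))))

beyond : ∀ k → 120 ℕ.≤ k → LogConcaveAt k × TuránAt k
beyond k p = [ (λ h → turán-sound (q k) (q (1 + k)) (q (2 + k)) (q (3 + k)) (Verify.verify-sound turán 120 173 379 773 16 361 medium k p h)) , large k ]′ (ℕ.<-≤-connex (3 + k) 65536)

log-concave : ∀ k → 31 ℕ.≤ k → LogConcaveAt k
log-concave k p = [ (λ h → concave-sound (q k) (q (1 + k)) (q (2 + k)) (q (3 + k)) (Verify.verify-sound concave 31 7 18 38 7 15 small k p (ℕ.≤-trans (ℕ.+-monoʳ-≤ 4 (ℕ.≤-pred h)) (ℕ.m≤m+n 123 5)))) , (λ h → proj₁ (beyond k h)) ]′ (ℕ.<-≤-connex k 120)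

mainTheorem1 :
    (∀ (n : ℕ) → n ≥ 33 →
      qℤ n ^ 2 ≥ℤ qℤ (n ∸ 1) * qℤ (n + 1))
    ×
    (∀ (n : ℕ) → n ≥ 121 →
      + 4 * (qℤ n ^ 2 - qℤ (n ∸ 1) * qℤ (n + 1)) * (qℤ (n + 1) ^ 2 - qℤ n * qℤ (n + 2))
        ≥ℤ (qℤ n * qℤ (n + 1) - qℤ (n ∸ 1) * qℤ (n + 2)) ^ 2)
mainTheorem1 = first , second
  where
  square : ∀ x → x * x ≡ x ^ 2
  square x = cong (λ e → x * e) (sym (ℤ.*-identityʳ x))
  first : ∀ n → n ≥ 33 → qℤ n ^ 2 ≥ℤ qℤ (n ∸ 1) * qℤ (n + 1)
  first (suc (suc k)) (ℕ.s≤s (ℕ.s≤s p)) = subst₂ ℤ._≤_ (cong (λ m → qℤ (1 + k) * qℤ m) (ℕ.+-comm 1 (2 + k))) (square (qℤ (2 + k))) (log-concave k p)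
  regroup : ∀ a b c d → + 4 * ((b * b - a * c) * (c * c - b * d)) ≡ + 4 * (b ^ 2 - a * c) * (c ^ 2 - b * d)
  regroup a b c d = trans (sym (ℤ.*-assoc (+ 4) (b * b - a * c) (c * c - b * d))) (cong₂ (λ x y → + 4 * (x - a * c) * (y - b * d)) (square b) (square c))
  second : ∀ n → n ≥ 121 → + 4 * (qℤ n ^ 2 - qℤ (n ∸ 1) * qℤ (n + 1)) * (qℤ (n + 1) ^ 2 - qℤ n * qℤ (n + 2)) ≥ℤ (qℤ n * qℤ (n + 1) - qℤ (n ∸ 1) * qℤ (n + 2)) ^ 2
  second (suc k) (ℕ.s≤s p) = subst₂ (λ m m′ → + 4 * (qℤ (1 + k) ^ 2 - qℤ k * qℤ m) * (qℤ m ^ 2 - qℤ (1 + k) * qℤ m′) ≥ℤ (qℤ (1 + k) * qℤ m - qℤ k * qℤ m′) ^ 2)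
    (ℕ.+-comm 1 (1 + k)) (ℕ.+-comm 2 (1 + k))
    (subst₂ ℤ._≤_ (square (qℤ (1 + k) * qℤ (2 + k) - qℤ k * qℤ (3 + k))) (regroup (qℤ k) (qℤ (1 + k)) (qℤ (2 + k)) (qℤ (3 + k))) (proj₂ (beyond k p)))
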